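{- Let $X=\{0,1,\dots,n\}$. If $A$ and $B$ are chosen independently and uniformly at random from $\mathcal{B}(X)$, then for any $\chi\in\{TBR,SPR,rSPR\}$, $$\mathbb{E}[d_\chi(A,B)] = n - \Theta(n^{2/3})$$ as $n\to\infty$.
   Context: For a finite set $X$ with $|X|>1$, a binary leaf-labelled tree with label set $X$ is a finite tree whose vertices are either tree vertices of degree $3$ or leaves of degree $1$, the leaves being in bijection with $X$ (their labels). $\mathcal{B}(X)$ denotes the set of all such trees up to label-preserving graph isomorphism. The leaf labelled $0$ is called the root. A TBR move on $T\in\mathcal{B}(X)$: delete an edge of $T$ and suppress all resulting degree-$2$ vertices, obtaining two binary trees $T_1,T_2$; then join them by a new edge between the midpoint of an edge of $T_1$ and the midpoint of an edge of $T_2$ (if one of them is a single vertex, the new edge is incident to that vertex). An SPR move taking $xy$ from $ab$ to $cd$ can be performed when $xy, ax, xb, cd$ are distinct edges (vertices $a,b,c,d$ need not be distinct) and the path from $c$ to $y$ contains $x$: delete $ax, xb$, add $ab$; then delete $cd$, add $cx, xd$. It is an rSPR move if moreover the path from the leaf $0$ to $y$ passes through $x$. $d_\chi(A,B)$ is the minimum number of $\chi$ moves needed to transform $A$ into $B$. -}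

module Defs where

open import Data.Bool using (Bool; true; false; _∧_; _∨_; not; if_then_else_)
open import Data.Nat using (ℕ; zero; suc; _+_; _*_; _≤_; _≤ᵇ_; _≡ᵇ_)
open import Data.Fin using (Fin; toℕ; _≟_)
open import Data.Fin.Permutation using (Permutation′; _⟨$⟩ʳ_)
open import Data.List using (List; []; _∷_; map; concatMap; length; filterᵇ; allFin)
open import Data.Bool.ListAction using (all; any)
open import Data.Nat.ListAction using (sum)
open import Data.List.Membership.Propositional using (_∈_)
open import Data.List.Relation.Unary.Unique.Propositional using (Unique)
open import Data.Vec using (Vec; lookup) renaming ([] to []ᵥ; _∷_ to _∷ᵥ_)
open import Data.Integer using (+_)
open import Data.Rational using (ℚ; 0ℚ; _/_) renaming (_*_ to _*ℚ_)
open import Data.Product using (Σ; ∃; ∃-syntax; _×_; _,_)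
open import Data.Sum using (_⊎_)
open import Relation.Nullary using (¬_; ⌊_⌋)
open import Relation.Binary.PropositionalEquality using (_≡_)

Graph : ℕ → Set
Graph m = Fin m → Fin m → Bool

module _ {m : ℕ} where

  Edge : Graph m → Fin m → Fin m → Set
  Edge G a b = G a b ≡ true

  addE : Graph m → Fin m → Fin m → Graph m
  addE G u v i j = (⌊ i ≟ u ⌋ ∧ ⌊ j ≟ v ⌋) ∨ (⌊ i ≟ v ⌋ ∧ ⌊ j ≟ u ⌋) ∨ G i j

  delE : Graph m → Fin m → Fin m → Graph m
  delE G u v i j = not ((⌊ i ≟ u ⌋ ∧ ⌊ j ≟ v ⌋) ∨ (⌊ i ≟ v ⌋ ∧ ⌊ j ≟ u ⌋)) ∧ G i j

  SameEdge : Fin m → Fin m → Fin m → Fin m → Set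
  SameEdge a b c d = (a ≡ c × b ≡ d) ⊎ (a ≡ d × b ≡ c)

  data Walk (G : Graph m) : Fin m → Fin m → List (Fin m) → Set where
    here : ∀ {a} → Walk G a a (a ∷ [])
    step : ∀ {a b c vs} → Edge G a b → Walk G b c vs → Walk G a c (a ∷ vs)

  Reach : Graph m → Fin m → Fin m → Set
  Reach G a b = ∃[ vs ] Walk G a b vs

  -- "the path from a to b contains x" (paths = walks without repeated vertices;
  -- in a tree the path between two vertices is unique)
  PathThrough : Graph m → Fin m → Fin m → Fin m → Set
  PathThrough G a b x = ∃[ vs ] (Walk G a b vs × Unique vs × x ∈ vs)

  _≐_ : Graph m → Graph m → Set
  G ≐ H = ∀ i j → G i j ≡ H i j

-- Representatives of B(X), X = {0,...,n}, n ≥ 1.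
-- A tree in B(X) has n+1 leaves and n-1 tree vertices, i.e. 2n vertices.
-- Representatives are graphs on Fin (n + n) where vertex i (toℕ i ≤ n) is the
-- leaf labelled i and the remaining vertices are the tree vertices.

V : ℕ → ℕ
V n = n + n

IsLeaf : {n : ℕ} → Fin (V n) → Set
IsLeaf {n} i = toℕ i ≤ n

module _ (n : ℕ) where

  private
    m = V n

  degree : Graph m → Fin m → ℕ
  degree G i = sum (map (λ j → if G i j then 1 else 0) (allFin m))

  reachStep : Graph m → Graph m → Graph m
  reachStep G R i j = R i j ∨ any (λ l → R i l ∧ G l j) (allFin m)

  iter : ℕ → (Graph m → Graph m) → Graph m → Graph m
  iter zero    f x = x
  iter (suc k) f x = f (iter k f x)

  reachMat : Graph m → Graph m
  reachMat G = iter m (reachStep G) (λ i j → ⌊ i ≟ j ⌋ ∨ G i j)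

  -- G is a binary leaf-labelled tree: a simple undirected connected graph,
  -- leaves (vertices 0..n) of degree 1, all other vertices of degree 3.
  -- (Connected + these degrees forces #edges = #vertices - 1, i.e. a tree.)
  isBinTree : Graph m → Bool
  isBinTree G =
    all (λ i → all (λ j → (not (G i j) ∨ G j i) ∧ not (⌊ i ≟ j ⌋ ∧ G i j)) (allFin m)) (allFin m)
    ∧ all (λ i → if toℕ i ≤ᵇ n then degree G i ≡ᵇ 1 else degree G i ≡ᵇ 3) (allFin m)
    ∧ all (λ i → all (λ j → reachMat G i j) (allFin m)) (allFin m)

  vecsOf : {A : Set} → List A → (k : ℕ) → List (Vec A k)
  vecsOf xs zero    = []ᵥ ∷ []
  vecsOf xs (suc k) = concatMap (λ x → map (x ∷ᵥ_) (vecsOf xs k)) xs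

  toGraph : Vec (Vec Bool m) m → Graph m
  toGraph M i j = lookup (lookup M i) j

  -- list of all representatives.  Each isomorphism class of B(X) is
  -- represented exactly (n-1)! times (the tree vertices are labelled
  -- arbitrarily; binary X-trees have no non-trivial leaf-fixing automorphisms),
  -- so the uniform distribution on this list is the uniform one on B(X).
  trees : List (Graph m)
  trees = filterᵇ isBinTree (map toGraph (vecsOf (vecsOf (true ∷ false ∷ []) m) m))

  Iso : Graph m → Graph m → Set
  Iso G H = Σ (Permutation′ m) λ σ →
              (∀ i → toℕ i ≤ n → σ ⟨$⟩ʳ i ≡ i)
            × (∀ i j → H (σ ⟨$⟩ʳ i) (σ ⟨$⟩ʳ j) ≡ G i j)

  sprResult : Graph m → (x a b c d : Fin m) → Graph m
  sprResult G x a b c d =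
    addE (addE (delE (addE (delE (delE G a x) x b) a b) c d) c x) x d

  SPRData : Graph m → (x y a b c d : Fin m) → Set
  SPRData G x y a b c d =
      Edge G x y × Edge G a x × Edge G x b × Edge G c d
    × ¬ SameEdge x y a x × ¬ SameEdge x y x b × ¬ SameEdge x y c d
    × ¬ SameEdge a x x b × ¬ SameEdge a x c d × ¬ SameEdge x b c d
    × PathThrough G c y x

  SPRStep : Graph m → Graph m → Set
  SPRStep G H = ∃[ x ] ∃[ y ] ∃[ a ] ∃[ b ] ∃[ c ] ∃[ d ]
                  (SPRData G x y a b c d × Iso (sprResult G x a b c d) H)

  rSPRStep : Graph m → Graph m → Set
  rSPRStep G H = ∃[ x ] ∃[ y ] ∃[ a ] ∃[ b ] ∃[ c ] ∃[ d ]
                  (SPRData G x y a b c d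
                   × (∃[ r ] (toℕ r ≡ 0 × PathThrough G r y x))
                   × Iso (sprResult G x a b c d) H)

  -- TBR.  After deleting the edge uv, each endpoint u is treated as follows:
  -- if u was a leaf (now isolated) it stays as the one-vertex tree; otherwise
  -- u has two neighbours p,q, it is suppressed (edge pq added) and then
  -- re-inserted as the midpoint of an edge rs of its own component.  Finally
  -- the edge uv is added back (joining the two midpoints).
  TBRSide : Graph m → Fin m → Graph m → Set
  TBRSide G u G' =
      ((∀ w → G u w ≡ false) × G' ≐ G)
    ⊎ (∃[ p ] ∃[ q ] ∃[ r ] ∃[ s ]
         (¬ p ≡ q × Edge G u p × Edge G u q
          × Edge (addE (delE (delE G u p) u q) p q) r s
          × Reach (addE (delE (delE G u p) u q) p q) p r
          × G' ≐ addE (addE (delE (addE (delE (delE G u p) u q) p q) r s) r u) u s))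

  TBRStep : Graph m → Graph m → Set
  TBRStep G H = ∃[ u ] ∃[ v ] ∃[ G₁ ] ∃[ G₂ ]
                  (Edge G u v × TBRSide (delE G u v) u G₁ × TBRSide G₁ v G₂
                   × Iso (addE G₂ u v) H)

data MoveType : Set where
  TBR SPR rSPR : MoveType

module _ (n : ℕ) where

  private
    m = V n

  Step : MoveType → Graph m → Graph m → Set
  Step TBR  = TBRStep n
  Step SPR  = SPRStep n
  Step rSPR = rSPRStep n

  data Steps (χ : MoveType) : ℕ → Graph m → Graph m → Set where
    done : ∀ {A B} → Iso n A B → Steps χ zero A B
    move : ∀ {k A B C} → Step χ A B → Steps χ k B C → Steps χ (suc k) A C

  IsDist : MoveType → (Graph m → Graph m → ℕ) → Set
  IsDist χ d = ∀ A B → isBinTree n A ≡ true → isBinTree n B ≡ true →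
                 Steps χ (d A B) A B × (∀ k → Steps χ k A B → d A B ≤ k)

  divℚ : ℕ → ℕ → ℚ
  divℚ s zero    = 0ℚ
  divℚ s (suc k) = (+ s) / suc k

  expectation : (Graph m → Graph m → ℕ) → ℚ
  expectation d =
    divℚ (sum (concatMap (λ A → map (λ B → d A B) (trees n)) (trees n)))
         (length (trees n) * length (trees n))

ℕtoℚ : ℕ → ℚ
ℕtoℚ k = (+ k) / 1

cube : ℚ → ℚ
cube x = x *ℚ x *ℚ x

{-# OPTIONS --safe #-}

-- Only one symmetry of the uniform distribution is used: its invariance under permutations of the leaf labels.
-- Cut every tree, rooted at the leaf 0, bottom-up into blocks of s to 2s leaves, where s has order n^(1/3).
-- This takes at most n / s = O(s²) cuts, and the cuts do not depend on the labels.
--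
-- Lower bound on the distance.  Colour the vertices of A by blocks.  A move of any kind admits a new colouring
-- with the same leaf colours and at most one more bichromatic edge, so B gets a colouring with d + O(s²) bichromatic
-- edges.  Refine it by the blocks of B.  A connected graph has at most one colour more than bichromatic edges, hence
-- n ≤ d + O(s²) + #{pairs of leaves sharing an A-block and a B-block}; by symmetry that number has mean O(s²).
--
-- Upper bound.  Pairs of leaves sharing an A-block and a B-block, no two pairs using the same block, form an
-- agreement forest together with the remaining leaves as singletons.  Merging its components into the component
-- of the root, top-down in B, takes one rSPR move each, so every pair saves a move.  On average there are of the
-- order of s² pairs sharing both blocks and only O(s⁵ / n) conflicts between them, so s² / 16 pairs survive
-- if n is a large enough multiple of s³.

module Submission where

open import Defs
import Data.Nat

module Proof where

  open import Data.Bool using (Bool; true; false; _∧_; _∨_; not; if_then_else_)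
  import Data.Bool.Properties as 𝔹ₚ
  open import Data.Bool.ListAction using (all; any)
  open import Data.Empty using (⊥; ⊥-elim)
  open import Data.Fin using (Fin; toℕ; fromℕ<; _≟_) renaming (zero to fzero; suc to fsuc)
  import Data.Fin.Properties as 𝔽ₚ
  open import Data.Fin.Permutation using (permutation; _⟨$⟩ʳ_; _⟨$⟩ˡ_; inverseʳ; inverseˡ)
  open import Data.List using (List; []; _∷_; _++_; map; concatMap; length; filterᵇ; allFin; cartesianProduct; _∷ʳ_)
  import Data.List.Properties as Lₚ
  open import Data.List.Membership.Propositional using (_∈_; _∉_)
  import Data.List.Membership.Propositional.Properties as ∈ₚ
  open import Data.List.Membership.Propositional.Properties.WithK using (unique∧set⇒bag)
  open import Data.List.Relation.Binary.BagAndSetEquality using (∼bag⇒↭)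
  open import Data.List.Relation.Binary.Permutation.Propositional using (_↭_; prep; swap; ↭-refl; ↭-sym; ↭-trans; ↭-reflexive) renaming (refl to prefl; trans to ptrans)
  import Data.List.Relation.Binary.Permutation.Propositional.Properties as ↭ₚ
  open import Data.List.Relation.Unary.All using (All; []; _∷_) renaming (map to All-map; lookup to All-lookup; tabulate to All-tabulate)
  import Data.List.Relation.Unary.All.Properties as Allₚ
  open import Data.List.Relation.Unary.AllPairs using (AllPairs; []; _∷_)
  import Data.List.Relation.Unary.AllPairs.Properties as APₚ
  open import Data.List.Relation.Unary.Any using (Any; here; there) renaming (map to Any-map; any? to anyL?)
  import Data.List.Relation.Unary.Any.Properties as Anyₚ
  open import Data.List.Relation.Unary.Unique.Propositional using (Unique)
  import Data.List.Relation.Unary.Unique.Propositional.Properties as Uₚ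
  open import Data.Maybe using (Maybe; just; nothing)
  open import Data.Nat using (ℕ; zero; suc; _+_; _*_; _∸_; _≤_; _<_; z≤n; s≤s; _≤ᵇ_; _≡ᵇ_; _<ᵇ_; _≤?_; _<?_; NonZero)
  open import Data.Nat.ListAction using (sum)
  import Data.Nat.Properties as ℕₚ
  open import Data.Nat.Tactic.RingSolver using (solve-∀)
  open import Data.Product using (Σ; ∃; ∃-syntax; _×_; _,_; proj₁; proj₂)
  open import Data.Sum using (_⊎_; inj₁; inj₂; [_,_]′) renaming (map to ⊎-map)
  open import Data.Unit using (⊤; tt)
  open import Data.Vec using (Vec; lookup; tabulate) renaming ([] to []ᵥ; _∷_ to _∷ᵥ_)
  import Data.Vec.Properties as Vₚ
  open import Function using (_∘_; id; case_of_)
  open import Function.Bundles using (mk⇔)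
  open import Relation.Binary.Definitions using (Tri; tri<; tri≈; tri>)
  open import Relation.Binary.PropositionalEquality using (_≡_; _≢_; refl; sym; trans; cong; cong₂; subst; subst₂; module ≡-Reasoning)
  open import Relation.Nullary using (¬_; Dec; yes; no; ⌊_⌋)
  open import Relation.Nullary.Decidable using (_×-dec_; _⊎-dec_; ¬?; map′)
  import Data.Integer as ℤ
  import Data.Integer.Properties as ℤₚ
  import Data.Rational as ℚ
  import Data.Rational.Properties as ℚₚ
  import Data.Rational.Solver
  import Data.Rational.Unnormalised as ℚᵘ
  import Data.Rational.Unnormalised.Properties as ℚᵘₚ

  𝟙 : Bool → ℕ
  𝟙 b = if b then 1 else 0

  𝟙≤1 : ∀ b → 𝟙 b ≤ 1
  𝟙≤1 true  = s≤s z≤n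
  𝟙≤1 false = z≤n

  ∧-split : ∀ {a b} → a ∧ b ≡ true → a ≡ true × b ≡ true
  ∧-split {true} {true} refl = refl , refl

  ∨-split : ∀ {a b} → a ∨ b ≡ true → a ≡ true ⊎ b ≡ true
  ∨-split {true} e = inj₁ refl
  ∨-split {false} e = inj₂ e

  ∨-introʳ : ∀ {a b} → b ≡ true → a ∨ b ≡ true
  ∨-introʳ {true}  _ = refl
  ∨-introʳ {false} e = e

  true≢false : ∀ {b} → b ≡ true → b ≡ false → ⊥
  true≢false refl ()

  Bool-≡ : ∀ {a b} → (a ≡ true → b ≡ true) → (b ≡ true → a ≡ true) → a ≡ b
  Bool-≡ {true}  {b}     f g = sym (f refl)
  Bool-≡ {false} {true}  f g = g refl
  Bool-≡ {false} {false} f g = refl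

  ≢true⇒≡false : ∀ {b} → b ≢ true → b ≡ false
  ≢true⇒≡false {true}  h = ⊥-elim (h refl)
  ≢true⇒≡false {false} h = refl

  does⇒ : ∀ {P : Set} (p : Dec P) → ⌊ p ⌋ ≡ true → P
  does⇒ (yes p) _ = p

  ⇒does : ∀ {P : Set} (p : Dec P) → P → ⌊ p ⌋ ≡ true
  ⇒does (yes p) _ = refl
  ⇒does (no ¬p) p = ⊥-elim (¬p p)

  ¬does⇒ : ∀ {P : Set} (p : Dec P) → ¬ P → ⌊ p ⌋ ≡ false
  ¬does⇒ (yes p) ¬p = ⊥-elim (¬p p)
  ¬does⇒ (no _)  _  = refl

  all-elim : ∀ {A : Set} {p : A → Bool} {xs x} → all p xs ≡ true → x ∈ xs → p x ≡ true
  all-elim {xs = y ∷ ys} h (here refl) = proj₁ (∧-split h)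
  all-elim {xs = y ∷ ys} h (there i)   = all-elim (proj₂ (∧-split h)) i

  all-intro : ∀ {A : Set} {p : A → Bool} xs → (∀ x → x ∈ xs → p x ≡ true) → all p xs ≡ true
  all-intro []       h = refl
  all-intro (x ∷ xs) h = cong₂ _∧_ (h x (here refl)) (all-intro xs (λ y i → h y (there i)))

  any-elim : ∀ {A : Set} {p : A → Bool} xs → any p xs ≡ true → ∃[ x ] (x ∈ xs × p x ≡ true)
  any-elim (x ∷ xs) h with ∨-split h
  ... | inj₁ e = x , here refl , e
  ... | inj₂ e with any-elim xs e
  ...   | y , i , e′ = y , there i , e′

  any-intro : ∀ {A : Set} {p : A → Bool} {xs x} → x ∈ xs → p x ≡ true → any p xs ≡ true
  any-intro {p = p} {x ∷ xs} (here refl) e = cong (_∨ any p xs) e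
  any-intro {p = p} {x ∷ xs} (there i)   e = ∨-introʳ {p x} (any-intro i e)

  module _ {A : Set} where

    ∑ : List A → (A → ℕ) → ℕ
    ∑ []       f = 0
    ∑ (x ∷ xs) f = f x + ∑ xs f

    syntax ∑ xs (λ x → e) = ∑[ x ∈ xs ] e

    sum-map : ∀ (f : A → ℕ) xs → sum (map f xs) ≡ ∑ xs f
    sum-map f []       = refl
    sum-map f (x ∷ xs) = cong (f x +_) (sum-map f xs)

    ∑-cong : ∀ {f g : A → ℕ} xs → (∀ x → x ∈ xs → f x ≡ g x) → ∑ xs f ≡ ∑ xs g
    ∑-cong []       h = refl
    ∑-cong (x ∷ xs) h = cong₂ _+_ (h x (here refl)) (∑-cong xs (λ y i → h y (there i)))

    ∑-mono : ∀ {f g : A → ℕ} xs → (∀ x → x ∈ xs → f x ≤ g x) → ∑ xs f ≤ ∑ xs g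
    ∑-mono []       h = z≤n
    ∑-mono (x ∷ xs) h = ℕₚ.+-mono-≤ (h x (here refl)) (∑-mono xs (λ y i → h y (there i)))

    ∑-+ : ∀ (f g : A → ℕ) xs → ∑[ x ∈ xs ] (f x + g x) ≡ ∑ xs f + ∑ xs g
    ∑-+ f g []       = refl
    ∑-+ f g (x ∷ xs) = trans (cong (f x + g x +_) (∑-+ f g xs)) (lem (f x) (g x) (∑ xs f) (∑ xs g))
      where
      lem : ∀ a b c d → a + b + (c + d) ≡ a + c + (b + d)
      lem = solve-∀

    ∑-*ˡ : ∀ c (f : A → ℕ) xs → ∑[ x ∈ xs ] (c * f x) ≡ c * ∑ xs f
    ∑-*ˡ c f []       = sym (ℕₚ.*-zeroʳ c)
    ∑-*ˡ c f (x ∷ xs) = trans (cong (c * f x +_) (∑-*ˡ c f xs)) (sym (ℕₚ.*-distribˡ-+ c (f x) (∑ xs f)))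

    ∑-*ʳ : ∀ c (f : A → ℕ) xs → ∑[ x ∈ xs ] (f x * c) ≡ ∑ xs f * c
    ∑-*ʳ c f xs = trans (∑-cong xs (λ x _ → ℕₚ.*-comm (f x) c)) (trans (∑-*ˡ c f xs) (ℕₚ.*-comm c (∑ xs f)))

    ∑-const : ∀ c (xs : List A) → ∑[ x ∈ xs ] c ≡ length xs * c
    ∑-const c []       = refl
    ∑-const c (x ∷ xs) = cong (c +_) (∑-const c xs)

    ∑-0 : ∀ (xs : List A) → ∑[ x ∈ xs ] 0 ≡ 0
    ∑-0 xs = trans (∑-const 0 xs) (ℕₚ.*-zeroʳ (length xs))

    ∑-++ : ∀ (f : A → ℕ) xs ys → ∑ (xs ++ ys) f ≡ ∑ xs f + ∑ ys f
    ∑-++ f []       ys = refl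
    ∑-++ f (x ∷ xs) ys = trans (cong (f x +_) (∑-++ f xs ys)) (sym (ℕₚ.+-assoc (f x) (∑ xs f) (∑ ys f)))

    ∑-↭ : ∀ (f : A → ℕ) {xs ys} → xs ↭ ys → ∑ xs f ≡ ∑ ys f
    ∑-↭ f prefl         = refl
    ∑-↭ f (prep x p)    = cong (f x +_) (∑-↭ f p)
    ∑-↭ f (swap x y p)  = trans (cong (λ z → f x + (f y + z)) (∑-↭ f p)) (lem (f x) (f y) _)
      where
      lem : ∀ a b c → a + (b + c) ≡ b + (a + c)
      lem = solve-∀
    ∑-↭ f (ptrans p q)  = trans (∑-↭ f p) (∑-↭ f q)

    ∑-filter : ∀ (p : A → Bool) (f : A → ℕ) xs → ∑ (filterᵇ p xs) f ≡ ∑[ x ∈ xs ] (𝟙 (p x) * f x)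
    ∑-filter p f []       = refl
    ∑-filter p f (x ∷ xs) with p x
    ... | true  = cong₂ _+_ (sym (ℕₚ.+-identityʳ (f x))) (∑-filter p f xs)
    ... | false = ∑-filter p f xs

    length-filter : ∀ (p : A → Bool) xs → length (filterᵇ p xs) ≡ ∑[ x ∈ xs ] 𝟙 (p x)
    length-filter p []       = refl
    length-filter p (x ∷ xs) with p x
    ... | true  = cong suc (length-filter p xs)
    ... | false = length-filter p xs

    ∑-term : ∀ (f : A → ℕ) {xs x} → x ∈ xs → f x ≤ ∑ xs f
    ∑-term f (here refl) = ℕₚ.m≤m+n _ _
    ∑-term f {y ∷ xs} (there i) = ℕₚ.≤-trans (∑-term f i) (ℕₚ.m≤n+m (∑ xs f) (f y))

    ∑-zero : ∀ (f : A → ℕ) xs → (∀ x → x ∈ xs → f x ≡ 0) → ∑ xs f ≡ 0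
    ∑-zero f xs h = trans (∑-cong xs h) (∑-0 xs)

    ∑-tight : ∀ (f g : A → ℕ) xs → (∀ x → f x ≤ g x) → ∑ xs g ≤ ∑ xs f → ∀ {x} → x ∈ xs → g x ≤ f x
    ∑-tight f g (y ∷ xs) le h (here refl) = ℕₚ.+-cancelʳ-≤ (∑ xs f) (g y) (f y)
      (ℕₚ.≤-trans (ℕₚ.+-monoʳ-≤ (g y) (∑-mono xs (λ x _ → le x))) h)
    ∑-tight f g (y ∷ xs) le h (there i) = ∑-tight f g xs le
      (ℕₚ.+-cancelˡ-≤ (f y) _ _ (ℕₚ.≤-trans (ℕₚ.+-monoˡ-≤ (∑ xs g) (le y)) h)) i

  ∑-map : ∀ {A B : Set} (h : A → B) (f : B → ℕ) xs → ∑ (map h xs) f ≡ ∑ xs (f ∘ h)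
  ∑-map h f []       = refl
  ∑-map h f (x ∷ xs) = cong (f (h x) +_) (∑-map h f xs)

  ∑-concatMap : ∀ {A B : Set} (h : A → List B) (f : B → ℕ) xs → ∑ (concatMap h xs) f ≡ ∑[ x ∈ xs ] ∑ (h x) f
  ∑-concatMap h f []       = refl
  ∑-concatMap h f (x ∷ xs) = trans (∑-++ f (h x) (concatMap h xs)) (cong (∑ (h x) f +_) (∑-concatMap h f xs))

  ∑-swap : ∀ {A B : Set} (f : A → B → ℕ) xs ys → ∑[ x ∈ xs ] ∑[ y ∈ ys ] f x y ≡ ∑[ y ∈ ys ] ∑[ x ∈ xs ] f x y
  ∑-swap f []       ys = sym (∑-0 ys)
  ∑-swap f (x ∷ xs) ys = trans (cong (∑ ys (f x) +_) (∑-swap f xs ys)) (sym (∑-+ (f x) (λ y → ∑[ z ∈ xs ] f z y) ys))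

  module _ {A : Set} where

    Unique-∷ : ∀ {x : A} {xs} → x ∉ xs → Unique xs → Unique (x ∷ xs)
    Unique-∷ x∉ u = Allₚ.¬Any⇒All¬ _ x∉ ∷ u

    Unique-head : ∀ {x : A} {xs} → Unique (x ∷ xs) → x ∉ xs
    Unique-head (h ∷ _) i = All-lookup h i refl

    Unique-tail : ∀ {x : A} {xs} → Unique (x ∷ xs) → Unique xs
    Unique-tail (_ ∷ u) = u

    Unique-++ : ∀ (xs : List A) {ys} → Unique xs → Unique ys → (∀ {v} → v ∈ xs → v ∉ ys) → Unique (xs ++ ys)
    Unique-++ xs u w d = Uₚ.++⁺ u w (λ (i , j) → d i j)

    Unique-++⁻ : ∀ (xs : List A) {ys} → Unique (xs ++ ys) → Unique xs × Unique ys × (∀ {v} → v ∈ xs → v ∉ ys)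
    Unique-++⁻ []       u = [] , u , λ ()
    Unique-++⁻ (x ∷ xs) {ys} (h ∷ u) with Unique-++⁻ xs u
    ... | u₁ , u₂ , d = Unique-∷ (λ i → Unique-head {x} {xs ++ ys} (h ∷ u) (∈ₚ.∈-++⁺ˡ i)) u₁ , u₂ ,
      λ { (here refl) j → Unique-head {x} {xs ++ ys} (h ∷ u) (∈ₚ.∈-++⁺ʳ xs j) ; (there i) j → d i j }

    AllPairs-↭ : ∀ {R : A → A → Set} → (∀ {x y} → R x y → R y x) → ∀ {xs ys} → xs ↭ ys → AllPairs R xs → AllPairs R ys
    AllPairs-↭ s prefl ap = ap
    AllPairs-↭ s (prep x p) (h ∷ ap) = ↭ₚ.All-resp-↭ p h ∷ AllPairs-↭ s p ap
    AllPairs-↭ s (swap x y p) ((h ∷ hs) ∷ (ks ∷ ap)) =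
      (s h ∷ ↭ₚ.All-resp-↭ p ks) ∷ (↭ₚ.All-resp-↭ p hs ∷ AllPairs-↭ s p ap)
    AllPairs-↭ s (ptrans p q) ap = AllPairs-↭ s q (AllPairs-↭ s p ap)

    Unique-↭ : ∀ {xs ys : List A} → xs ↭ ys → Unique xs → Unique ys
    Unique-↭ = AllPairs-↭ (λ ne e → ne (sym e))

    unique-set-↭ : ∀ {xs ys : List A} → Unique xs → Unique ys → (∀ {x} → x ∈ xs → x ∈ ys) → (∀ {x} → x ∈ ys → x ∈ xs) → xs ↭ ys
    unique-set-↭ u v f g = ∼bag⇒↭ (unique∧set⇒bag u v (mk⇔ f g))

    ∈⇒↭ : ∀ {x : A} {xs} → x ∈ xs → ∃[ ys ] (xs ↭ x ∷ ys)
    ∈⇒↭ {x} {_ ∷ xs} (here refl) = xs , ↭-refl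
    ∈⇒↭ {x} {y ∷ xs} (there i) with ∈⇒↭ i
    ... | ys , p = y ∷ ys , ↭-trans (prep y p) (swap y x ↭-refl)

    unique-⊆-length : ∀ {xs ys : List A} → Unique xs → (∀ {x} → x ∈ xs → x ∈ ys) → length xs ≤ length ys
    unique-⊆-length {[]}     u f = z≤n
    unique-⊆-length {x ∷ xs} {ys} u f with ∈⇒↭ (f (here refl))
    ... | zs , p = subst (suc (length xs) ≤_) (sym (↭ₚ.↭-length p)) (s≤s (unique-⊆-length (Unique-tail u) g))
      where
      g : ∀ {v} → v ∈ xs → v ∈ zs
      g i with ↭ₚ.∈-resp-↭ p (f (there i))
      ... | here refl = ⊥-elim (Unique-head u i)
      ... | there j   = j

    Unique-filter : ∀ (p : A → Bool) {xs} → Unique xs → Unique (filterᵇ p xs)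
    Unique-filter p = APₚ.filter⁺ _

    ∈-filter⁺ : ∀ (p : A → Bool) {xs x} → x ∈ xs → p x ≡ true → x ∈ filterᵇ p xs
    ∈-filter⁺ p {y ∷ xs} (here refl) e with p y
    ∈-filter⁺ p {y ∷ xs} (here refl) refl | true = here refl
    ∈-filter⁺ p {y ∷ xs} (there i) e with p y
    ... | true  = there (∈-filter⁺ p i e)
    ... | false = ∈-filter⁺ p i e

    ∈-filter⁻ : ∀ (p : A → Bool) xs {x} → x ∈ filterᵇ p xs → x ∈ xs × p x ≡ true
    ∈-filter⁻ p (y ∷ xs) i with p y in eq
    ∈-filter⁻ p (y ∷ xs) (here refl) | true = here refl , eq
    ∈-filter⁻ p (y ∷ xs) (there i) | true = let (a , b) = ∈-filter⁻ p xs i in there a , b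
    ... | false = let (a , b) = ∈-filter⁻ p xs i in there a , b

  ∈-allFin : ∀ {m} (i : Fin m) → i ∈ allFin m
  ∈-allFin = ∈ₚ.∈-allFin

  module _ {m : ℕ} where

    ∑-δ-∉ : ∀ (φ : Fin m → ℕ) i xs → i ∉ xs → ∑[ j ∈ xs ] (𝟙 ⌊ i ≟ j ⌋ * φ j) ≡ 0
    ∑-δ-∉ φ i xs i∉ = ∑-zero _ xs (λ j j∈ → cong (λ b → 𝟙 b * φ j) (¬does⇒ (i ≟ j) (λ { refl → i∉ j∈ })))

    ∑-δ-∈ : ∀ (φ : Fin m → ℕ) i {xs} → Unique xs → i ∈ xs → ∑[ j ∈ xs ] (𝟙 ⌊ i ≟ j ⌋ * φ j) ≡ φ i
    ∑-δ-∈ φ i {x ∷ xs} u (here refl) rewrite ⇒does (i ≟ i) refl | ∑-δ-∉ φ i xs (Unique-head u) =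
      trans (ℕₚ.+-identityʳ _) (ℕₚ.+-identityʳ _)
    ∑-δ-∈ φ i {x ∷ xs} u (there k) rewrite ¬does⇒ (i ≟ x) (λ { refl → Unique-head u k }) = ∑-δ-∈ φ i (Unique-tail u) k

    ∑-δ-≤ : ∀ (φ : Fin m → ℕ) i {xs} → Unique xs → ∑[ j ∈ xs ] (𝟙 ⌊ i ≟ j ⌋ * φ j) ≤ φ i
    ∑-δ-≤ φ i {xs} u with anyL? (i ≟_) xs
    ... | yes k = ℕₚ.≤-reflexive (∑-δ-∈ φ i u k)
    ... | no ¬k = subst (_≤ φ i) (sym (∑-δ-∉ φ i xs ¬k)) z≤n

    ∑-δ : ∀ (φ : Fin m → ℕ) i → ∑[ j ∈ allFin m ] (𝟙 ⌊ i ≟ j ⌋ * φ j) ≡ φ i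
    ∑-δ φ i = ∑-δ-∈ φ i (Uₚ.allFin⁺ m) (∈-allFin i)

    allFin-map-↭ : ∀ (τ : Fin m → Fin m) → (∀ i → τ (τ i) ≡ i) → map τ (allFin m) ↭ allFin m
    allFin-map-↭ τ inv = unique-set-↭ (Uₚ.map⁺ (λ {x} {y} e → trans (sym (inv x)) (trans (cong τ e) (inv y))) (Uₚ.allFin⁺ m))
      (Uₚ.allFin⁺ m) (λ _ → ∈-allFin _) (λ {x} _ → subst (_∈ map τ (allFin m)) (inv x) (∈ₚ.∈-map⁺ τ (∈-allFin (τ x))))

    ∑-invol : ∀ (τ : Fin m → Fin m) → (∀ i → τ (τ i) ≡ i) → ∀ f → ∑ (allFin m) (f ∘ τ) ≡ ∑ (allFin m) f
    ∑-invol τ inv f = trans (sym (∑-map τ f (allFin m))) (∑-↭ f (allFin-map-↭ τ inv))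

    ≟-comm : ∀ (i j : Fin m) → ⌊ i ≟ j ⌋ ≡ ⌊ j ≟ i ⌋
    ≟-comm i j = Bool-≡ (λ e → ⇒does (j ≟ i) (sym (does⇒ (i ≟ j) e))) (λ e → ⇒does (i ≟ j) (sym (does⇒ (j ≟ i) e)))

  -- Graphs and their edge lists

  module _ {m : ℕ} where

    SE-refl : ∀ {a b : Fin m} → SameEdge a b a b
    SE-refl = inj₁ (refl , refl)

    SE-swap : ∀ {a b : Fin m} → SameEdge a b b a
    SE-swap = inj₂ (refl , refl)

    SE-sym : ∀ {a b c d : Fin m} → SameEdge a b c d → SameEdge c d a b
    SE-sym (inj₁ (refl , refl)) = SE-refl
    SE-sym (inj₂ (refl , refl)) = SE-swap

    SE-flip : ∀ {a b c d : Fin m} → SameEdge a b c d → SameEdge b a c d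
    SE-flip (inj₁ (refl , refl)) = SE-swap
    SE-flip (inj₂ (refl , refl)) = SE-refl

    SE-trans : ∀ {a b c d e f : Fin m} → SameEdge a b c d → SameEdge c d e f → SameEdge a b e f
    SE-trans (inj₁ (refl , refl)) q = q
    SE-trans (inj₂ (refl , refl)) q = SE-flip q

    sameEdge? : ∀ (a b c d : Fin m) → Dec (SameEdge a b c d)
    sameEdge? a b c d = ((a ≟ c) ×-dec (b ≟ d)) ⊎-dec ((a ≟ d) ×-dec (b ≟ c))

    InE : List (Fin m × Fin m) → Fin m → Fin m → Set
    InE E i j = Any (λ e → SameEdge i j (proj₁ e) (proj₂ e)) E

    inE? : ∀ E i j → Dec (InE E i j)
    inE? E i j = anyL? (λ e → sameEdge? i j (proj₁ e) (proj₂ e)) E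

    InE-flip : ∀ {E i j} → InE E i j → InE E j i
    InE-flip = Any-map SE-flip

    InE-resp : ∀ {E i j k l} → SameEdge i j k l → InE E k l → InE E i j
    InE-resp s = Any-map (SE-trans s)

    ∈⇒InE : ∀ {E i j} → (i , j) ∈ E → InE E i j
    ∈⇒InE = Any-map (λ { refl → SE-refl })

    Rep : Graph m → List (Fin m × Fin m) → Set
    Rep G E = ∀ i j → (G i j ≡ true → InE E i j) × (InE E i j → G i j ≡ true)

    Simple : List (Fin m × Fin m) → Set
    Simple = AllPairs (λ e f → ¬ SameEdge (proj₁ e) (proj₂ e) (proj₁ f) (proj₂ f))

    Simple-↭ : ∀ {E F} → E ↭ F → Simple E → Simple F
    Simple-↭ = AllPairs-↭ (λ n s → n (SE-sym s))

    Simple-head : ∀ {a b E} → Simple ((a , b) ∷ E) → ¬ InE E a b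
    Simple-head (h ∷ _) i = Allₚ.All¬⇒¬Any h i

    Simple-tail : ∀ {e E} → Simple (e ∷ E) → Simple E
    Simple-tail (_ ∷ s) = s

    toG : List (Fin m × Fin m) → Graph m
    toG E i j = ⌊ inE? E i j ⌋

    Rep-toG : ∀ E → Rep (toG E) E
    Rep-toG E i j = does⇒ (inE? E i j) , ⇒does (inE? E i j)

    Rep-↭ : ∀ {G E F} → E ↭ F → Rep G E → Rep G F
    Rep-↭ p r i j = (λ e → ↭ₚ.Any-resp-↭ p (proj₁ (r i j) e)) , (λ e → proj₂ (r i j) (↭ₚ.Any-resp-↭ (↭-sym p) e))

    Rep-sym : ∀ {G E} → Rep G E → ∀ {i j} → G i j ≡ true → G j i ≡ true
    Rep-sym r {i} {j} e = proj₂ (r j i) (InE-flip (proj₁ (r i j) e))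

    ⌊≟⌋∧⇒ : ∀ {i j k l : Fin m} → ⌊ i ≟ k ⌋ ∧ ⌊ j ≟ l ⌋ ≡ true → i ≡ k × j ≡ l
    ⌊≟⌋∧⇒ {i} {j} {k} {l} e = let (a , b) = ∧-split e in does⇒ (i ≟ k) a , does⇒ (j ≟ l) b

    ⇒⌊≟⌋∧ : ∀ {i j k l : Fin m} → i ≡ k → j ≡ l → ⌊ i ≟ k ⌋ ∧ ⌊ j ≟ l ⌋ ≡ true
    ⇒⌊≟⌋∧ {i} {j} {k} {l} a b = cong₂ _∧_ (⇒does (i ≟ k) a) (⇒does (j ≟ l) b)

    sameᵇ : (u v i j : Fin m) → Bool
    sameᵇ u v i j = (⌊ i ≟ u ⌋ ∧ ⌊ j ≟ v ⌋) ∨ (⌊ i ≟ v ⌋ ∧ ⌊ j ≟ u ⌋)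

    sameᵇ⇒ : ∀ u v i j → sameᵇ u v i j ≡ true → SameEdge i j u v
    sameᵇ⇒ u v i j e with ∨-split e
    ... | inj₁ a = inj₁ (⌊≟⌋∧⇒ a)
    ... | inj₂ a = inj₂ (⌊≟⌋∧⇒ a)

    ⇒sameᵇ : ∀ {u v i j} → SameEdge i j u v → sameᵇ u v i j ≡ true
    ⇒sameᵇ {u} {v} {i} {j} (inj₁ (a , b)) = cong (_∨ (⌊ i ≟ v ⌋ ∧ ⌊ j ≟ u ⌋)) (⇒⌊≟⌋∧ a b)
    ⇒sameᵇ {u} {v} {i} {j} (inj₂ (a , b)) = ∨-introʳ {⌊ i ≟ u ⌋ ∧ ⌊ j ≟ v ⌋} (⇒⌊≟⌋∧ a b)

    addE-sameᵇ : ∀ (G : Graph m) u v i j → addE G u v i j ≡ sameᵇ u v i j ∨ G i j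
    addE-sameᵇ G u v i j = sym (𝔹ₚ.∨-assoc (⌊ i ≟ u ⌋ ∧ ⌊ j ≟ v ⌋) _ _)

    addE⇒ : ∀ (G : Graph m) u v i j → addE G u v i j ≡ true → SameEdge i j u v ⊎ G i j ≡ true
    addE⇒ G u v i j e with ∨-split {sameᵇ u v i j} (trans (sym (addE-sameᵇ G u v i j)) e)
    ... | inj₁ a = inj₁ (sameᵇ⇒ u v i j a)
    ... | inj₂ a = inj₂ a

    addE-new : ∀ (G : Graph m) {u v i j} → SameEdge i j u v → addE G u v i j ≡ true
    addE-new G {u} {v} {i} {j} s = trans (addE-sameᵇ G u v i j) (cong (_∨ G i j) (⇒sameᵇ s))

    addE-old : ∀ (G : Graph m) {u v i j} → G i j ≡ true → addE G u v i j ≡ true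
    addE-old G {u} {v} {i} {j} s = trans (addE-sameᵇ G u v i j) (∨-introʳ {sameᵇ u v i j} s)

    delE⇒ : ∀ (G : Graph m) u v i j → delE G u v i j ≡ true → ¬ SameEdge i j u v × G i j ≡ true
    delE⇒ G u v i j e with ∧-split {not (sameᵇ u v i j)} e
    ... | a , b = (λ s → true≢false (⇒sameᵇ s) (trans (sym (𝔹ₚ.not-involutive _)) (cong not a))) , b

    delE-keep : ∀ (G : Graph m) {u v i j} → ¬ SameEdge i j u v → G i j ≡ true → delE G u v i j ≡ true
    delE-keep G {u} {v} {i} {j} n e = cong₂ _∧_ (cong not (≢true⇒≡false (λ s → n (sameᵇ⇒ u v i j s)))) e

    Rep-add : ∀ {G E u v a b} → SameEdge u v a b → Rep G E → Rep (addE G u v) ((a , b) ∷ E)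
    Rep-add {G} {E} {u} {v} s r i j = f , g
      where
      f : addE G u v i j ≡ true → InE _ i j
      f e with addE⇒ G u v i j e
      ... | inj₁ t = here (SE-trans t s)
      ... | inj₂ t = there (proj₁ (r i j) t)
      g : InE _ i j → addE G u v i j ≡ true
      g (here t)  = addE-new G (SE-trans t (SE-sym s))
      g (there t) = addE-old G (proj₂ (r i j) t)

    Rep-del : ∀ {G E u v a b} → SameEdge u v a b → ¬ InE E a b → Rep G ((a , b) ∷ E) → Rep (delE G u v) E
    Rep-del {G} {E} {u} {v} {a} {b} s n r i j = f , g
      where
      f : delE G u v i j ≡ true → InE E i j
      f e with delE⇒ G u v i j e
      ... | ns , t with proj₁ (r i j) t
      ...   | here q  = ⊥-elim (ns (SE-trans q (SE-sym s)))
      ...   | there q = q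
      g : InE E i j → delE G u v i j ≡ true
      g q = delE-keep G (λ t → n (InE-resp (SE-sym (SE-trans t s)) q)) (proj₂ (r i j) (there q))

    Walk-mono : ∀ {G H : Graph m} → (∀ {i j} → G i j ≡ true → H i j ≡ true) → ∀ {a b vs} → Walk G a b vs → Walk H a b vs
    Walk-mono f here       = here
    Walk-mono f (step e w) = step (f e) (Walk-mono f w)

    Walk-snoc : ∀ {G : Graph m} {a b c vs} → Walk G a b vs → G b c ≡ true → Walk G a c (vs ∷ʳ c)
    Walk-snoc here       e = step e here
    Walk-snoc (step f w) e = step f (Walk-snoc w e)

    Walk-end : ∀ {G : Graph m} {a b vs} → Walk G a b vs → b ∈ vs
    Walk-end here       = here refl
    Walk-end (step e w) = there (Walk-end w)

    Walk-vertex : ∀ {G : Graph m} {a b vs v} → Walk G a b vs → v ∈ vs → v ≡ a ⊎ ∃[ u ] (G u v ≡ true)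
    Walk-vertex here (here refl) = inj₁ refl
    Walk-vertex (step e w) (here refl) = inj₁ refl
    Walk-vertex (step {a} e w) (there i) with Walk-vertex w i
    ... | inj₁ refl = inj₂ (a , e)
    ... | inj₂ h    = inj₂ h

    Reach-trans : ∀ {G : Graph m} {a b c} → Reach G a b → Reach G b c → Reach G a c
    Reach-trans (_ , here) r = r
    Reach-trans (_ , step e w) r with Reach-trans (_ , w) r
    ... | vs , w′ = _ , step e w′

    Reach-sym : ∀ {G : Graph m} → (∀ {i j} → G i j ≡ true → G j i ≡ true) → ∀ {a b} → Reach G a b → Reach G b a
    Reach-sym s (_ , here) = _ , here
    Reach-sym s (_ , step e w) = Reach-trans (Reach-sym s (_ , w)) (_ , step (s e) here)

    Walk-suffix : ∀ {G : Graph m} {a b c vs} → Walk G a b vs → Unique vs → c ∈ vs → ∃[ ws ] (Walk G c b ws × Unique ws)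
    Walk-suffix here u (here refl) = _ , here , u
    Walk-suffix (step e w) u (here refl) = _ , step e w , u
    Walk-suffix (step e w) u (there i) = Walk-suffix w (Unique-tail u) i

    loop-erase : ∀ {G : Graph m} {a b vs} → Walk G a b vs → ∃[ ws ] (Walk G a b ws × Unique ws)
    loop-erase here = _ , here , [] ∷ []
    loop-erase (step {a} e w) with loop-erase w
    ... | ws , w′ , u with anyL? (a ≟_) ws
    ...   | yes i = Walk-suffix w′ u i
    ...   | no ¬i = a ∷ ws , step e w′ , Unique-∷ ¬i u

    -- Every edge is counted in both directions.

    W : Graph m → (Fin m → Fin m → ℕ) → ℕ
    W G φ = ∑[ i ∈ allFin m ] ∑[ j ∈ allFin m ] (𝟙 (G i j) * φ i j)

    incid : (u v i j : Fin m) → ℕ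
    incid u v i j = 𝟙 (⌊ i ≟ u ⌋ ∧ ⌊ j ≟ v ⌋) + 𝟙 (⌊ i ≟ v ⌋ ∧ ⌊ j ≟ u ⌋)

    𝟙-∧ : ∀ a b → 𝟙 (a ∧ b) ≡ 𝟙 a * 𝟙 b
    𝟙-∧ true  b = sym (ℕₚ.+-identityʳ _)
    𝟙-∧ false b = refl

    private
      ∑∑-δ : ∀ (φ : Fin m → Fin m → ℕ) (u v : Fin m) → ∑[ i ∈ allFin m ] ∑[ j ∈ allFin m ] (𝟙 (⌊ i ≟ u ⌋ ∧ ⌊ j ≟ v ⌋) * φ i j) ≡ φ u v
      ∑∑-δ φ u v = begin
        ∑[ i ∈ allFin m ] ∑[ j ∈ allFin m ] (𝟙 (⌊ i ≟ u ⌋ ∧ ⌊ j ≟ v ⌋) * φ i j) ≡⟨ ∑-cong (allFin m) (λ i _ → ∑-cong (allFin m) (λ j _ → eq i j)) ⟩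
        ∑[ i ∈ allFin m ] ∑[ j ∈ allFin m ] (𝟙 ⌊ u ≟ i ⌋ * (𝟙 ⌊ v ≟ j ⌋ * φ i j)) ≡⟨ ∑-cong (allFin m) (λ i _ → ∑-*ˡ (𝟙 ⌊ u ≟ i ⌋) (λ j → 𝟙 ⌊ v ≟ j ⌋ * φ i j) (allFin m)) ⟩
        ∑[ i ∈ allFin m ] (𝟙 ⌊ u ≟ i ⌋ * ∑[ j ∈ allFin m ] (𝟙 ⌊ v ≟ j ⌋ * φ i j)) ≡⟨ ∑-δ (λ i → ∑[ j ∈ allFin m ] (𝟙 ⌊ v ≟ j ⌋ * φ i j)) u ⟩
        ∑[ j ∈ allFin m ] (𝟙 ⌊ v ≟ j ⌋ * φ u j) ≡⟨ ∑-δ (φ u) v ⟩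
        φ u v ∎
        where
        open ≡-Reasoning
        eq : ∀ i j → 𝟙 (⌊ i ≟ u ⌋ ∧ ⌊ j ≟ v ⌋) * φ i j ≡ 𝟙 ⌊ u ≟ i ⌋ * (𝟙 ⌊ v ≟ j ⌋ * φ i j)
        eq i j = trans (cong (_* φ i j) (trans (𝟙-∧ ⌊ i ≟ u ⌋ ⌊ j ≟ v ⌋) (cong₂ (λ a b → 𝟙 a * 𝟙 b) (≟-comm i u) (≟-comm j v))))
          (ℕₚ.*-assoc (𝟙 ⌊ u ≟ i ⌋) (𝟙 ⌊ v ≟ j ⌋) (φ i j))

      ∑∑-distrib : ∀ (f g φ : Fin m → Fin m → ℕ) → ∑[ i ∈ allFin m ] ∑[ j ∈ allFin m ] ((f i j + g i j) * φ i j)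
        ≡ ∑[ i ∈ allFin m ] ∑[ j ∈ allFin m ] (f i j * φ i j) + ∑[ i ∈ allFin m ] ∑[ j ∈ allFin m ] (g i j * φ i j)
      ∑∑-distrib f g φ = trans
        (∑-cong (allFin m) (λ i _ → trans (∑-cong (allFin m) (λ j _ → ℕₚ.*-distribʳ-+ (φ i j) (f i j) (g i j)))
          (∑-+ (λ j → f i j * φ i j) (λ j → g i j * φ i j) (allFin m))))
        (∑-+ (λ i → ∑[ j ∈ allFin m ] (f i j * φ i j)) (λ i → ∑[ j ∈ allFin m ] (g i j * φ i j)) (allFin m))

    ∑-incid : ∀ (φ : Fin m → Fin m → ℕ) u v → ∑[ i ∈ allFin m ] ∑[ j ∈ allFin m ] (incid u v i j * φ i j) ≡ φ u v + φ v u
    ∑-incid φ u v = trans (∑∑-distrib (λ i j → 𝟙 (⌊ i ≟ u ⌋ ∧ ⌊ j ≟ v ⌋)) (λ i j → 𝟙 (⌊ i ≟ v ⌋ ∧ ⌊ j ≟ u ⌋)) φ)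
      (cong₂ _+_ (∑∑-δ φ u v) (∑∑-δ φ v u))

    W-incid : ∀ G φ u v → ∑[ i ∈ allFin m ] ∑[ j ∈ allFin m ] ((𝟙 (G i j) + incid u v i j) * φ i j) ≡ W G φ + (φ u v + φ v u)
    W-incid G φ u v = trans (∑∑-distrib (λ i j → 𝟙 (G i j)) (incid u v) φ) (cong (W G φ +_) (∑-incid φ u v))

    incid-no : ∀ {u v i j} → ¬ SameEdge i j u v → incid u v i j ≡ 0
    incid-no n = cong₂ (λ a b → 𝟙 a + 𝟙 b) (≢true⇒≡false (λ e → n (inj₁ (⌊≟⌋∧⇒ e)))) (≢true⇒≡false (λ e → n (inj₂ (⌊≟⌋∧⇒ e))))

    incid-yes : ∀ {u v i j} → u ≢ v → SameEdge i j u v → incid u v i j ≡ 1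
    incid-yes {u} {v} {i} {j} ne (inj₁ (refl , refl)) = cong₂ (λ a b → 𝟙 a + 𝟙 b) (⇒⌊≟⌋∧ {i} {j} refl refl)
      (≢true⇒≡false (λ e → ne (proj₁ (⌊≟⌋∧⇒ {i} {j} {j} {i} e))))
    incid-yes {u} {v} {i} {j} ne (inj₂ (refl , refl)) = cong₂ (λ a b → 𝟙 a + 𝟙 b)
      (≢true⇒≡false (λ e → ne (proj₂ (⌊≟⌋∧⇒ {i} {j} {j} {i} e)))) (⇒⌊≟⌋∧ {i} {j} refl refl)

    W-add : ∀ G φ u v → W (addE G u v) φ ≤ W G φ + (φ u v + φ v u)
    W-add G φ u v = subst (W (addE G u v) φ ≤_) (W-incid G φ u v)
      (∑-mono (allFin m) (λ i _ → ∑-mono (allFin m) (λ j _ → ℕₚ.*-monoˡ-≤ (φ i j) (pt (⌊ i ≟ u ⌋ ∧ ⌊ j ≟ v ⌋) (⌊ i ≟ v ⌋ ∧ ⌊ j ≟ u ⌋) (G i j)))))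
      where
      pt : ∀ a b c → 𝟙 (a ∨ b ∨ c) ≤ 𝟙 c + (𝟙 a + 𝟙 b)
      pt true  b     c = ℕₚ.≤-trans (s≤s z≤n) (ℕₚ.m≤n+m (suc (𝟙 b)) (𝟙 c))
      pt false true  c = ℕₚ.m≤n+m 1 (𝟙 c)
      pt false false c = ℕₚ.m≤m+n (𝟙 c) 0

    W-del : ∀ G φ u v → u ≢ v → G u v ≡ true → G v u ≡ true → W (delE G u v) φ + (φ u v + φ v u) ≤ W G φ
    W-del G φ u v ne e e′ = subst (_≤ W G φ) (W-incid (delE G u v) φ u v)
      (∑-mono (allFin m) (λ i _ → ∑-mono (allFin m) (λ j _ → ℕₚ.*-monoˡ-≤ (φ i j) (pt i j (sameEdge? i j u v)))))
      where
      pt : ∀ i j → Dec (SameEdge i j u v) → 𝟙 (delE G u v i j) + incid u v i j ≤ 𝟙 (G i j)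
      pt i j (yes s) = ℕₚ.≤-reflexive (trans (cong₂ (λ a b → 𝟙 a + b)
        (≢true⇒≡false (λ d → proj₁ (delE⇒ G u v i j d) s)) (incid-yes ne s)) (cong 𝟙 (sym (here′ s))))
        where
        here′ : SameEdge i j u v → G i j ≡ true
        here′ (inj₁ (refl , refl)) = e
        here′ (inj₂ (refl , refl)) = e′
      pt i j (no n) = ℕₚ.≤-reflexive (trans (cong₂ (λ a b → 𝟙 a + b)
        (Bool-≡ (λ d → proj₂ (delE⇒ G u v i j d)) (delE-keep G n)) (incid-no n)) (ℕₚ.+-identityʳ _))

    Loopless : List (Fin m × Fin m) → Set
    Loopless = All (λ e → proj₁ e ≢ proj₂ e)

    ∑-incid-list : ∀ E → Simple E → Loopless E → ∀ i j → ∑[ e ∈ E ] incid (proj₁ e) (proj₂ e) i j ≡ 𝟙 ⌊ inE? E i j ⌋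
    ∑-incid-list [] s l i j = refl
    ∑-incid-list ((a , b) ∷ E) sm (ne ∷ ll) i j = go (sameEdge? i j a b)
      where
      F = (a , b) ∷ E
      go : Dec (SameEdge i j a b) → incid a b i j + ∑[ e ∈ E ] incid (proj₁ e) (proj₂ e) i j ≡ 𝟙 ⌊ inE? F i j ⌋
      go (yes s) = trans (cong₂ _+_ (incid-yes ne s) (trans (∑-incid-list E (Simple-tail sm) ll i j)
          (cong 𝟙 (¬does⇒ (inE? E i j) (λ k → Simple-head sm (InE-resp (SE-sym s) k))))))
        (sym (cong 𝟙 (⇒does (inE? F i j) (here s))))
      go (no n) = trans (cong₂ _+_ (incid-no n) (∑-incid-list E (Simple-tail sm) ll i j))
        (cong 𝟙 (Bool-≡ (λ k → ⇒does (inE? F i j) (there (does⇒ (inE? E i j) k)))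
          (λ k → ⇒does (inE? E i j) (drop (does⇒ (inE? F i j) k)))))
        where
        drop : InE F i j → InE E i j
        drop (here s)  = ⊥-elim (n s)
        drop (there k) = k

    W-list : ∀ {G E} φ → Simple E → Loopless E → Rep G E → W G φ ≡ ∑[ e ∈ E ] (φ (proj₁ e) (proj₂ e) + φ (proj₂ e) (proj₁ e))
    W-list {G} {E} φ sm ll r = begin
      W G φ ≡⟨ ∑-cong (allFin m) (λ i _ → ∑-cong (allFin m) (λ j _ → trans (cong (_* φ i j) (trans (cong 𝟙 (G≡ i j)) (sym (∑-incid-list E sm ll i j)))) (sym (∑-*ʳ (φ i j) (λ e → incid (proj₁ e) (proj₂ e) i j) E)))) ⟩
      ∑[ i ∈ allFin m ] ∑[ j ∈ allFin m ] ∑[ e ∈ E ] (incid (proj₁ e) (proj₂ e) i j * φ i j) ≡⟨ ∑-cong (allFin m) (λ i _ → ∑-swap (λ j e → incid (proj₁ e) (proj₂ e) i j * φ i j) (allFin m) E) ⟩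
      ∑[ i ∈ allFin m ] ∑[ e ∈ E ] ∑[ j ∈ allFin m ] (incid (proj₁ e) (proj₂ e) i j * φ i j) ≡⟨ ∑-swap (λ i e → ∑[ j ∈ allFin m ] (incid (proj₁ e) (proj₂ e) i j * φ i j)) (allFin m) E ⟩
      ∑[ e ∈ E ] ∑[ i ∈ allFin m ] ∑[ j ∈ allFin m ] (incid (proj₁ e) (proj₂ e) i j * φ i j) ≡⟨ ∑-cong E (λ e _ → ∑-incid φ (proj₁ e) (proj₂ e)) ⟩
      ∑[ e ∈ E ] (φ (proj₁ e) (proj₂ e) + φ (proj₂ e) (proj₁ e)) ∎
      where
      open ≡-Reasoning
      G≡ : ∀ i j → G i j ≡ ⌊ inE? E i j ⌋
      G≡ i j = Bool-≡ (λ e → ⇒does (inE? E i j) (proj₁ (r i j) e)) (λ e → proj₂ (r i j) (does⇒ (inE? E i j) e))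

    W-degree : ∀ (G : Graph m) k → W G (λ i _ → 𝟙 ⌊ k ≟ i ⌋) ≡ ∑[ j ∈ allFin m ] 𝟙 (G k j)
    W-degree G k = trans (∑-cong (allFin m) (λ i _ → trans (∑-*ʳ (𝟙 ⌊ k ≟ i ⌋) (λ j → 𝟙 (G i j)) (allFin m)) (ℕₚ.*-comm _ (𝟙 ⌊ k ≟ i ⌋)))) (∑-δ (λ i → ∑[ j ∈ allFin m ] 𝟙 (G i j)) k)

    data Tree : Set where
      leaf : Fin m → Tree
      node : Fin m → Tree → Tree → Tree

    top : Tree → Fin m
    top (leaf v)     = v
    top (node v _ _) = v

    verts : Tree → List (Fin m)
    verts (leaf v)     = v ∷ []
    verts (node v l r) = v ∷ verts l ++ verts r

    leaves : Tree → List (Fin m)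
    leaves (leaf v)     = v ∷ []
    leaves (node v l r) = leaves l ++ leaves r

    edges : Fin m → Tree → List (Fin m × Fin m)
    edges p (leaf v)     = (p , v) ∷ []
    edges p (node v l r) = (p , v) ∷ edges v l ++ edges v r

    top∈verts : ∀ t → top t ∈ verts t
    top∈verts (leaf v)     = here refl
    top∈verts (node v l r) = here refl

    top-edge : ∀ p t → (p , top t) ∈ edges p t
    top-edge p (leaf v)     = here refl
    top-edge p (node v l r) = here refl

    edges⇒verts : ∀ p t {e} → e ∈ edges p t → proj₁ e ∈ p ∷ verts t × proj₂ e ∈ verts t
    edges⇒verts p (leaf v) (here refl) = here refl , here refl
    edges⇒verts p (node v l r) (here refl) = here refl , here refl
    edges⇒verts p (node v l r) (there i) with ∈ₚ.∈-++⁻ (edges v l) i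
    ... | inj₁ j = let (a , b) = edges⇒verts v l j in there (up a) , there (∈ₚ.∈-++⁺ˡ b)
      where
      up : ∀ {w} → w ∈ v ∷ verts l → w ∈ verts (node v l r)
      up (here e)  = here e
      up (there k) = there (∈ₚ.∈-++⁺ˡ k)
    ... | inj₂ j = let (a , b) = edges⇒verts v r j in there (up a) , there (∈ₚ.∈-++⁺ʳ (verts l) b)
      where
      up : ∀ {w} → w ∈ v ∷ verts r → w ∈ verts (node v l r)
      up (here e)  = here e
      up (there k) = there (∈ₚ.∈-++⁺ʳ (verts l) k)

    InE⇒verts : ∀ p t {i j} → InE (edges p t) i j → i ∈ p ∷ verts t × j ∈ p ∷ verts t
    InE⇒verts p t k = go (edges⇒verts p t) k
      where
      go : ∀ {E i j} → (∀ {e} → e ∈ E → proj₁ e ∈ p ∷ verts t × proj₂ e ∈ verts t) → InE E i j → i ∈ p ∷ verts t × j ∈ p ∷ verts t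
      go h (here (inj₁ (refl , refl))) = let (a , b) = h (here refl) in a , there b
      go h (here (inj₂ (refl , refl))) = let (a , b) = h (here refl) in there b , a
      go h (there k) = go (λ i → h (there i)) k

    Unique-node : ∀ {p v l r} → Unique (p ∷ verts (node v l r)) → Unique (v ∷ verts l) × Unique (v ∷ verts r) × (∀ {w} → w ∈ verts l → w ∉ verts r)
    Unique-node {p} {v} {l} {r} (_ ∷ u@(h ∷ u′)) with Unique-++⁻ (verts l) u′
    ... | a , b , d = Unique-∷ (λ i → Unique-head u (∈ₚ.∈-++⁺ˡ i)) a , Unique-∷ (λ i → Unique-head u (∈ₚ.∈-++⁺ʳ (verts l) i)) b , d

    edges-simple : ∀ p t → Unique (p ∷ verts t) → Simple (edges p t)
    edges-simple p (leaf v) u = [] ∷ []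
    edges-simple p (node v l r) u with Unique-node {p} {v} {l} {r} u
    ... | ul , ur , d = All-tabulate (λ {e} i s → Unique-head u (sub i s))
        ∷ APₚ.++⁺ (edges-simple v l ul) (edges-simple v r ur)
            (All-tabulate (λ {e} i → All-tabulate (λ {f} j s → cross i j s)))
      where
      sub : ∀ {e} → e ∈ edges v l ++ edges v r → SameEdge p v (proj₁ e) (proj₂ e) → p ∈ verts (node v l r)
      sub {e} i s with InE⇒verts-++ | ∈⇒InE i
        where
        InE⇒verts-++ : ∀ {i j} → InE (edges v l ++ edges v r) i j → i ∈ verts (node v l r)
        InE⇒verts-++ k with Anyₚ.++⁻ (edges v l) k
        ... | inj₁ k′ = [ here , (λ z → there (∈ₚ.∈-++⁺ˡ z)) ]′ (Data.List.Relation.Unary.Any.toSum (proj₁ (InE⇒verts v l k′)))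
        ... | inj₂ k′ = [ here , (λ z → there (∈ₚ.∈-++⁺ʳ (verts l) z)) ]′ (Data.List.Relation.Unary.Any.toSum (proj₁ (InE⇒verts v r k′)))
      ... | f | k = f (InE-resp {i = p} {v} s k)
      cross : ∀ {e f} → e ∈ edges v l → f ∈ edges v r → ¬ SameEdge (proj₁ e) (proj₂ e) (proj₁ f) (proj₂ f)
      cross i j s with edges⇒verts v l i | s
      ... | _ , b | inj₁ (refl , refl) = d b (proj₂ (edges⇒verts v r j))
      ... | _ , b | inj₂ (refl , refl) with proj₁ (edges⇒verts v r j)
      ...   | here refl = Unique-head ul b
      ...   | there k   = d b k

    edges-loopless : ∀ p t → Unique (p ∷ verts t) → Loopless (edges p t)
    edges-loopless p (leaf v) u = (λ { refl → Unique-head u (here refl) }) ∷ []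
    edges-loopless p (node v l r) u with Unique-node {p} {v} {l} {r} u
    ... | ul , ur , _ = (λ { refl → Unique-head u (here refl) }) ∷ Allₚ.++⁺ (edges-loopless v l ul) (edges-loopless v r ur)

    edges-connect : ∀ (R : Fin m → Fin m → Set) → (∀ {a b c} → R a b → R b c → R a c) →
      ∀ p t → (∀ {i j} → (i , j) ∈ edges p t → R i j) → ∀ {w} → w ∈ verts t → R p w
    edges-connect R tr p (leaf v) h (here refl) = h (here refl)
    edges-connect R tr p (node v l r) h (here refl) = h (here refl)
    edges-connect R tr p (node v l r) h (there i) with ∈ₚ.∈-++⁻ (verts l) i
    ... | inj₁ j = tr (h (here refl)) (edges-connect R tr v l (λ k → h (there (∈ₚ.∈-++⁺ˡ k))) j)
    ... | inj₂ j = tr (h (here refl)) (edges-connect R tr v r (λ k → h (there (∈ₚ.∈-++⁺ʳ (edges v l) k))) j)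

    edges-reach : ∀ {G} p t → Rep G (edges p t) → ∀ {a b} → a ∈ p ∷ verts t → b ∈ p ∷ verts t → Reach G a b
    edges-reach {G} p t r ia ib = Reach-trans (Reach-sym (Rep-sym r) (from ia)) (from ib)
      where
      from : ∀ {w} → w ∈ p ∷ verts t → Reach G p w
      from (here refl) = _ , here
      from (there i)   = edges-connect (Reach G) Reach-trans p t (λ {x} {y} k → _ , step (proj₂ (r x y) (∈⇒InE k)) here) i

  -- Binary trees from graphs

  ∑-allFin-suc : ∀ {m} (f : Fin (suc m) → ℕ) → ∑ (allFin (suc m)) f ≡ f fzero + ∑ (allFin m) (f ∘ fsuc)
  ∑-allFin-suc {m} f = cong (f fzero +_) (trans (cong (λ xs → ∑ xs f) (sym (Lₚ.map-tabulate id fsuc))) (∑-map fsuc f (allFin m)))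

  length-allFin : ∀ m → length (allFin m) ≡ m
  length-allFin m = Lₚ.length-tabulate id

  <ᵇ-suc : ∀ a b → (a <ᵇ suc b) ≡ (a ≤ᵇ b)
  <ᵇ-suc zero    b = refl
  <ᵇ-suc (suc a) b = refl

  count-≤ᵇ : ∀ {m} c → suc c ≤ m → ∑[ i ∈ allFin m ] 𝟙 (toℕ i ≤ᵇ c) ≡ suc c
  count-≤ᵇ {suc m} zero le = trans (∑-allFin-suc {m} (λ i → 𝟙 (toℕ i ≤ᵇ 0))) (cong suc (∑-zero _ (allFin m) (λ x _ → refl)))
  count-≤ᵇ {suc m} (suc c) (s≤s le) = trans (∑-allFin-suc {m} (λ i → 𝟙 (toℕ i ≤ᵇ suc c)))
    (cong suc (trans (∑-cong (allFin m) (λ i _ → cong 𝟙 (<ᵇ-suc (toℕ i) c))) (count-≤ᵇ c le)))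

  least : (P : ℕ → Bool) → ∀ K → P K ≡ true → ∃[ k ] (k ≤ K × P k ≡ true × (∀ j → j < k → P j ≡ false))
  least P K h with P 0 in eq
  ... | true = 0 , z≤n , eq , λ j ()
  least P zero h | false = ⊥-elim (true≢false h eq)
  least P (suc K) h | false with least (P ∘ suc) K h
  ... | k , le , pk , mn = suc k , s≤s le , pk , λ { zero _ → eq ; (suc j) (s≤s lt) → mn j lt }

  ≤ᵇ-true : ∀ {a b} → a ≤ b → (a ≤ᵇ b) ≡ true
  ≤ᵇ-true {a} {b} le with a ≤ᵇ b | ℕₚ.≤⇒≤ᵇ le
  ... | true | _ = refl

  ≤ᵇ-false : ∀ {a b} → b < a → (a ≤ᵇ b) ≡ false
  ≤ᵇ-false {a} {b} lt = ≢true⇒≡false (λ e → ℕₚ.<⇒≱ lt (ℕₚ.≤ᵇ⇒≤ a b (subst Data.Bool.T (sym e) tt)))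

  ≤ᵇ-elim : ∀ {a b} → (a ≤ᵇ b) ≡ true → a ≤ b
  ≤ᵇ-elim {a} {b} e = ℕₚ.≤ᵇ⇒≤ a b (subst Data.Bool.T (sym e) tt)

  ≡ᵇ-elim : ∀ {a b} → (a ≡ᵇ b) ≡ true → a ≡ b
  ≡ᵇ-elim {a} {b} e = ℕₚ.≡ᵇ⇒≡ a b (subst Data.Bool.T (sym e) tt)

  module _ {k : ℕ} where

    private
      n = suc k
      m = V n

    root : Fin m
    root = fzero

    record IsTree (G : Graph m) : Set where
      field
        symm : ∀ {i j} → G i j ≡ true → G j i ≡ true
        irr  : ∀ i → G i i ≡ false
        degL : ∀ i → toℕ i ≤ n → ∑[ j ∈ allFin m ] 𝟙 (G i j) ≡ 1
        degN : ∀ i → n < toℕ i → ∑[ j ∈ allFin m ] 𝟙 (G i j) ≡ 3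
        conn : ∀ i j → reachMat n G i j ≡ true

    symᵇ : Graph m → Fin m → Fin m → Bool
    symᵇ G i j = (not (G i j) ∨ G j i) ∧ not (⌊ i ≟ j ⌋ ∧ G i j)

    degᵇ : Graph m → Fin m → Bool
    degᵇ G i = if toℕ i ≤ᵇ n then degree n G i ≡ᵇ 1 else degree n G i ≡ᵇ 3

    isBinTree⇒ : ∀ G → isBinTree n G ≡ true → IsTree G
    isBinTree⇒ G h = record
      { symm = λ {i} {j} e → ∨-case (proj₁ (cell i j)) e
      ; irr = λ i → not-case i (proj₂ (cell i i))
      ; degL = λ i le → trans (sym (sum-map (λ j → 𝟙 (G i j)) (allFin m))) (≡ᵇ-elim (subst (λ b → (if b then degree n G i ≡ᵇ 1 else degree n G i ≡ᵇ 3) ≡ true) (≤ᵇ-true le) (h₂ i)))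
      ; degN = λ i lt → trans (sym (sum-map (λ j → 𝟙 (G i j)) (allFin m))) (≡ᵇ-elim (subst (λ b → (if b then degree n G i ≡ᵇ 1 else degree n G i ≡ᵇ 3) ≡ true) (≤ᵇ-false lt) (h₂ i)))
      ; conn = λ i j → all-elim {p = reachMat n G i} (all-elim {p = λ i → all (reachMat n G i) (allFin m)} h₃ (∈-allFin i)) (∈-allFin j)
      }
      where
      c₁ = all (λ i → all (symᵇ G i) (allFin m)) (allFin m)
      c₂ = all (degᵇ G) (allFin m)
      c₃ = all (λ i → all (reachMat n G i) (allFin m)) (allFin m)
      h₁ : c₁ ≡ true
      h₁ = proj₁ (∧-split {c₁} {c₂ ∧ c₃} h)
      h₂ : ∀ i → degᵇ G i ≡ true
      h₂ i = all-elim {p = degᵇ G} (proj₁ (∧-split {c₂} {c₃} (proj₂ (∧-split {c₁} {c₂ ∧ c₃} h)))) (∈-allFin i)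
      h₃ : c₃ ≡ true
      h₃ = proj₂ (∧-split {c₂} {c₃} (proj₂ (∧-split {c₁} {c₂ ∧ c₃} h)))
      cell : ∀ i j → (not (G i j) ∨ G j i) ≡ true × not (⌊ i ≟ j ⌋ ∧ G i j) ≡ true
      cell i j = ∧-split (all-elim {p = symᵇ G i} (all-elim {p = λ i → all (symᵇ G i) (allFin m)} h₁ (∈-allFin i)) (∈-allFin j))
      ∨-case : ∀ {a b} → (not a ∨ b) ≡ true → a ≡ true → b ≡ true
      ∨-case e refl = e
      not-case : ∀ i → not (⌊ i ≟ i ⌋ ∧ G i i) ≡ true → G i i ≡ false
      not-case i e rewrite ⇒does (i ≟ i) refl = trans (sym (𝔹ₚ.not-involutive _)) (cong not e)

    data Sub (G : Graph m) : Fin m → Fin m → Tree {m} → Set where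
      sleaf : ∀ {p v} → toℕ v ≤ n → G v p ≡ true → (∀ j → G v j ≡ true → j ≡ p) → Sub G p v (leaf v)
      snode : ∀ {p v a b l r} → n < toℕ v → G v p ≡ true → G v a ≡ true → G v b ≡ true →
              a ≢ b → p ≢ a → p ≢ b → (∀ j → G v j ≡ true → j ≡ p ⊎ j ≡ a ⊎ j ≡ b) →
              Sub G v a l → Sub G v b r → Sub G p v (node v l r)

    Sub-top : ∀ {G p v t} → Sub G p v t → top t ≡ v
    Sub-top (sleaf _ _ _) = refl
    Sub-top (snode _ _ _ _ _ _ _ _ _ _) = refl

    Sub-adj : ∀ {G p v t} → Sub G p v t → ∀ {u w} → u ∈ verts t → G u w ≡ true → InE (edges p t) u w
    Sub-adj (sleaf _ _ h) (here refl) e with h _ e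
    ... | refl = here SE-swap
    Sub-adj {p = p} {v} (snode {l = l} {r} _ _ _ _ _ _ _ h sl sr) (here refl) e with h _ e
    ... | inj₁ refl        = here SE-swap
    ... | inj₂ (inj₁ refl) = there (Anyₚ.++⁺ˡ (∈⇒InE (subst (λ z → (v , z) ∈ edges v l) (Sub-top sl) (top-edge v l))))
    ... | inj₂ (inj₂ refl) = there (Anyₚ.++⁺ʳ (edges v l) (∈⇒InE (subst (λ z → (v , z) ∈ edges v r) (Sub-top sr) (top-edge v r))))
    Sub-adj {v = v} (snode {l = l} {r} _ _ _ _ _ _ _ _ sl sr) (there i) e with ∈ₚ.∈-++⁻ (verts l) i
    ... | inj₁ j = there (Anyₚ.++⁺ˡ (Sub-adj sl j e))
    ... | inj₂ j = there (Anyₚ.++⁺ʳ (edges v l) (Sub-adj sr j e))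

    Sub-edge : ∀ {G p v t} → Sub G p v t → ∀ {e} → e ∈ edges p t → G (proj₂ e) (proj₁ e) ≡ true
    Sub-edge (sleaf _ g _) (here refl) = g
    Sub-edge (snode _ g _ _ _ _ _ _ _ _) (here refl) = g
    Sub-edge {v = v} (snode {l = l} _ _ _ _ _ _ _ _ sl sr) (there i) with ∈ₚ.∈-++⁻ (edges v l) i
    ... | inj₁ j = Sub-edge sl j
    ... | inj₂ j = Sub-edge sr j

    record TreeOf (G : Graph m) : Set where
      field
        tree  : Tree {m}
        subt  : Sub G root (top tree) tree
        uniq  : Unique (root ∷ verts tree)
        compl : ∀ v → v ∈ root ∷ verts tree
        nbr₀  : ∀ j → G root j ≡ true → j ≡ top tree
        symG  : ∀ {i j} → G i j ≡ true → G j i ≡ true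

      rep : Rep G (edges root tree)
      rep i j = f (compl i) , g
        where
        f : i ∈ root ∷ verts tree → G i j ≡ true → InE (edges root tree) i j
        f (here refl) e with nbr₀ j e
        ... | refl = ∈⇒InE (top-edge root tree)
        f (there i∈) e = Sub-adj subt i∈ e
        g : InE (edges root tree) i j → G i j ≡ true
        g h = go (λ {e} → Sub-edge subt {e}) h
          where
          go : ∀ {E} → (∀ {e} → e ∈ E → G (proj₂ e) (proj₁ e) ≡ true) → InE E i j → G i j ≡ true
          go q (here (inj₁ (refl , refl))) = symG (q (here refl))
          go q (here (inj₂ (refl , refl))) = q (here refl)
          go q (there z) = go (λ y → q (there y)) z

    module Extract (G : Graph m) (T : IsTree G) where
      open IsTree T

      reached : ℕ → Fin m → Bool
      reached zero    v = ⌊ v ≟ root ⌋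
      reached (suc i) v = reached i v ∨ any (λ l → reached i l ∧ G l v) (allFin m)

      reached-iter : ∀ i v → iter n i (reachStep n G) (λ a b → ⌊ a ≟ b ⌋ ∨ G a b) root v ≡ true → reached (suc i) v ≡ true
      reached-iter zero v e with ∨-split {⌊ root ≟ v ⌋} e
      ... | inj₁ e′ = cong (_∨ any (λ l → reached 0 l ∧ G l v) (allFin m)) (⇒does (v ≟ root) (sym (does⇒ (root ≟ v) e′)))
      ... | inj₂ e′ = ∨-introʳ {reached 0 v} (any-intro (∈-allFin root) (cong₂ _∧_ (⇒does (root ≟ root) refl) e′))
      reached-iter (suc i) v e with ∨-split {iter n i (reachStep n G) (λ a b → ⌊ a ≟ b ⌋ ∨ G a b) root v} e
      ... | inj₁ e′ = cong (_∨ any (λ l → reached (suc i) l ∧ G l v) (allFin m)) (reached-iter i v e′)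
      ... | inj₂ e′ with any-elim (allFin m) e′
      ...   | l , _ , q with ∧-split q
      ...     | q₁ , q₂ = ∨-introʳ {reached (suc i) v} (any-intro (∈-allFin l) (cong₂ _∧_ (reached-iter i l q₁) q₂))

      K : ℕ
      K = suc m

      abstract
       first : ∀ v → ∃[ i ] (i ≤ K × reached i v ≡ true × (∀ j → j < i → reached j v ≡ false))
       first v = least (λ i → reached i v) K (reached-iter m v (conn root v))

      lev : Fin m → ℕ
      lev v = proj₁ (first v)

      lev≤K : ∀ v → lev v ≤ K
      lev≤K v = proj₁ (proj₂ (first v))

      lev-min : ∀ v i → reached i v ≡ true → lev v ≤ i
      lev-min v i e = ℕₚ.≮⇒≥ (λ lt → true≢false e (proj₂ (proj₂ (proj₂ (first v))) i lt))

      parent : ∀ v → v ≢ root → ∃[ u ] (G u v ≡ true × lev u < lev v)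
      parent v ne with lev v in eq | proj₂ (proj₂ (first v))
      ... | zero  | e , _ = ⊥-elim (ne (does⇒ (v ≟ root) e))
      ... | suc i | e , mn with ∨-split {reached i v} e
      ...   | inj₁ e′ = ⊥-elim (true≢false e′ (mn i (ℕₚ.n<1+n i)))
      ...   | inj₂ e′ with any-elim (allFin m) e′
      ...     | u , _ , q = u , proj₂ (∧-split {reached i u} q) , s≤s (lev-min u i (proj₁ (∧-split q)))

      parentOrRoot : ∀ v → Dec (v ≡ root) → ∃[ u ] (v ≢ root → G u v ≡ true × lev u < lev v)
      parentOrRoot v (yes e) = root , λ ne → ⊥-elim (ne e)
      parentOrRoot v (no ne) = proj₁ (parent v ne) , λ _ → proj₂ (parent v ne)

      abstract
       par : Fin m → Fin m
       par v = proj₁ (parentOrRoot v (v ≟ root))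

       par-spec : ∀ v → v ≢ root → G (par v) v ≡ true × lev (par v) < lev v
       par-spec v = proj₂ (parentOrRoot v (v ≟ root))

      pe : Fin m → Fin m → ℕ
      pe i j = 𝟙 (not ⌊ i ≟ root ⌋) * 𝟙 ⌊ par i ≟ j ⌋

      private
        nr : ℕ
        nr = ∑[ i ∈ allFin m ] 𝟙 (not ⌊ i ≟ root ⌋)

        nr-eq : nr + 1 ≡ m
        nr-eq = begin
          nr + 1 ≡⟨ cong (nr +_) (sym (∑-δ {m} (λ _ → 1) root)) ⟩
          nr + ∑[ j ∈ allFin m ] (𝟙 ⌊ root ≟ j ⌋ * 1) ≡⟨ sym (∑-+ (λ i → 𝟙 (not ⌊ i ≟ root ⌋)) (λ j → 𝟙 ⌊ root ≟ j ⌋ * 1) (allFin m)) ⟩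
          ∑[ i ∈ allFin m ] (𝟙 (not ⌊ i ≟ root ⌋) + 𝟙 ⌊ root ≟ i ⌋ * 1) ≡⟨ ∑-cong {f = λ i → 𝟙 (not ⌊ i ≟ root ⌋) + 𝟙 ⌊ root ≟ i ⌋ * 1} {g = λ _ → 1} (allFin m) (λ i _ → trans (cong (λ b → 𝟙 (not ⌊ i ≟ root ⌋) + 𝟙 b * 1) (≟-comm root i)) (lem ⌊ i ≟ root ⌋)) ⟩
          ∑[ i ∈ allFin m ] 1 ≡⟨ ∑-const 1 (allFin m) ⟩
          length (allFin m) * 1 ≡⟨ trans (ℕₚ.*-identityʳ _) (length-allFin m) ⟩
          m ∎
          where
          open ≡-Reasoning
          lem : ∀ b → 𝟙 (not b) + 𝟙 b * 1 ≡ 1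
          lem true = refl
          lem false = refl

        ∑-pe : ∑[ i ∈ allFin m ] ∑[ j ∈ allFin m ] pe i j ≡ nr
        ∑-pe = ∑-cong {f = λ i → ∑[ j ∈ allFin m ] pe i j} {g = λ i → 𝟙 (not ⌊ i ≟ root ⌋)} (allFin m) (λ i _ → trans (∑-*ˡ (𝟙 (not ⌊ i ≟ root ⌋)) (λ j → 𝟙 ⌊ par i ≟ j ⌋) (allFin m))
          (trans (cong (𝟙 (not ⌊ i ≟ root ⌋) *_) (trans (∑-cong {f = λ j → 𝟙 ⌊ par i ≟ j ⌋} {g = λ j → 𝟙 ⌊ par i ≟ j ⌋ * 1} (allFin m) (λ j _ → sym (ℕₚ.*-identityʳ _))) (∑-δ {m} (λ _ → 1) (par i)))) (ℕₚ.*-identityʳ _)))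

        ∑-deg : ∑[ i ∈ allFin m ] ∑[ j ∈ allFin m ] 𝟙 (G i j) + 2 * suc n ≡ 3 * m
        ∑-deg = trans (cong (λ z → dsum + 2 * z) (sym (count-≤ᵇ n (s≤s (ℕₚ.m≤n+m (suc k) k)))))
          (trans (cong (dsum +_) (sym (∑-*ˡ 2 (λ i → 𝟙 (toℕ i ≤ᵇ n)) (allFin m))))
          (trans (sym (∑-+ (λ i → ∑[ j ∈ allFin m ] 𝟙 (G i j)) (λ i → 2 * 𝟙 (toℕ i ≤ᵇ n)) (allFin m)))
          (trans (∑-cong (allFin m) (λ i _ → pt i (ℕₚ.≤-<-connex (toℕ i) n))) (trans (∑-const 3 (allFin m)) (trans (cong (_* 3) (length-allFin m)) (ℕₚ.*-comm m 3))))))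
          where
          dsum = ∑[ i ∈ allFin m ] ∑[ j ∈ allFin m ] 𝟙 (G i j)
          pt : ∀ i → (toℕ i ≤ n) ⊎ (n < toℕ i) → ∑[ j ∈ allFin m ] 𝟙 (G i j) + 2 * 𝟙 (toℕ i ≤ᵇ n) ≡ 3
          pt i (inj₁ le) = cong₂ (λ a b → a + 2 * 𝟙 b) (degL i le) (≤ᵇ-true le)
          pt i (inj₂ lt) = cong₂ (λ a b → a + 2 * 𝟙 b) (degN i lt) (≤ᵇ-false lt)

        total : ∑[ i ∈ allFin m ] ∑[ j ∈ allFin m ] 𝟙 (G i j) ≡ ∑[ i ∈ allFin m ] ∑[ j ∈ allFin m ] (pe i j + pe j i)
        total = ℕₚ.+-cancelʳ-≡ (2 * suc n) _ _ (trans ∑-deg (trans (sym arith) (cong (_+ 2 * suc n) (sym sides))))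
          where
          sides : ∑[ i ∈ allFin m ] ∑[ j ∈ allFin m ] (pe i j + pe j i) ≡ nr + nr
          sides = trans (∑-cong (allFin m) (λ i _ → ∑-+ (pe i) (λ j → pe j i) (allFin m)))
            (trans (∑-+ (λ i → ∑[ j ∈ allFin m ] pe i j) (λ i → ∑[ j ∈ allFin m ] pe j i) (allFin m))
              (cong₂ _+_ ∑-pe (trans (∑-swap (λ i j → pe j i) (allFin m) (allFin m)) ∑-pe)))
          arith : nr + nr + 2 * suc n ≡ 3 * m
          arith = ℕₚ.+-cancelʳ-≡ 2 _ _ (trans (lem₁ nr k) (trans (cong (λ z → z + z + 2 * (k + 2)) nr-eq) (lem₂ k)))
            where
            lem₁ : ∀ a k → a + a + 2 * suc (suc k) + 2 ≡ (a + 1) + (a + 1) + 2 * (k + 2)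
            lem₁ = solve-∀
            lem₂ : ∀ k → (suc k + suc k) + (suc k + suc k) + 2 * (k + 2) ≡ 3 * (suc k + suc k) + 2
            lem₂ = solve-∀

        pe-pos : ∀ {i j} → 1 ≤ pe i j → i ≢ root × par i ≡ j
        pe-pos {i} {j} h with i ≟ root | par i ≟ j
        ... | no ne | yes e = ne , e

        pe-le : ∀ i j → pe i j ≤ 1
        pe-le i j = ℕₚ.*-mono-≤ (𝟙≤1 (not ⌊ i ≟ root ⌋)) (𝟙≤1 ⌊ par i ≟ j ⌋)

        ≤1-case : ∀ {a} → a ≤ 1 → a ≡ 0 ⊎ 1 ≤ a
        ≤1-case z≤n       = inj₁ refl
        ≤1-case (s≤s z≤n) = inj₂ (s≤s z≤n)

        pe-G : ∀ i j → pe i j + pe j i ≤ 𝟙 (G i j)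
        pe-G i j with ≤1-case (pe-le i j) | ≤1-case (pe-le j i)
        ... | inj₁ a | inj₁ b = subst (_≤ 𝟙 (G i j)) (sym (cong₂ _+_ a b)) z≤n
        ... | inj₂ a | inj₂ b with pe-pos {i} {j} a | pe-pos {j} {i} b
        ...   | ni , refl | nj , e = ⊥-elim (ℕₚ.<-asym (proj₂ (par-spec i ni)) (subst (λ z → lev z < lev (par i)) e (proj₂ (par-spec (par i) nj))))
        pe-G i j | inj₁ a | inj₂ b with pe-pos {j} {i} b
        ...   | nj , refl = subst₂ _≤_ (sym (cong (_+ pe j i) a)) (cong 𝟙 (sym (proj₁ (par-spec j nj)))) (pe-le j (par j))
        pe-G i j | inj₂ a | inj₁ b with pe-pos {i} {j} a
        ...   | ni , refl = subst₂ _≤_ (trans (sym (ℕₚ.+-identityʳ _)) (cong (pe i j +_) (sym b))) (cong 𝟙 (sym (symm (proj₁ (par-spec i ni))))) (pe-le i (par i))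

      adj : ∀ {i j} → G i j ≡ true → (i ≢ root × par i ≡ j) ⊎ (j ≢ root × par j ≡ i)
      adj {i} {j} e = split (subst (λ b → 𝟙 b ≤ pe i j + pe j i) e
        (∑-tight (λ j → pe i j + pe j i) (λ j → 𝟙 (G i j)) (allFin m) (pe-G i)
          (∑-tight (λ i → ∑[ j ∈ allFin m ] (pe i j + pe j i)) (λ i → ∑[ j ∈ allFin m ] 𝟙 (G i j)) (allFin m)
            (λ i → ∑-mono (allFin m) (λ j _ → pe-G i j)) (ℕₚ.≤-reflexive total) (∈-allFin i)) (∈-allFin j)))
        where
        split : 1 ≤ pe i j + pe j i → (i ≢ root × par i ≡ j) ⊎ (j ≢ root × par j ≡ i)
        split h with ≤1-case (pe-le i j)
        ... | inj₁ z = inj₂ (pe-pos {j} {i} (subst (λ a → 1 ≤ a + pe j i) z h))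
        ... | inj₂ o = inj₁ (pe-pos {i} {j} o)

      nbrs : Fin m → List (Fin m)
      nbrs v = filterᵇ (G v) (allFin m)

      nbrs-∈ : ∀ {v j} → G v j ≡ true → j ∈ nbrs v
      nbrs-∈ {v} {j} e = ∈-filter⁺ (G v) (∈-allFin j) e

      nbrs-G : ∀ {v j} → j ∈ nbrs v → G v j ≡ true
      nbrs-G {v} i = proj₂ (∈-filter⁻ (G v) (allFin m) i)

      only : ∀ v → toℕ v ≤ n → ∃[ p ] (G v p ≡ true × (∀ j → G v j ≡ true → j ≡ p))
      only v le with nbrs v in eq | trans (length-filter (G v) (allFin m)) (degL v le)
      ... | p ∷ [] | _ = p , nbrs-G (subst (p ∈_) (sym eq) (here refl)) , λ j e → un (subst (j ∈_) eq (nbrs-∈ e))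
        where
        un : ∀ {j} → j ∈ p ∷ [] → j ≡ p
        un (here e) = e

      three : ∀ v p → n < toℕ v → G v p ≡ true → ∃[ a ] ∃[ b ] (G v a ≡ true × G v b ≡ true × a ≢ b × p ≢ a × p ≢ b × (∀ j → G v j ≡ true → j ≡ p ⊎ j ≡ a ⊎ j ≡ b))
      three v p lt e with ∈⇒↭ (nbrs-∈ e)
      ... | ys , perm with ys | perm | trans (sym (↭ₚ.↭-length perm)) (trans (length-filter (G v) (allFin m)) (degN v lt))
      ...   | a ∷ b ∷ [] | q | _ with Unique-↭ q (Unique-filter (G v) (Uₚ.allFin⁺ m))
      ...     | (pa ∷ pb ∷ []) ∷ (ab ∷ []) ∷ [] ∷ [] = a , b , g (there (here refl)) , g (there (there (here refl))) , ab , pa , pb , λ j h → un (↭ₚ.∈-resp-↭ q (nbrs-∈ h))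
        where
        g : ∀ {j} → j ∈ p ∷ a ∷ b ∷ [] → G v j ≡ true
        g i = nbrs-G (↭ₚ.∈-resp-↭ (↭-sym q) i)
        un : ∀ {j} → j ∈ p ∷ a ∷ b ∷ [] → j ≡ p ⊎ j ≡ a ⊎ j ≡ b
        un (here e) = inj₁ e
        un (there (here e)) = inj₂ (inj₁ e)
        un (there (there (here e))) = inj₂ (inj₂ e)

      data Anc (a : Fin m) : Fin m → Set where
        anc-refl : Anc a a
        anc-step : ∀ {w} → w ≢ root → Anc a (par w) → Anc a w

      Anc-lev : ∀ {a w} → Anc a w → lev a ≤ lev w
      Anc-lev anc-refl = ℕₚ.≤-refl
      Anc-lev (anc-step ne h) = ℕₚ.≤-trans (Anc-lev h) (ℕₚ.<⇒≤ (proj₂ (par-spec _ ne)))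

      Anc-linear : ∀ {a b w} → Anc a w → Anc b w → Anc a b ⊎ Anc b a
      Anc-linear anc-refl h = inj₂ h
      Anc-linear (anc-step ne h) anc-refl = inj₁ (anc-step ne h)
      Anc-linear (anc-step _ h) (anc-step _ h′) = Anc-linear h h′

      Anc-trans : ∀ {a b w} → Anc a b → Anc b w → Anc a w
      Anc-trans h anc-refl = h
      Anc-trans h (anc-step ne g) = anc-step ne (Anc-trans h g)

      Anc-sib : ∀ {a b} → a ≢ root → b ≢ root → par a ≡ par b → a ≢ b → ¬ Anc a b
      Anc-sib na nb e ne anc-refl = ne refl
      Anc-sib {a} {b} na nb e ne (anc-step _ h) = ℕₚ.<⇒≱ (subst (λ z → lev z < lev a) e (proj₂ (par-spec a na))) (Anc-lev h)

      build : ∀ i v → v ≢ root → K < lev v + i → ∃[ t ] (Sub G (par v) v t × Unique (verts t) × (∀ {w} → w ∈ verts t → Anc v w))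
      build zero v ne lt = ⊥-elim (ℕₚ.<⇒≱ lt (subst (_≤ K) (sym (ℕₚ.+-identityʳ _)) (lev≤K v)))
      build (suc i) v ne lt with ℕₚ.≤-<-connex (toℕ v) n
      ... | inj₁ le with only v le
      ...   | p , e , h = leaf v , sleaf le gp (λ j q → trans (h j q) (sym (h (par v) gp))) , [] ∷ [] , λ { (here refl) → anc-refl }
        where
        gp : G v (par v) ≡ true
        gp = symm (proj₁ (par-spec v ne))
      build (suc i) v ne lt | inj₂ gt with three v (par v) gt (symm (proj₁ (par-spec v ne)))
      ...   | a , b , ga , gb , ab , pa , pb , h with child a ga pa | child b gb pb
        where
        child : ∀ c → G v c ≡ true → par v ≢ c → c ≢ root × par c ≡ v
        child c g nc with adj g
        ... | inj₁ (_ , e) = ⊥-elim (nc e)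
        ... | inj₂ q = q
      ...     | na , ea | nb , eb with build i a na (deeper na ea) | build i b nb (deeper nb eb)
        where
        deeper : ∀ {c} → c ≢ root → par c ≡ v → K < lev c + i
        deeper {c} nc e = ℕₚ.≤-trans lt (subst (_≤ lev c + i) (sym (ℕₚ.+-suc (lev v) i))
          (ℕₚ.+-monoˡ-≤ i (subst (λ z → lev z < lev c) e (proj₂ (par-spec c nc)))))
      ...       | l , sl , ul , al | r , sr , ur , ar = node v l r ,
          snode gt (symm (proj₁ (par-spec v ne))) ga gb ab pa pb h (subst (λ z → Sub G z a l) ea sl) (subst (λ z → Sub G z b r) eb sr) ,
          Unique-∷ fresh (Unique-++ (verts l) ul ur disj) , anc
        where
        anc-a : Anc v a
        anc-a = anc-step na (subst (Anc v) (sym ea) anc-refl)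
        anc-b : Anc v b
        anc-b = anc-step nb (subst (Anc v) (sym eb) anc-refl)
        disj : ∀ {w} → w ∈ verts l → w ∉ verts r
        disj x y with Anc-linear (al x) (ar y)
        ... | inj₁ q = Anc-sib na nb (trans ea (sym eb)) ab q
        ... | inj₂ q = Anc-sib nb na (trans eb (sym ea)) (λ z → ab (sym z)) q
        below : ∀ {c} → c ≢ root → par c ≡ v → ¬ Anc c v
        below {c} nc e q = ℕₚ.<⇒≱ (subst (λ z → lev z < lev c) e (proj₂ (par-spec c nc))) (Anc-lev q)
        fresh : v ∉ verts l ++ verts r
        fresh x with ∈ₚ.∈-++⁻ (verts l) x
        ... | inj₁ y = below na ea (al y)
        ... | inj₂ y = below nb eb (ar y)
        anc : ∀ {w} → w ∈ v ∷ verts l ++ verts r → Anc v w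
        anc (here refl) = anc-refl
        anc (there x) with ∈ₚ.∈-++⁻ (verts l) x
        ... | inj₁ y = Anc-trans anc-a (al y)
        ... | inj₂ y = Anc-trans anc-b (ar y)

      extract : TreeOf G
      extract with only root z≤n
      ... | c , gc , hc with adj gc
      ...   | inj₁ (ne , _) = ⊥-elim (ne refl)
      ...   | inj₂ (ne , e) with build (suc K) c ne (ℕₚ.m≤n+m (suc K) (lev c))
      ...     | t , st , ut , at = record
          { tree = t
          ; subt = subst₂ (λ p v → Sub G p v t) e (sym (Sub-top st)) st
          ; uniq = Unique-∷ (λ x → noroot (at x)) ut
          ; compl = λ v → comp (suc (lev v)) v ℕₚ.≤-refl
          ; nbr₀ = λ j g → trans (hc j g) (sym (Sub-top st))
          ; symG = symm }
        where
        noroot : ¬ Anc c root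
        noroot anc-refl = ne refl
        noroot (anc-step n′ _) = n′ refl
        comp : ∀ i v → lev v < i → v ∈ root ∷ verts t
        comp (suc i) v (s≤s le) with v ≟ root
        ... | yes e′ = here e′
        ... | no ne′ with par-spec v ne′
        ...   | g , lt with comp i (par v) (ℕₚ.≤-trans lt le)
        ...     | here pr = there (subst (_∈ verts t) (sym (trans (hc v (subst (λ z → G z v ≡ true) pr g)) (sym (Sub-top st)))) (top∈verts t))
        ...     | there x = subst (λ z → v ∈ z ∷ verts t) e (proj₂ (InE⇒verts (par c) t (Sub-adj st x g)))

  -- Moves on trees

  module _ {m : ℕ} where

    inner : Tree {m} → List (Fin m × Fin m)
    inner (leaf v)     = []
    inner (node v l r) = edges v l ++ edges v r

    edges-inner : ∀ p t → edges p t ≡ (p , top t) ∷ inner t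
    edges-inner p (leaf v)     = refl
    edges-inner p (node v l r) = refl

    data Ins (x : Fin m) (s : Tree {m}) : Tree {m} → Tree {m} → Set where
      hereL : ∀ {u} → Ins x s u (node x s u)
      hereR : ∀ {u} → Ins x s u (node x u s)
      inL   : ∀ {v l l′ r} → Ins x s l l′ → Ins x s (node v l r) (node v l′ r)
      inR   : ∀ {v l r r′} → Ins x s r r′ → Ins x s (node v l r) (node v l r′)

    Ins-verts : ∀ {x s u t} → Ins x s u t → verts t ↭ x ∷ verts s ++ verts u
    Ins-verts hereL = ↭-refl
    Ins-verts {x} {s} {u} hereR = prep x (↭ₚ.++-comm (verts u) (verts s))
    Ins-verts {x} {s} (inL {v} {l} {l′} {r} i) = begin
      v ∷ verts l′ ++ verts r ↭⟨ prep v (↭ₚ.++⁺ʳ (verts r) (Ins-verts i)) ⟩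
      v ∷ x ∷ (verts s ++ verts l) ++ verts r ↭⟨ swap v x ↭-refl ⟩
      x ∷ v ∷ (verts s ++ verts l) ++ verts r ≡⟨ cong (λ z → x ∷ v ∷ z) (Lₚ.++-assoc (verts s) (verts l) (verts r)) ⟩
      x ∷ v ∷ verts s ++ verts l ++ verts r ↭⟨ prep x (↭-sym (↭ₚ.shift v (verts s) (verts l ++ verts r))) ⟩
      x ∷ verts s ++ v ∷ verts l ++ verts r ∎
      where open Data.List.Relation.Binary.Permutation.Propositional.PermutationReasoning
    Ins-verts {x} {s} (inR {v} {l} {r} {r′} i) = begin
      v ∷ verts l ++ verts r′ ↭⟨ prep v (↭ₚ.++⁺ˡ (verts l) (Ins-verts i)) ⟩
      v ∷ verts l ++ x ∷ verts s ++ verts r ↭⟨ prep v (↭ₚ.shift x (verts l) (verts s ++ verts r)) ⟩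
      v ∷ x ∷ verts l ++ verts s ++ verts r ↭⟨ swap v x (↭ₚ.shifts (verts l) (verts s)) ⟩
      x ∷ v ∷ verts s ++ verts l ++ verts r ↭⟨ prep x (↭-sym (↭ₚ.shift v (verts s) (verts l ++ verts r))) ⟩
      x ∷ verts s ++ v ∷ verts l ++ verts r ∎
      where open Data.List.Relation.Binary.Permutation.Propositional.PermutationReasoning

    private
      EL = List (Fin m × Fin m)

      pull : ∀ (e : Fin m × Fin m) f {A B : EL} → A ↭ f ∷ B → e ∷ A ↭ f ∷ e ∷ B
      pull e f p = ↭-trans (prep e p) (swap e f ↭-refl)

    Ins-edges : ∀ {x s u t} → Ins x s u t → ∀ p → ∃[ a ] ∃[ b ] ∃[ R ]
      (edges p u ↭ (a , b) ∷ R × edges p t ↭ (a , x) ∷ (x , b) ∷ edges x s ++ R)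
    Ins-edges {x} {s} {u} hereL p = p , top u , inner u , ↭-reflexive (edges-inner p u) ,
      prep (p , x) (↭-trans (↭-reflexive (cong (edges x s ++_) (edges-inner x u))) (↭ₚ.shift (x , top u) (edges x s) (inner u)))
    Ins-edges {x} {s} {u} hereR p = p , top u , inner u , ↭-reflexive (edges-inner p u) ,
      prep (p , x) (↭-trans (↭-reflexive (cong (_++ edges x s) (edges-inner x u))) (prep (x , top u) (↭ₚ.++-comm (inner u) (edges x s))))
    Ins-edges {x} {s} (inL {v} {l} {l′} {r} i) p with Ins-edges i v
    ... | a , b , R , q₁ , q₂ = a , b , (p , v) ∷ R ++ edges v r , pull (p , v) (a , b) (↭ₚ.++⁺ʳ (edges v r) q₁) ,
      (begin
      (p , v) ∷ edges v l′ ++ edges v r ↭⟨ prep (p , v) (↭ₚ.++⁺ʳ (edges v r) q₂) ⟩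
      (p , v) ∷ (a , x) ∷ (x , b) ∷ (edges x s ++ R) ++ edges v r ≡⟨ cong (λ z → (p , v) ∷ (a , x) ∷ (x , b) ∷ z) (Lₚ.++-assoc (edges x s) R (edges v r)) ⟩
      (p , v) ∷ (a , x) ∷ (x , b) ∷ edges x s ++ R ++ edges v r ↭⟨ pull (p , v) (a , x) ↭-refl ⟩
      (a , x) ∷ (p , v) ∷ (x , b) ∷ edges x s ++ R ++ edges v r ↭⟨ prep (a , x) (pull (p , v) (x , b) ↭-refl) ⟩
      (a , x) ∷ (x , b) ∷ (p , v) ∷ edges x s ++ R ++ edges v r ↭⟨ prep (a , x) (prep (x , b) (↭-sym (↭ₚ.shift (p , v) (edges x s) (R ++ edges v r)))) ⟩
      (a , x) ∷ (x , b) ∷ edges x s ++ (p , v) ∷ R ++ edges v r ∎)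
      where open Data.List.Relation.Binary.Permutation.Propositional.PermutationReasoning
    Ins-edges {x} {s} (inR {v} {l} {r} {r′} i) p with Ins-edges i v
    ... | a , b , R , q₁ , q₂ = a , b , (p , v) ∷ edges v l ++ R ,
      pull (p , v) (a , b) (↭-trans (↭ₚ.++⁺ˡ (edges v l) q₁) (↭ₚ.shift (a , b) (edges v l) R)) ,
      (begin
      (p , v) ∷ edges v l ++ edges v r′ ↭⟨ prep (p , v) (↭ₚ.++⁺ˡ (edges v l) q₂) ⟩
      (p , v) ∷ edges v l ++ (a , x) ∷ (x , b) ∷ edges x s ++ R ↭⟨ pull (p , v) (a , x) (↭ₚ.shift (a , x) (edges v l) _) ⟩
      (a , x) ∷ (p , v) ∷ edges v l ++ (x , b) ∷ edges x s ++ R ↭⟨ prep (a , x) (pull (p , v) (x , b) (↭ₚ.shift (x , b) (edges v l) _)) ⟩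
      (a , x) ∷ (x , b) ∷ (p , v) ∷ edges v l ++ edges x s ++ R ↭⟨ prep (a , x) (prep (x , b) (prep (p , v) (↭ₚ.shifts (edges v l) (edges x s)))) ⟩
      (a , x) ∷ (x , b) ∷ (p , v) ∷ edges x s ++ edges v l ++ R ↭⟨ prep (a , x) (prep (x , b) (↭-sym (↭ₚ.shift (p , v) (edges x s) (edges v l ++ R)))) ⟩
      (a , x) ∷ (x , b) ∷ edges x s ++ (p , v) ∷ edges v l ++ R ∎)
      where open Data.List.Relation.Binary.Permutation.Propositional.PermutationReasoning

    Within : List (Fin m) → EL → Set
    Within S = All (λ e → proj₁ e ∈ S × proj₂ e ∈ S)

    Within-InE : ∀ {S E i j} → Within S E → InE E i j → i ∈ S × j ∈ S
    Within-InE (h ∷ w) (here (inj₁ (refl , refl))) = h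
    Within-InE ((a , b) ∷ w) (here (inj₂ (refl , refl))) = b , a
    Within-InE (h ∷ w) (there i) = Within-InE w i

    Within-edges : ∀ p t → Within (p ∷ verts t) (edges p t)
    Within-edges p t = All-tabulate (λ {e} i → let (a , b) = edges⇒verts p t i in a , there b)

    Within-⊆ : ∀ {S S′ E} → (∀ {v} → v ∈ S → v ∈ S′) → Within S E → Within S′ E
    Within-⊆ f = All-map (λ (a , b) → f a , f b)

    inner-within : ∀ t → Within (verts t) (inner t)
    inner-within (leaf v) = []
    inner-within (node v l r) = Allₚ.++⁺ (Within-⊆ (λ { (here e) → here e ; (there i) → there (∈ₚ.∈-++⁺ˡ i) }) (Within-edges v l))
      (Within-⊆ (λ { (here e) → here e ; (there i) → there (∈ₚ.∈-++⁺ʳ (verts l) i) }) (Within-edges v r))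

    Simple-++ : ∀ {S E F} → Simple E → Simple F → Within S E → All (λ f → proj₂ f ∉ S) F → Simple (E ++ F)
    Simple-++ {S} {E} {F} se sf w d = APₚ.++⁺ se sf (All-tabulate (λ {e} i → All-tabulate (λ {f} j q → bad (All-lookup w i) (All-lookup d j) q)))
      where
      bad : ∀ {e f : Fin m × Fin m} → proj₁ e ∈ S × proj₂ e ∈ S → proj₂ f ∉ S → ¬ SameEdge (proj₁ e) (proj₂ e) (proj₁ f) (proj₂ f)
      bad (a , b) nf (inj₁ (refl , refl)) = nf b
      bad (a , b) nf (inj₂ (refl , refl)) = nf a

  Iso-id : ∀ {n} {G H : Graph (V n)} → G ≐ H → Iso n G H
  Iso-id h = Data.Fin.Permutation.id , (λ i _ → refl) , λ i j → sym (h i j)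

  module Regraft (n : ℕ) {r x : Fin (V n)} {s u t t′ : Tree {V n}} (i₁ : Ins x s u t) (i₂ : Ins x s u t′)
    (r₀ : toℕ r ≡ 0) (U : Unique (r ∷ verts t)) where

    private
      m = V n
      y = top s
      Sset : List (Fin m)
      Sset = x ∷ r ∷ verts u

    Ut : Unique (r ∷ x ∷ verts s ++ verts u)
    Ut = Unique-↭ (prep r (Ins-verts i₁)) U

    U′ : Unique (r ∷ verts t′)
    U′ = Unique-↭ (prep r (↭-sym (Ins-verts i₂))) Ut

    private
      Uxs : Unique (x ∷ verts s)
      Uxs = proj₁ (Unique-++⁻ (x ∷ verts s) (Unique-tail Ut))

      disj : ∀ {v} → v ∈ x ∷ verts s → v ∉ verts u
      disj = proj₂ (proj₂ (Unique-++⁻ (x ∷ verts s) (Unique-tail Ut)))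

      Uu : Unique (r ∷ verts u)
      Uu = Unique-∷ (λ i → Unique-head Ut (there (∈ₚ.∈-++⁺ʳ (verts s) i))) (proj₁ (proj₂ (Unique-++⁻ (x ∷ verts s) (Unique-tail Ut))))

      s∉S : ∀ {v} → v ∈ verts s → v ∉ Sset
      s∉S i (here refl) = Unique-head Uxs i
      s∉S i (there (here refl)) = Unique-head Ut (there (∈ₚ.∈-++⁺ˡ i))
      s∉S i (there (there j)) = disj (there i) j

    module Go (G : Graph m) (rp : Rep G (edges r t))
      {a b c d : Fin m} {R R′ : List (Fin m × Fin m)}
      (pu : edges r u ↭ (a , b) ∷ R) (pt : edges r t ↭ (a , x) ∷ (x , b) ∷ edges x s ++ R)
      (pu′ : edges r u ↭ (c , d) ∷ R′) (pt′ : edges r t′ ↭ (c , x) ∷ (x , d) ∷ edges x s ++ R′)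
      (Z : List (Fin m × Fin m)) (pR : R ↭ (c , d) ∷ Z) (pR′ : R′ ↭ (a , b) ∷ Z) where

      private
        Es = inner s

        Et : edges r t ↭ (a , x) ∷ (x , b) ∷ (x , y) ∷ (c , d) ∷ Es ++ Z
        Et = ↭-trans pt (prep _ (prep _ (↭-trans (↭-reflexive (cong (_++ R) (edges-inner x s)))
          (prep _ (↭-trans (↭ₚ.++⁺ˡ Es pR) (↭ₚ.shift (c , d) Es Z))))))

        Et′ : edges r t′ ↭ (x , y) ∷ (x , d) ∷ (c , x) ∷ (a , b) ∷ Es ++ Z
        Et′ = ↭-trans pt′ (↭-trans (prep _ (prep _ (↭-trans (↭-reflexive (cong (_++ R′) (edges-inner x s)))
          (prep _ (↭-trans (↭ₚ.++⁺ˡ Es pR′) (↭ₚ.shift (a , b) Es Z))))))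
          (↭-trans (swap _ _ ↭-refl) (↭-trans (prep _ (swap _ _ ↭-refl)) (swap _ _ ↭-refl))))

        simp : Simple ((a , x) ∷ (x , b) ∷ (x , y) ∷ (c , d) ∷ Es ++ Z)
        simp = Simple-↭ Et (edges-simple r t U)

        eu : edges r u ↭ (c , d) ∷ (a , b) ∷ Z
        eu = ↭-trans pu′ (prep _ pR′)

        wu : Within Sset ((c , d) ∷ (a , b) ∷ Z)
        wu = ↭ₚ.All-resp-↭ eu (Within-⊆ there (Within-edges r u))

        simp₂ : Simple ((c , d) ∷ (a , b) ∷ (x , y) ∷ Es ++ Z)
        simp₂ = Simple-↭ (prep _ (prep _ (↭-trans (↭ₚ.++-comm Z (edges x s)) (↭-reflexive (cong (_++ Z) (edges-inner x s))))))
          (Simple-++ (Simple-↭ eu (edges-simple r u Uu)) (edges-simple x s Uxs) wu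
            (All-tabulate (λ i → s∉S (proj₂ (edges⇒verts x s i)))))

        cS : c ∈ r ∷ verts u
        cS = proj₁ (edges⇒verts r u (↭ₚ.∈-resp-↭ (↭-sym pu′) (here refl)))
        dS : d ∈ verts u
        dS = proj₂ (edges⇒verts r u (↭ₚ.∈-resp-↭ (↭-sym pu′) (here refl)))
        aS : a ∈ r ∷ verts u
        aS = proj₁ (edges⇒verts r u (↭ₚ.∈-resp-↭ (↭-sym pu) (here refl)))
        bS : b ∈ verts u
        bS = proj₂ (edges⇒verts r u (↭ₚ.∈-resp-↭ (↭-sym pu) (here refl)))

        rp₀ = Rep-↭ Et rp

        edge : ∀ {i j} → InE ((a , x) ∷ (x , b) ∷ (x , y) ∷ (c , d) ∷ Es ++ Z) i j → G i j ≡ true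
        edge {i} {j} = proj₂ (rp₀ i j)

        path : ∀ w → w ∈ r ∷ verts u → PathThrough G w y x
        path w w∈ = let (vs , wk , un) = loop-erase (proj₂ (w⇝x w∈)) in
            vs ∷ʳ y , Walk-snoc (Walk-mono H⊆G wk) (edge (there (there (here SE-refl)))) ,
            Unique-++ vs un ([] ∷ []) (λ { i (here e) → y∉ wk i e }) , ∈ₚ.∈-++⁺ˡ (Walk-end wk)
          where
          EH : List (Fin m × Fin m)
          EH = (a , x) ∷ (x , b) ∷ R
          H = toG EH
          rH : Rep H EH
          rH = Rep-toG EH
          wH : Within Sset EH
          wH = (there aS , here refl) ∷ (here refl , there (there bS)) ∷ Data.List.Relation.Unary.All.tail (↭ₚ.All-resp-↭ pu (Within-⊆ there (Within-edges r u)))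
          link : ∀ {i j} → (i , j) ∈ edges r u → Reach H i j
          link {i} {j} e with ↭ₚ.∈-resp-↭ pu e
          ... | here refl = _ , step (proj₂ (rH a x) (here SE-refl)) (step (proj₂ (rH x b) (there (here SE-refl))) here)
          ... | there z   = _ , step (proj₂ (rH i j) (there (there (∈⇒InE z)))) here
          from : ∀ {v} → v ∈ r ∷ verts u → Reach H r v
          from (here refl) = _ , here
          from (there i) = edges-connect (Reach H) Reach-trans r u link i
          w⇝x : ∀ {v} → v ∈ r ∷ verts u → Reach H v x
          w⇝x i = Reach-trans (Reach-sym (Rep-sym rH) (from i)) (Reach-trans (from aS) (_ , step (proj₂ (rH a x) (here SE-refl)) here))
          y∉ : ∀ {vs v} → Walk H w x vs → v ∈ vs → v ≡ y → ⊥
          y∉ wk i refl with Walk-vertex wk i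
          ... | inj₁ refl = s∉S (top∈verts s) (there w∈)
          ... | inj₂ (v , e) = s∉S (top∈verts s) (proj₂ (Within-InE wH (proj₁ (rH v y) e)))
          H⊆G : ∀ {i j} → H i j ≡ true → G i j ≡ true
          H⊆G {i} {j} e = proj₂ (Rep-↭ pt rp i j) (emb (proj₁ (rH i j) e))
            where
            emb : InE EH i j → InE ((a , x) ∷ (x , b) ∷ edges x s ++ R) i j
            emb (here q) = here q
            emb (there (here q)) = there (here q)
            emb (there (there q)) = there (there (Anyₚ.++⁺ʳ (edges x s) q))

        sprData : SPRData n G x y a b c d
        sprData with simp
        ... | (ax-xb ∷ ax-xy ∷ ax-cd ∷ _) ∷ (xb-xy ∷ xb-cd ∷ _) ∷ (xy-cd ∷ _) ∷ _ =
          edge (there (there (here SE-refl))) , edge (here SE-refl) , edge (there (here SE-refl)) , edge (there (there (there (here SE-refl)))) ,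
          (λ q → ax-xy (SE-sym q)) , (λ q → xb-xy (SE-sym q)) , xy-cd , ax-xb , ax-cd , xb-cd , path c cS

        repB : Rep (delE (delE G a x) x b) ((x , y) ∷ (c , d) ∷ Es ++ Z)
        repB = Rep-del SE-refl (Simple-head (Simple-tail simp)) (Rep-del SE-refl (Simple-head simp) rp₀)

        toEt′ : ∀ {H} → Rep H ((x , d) ∷ (c , x) ∷ (a , b) ∷ (x , y) ∷ Es ++ Z) → Rep H (edges r t′)
        toEt′ h = Rep-↭ (↭-trans (prep _ (prep _ (swap _ _ ↭-refl))) (↭-trans (prep _ (swap _ _ ↭-refl)) (↭-trans (swap _ _ ↭-refl) (↭-sym Et′)))) h

        sprRep : Rep (sprResult n G x a b c d) (edges r t′)
        sprRep = toEt′ (Rep-add SE-refl (Rep-add SE-refl (Rep-del SE-refl (Simple-head simp₂)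
          (Rep-↭ (↭-trans (prep _ (swap _ _ ↭-refl)) (swap _ _ ↭-refl)) (Rep-add SE-refl repB)))))

        -- TBR: delete xy, move x onto cd, put the other end y back where it was.
        G₀ = delE G x y
        X₀ = addE (delE (delE G₀ x a) x b) a b
        G₁ = addE (addE (delE X₀ c d) c x) x d

        simp₀ : Simple ((x , y) ∷ (a , x) ∷ (x , b) ∷ (c , d) ∷ Es ++ Z)
        simp₀ = Simple-↭ (↭-trans (prep _ (swap _ _ ↭-refl)) (swap _ _ ↭-refl)) simp

        rep₀ : Rep G₀ ((a , x) ∷ (x , b) ∷ (c , d) ∷ Es ++ Z)
        rep₀ = Rep-del SE-refl (Simple-head simp₀) (Rep-↭ (↭-trans (prep _ (swap _ _ ↭-refl)) (swap _ _ ↭-refl)) rp₀)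

        repX : Rep X₀ ((a , b) ∷ (c , d) ∷ Es ++ Z)
        repX = Rep-add SE-refl (Rep-del SE-refl (Simple-head (Simple-tail (Simple-tail simp₀)))
          (Rep-del SE-swap (Simple-head (Simple-tail simp₀)) rep₀))

        rep₁ : Rep G₁ ((x , d) ∷ (c , x) ∷ (a , b) ∷ Es ++ Z)
        rep₁ = Rep-add SE-refl (Rep-add SE-refl (Rep-del SE-refl nocd (Rep-↭ (swap _ _ ↭-refl) repX)))
          where
          nocd : ¬ InE ((a , b) ∷ Es ++ Z) c d
          nocd (here q)  = Simple-head simp₂ (here q)
          nocd (there q) = Simple-head simp₂ (there (there q))

        a≢b : a ≢ b
        a≢b with ↭ₚ.All-resp-↭ pu (edges-loopless r u Uu)
        ... | ne ∷ _ = ne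

        side₁ : TBRSide n G₀ x G₁
        side₁ = inj₂ (a , b , c , d , a≢b , proj₂ (rep₀ x a) (here SE-swap) , proj₂ (rep₀ x b) (there (here SE-refl)) ,
          proj₂ (repX c d) (there (here SE-refl)) , reach , λ i j → refl)
          where
          X⊇u : ∀ {i j} → toG (edges r u) i j ≡ true → X₀ i j ≡ true
          X⊇u {i} {j} e = proj₂ (repX i j) (emb (↭ₚ.Any-resp-↭ eu (proj₁ (Rep-toG (edges r u) i j) e)))
            where
            emb : InE ((c , d) ∷ (a , b) ∷ Z) i j → InE ((a , b) ∷ (c , d) ∷ Es ++ Z) i j
            emb (here q) = there (here q)
            emb (there (here q)) = here q
            emb (there (there q)) = there (there (Anyₚ.++⁺ʳ Es q))
          reach : Reach X₀ a c
          reach = let (vs , w) = edges-reach r u (Rep-toG (edges r u)) aS cS in vs , Walk-mono X⊇u w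

        wZ : Within Sset ((x , d) ∷ (c , x) ∷ (a , b) ∷ Z)
        wZ = (here refl , there (there dS)) ∷ (there cS , here refl) ∷ Data.List.Relation.Unary.All.tail wu

        side₂ : ∀ s₀ → s ≡ s₀ → ∃[ G₂ ] (TBRSide n G₁ y G₂ × Rep (addE G₂ x y) (edges r t′))
        side₂ (leaf v) refl = G₁ , inj₁ ((λ w → ≢true⇒≡false (λ e → s∉S (here refl) (proj₁ (Within-InE wZ (proj₁ (rep₁ v w) e))))) , λ i j → refl) ,
          Rep-↭ (↭-sym Et′) (Rep-add SE-refl rep₁)
        side₂ (node v l q) refl = G₂ , inj₂ (p′ , q′ , p′ , q′ , p≢q , proj₂ (rep₁′ v p′) (here SE-refl) , proj₂ (rep₁′ v q′) (there (here SE-refl)) ,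
            proj₂ (repY p′ q′) (here SE-refl) , (_ , here) , λ i j → refl) ,
          Rep-↭ (↭-trans (prep _ (↭-sym perm₁)) (↭-sym Et′)) (Rep-add SE-refl (Rep-↭ (swap _ _ ↭-refl) rep₂))
          where
          p′ = top l
          q′ = top q
          L : List (Fin m × Fin m)
          L = (x , d) ∷ (c , x) ∷ (a , b) ∷ inner l ++ inner q ++ Z
          permE : edges v l ++ edges v q ↭ (v , p′) ∷ (v , q′) ∷ inner l ++ inner q
          permE = ↭-trans (↭-reflexive (cong₂ _++_ (edges-inner v l) (edges-inner v q))) (prep _ (↭ₚ.shift (v , q′) (inner l) (inner q)))
          perm₁ : (x , d) ∷ (c , x) ∷ (a , b) ∷ (edges v l ++ edges v q) ++ Z ↭ (v , p′) ∷ (v , q′) ∷ L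
          perm₁ = ↭-trans (prep _ (prep _ (prep _ (↭-trans (↭ₚ.++⁺ʳ Z permE) (↭-reflexive (cong (λ z → (v , p′) ∷ (v , q′) ∷ z) (Lₚ.++-assoc (inner l) (inner q) Z)))))))
            (↭ₚ.shifts ((x , d) ∷ (c , x) ∷ (a , b) ∷ []) ((v , p′) ∷ (v , q′) ∷ []))
          rep₁′ : Rep G₁ ((v , p′) ∷ (v , q′) ∷ L)
          rep₁′ = Rep-↭ perm₁ rep₁
          simp₁ : Simple ((v , p′) ∷ (v , q′) ∷ L)
          simp₁ = Simple-↭ perm₁ (Simple-tail (Simple-↭ Et′ (edges-simple r t′ U′)))
          Ulq = Unique-node {r = q} Uxs
          p≢q : ¬ p′ ≡ q′
          p≢q e = proj₂ (proj₂ Ulq) (top∈verts l) (subst (_∈ verts q) (sym e) (top∈verts q))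
          Y = addE (delE (delE G₁ v p′) v q′) p′ q′
          repY : Rep Y ((p′ , q′) ∷ L)
          repY = Rep-add SE-refl (Rep-del SE-refl (Simple-head (Simple-tail simp₁)) (Rep-del SE-refl (Simple-head simp₁) rep₁′))
          p∈s : p′ ∈ verts (node v l q)
          p∈s = there (∈ₚ.∈-++⁺ˡ (top∈verts l))
          nopq : ¬ InE L p′ q′
          nopq z with Anyₚ.++⁻ ((x , d) ∷ (c , x) ∷ (a , b) ∷ []) z
          ... | inj₁ z₁ = s∉S p∈s (proj₁ (Within-InE (Allₚ.++⁻ˡ ((x , d) ∷ (c , x) ∷ (a , b) ∷ []) wZ) z₁))
          ... | inj₂ z₁ with Anyₚ.++⁻ (inner l) z₁
          ...   | inj₁ z₂ = proj₂ (proj₂ Ulq) (proj₂ (Within-InE (inner-within l) z₂)) (top∈verts q)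
          ...   | inj₂ z₂ with Anyₚ.++⁻ (inner q) z₂
          ...     | inj₁ z₃ = proj₂ (proj₂ Ulq) (top∈verts l) (proj₁ (Within-InE (inner-within q) z₃))
          ...     | inj₂ z₃ = s∉S p∈s (proj₁ (Within-InE (Allₚ.++⁻ʳ ((x , d) ∷ (c , x) ∷ (a , b) ∷ []) wZ) z₃))
          G₂ = addE (addE (delE Y p′ q′) p′ v) v q′
          rep₂ : Rep G₂ ((v , q′) ∷ (v , p′) ∷ L)
          rep₂ = Rep-add SE-refl (Rep-add SE-swap (Rep-del SE-refl nopq repY))

      moved : ∀ χ → ∃[ G′ ] (Step n χ G G′ × Rep G′ (edges r t′))
      moved SPR = sprResult n G x a b c d , (x , y , a , b , c , d , sprData , Iso-id {n} (λ i j → refl)) , sprRep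
      moved rSPR = sprResult n G x a b c d ,
        (x , y , a , b , c , d , sprData , (r , r₀ , path r (here refl)) , Iso-id {n} (λ i j → refl)) , sprRep
      moved TBR with side₂ s refl
      ... | G₂ , sd , h = addE G₂ x y ,
        (x , y , G₁ , G₂ , edge (there (there (here SE-refl))) , side₁ , sd , Iso-id {n} (λ i j → refl)) , h

    regraft : ∀ χ G → Rep G (edges r t) → ∃[ G′ ] (Rep G′ (edges r t′) × (Step n χ G G′ ⊎ G′ ≡ G))
    regraft χ G rp with Ins-edges i₁ r | Ins-edges i₂ r
    ... | a , b , R , pu , pt | c , d , R′ , pu′ , pt′ with ↭ₚ.∈-resp-↭ pu′ (↭ₚ.∈-resp-↭ (↭-sym pu) (here refl))
    ...   | here refl = G , Rep-↭ (↭-trans pt (↭-trans (prep _ (prep _ (↭ₚ.++⁺ˡ (edges x s) (↭ₚ.drop-∷ (↭-trans (↭-sym pu) pu′))))) (↭-sym pt′))) rp , inj₂ refl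
    ...   | there z with ∈⇒↭ z
    ...     | Z , pR′ with Go.moved G rp pu pt pu′ pt′ Z (↭ₚ.drop-∷ (↭-trans (↭-sym pu) (↭-trans pu′ (↭-trans (prep _ pR′) (swap _ _ ↭-refl))))) pR′ χ
    ...       | G′ , st , h = G′ , h , inj₁ st

  Above : ∀ {m} → ℕ → Tree {m} → Set
  Above n (leaf v)     = ⊤
  Above n (node v l r) = n < toℕ v × Above n l × Above n r

  Ins-above : ∀ {m n x s u t} → Ins {m} x s u t → Above n t → n < toℕ x × Above n s × Above n u
  Ins-above hereL (a , b , c) = a , b , c
  Ins-above hereR (a , b , c) = a , c , b
  Ins-above (inL i) (a , b , c) = let (x , y , z) = Ins-above i b in x , y , (a , z , c)
  Ins-above (inR i) (a , b , c) = let (x , y , z) = Ins-above i c in x , y , (a , b , z)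

  above-Ins : ∀ {m n x s u t} → Ins {m} x s u t → n < toℕ x → Above n s → Above n u → Above n t
  above-Ins hereL a b c = a , b , c
  above-Ins hereR a b c = a , c , b
  above-Ins (inL i) a b (c , d , e) = c , above-Ins i a b d , e
  above-Ins (inR i) a b (c , d , e) = c , d , above-Ins i a b e

  module _ {m : ℕ} where

    data Match : Tree {m} → Tree {m} → Set where
      mleaf : ∀ {v} → Match (leaf v) (leaf v)
      mnode : ∀ {v w l r l′ r′} → Match l l′ → Match r r′ → Match (node v l r) (node w l′ r′)
      mswap : ∀ {v w l r l′ r′} → Match l r′ → Match r l′ → Match (node v l r) (node w l′ r′)

    zipM : ∀ {t t′} → Match t t′ → List (Fin m × Fin m)
    zipM (mleaf {v}) = (v , v) ∷ []
    zipM (mnode {v} {w} a b) = (v , w) ∷ zipM a ++ zipM b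
    zipM (mswap {v} {w} a b) = (v , w) ∷ zipM a ++ zipM b

    zipM₁ : ∀ {t t′} (q : Match t t′) → map proj₁ (zipM q) ≡ verts t
    zipM₁ mleaf = refl
    zipM₁ (mnode {v} a b) = cong (v ∷_) (trans (Lₚ.map-++ proj₁ (zipM a) (zipM b)) (cong₂ _++_ (zipM₁ a) (zipM₁ b)))
    zipM₁ (mswap {v} a b) = cong (v ∷_) (trans (Lₚ.map-++ proj₁ (zipM a) (zipM b)) (cong₂ _++_ (zipM₁ a) (zipM₁ b)))

    zipM₂ : ∀ {t t′} (q : Match t t′) → map proj₂ (zipM q) ↭ verts t′
    zipM₂ mleaf = ↭-refl
    zipM₂ (mnode {v} {w} a b) = prep w (↭-trans (↭-reflexive (Lₚ.map-++ proj₂ (zipM a) (zipM b))) (↭ₚ.++⁺ (zipM₂ a) (zipM₂ b)))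
    zipM₂ (mswap {v} {w} {l′ = l′} {r′} a b) = prep w (↭-trans (↭-reflexive (Lₚ.map-++ proj₂ (zipM a) (zipM b)))
      (↭-trans (↭ₚ.++⁺ (zipM₂ a) (zipM₂ b)) (↭ₚ.++-comm (verts r′) (verts l′))))

    Carries : List (Fin m × Fin m) → List (Fin m × Fin m) → List (Fin m × Fin m) → Set
    Carries Z E E′ = ∀ {i j} → (i , j) ∈ E → ∃[ i′ ] ∃[ j′ ] ((i′ , j′) ∈ E′ × (i , i′) ∈ Z × (j , j′) ∈ Z)

    Carries-⊆ : ∀ {Z Z′ E E′ E″} → (∀ {e} → e ∈ Z → e ∈ Z′) → (∀ {e} → e ∈ E′ → e ∈ E″) → Carries Z E E′ → Carries Z′ E E″
    Carries-⊆ f g h i = let (i′ , j′ , a , b , c) = h i in i′ , j′ , g a , f b , f c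

    Carries-node : ∀ {Z E₁ E₂ E′ p v p′ v′} → (p′ , v′) ∈ E′ → (p , p′) ∈ Z → (v , v′) ∈ Z → Carries Z E₁ E′ → Carries Z E₂ E′ → Carries Z ((p , v) ∷ E₁ ++ E₂) E′
    Carries-node {E₁ = E₁} a b c h₁ h₂ (here refl) = _ , _ , a , b , c
    Carries-node {E₁ = E₁} a b c h₁ h₂ (there i) = [ h₁ , h₂ ]′ (∈ₚ.∈-++⁻ E₁ i)

    private
      lift₁ : ∀ {a b : Fin m × Fin m} {xs : List (Fin m × Fin m)} ys {e} → e ∈ b ∷ xs → e ∈ a ∷ b ∷ xs ++ ys
      lift₁ ys (here q) = there (here q)
      lift₁ ys (there i) = there (there (∈ₚ.∈-++⁺ˡ i))
      lift₂ : ∀ {a b : Fin m × Fin m} xs {ys : List (Fin m × Fin m)} {e} → e ∈ b ∷ ys → e ∈ a ∷ b ∷ xs ++ ys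
      lift₂ xs (here q) = there (here q)
      lift₂ xs (there i) = there (there (∈ₚ.∈-++⁺ʳ xs i))
      inˡ : ∀ {a : Fin m × Fin m} {xs ys : List (Fin m × Fin m)} {e} → e ∈ xs → e ∈ a ∷ xs ++ ys
      inˡ i = there (∈ₚ.∈-++⁺ˡ i)
      inʳ : ∀ {a : Fin m × Fin m} xs {ys : List (Fin m × Fin m)} {e} → e ∈ ys → e ∈ a ∷ xs ++ ys
      inʳ xs i = there (∈ₚ.∈-++⁺ʳ xs i)

    carry₁ : ∀ {t t′} (q : Match t t′) p p′ → Carries ((p , p′) ∷ zipM q) (edges p t) (edges p′ t′)
    carry₁ (mleaf {v}) p p′ (here refl) = p′ , v , here refl , here refl , there (here refl)
    carry₁ (mnode {v} {w} {l} {r} {l′} {r′} a b) p p′ = Carries-node (here refl) (here refl) (there (here refl))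
      (Carries-⊆ (lift₁ (zipM b)) inˡ (carry₁ a v w)) (Carries-⊆ (lift₂ (zipM a)) (inʳ (edges w l′)) (carry₁ b v w))
    carry₁ (mswap {v} {w} {l} {r} {l′} {r′} a b) p p′ = Carries-node (here refl) (here refl) (there (here refl))
      (Carries-⊆ (lift₁ (zipM b)) (inʳ (edges w l′)) (carry₁ a v w)) (Carries-⊆ (lift₂ (zipM a)) inˡ (carry₁ b v w))

    flipZ : List (Fin m × Fin m) → List (Fin m × Fin m)
    flipZ = map (λ (a , b) → b , a)

    carry₂ : ∀ {t t′} (q : Match t t′) p p′ → Carries (flipZ ((p , p′) ∷ zipM q)) (edges p′ t′) (edges p t)
    carry₂ (mleaf {v}) p p′ (here refl) = p , v , here refl , here refl , there (here refl)
    carry₂ (mnode {v} {w} {l} {r} {l′} {r′} a b) p p′ = Carries-node (here refl) (here refl) (there (here refl))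
      (Carries-⊆ (λ {e} i → subst (e ∈_) (sym eq) (lift₁ (flipZ (zipM b)) i)) inˡ (carry₂ a v w))
      (Carries-⊆ (λ {e} i → subst (e ∈_) (sym eq) (lift₂ (flipZ (zipM a)) i)) (inʳ (edges v l)) (carry₂ b v w))
      where eq = cong {A = List (Fin m × Fin m)} {B = List (Fin m × Fin m)} (λ z → (p′ , p) ∷ (w , v) ∷ z) (Lₚ.map-++ (λ (a , b) → b , a) (zipM a) (zipM b))
    carry₂ (mswap {v} {w} {l} {r} {l′} {r′} a b) p p′ = Carries-node (here refl) (here refl) (there (here refl))
      (Carries-⊆ (λ {e} i → subst (e ∈_) (sym eq) (lift₂ (flipZ (zipM a)) i)) (inʳ (edges v l)) (carry₂ b v w))
      (Carries-⊆ (λ {e} i → subst (e ∈_) (sym eq) (lift₁ (flipZ (zipM b)) i)) inˡ (carry₂ a v w))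
      where eq = cong {A = List (Fin m × Fin m)} {B = List (Fin m × Fin m)} (λ z → (p′ , p) ∷ (w , v) ∷ z) (Lₚ.map-++ (λ (a , b) → b , a) (zipM a) (zipM b))

    zipM-leaf : ∀ {n t t′} (q : Match t t′) → Above n t → ∀ {i w} → (i , w) ∈ zipM q → toℕ i ≤ n → i ≡ w
    zipM-leaf mleaf _ (here refl) le = refl
    zipM-leaf (mnode a b) (lt , _ , _) (here refl) le = ⊥-elim (ℕₚ.<⇒≱ lt le)
    zipM-leaf (mnode a b) (_ , al , ar) (there i) le with ∈ₚ.∈-++⁻ (zipM a) i
    ... | inj₁ j = zipM-leaf a al j le
    ... | inj₂ j = zipM-leaf b ar j le
    zipM-leaf (mswap a b) (lt , _ , _) (here refl) le = ⊥-elim (ℕₚ.<⇒≱ lt le)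
    zipM-leaf (mswap a b) (_ , al , ar) (there i) le with ∈ₚ.∈-++⁻ (zipM a) i
    ... | inj₁ j = zipM-leaf a al j le
    ... | inj₂ j = zipM-leaf b ar j le

    functional : ∀ {B : Set} {Z : List (Fin m × B)} → Unique (map proj₁ Z) → ∀ {v w w′} → (v , w) ∈ Z → (v , w′) ∈ Z → w ≡ w′
    functional u (here refl) (here refl) = refl
    functional u (here refl) (there j) = ⊥-elim (Unique-head u (∈ₚ.∈-map⁺ proj₁ j))
    functional u (there i) (here refl) = ⊥-elim (Unique-head u (∈ₚ.∈-map⁺ proj₁ i))
    functional u (there i) (there j) = functional (Unique-tail u) i j

    record Labelled (n : ℕ) (r : Fin m) (t : Tree {m}) : Set where
      field
        uniq  : Unique (r ∷ verts t)
        compl : ∀ v → v ∈ r ∷ verts t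
        above : Above n t

  module _ (n : ℕ) {r : Fin (V n)} (r₀ : toℕ r ≡ 0) where

    private m = V n

    Match⇒Iso : ∀ {t t′ : Tree {m}} {G H} → Match t t′ → Labelled n r t → Labelled n r t′ →
      Rep G (edges r t) → Rep H (edges r t′) → Iso n G H
    Match⇒Iso {t} {t′} {G} {H} q L L′ rG rH = permutation φ ψ φψ ψφ , fixes , edge≡
      where
      module L = Labelled L
      module L′ = Labelled L′
      Z : List (Fin m × Fin m)
      Z = (r , r) ∷ zipM q
      u₁ : Unique (map proj₁ Z)
      u₁ = subst Unique (cong (r ∷_) (sym (zipM₁ q))) L.uniq
      p₂ : map proj₁ (flipZ Z) ↭ r ∷ verts t′
      p₂ = ↭-trans (↭-reflexive (sym (Lₚ.map-∘ Z))) (prep r (zipM₂ q))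
      u₂ : Unique (map proj₁ (flipZ Z))
      u₂ = Unique-↭ (↭-sym p₂) L′.uniq
      f : ∀ v → ∃[ w ] ((v , w) ∈ Z)
      f v with ∈ₚ.∈-map⁻ proj₁ (subst (v ∈_) (cong (r ∷_) (sym (zipM₁ q))) (L.compl v))
      ... | (_ , w) , i , refl = w , i
      g : ∀ v → ∃[ w ] ((v , w) ∈ flipZ Z)
      g v with ∈ₚ.∈-map⁻ proj₁ (↭ₚ.∈-resp-↭ (↭-sym p₂) (L′.compl v))
      ... | (_ , w) , i , refl = w , i
      unflip : ∀ {Z v w} → (v , w) ∈ flipZ {m} Z → (w , v) ∈ Z
      unflip i with ∈ₚ.∈-map⁻ (λ (a , b) → b , a) i
      ... | _ , j , refl = j
      φ ψ : Fin m → Fin m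
      φ v = proj₁ (f v)
      ψ v = proj₁ (g v)
      φψ : ∀ v → φ (ψ v) ≡ v
      φψ v = functional u₁ (proj₂ (f (ψ v))) (unflip (proj₂ (g v)))
      ψφ : ∀ v → ψ (φ v) ≡ v
      ψφ v = functional u₂ (proj₂ (g (φ v))) (∈ₚ.∈-map⁺ (λ (a , b) → b , a) (proj₂ (f v)))
      fixes : ∀ i → toℕ i ≤ n → φ i ≡ i
      fixes i le with proj₂ (f i)
      ... | here e  = trans (cong proj₂ e) (sym (cong proj₁ e))
      ... | there k = sym (zipM-leaf q L.above k le)
      go₁ : ∀ {E i j} → (∀ {e} → e ∈ E → e ∈ edges r t) → InE E i j → InE (edges r t′) (φ i) (φ j)
      go₁ h (here (inj₁ (refl , refl))) with carry₁ q r r (h (here refl))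
      ... | i′ , j′ , x , y , z = subst₂ (InE (edges r t′)) (functional u₁ y (proj₂ (f _))) (functional u₁ z (proj₂ (f _))) (∈⇒InE x)
      go₁ h (here (inj₂ (refl , refl))) with carry₁ q r r (h (here refl))
      ... | i′ , j′ , x , y , z = InE-flip (subst₂ (InE (edges r t′)) (functional u₁ y (proj₂ (f _))) (functional u₁ z (proj₂ (f _))) (∈⇒InE x))
      go₁ h (there k) = go₁ (λ i → h (there i)) k
      go₂ : ∀ {E i j} → (∀ {e} → e ∈ E → e ∈ edges r t′) → InE E i j → InE (edges r t) (ψ i) (ψ j)
      go₂ h (here (inj₁ (refl , refl))) with carry₂ q r r (h (here refl))
      ... | i′ , j′ , x , y , z = subst₂ (InE (edges r t)) (functional u₂ y (proj₂ (g _))) (functional u₂ z (proj₂ (g _))) (∈⇒InE x)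
      go₂ h (here (inj₂ (refl , refl))) with carry₂ q r r (h (here refl))
      ... | i′ , j′ , x , y , z = InE-flip (subst₂ (InE (edges r t)) (functional u₂ y (proj₂ (g _))) (functional u₂ z (proj₂ (g _))) (∈⇒InE x))
      go₂ h (there k) = go₂ (λ i → h (there i)) k
      edge≡ : ∀ i j → H (φ i) (φ j) ≡ G i j
      edge≡ i j = Bool-≡
        (λ e → subst₂ (λ a b → G a b ≡ true) (ψφ i) (ψφ j) (proj₂ (rG _ _) (go₂ id (proj₁ (rH (φ i) (φ j)) e))))
        (λ e → proj₂ (rH (φ i) (φ j)) (go₁ id (proj₁ (rG i j) e)))

  -- Cut t c F: deleting some edges of t leaves the component c (if any) hanging from the root edge, and the list F of further components.

  module _ {m : ℕ} where

    data Shape : Set where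
      lf : Fin m → Shape
      nd : Shape → Shape → Shape

    data Join : Maybe Shape → Maybe Shape → Maybe Shape → Set where
      j-none  : Join nothing nothing nothing
      j-left  : ∀ {c} → Join (just c) nothing (just c)
      j-right : ∀ {c} → Join nothing (just c) (just c)
      j-both  : ∀ {c d} → Join (just c) (just d) (just (nd c d))
      j-swap  : ∀ {c d} → Join (just c) (just d) (just (nd d c))

    data Cut : Tree {m} → Maybe Shape → List Shape → Set where
      leafC : ∀ {v} → Cut (leaf v) (just (lf v)) []
      cutC  : ∀ {t c F} → Cut t (just c) F → Cut t nothing (c ∷ F)
      nodeC : ∀ {v l r c₁ c₂ c F₁ F₂} → Cut l c₁ F₁ → Cut r c₂ F₂ → Join c₁ c₂ c → Cut (node v l r) c (F₁ ++ F₂)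

    data InsS (D : Shape) : Maybe Shape → Shape → Set where
      s-empty : InsS D nothing D
      s-topL  : ∀ {c} → InsS D (just c) (nd D c)
      s-topR  : ∀ {c} → InsS D (just c) (nd c D)
      s-inL   : ∀ {l r l′} → InsS D (just l) l′ → InsS D (just (nd l r)) (nd l′ r)
      s-inR   : ∀ {l r r′} → InsS D (just r) r′ → InsS D (just (nd l r)) (nd l r′)

    joinL : ∀ {D c₁ c₁⁺ c₂ c} → InsS D c₁ c₁⁺ → Join c₁ c₂ c → ∃[ c⁺ ] (Join (just c₁⁺) c₂ (just c⁺) × InsS D c c⁺)
    joinL s-empty j-none  = _ , j-left , s-empty
    joinL s-empty j-right = _ , j-both , s-topL
    joinL i j-left = _ , j-left , i
    joinL i j-both = _ , j-both , s-inL i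
    joinL i j-swap = _ , j-swap , s-inR i

    joinR : ∀ {D c₁ c₂ c₂⁺ c} → InsS D c₂ c₂⁺ → Join c₁ c₂ c → ∃[ c⁺ ] (Join c₁ (just c₂⁺) (just c⁺) × InsS D c c⁺)
    joinR s-empty j-none = _ , j-right , s-empty
    joinR s-empty j-left = _ , j-both , s-topR
    joinR i j-right = _ , j-right , i
    joinR i j-both = _ , j-both , s-inR i
    joinR i j-swap = _ , j-swap , s-inL i

    uncut : ∀ {t c F D′ F′} → Cut t c F → F ≡ D′ ∷ F′ → ∃[ D ] ∃[ F⁻ ] ∃[ c⁺ ] (F ↭ D ∷ F⁻ × Cut t (just c⁺) F⁻ × InsS D c c⁺)
    uncut (cutC h) refl = _ , _ , _ , ↭-refl , h , s-empty
    uncut (nodeC {F₁ = []} h₁ h₂ j) e with uncut h₂ e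
    ... | D , F⁻ , c⁺ , p , h , i with joinR i j
    ...   | c″ , j′ , i′ = D , F⁻ , c″ , p , nodeC h₁ h j′ , i′
    uncut (nodeC {F₁ = _ ∷ _} {F₂} h₁ h₂ j) e with uncut h₁ refl
    ... | D , F⁻ , c⁺ , p , h , i with joinL i j
    ...   | c″ , j′ , i′ = D , F⁻ ++ F₂ , c″ , ↭ₚ.++⁺ʳ F₂ p , nodeC h h₂ j′ , i′

    Graft : Fin m → Tree {m} → Tree {m} → Shape → List Shape → Set
    Graft x s u c⁺ F = ∃[ t ] ∃[ F′ ] (Ins x s u t × Cut t (just c⁺) F′ × F′ ↭ F)

    graftL : ∀ {x s v l r c₁ c₂ c F₁ F₂ Fs} → Graft x s l c₁ (Fs ++ F₁) → Cut r c₂ F₂ → Join (just c₁) c₂ (just c) → Graft x s (node v l r) c (Fs ++ F₁ ++ F₂)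
    graftL {F₁ = F₁} {F₂} {Fs} (t , F′ , a , b , p) h j = _ , _ , inL a , nodeC b h j , ↭-trans (↭ₚ.++⁺ʳ F₂ p) (↭-reflexive (Lₚ.++-assoc Fs F₁ F₂))

    graftR : ∀ {x s v l r c₁ c₂ c F₁ F₂ Fs} → Cut l c₁ F₁ → Graft x s r c₂ (Fs ++ F₂) → Join c₁ (just c₂) (just c) → Graft x s (node v l r) c (Fs ++ F₁ ++ F₂)
    graftR {F₁ = F₁} {F₂} {Fs} h (t , F′ , a , b , p) j = _ , _ , inR a , nodeC h b j , ↭-trans (↭ₚ.++⁺ˡ F₁ p) (↭ₚ.shifts F₁ Fs)

    graft : ∀ {x s D u c F Fs c⁺} → Cut s (just D) Fs → Cut u c F → InsS D c c⁺ → Graft x s u c⁺ (Fs ++ F)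
    graft hs hu s-empty = _ , _ , hereL , nodeC hs hu j-left , ↭-refl
    graft hs hu s-topL  = _ , _ , hereL , nodeC hs hu j-both , ↭-refl
    graft hs hu s-topR  = _ , _ , hereL , nodeC hs hu j-swap , ↭-refl
    graft {Fs = Fs} hs (nodeC h₁ h₂ j-left)  (s-inL i) = graftL {Fs = Fs} (graft hs h₁ (s-inL i)) h₂ j-left
    graft {Fs = Fs} hs (nodeC h₁ h₂ j-right) (s-inL i) = graftR {Fs = Fs} h₁ (graft hs h₂ (s-inL i)) j-right
    graft {Fs = Fs} hs (nodeC h₁ h₂ j-both)  (s-inL i) = graftL {Fs = Fs} (graft hs h₁ i) h₂ j-both
    graft {Fs = Fs} hs (nodeC h₁ h₂ j-swap)  (s-inL i) = graftR {Fs = Fs} h₁ (graft hs h₂ i) j-swap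
    graft {Fs = Fs} hs (nodeC h₁ h₂ j-left)  (s-inR i) = graftL {Fs = Fs} (graft hs h₁ (s-inR i)) h₂ j-left
    graft {Fs = Fs} hs (nodeC h₁ h₂ j-right) (s-inR i) = graftR {Fs = Fs} h₁ (graft hs h₂ (s-inR i)) j-right
    graft {Fs = Fs} hs (nodeC h₁ h₂ j-both)  (s-inR i) = graftR {Fs = Fs} h₁ (graft hs h₂ i) j-both
    graft {Fs = Fs} hs (nodeC h₁ h₂ j-swap)  (s-inR i) = graftL {Fs = Fs} (graft hs h₁ i) h₂ j-swap

    data Prune (t : Tree {m}) (c : Maybe Shape) (F : List Shape) (D : Shape) : Set where
      whole : ∀ {F⁻} → c ≡ nothing → Cut t (just D) F⁻ → F ↭ D ∷ F⁻ → Prune t c F D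
      part  : ∀ {x s u Fs Fu} → Ins x s u t → Cut s (just D) Fs → Cut u c Fu → F ↭ D ∷ Fs ++ Fu → Prune t c F D

    prune : ∀ {t c F D} → Cut t c F → D ∈ F → Prune t c F D
    prune (cutC h) (here refl) = whole refl h ↭-refl
    prune (cutC {c = c} h) (there i) with prune h i
    ... | part {Fs = Fs} {Fu} a b d p = part a b (cutC d)
      (↭-trans (prep c p) (↭-trans (swap c _ ↭-refl) (prep _ (↭-sym (↭ₚ.shift c Fs Fu)))))
    prune (nodeC {F₁ = F₁} {F₂} h₁ h₂ j) i with ∈ₚ.∈-++⁻ F₁ i
    ... | inj₁ k with prune h₁ k
    ...   | part {Fs = Fs} {Fu} a b d p = part (inL a) b (nodeC d h₂ j)
      (↭-trans (↭ₚ.++⁺ʳ F₂ p) (prep _ (↭-reflexive (Lₚ.++-assoc Fs Fu F₂))))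
    ...   | whole refl b p with j
    ...     | j-none  = part hereL b h₂ (↭ₚ.++⁺ʳ F₂ p)
    ...     | j-right = part hereL b h₂ (↭ₚ.++⁺ʳ F₂ p)
    prune (nodeC {F₁ = F₁} {F₂} h₁ h₂ j) i | inj₂ k with prune h₂ k
    ...   | part {Fs = Fs} {Fu} a b d p = part (inR a) b (nodeC h₁ d j)
      (↭-trans (↭ₚ.++⁺ˡ F₁ p) (↭-trans (↭ₚ.shift _ F₁ (Fs ++ Fu)) (prep _ (↭ₚ.shifts F₁ Fs))))
    ...   | whole {F⁻} refl b p with j
    ...     | j-none = part hereR b h₁ (↭-trans (↭ₚ.++-comm F₁ F₂) (↭ₚ.++⁺ʳ F₁ p))
    ...     | j-left = part hereR b h₁ (↭-trans (↭ₚ.++-comm F₁ F₂) (↭ₚ.++⁺ʳ F₁ p))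

    Cut-nonempty : ∀ {t F} → Cut t nothing F → F ≢ []
    Cut-nonempty (cutC _) ()
    Cut-nonempty (nodeC {F₁ = []} h₁ h₂ j-none) e = Cut-nonempty h₁ refl

    Cut-match : ∀ {t t′ c F F′} → Cut t (just c) F → F ≡ [] → Cut t′ (just c) F′ → F′ ≡ [] → Match t t′
    Cut-match leafC _ leafC _ = mleaf
    Cut-match (nodeC {F₁ = []} h₁ h₂ j-left) e _ _ = ⊥-elim (Cut-nonempty h₂ e)
    Cut-match (nodeC {F₁ = []} h₁ h₂ j-right) e _ _ = ⊥-elim (Cut-nonempty h₁ refl)
    Cut-match _ _ (nodeC {F₁ = []} h₁ h₂ j-left) e = ⊥-elim (Cut-nonempty h₂ e)
    Cut-match _ _ (nodeC {F₁ = []} h₁ h₂ j-right) e = ⊥-elim (Cut-nonempty h₁ refl)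
    Cut-match (nodeC {F₁ = []} a b j-both) e (nodeC {F₁ = []} c d j-both) e′ = mnode (Cut-match a refl c refl) (Cut-match b e d e′)
    Cut-match (nodeC {F₁ = []} a b j-swap) e (nodeC {F₁ = []} c d j-swap) e′ = mnode (Cut-match a refl c refl) (Cut-match b e d e′)
    Cut-match (nodeC {F₁ = []} a b j-both) e (nodeC {F₁ = []} c d j-swap) e′ = mswap (Cut-match a refl d e′) (Cut-match b e c refl)
    Cut-match (nodeC {F₁ = []} a b j-swap) e (nodeC {F₁ = []} c d j-both) e′ = mswap (Cut-match a refl d e′) (Cut-match b e c refl)

  module _ (n : ℕ) {r : Fin (V n)} (r₀ : toℕ r ≡ 0) (χ : MoveType) where

    private m = V n

    Labelled-move : ∀ {x s u} {t t′ : Tree {m}} → Ins x s u t → Ins x s u t′ → Labelled n r t → Labelled n r t′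
    Labelled-move i i′ L = record
      { uniq  = Unique-↭ p uniq
      ; compl = λ v → ↭ₚ.∈-resp-↭ p (compl v)
      ; above = let (a , b , c) = Ins-above i above in above-Ins i′ a b c }
      where
      open Labelled L
      p = prep r (↭-trans (Ins-verts i) (↭-sym (Ins-verts i′)))

    -- The components are merged into the root component one at a time, top-down in the target tree; each merge costs one move.
    agreement-bound : ∀ k {tA tB c F F′ A B} → length F ≤ k → Cut {m} tA c F → Cut tB c F′ → F ↭ F′ →
      Labelled n r tA → Labelled n r tB → Rep A (edges r tA) → Rep B (edges r tB) → ∃[ j ] (j ≤ length F × Steps n χ j A B)
    agreement-bound k {c = nothing} {F′ = []} le hA hB p LA LB rA rB = ⊥-elim (Cut-nonempty hB refl)
    agreement-bound k {c = just c} {F′ = []} le hA hB p LA LB rA rB =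
      0 , z≤n , done (Match⇒Iso n r₀ (Cut-match hA (↭ₚ.↭-empty-inv p) hB refl) LA LB rA rB)
    agreement-bound zero {F = []} {F′ = _ ∷ _} le hA hB p LA LB rA rB = ⊥-elim (↭ₚ.¬x∷xs↭[] (↭-sym p))
    agreement-bound (suc k) {F = F} {F′ = _ ∷ _} le hA hB p LA LB rA rB with uncut hB refl
    ... | D , F⁻ , c⁺ , q , hB′ , i with prune hA (↭ₚ.∈-resp-↭ (↭-sym (↭-trans p q)) (here refl))
    ...   | whole {G⁻} refl h w with i
    ...     | s-empty with agreement-bound k (ℕₚ.≤-pred (subst (_≤ suc k) (↭ₚ.↭-length w) le)) h hB′ (↭ₚ.drop-∷ (↭-trans (↭-sym w) (↭-trans p q))) LA LB rA rB
    ...       | j , jle , st = j , ℕₚ.≤-trans jle (subst (length G⁻ ≤_) (sym (↭ₚ.↭-length w)) (ℕₚ.n≤1+n _)) , st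
    agreement-bound (suc k) {F = F} {F′ = _ ∷ _} {A} {B} le hA hB p LA LB rA rB | D , F⁻ , c⁺ , q , hB′ , i | part {Fs = Fs} {Fu} ins hs hu w with graft hs hu i
    ...     | t′ , F″ , ins′ , h′ , w′ with Regraft.regraft n ins ins′ r₀ (Labelled.uniq LA) χ A rA
    ...       | G′ , rep′ , stp with agreement-bound k {A = G′} lek h′ hB′ (↭-trans w′ (↭ₚ.drop-∷ (↭-trans (↭-sym w) (↭-trans p q)))) (Labelled-move ins ins′ LA) LB rep′ rB
      where
      len : suc (length F″) ≡ length F
      len = trans (cong suc (↭ₚ.↭-length w′)) (sym (↭ₚ.↭-length w))
      lek : length F″ ≤ k
      lek = ℕₚ.≤-pred (subst (_≤ suc k) (sym len) le)
    ...         | j , jle , st = finish stp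
      where
      len : suc (length F″) ≡ length F
      len = trans (cong suc (↭ₚ.↭-length w′)) (sym (↭ₚ.↭-length w))
      finish : Step n χ A G′ ⊎ G′ ≡ A → ∃[ j ] (j ≤ length F × Steps n χ j A B)
      finish (inj₁ e) = suc j , subst (suc j ≤_) len (s≤s jle) , move e st
      finish (inj₂ refl) = j , ℕₚ.≤-trans jle (subst (length F″ ≤_) len (ℕₚ.n≤1+n _)) , st

  -- Colourings under moves

  module _ {m : ℕ} where

    ∑-bij : ∀ (σ ρ : Fin m → Fin m) → (∀ i → σ (ρ i) ≡ i) → (∀ i → ρ (σ i) ≡ i) → ∀ f → ∑ (allFin m) (f ∘ σ) ≡ ∑ (allFin m) f
    ∑-bij σ ρ σρ ρσ f = trans (sym (∑-map σ f (allFin m))) (∑-↭ f (unique-set-↭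
      (Uₚ.map⁺ (λ {x} {y} e → trans (sym (ρσ x)) (trans (cong ρ e) (ρσ y))) (Uₚ.allFin⁺ m)) (Uₚ.allFin⁺ m)
      (λ _ → ∈-allFin _) (λ {x} _ → subst (_∈ map σ (allFin m)) (σρ x) (∈ₚ.∈-map⁺ σ (∈-allFin (ρ x))))))

    deg : Graph m → Fin m → ℕ
    deg G i = ∑[ j ∈ allFin m ] 𝟙 (G i j)

    deg-add : ∀ G u v i → deg (addE G u v) i ≤ deg G i + (𝟙 ⌊ i ≟ u ⌋ + 𝟙 ⌊ i ≟ v ⌋)
    deg-add G u v i = subst₂ (λ a b → a ≤ b + _) (W-degree (addE G u v) i) (W-degree G i) (W-add G (λ k _ → 𝟙 ⌊ i ≟ k ⌋) u v)

    deg-del : ∀ G u v i → u ≢ v → G u v ≡ true → G v u ≡ true → deg (delE G u v) i + (𝟙 ⌊ i ≟ u ⌋ + 𝟙 ⌊ i ≟ v ⌋) ≤ deg G i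
    deg-del G u v i ne e e′ = subst₂ (λ a b → a + _ ≤ b) (W-degree (delE G u v) i) (W-degree G i) (W-del G (λ k _ → 𝟙 ⌊ i ≟ k ⌋) u v ne e e′)

    ∑-two : ∀ (f : Fin m → ℕ) {xs x y} → x ∈ xs → y ∈ xs → x ≢ y → f x + f y ≤ ∑ xs f
    ∑-two f (here refl) (here refl) ne = ⊥-elim (ne refl)
    ∑-two f {x ∷ xs} (here refl) (there j) ne = ℕₚ.+-monoʳ-≤ (f x) (∑-term f j)
    ∑-two f {y ∷ xs} {x} (there i) (here refl) ne = subst (_≤ f y + ∑ xs f) (ℕₚ.+-comm (f y) (f x)) (ℕₚ.+-monoʳ-≤ (f y) (∑-term f i))
    ∑-two f {z ∷ xs} (there i) (there j) ne = ℕₚ.≤-trans (∑-two f i j ne) (ℕₚ.m≤n+m (∑ xs f) (f z))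

    wt : (Fin m → Fin m) → Fin m → Fin m → ℕ
    wt f i j = 𝟙 (not ⌊ f i ≟ f j ⌋)

    wt-0 : ∀ f {i j} → f i ≡ f j → wt f i j ≡ 0
    wt-0 f {i} {j} e = cong (λ b → 𝟙 (not b)) (⇒does (f i ≟ f j) e)

    wt-sym : ∀ f i j → wt f i j ≡ wt f j i
    wt-sym f i j = cong (λ b → 𝟙 (not b)) (≟-comm (f i) (f j))

    wt-tri : ∀ f a x b → wt f a b ≤ wt f a x + wt f x b
    wt-tri f a x b with f a ≟ f x | f x ≟ f b
    ... | yes p | yes q = ℕₚ.≤-reflexive (wt-0 f (trans p q))
    ... | yes p | no _ = 𝟙≤1 _
    ... | no _ | _ = ℕₚ.≤-trans (𝟙≤1 _) (s≤s z≤n)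

    bc : Graph m → (Fin m → Fin m) → ℕ
    bc G f = W G (wt f)

    W-cong : ∀ {G H : Graph m} φ → G ≐ H → W G φ ≡ W H φ
    W-cong φ h = ∑-cong (allFin m) (λ i _ → ∑-cong (allFin m) (λ j _ → cong (λ b → 𝟙 b * φ i j) (h i j)))

    deg-cong : ∀ {G H : Graph m} → G ≐ H → ∀ i → deg G i ≡ deg H i
    deg-cong h i = ∑-cong (allFin m) (λ j _ → cong 𝟙 (h i j))

    recolour : (Fin m → Fin m) → Fin m → Fin m → Fin m → Fin m
    recolour f u γ i = if ⌊ i ≟ u ⌋ then γ else f i

    recolour-≡ : ∀ f u γ → recolour f u γ u ≡ γ
    recolour-≡ f u γ = cong (λ b → if b then γ else f u) (⇒does (u ≟ u) refl)

    recolour-≢ : ∀ f u γ {i} → i ≢ u → recolour f u γ i ≡ f i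
    recolour-≢ f u γ {i} ne = cong (λ b → if b then γ else f i) (¬does⇒ (i ≟ u) ne)

    recolour-at : ∀ f u r → recolour f u (f r) r ≡ f r
    recolour-at f u r with r ≟ u
    ... | yes _ = refl
    ... | no _  = refl

    record Simp (G : Graph m) : Set where
      field
        symS : ∀ {i j} → G i j ≡ true → G j i ≡ true
        irrS : ∀ {i j} → G i j ≡ true → i ≢ j
    open Simp

    Simp-add : ∀ {G u v} → u ≢ v → Simp G → Simp (addE G u v)
    symS (Simp-add {G} {u} {v} ne s) {i} {j} e with addE⇒ G u v i j e
    ... | inj₁ q = addE-new G (SE-flip q)
    ... | inj₂ q = addE-old G (symS s q)
    irrS (Simp-add {G} {u} {v} ne s) {i} {j} e with addE⇒ G u v i j e
    ... | inj₁ (inj₁ (refl , refl)) = ne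
    ... | inj₁ (inj₂ (refl , refl)) = λ q → ne (sym q)
    ... | inj₂ q = irrS s q

    Simp-del : ∀ {G u v} → Simp G → Simp (delE G u v)
    symS (Simp-del {G} {u} {v} s) {i} {j} e = let (a , b) = delE⇒ G u v i j e in delE-keep G (λ q → a (SE-flip q)) (symS s b)
    irrS (Simp-del {G} {u} {v} s) {i} {j} e = irrS s (proj₂ (delE⇒ G u v i j e))

    Simp-cong : ∀ {G H : Graph m} → G ≐ H → Simp G → Simp H
    symS (Simp-cong h s) {i} {j} e = trans (sym (h j i)) (symS s (trans (h i j) e))
    irrS (Simp-cong h s) {i} {j} e = irrS s (trans (h i j) e)

    record Added (G : Graph m) (u v : Fin m) (H : Graph m) : Set where
      field
        elim : ∀ {i j} → H i j ≡ true → SameEdge i j u v ⊎ G i j ≡ true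
        new  : ∀ {i j} → SameEdge i j u v → H i j ≡ true
        old  : ∀ {i j} → G i j ≡ true → H i j ≡ true

    record Deleted (G : Graph m) (u v : Fin m) (H : Graph m) : Set where
      field
        elim : ∀ {i j} → H i j ≡ true → ¬ SameEdge i j u v × G i j ≡ true
        keep : ∀ {i j} → ¬ SameEdge i j u v → G i j ≡ true → H i j ≡ true

    added : ∀ G u v → Added G u v (addE G u v)
    added G u v = record { elim = λ {i} {j} → addE⇒ G u v i j ; new = λ {i} {j} → addE-new G {u} {v} {i} {j} ; old = λ {i} {j} → addE-old G {u} {v} {i} {j} }

    deleted : ∀ G u v → Deleted G u v (delE G u v)
    deleted G u v = record { elim = λ {i} {j} → delE⇒ G u v i j ; keep = λ {i} {j} → delE-keep G {u} {v} {i} {j} }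

    spr-tbr : ∀ {G x y a b c d A₀ A₁ A₂ A₃ A₄ A₅ B₀ B₁ B₂ B₃ B₄ B₅ B₆ B₇} → Simp G → G x y ≡ true →
      ¬ SameEdge x y a x → ¬ SameEdge x y x b → ¬ SameEdge x y c d →
      Deleted G a x A₀ → Deleted A₀ x b A₁ → Added A₁ a b A₂ → Deleted A₂ c d A₃ → Added A₃ c x A₄ → Added A₄ x d A₅ →
      Deleted G x y B₀ → Deleted B₀ x a B₁ → Deleted B₁ x b B₂ → Added B₂ a b B₃ → Deleted B₃ c d B₄ → Added B₄ c x B₅ → Added B₅ x d B₆ → Added B₆ x y B₇ →
      A₅ ≐ B₇
    spr-tbr {G} {x} {y} {a} {b} {c} {d} {A₀} {A₁} {A₂} {A₃} {A₄} {A₅} {B₀} {B₁} {B₂} {B₃} {B₄} {B₅} {B₆} {B₇} S xy xy-ax xy-xb xy-cd a₀ a₁ a₂ a₃ a₄ a₅ b₀ b₁ b₂ b₃ b₄ b₅ b₆ b₇ i j = Bool-≡ to from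
      where
      open Added
      open Deleted renaming (elim to delim)
      to : A₅ i j ≡ true → B₇ i j ≡ true
      to e with sameEdge? i j x y
      ... | yes s = new b₇ s
      ... | no ns with elim a₅ e
      ...   | inj₁ s = old b₇ (new b₆ s)
      ...   | inj₂ s with elim a₄ s
      ...     | inj₁ q = old b₇ (old b₆ (new b₅ q))
      ...     | inj₂ q with delim a₃ q
      ...       | ncd , q₁ with elim a₂ q₁
      ...         | inj₁ q₂ = old b₇ (old b₆ (old b₅ (keep b₄ ncd (new b₃ q₂))))
      ...         | inj₂ q₂ with delim a₁ q₂
      ...           | nxb , q₃ with delim a₀ q₃
      ...             | nax , q₄ = old b₇ (old b₆ (old b₅ (keep b₄ ncd (old b₃ (keep b₂ nxb (keep b₁ (λ z → nax (SE-trans z SE-swap)) (keep b₀ ns q₄)))))))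
      base : ¬ SameEdge i j c d → ¬ SameEdge i j x b → ¬ SameEdge i j a x → G i j ≡ true → A₅ i j ≡ true
      base n₁ n₂ n₃ e = old a₅ (old a₄ (keep a₃ n₁ (old a₂ (keep a₁ n₂ (keep a₀ n₃ e)))))
      edge : SameEdge i j x y → G i j ≡ true
      edge (inj₁ (refl , refl)) = xy
      edge (inj₂ (refl , refl)) = symS S xy
      from : B₇ i j ≡ true → A₅ i j ≡ true
      from e with elim b₇ e
      ... | inj₁ s = base (λ z → xy-cd (SE-trans (SE-sym s) z)) (λ z → xy-xb (SE-trans (SE-sym s) z)) (λ z → xy-ax (SE-trans (SE-sym s) z)) (edge s)
      ... | inj₂ s with elim b₆ s
      ...   | inj₁ q = new a₅ q
      ...   | inj₂ q with elim b₅ q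
      ...     | inj₁ q₁ = old a₅ (new a₄ q₁)
      ...     | inj₂ q₁ with delim b₄ q₁
      ...       | ncd , q₂ with elim b₃ q₂
      ...         | inj₁ q₃ = old a₅ (old a₄ (keep a₃ ncd (new a₂ q₃)))
      ...         | inj₂ q₃ with delim b₂ q₃
      ...           | nxb , q₄ with delim b₁ q₄
      ...             | nxa , q₅ = base ncd nxb (λ z → nxa (SE-trans z SE-swap)) (proj₂ (delim b₀ q₅))

    -- Suppressing u (of degree 2) and putting it on another edge rs, with the colour of r, creates no bichromatic edge.
    side-bc : ∀ {K u p q r s} f → Simp K → deg K u ≤ 2 → p ≢ q → K u p ≡ true → K u q ≡ true →
      let K₁ = addE (delE (delE K u p) u q) p q
          K₃ = addE (addE (delE K₁ r s) r u) u s in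
      K₁ r s ≡ true → Simp K₃ × (∀ i → deg K₃ i ≤ deg K i) × bc K₃ (recolour f u (f r)) ≤ bc K f
    side-bc {K} {u} {p} {q} {r} {s} f S d≤ p≢q up uq rs = S₃ , degs , bcs
      where
      f′ = recolour f u (f r)
      u≢p = irrS S up
      u≢q = irrS S uq
      Ka = delE K u p
      K₀ = delE Ka u q
      K₁ = addE K₀ p q
      K₂ = delE K₁ r s
      Kb = addE K₂ r u
      K₃ = addE Kb u s
      Sa = Simp-del {u = u} {p} S
      S₀ = Simp-del {u = u} {q} Sa
      S₁ = Simp-add p≢q S₀
      uqa : Ka u q ≡ true
      uqa = delE-keep K (λ { (inj₁ (_ , e)) → p≢q (sym e) ; (inj₂ (e , _)) → u≢p e }) uq
      self : 𝟙 ⌊ u ≟ u ⌋ ≡ 1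
      self = cong 𝟙 (⇒does (u ≟ u) refl)
      deg0 : deg K₀ u ≡ 0
      deg0 = ℕₚ.n≤0⇒n≡0 (ℕₚ.+-cancelʳ-≤ 2 (deg K₀ u) 0 (begin
        deg K₀ u + 2 ≡⟨ sym (ℕₚ.+-assoc (deg K₀ u) 1 1) ⟩
        deg K₀ u + 1 + 1 ≤⟨ ℕₚ.+-monoˡ-≤ 1 (ℕₚ.+-monoʳ-≤ (deg K₀ u) (ℕₚ.≤-trans (ℕₚ.≤-reflexive (sym self)) (ℕₚ.m≤m+n (𝟙 ⌊ u ≟ u ⌋) (𝟙 ⌊ u ≟ q ⌋)))) ⟩
        deg K₀ u + (𝟙 ⌊ u ≟ u ⌋ + 𝟙 ⌊ u ≟ q ⌋) + 1 ≤⟨ ℕₚ.+-mono-≤ (deg-del Ka u q u u≢q uqa (symS Sa {u} {q} uqa)) (ℕₚ.≤-trans (ℕₚ.≤-reflexive (sym self)) (ℕₚ.m≤m+n (𝟙 ⌊ u ≟ u ⌋) (𝟙 ⌊ u ≟ p ⌋))) ⟩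
        deg Ka u + (𝟙 ⌊ u ≟ u ⌋ + 𝟙 ⌊ u ≟ p ⌋) ≤⟨ deg-del K u p u u≢p up (symS S up) ⟩
        deg K u ≤⟨ d≤ ⟩
        2 ∎))
        where open ℕₚ.≤-Reasoning
      iso₀ : ∀ {j} → K₀ u j ≢ true
      iso₀ {j} e = ℕₚ.<⇒≱ (s≤s z≤n) (subst (1 ≤_) deg0 (subst (λ b → 𝟙 b ≤ deg K₀ u) e (∑-term (λ j → 𝟙 (K₀ u j)) (∈-allFin j))))
      iso₁ : ∀ {j} → K₁ u j ≢ true
      iso₁ {j} e with addE⇒ K₀ p q u j e
      ... | inj₁ (inj₁ (a , _)) = u≢p a
      ... | inj₁ (inj₂ (a , _)) = u≢q a
      ... | inj₂ a = iso₀ a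
      r≢u : r ≢ u
      r≢u refl = iso₁ rs
      u≢s : u ≢ s
      u≢s refl = iso₁ (symS S₁ {r} {s} rs)
      r≢s = irrS S₁ {r} {s} rs
      S₂ = Simp-del {u = r} {s} S₁
      S₃ : Simp K₃
      S₃ = Simp-add u≢s (Simp-add r≢u S₂)
      degs : ∀ i → deg K₃ i ≤ deg K i
      degs i = ℕₚ.+-cancelʳ-≤ (Ir + Is + (Iu + Iq) + (Iu + Ip)) (deg K₃ i) (deg K i) (begin
        deg K₃ i + (Ir + Is + (Iu + Iq) + (Iu + Ip)) ≤⟨ ℕₚ.+-monoˡ-≤ _ (ℕₚ.≤-trans (deg-add Kb u s i) (ℕₚ.+-monoˡ-≤ (Iu + Is) (deg-add K₂ r u i))) ⟩
        deg K₂ i + (Ir + Iu) + (Iu + Is) + (Ir + Is + (Iu + Iq) + (Iu + Ip)) ≡⟨ l₁ (deg K₂ i) Ir Iu Is Ip Iq ⟩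
        (deg K₂ i + (Ir + Is)) + (Ir + Is + Iu + Iu + (Iu + Iq) + (Iu + Ip)) ≤⟨ ℕₚ.+-monoˡ-≤ _ (ℕₚ.≤-trans (deg-del K₁ r s i r≢s rs (symS S₁ {r} {s} rs)) (deg-add K₀ p q i)) ⟩
        deg K₀ i + (Ip + Iq) + (Ir + Is + Iu + Iu + (Iu + Iq) + (Iu + Ip)) ≡⟨ l₂ (deg K₀ i) Ir Iu Is Ip Iq ⟩
        deg K₀ i + (Iu + Iq) + (Iu + Ip) + (Ir + Is + (Iu + Iq) + (Iu + Ip)) ≤⟨ ℕₚ.+-monoˡ-≤ _ (ℕₚ.≤-trans (ℕₚ.+-monoˡ-≤ (Iu + Ip) (deg-del Ka u q i u≢q uqa (symS Sa {u} {q} uqa))) (deg-del K u p i u≢p up (symS S up))) ⟩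
        deg K i + (Ir + Is + (Iu + Iq) + (Iu + Ip)) ∎)
        where
        open ℕₚ.≤-Reasoning
        Ir = 𝟙 ⌊ i ≟ r ⌋
        Is = 𝟙 ⌊ i ≟ s ⌋
        Iu = 𝟙 ⌊ i ≟ u ⌋
        Ip = 𝟙 ⌊ i ≟ p ⌋
        Iq = 𝟙 ⌊ i ≟ q ⌋
        l₁ : ∀ D r u s p q → D + (r + u) + (u + s) + (r + s + (u + q) + (u + p)) ≡ (D + (r + s)) + (r + s + u + u + (u + q) + (u + p))
        l₁ = solve-∀
        l₂ : ∀ D r u s p q → D + (p + q) + (r + s + u + u + (u + q) + (u + p)) ≡ D + (u + q) + (u + p) + (r + s + (u + q) + (u + p))
        l₂ = solve-∀
      w : Fin m → Fin m → ℕ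
      w i j = wt f i j + wt f j i
      w′ : Fin m → Fin m → ℕ
      w′ i j = wt f′ i j + wt f′ j i
      same : bc K₁ f′ ≤ bc K₁ f
      same = ∑-mono (allFin m) (λ i _ → ∑-mono (allFin m) (λ j _ → pt i j))
        where
        pt : ∀ i j → 𝟙 (K₁ i j) * wt f′ i j ≤ 𝟙 (K₁ i j) * wt f i j
        pt i j with K₁ i j in eq
        ... | false = z≤n
        ... | true  = ℕₚ.≤-reflexive (cong (_+ 0) (cong₂ (λ a b → 𝟙 (not ⌊ a ≟ b ⌋))
          (recolour-≢ f u (f r) (λ { refl → iso₁ eq })) (recolour-≢ f u (f r) (λ { refl → iso₁ (symS S₁ {i} {j} eq) }))))
      f′u≡f′r : f′ u ≡ f′ r
      f′u≡f′r = trans (recolour-≡ f u (f r)) (sym (recolour-at f u r))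
      ru0 : w′ r u ≡ 0
      ru0 = cong₂ _+_ (wt-0 f′ (sym f′u≡f′r)) (wt-0 f′ f′u≡f′r)
      us : w′ u s ≡ w′ r s
      us = cong₂ (λ a b → 𝟙 (not ⌊ a ≟ f′ s ⌋) + 𝟙 (not ⌊ f′ s ≟ b ⌋)) f′u≡f′r f′u≡f′r
      bcs : bc K₃ f′ ≤ bc K f
      bcs = begin
        bc K₃ f′ ≤⟨ W-add Kb (wt f′) u s ⟩
        bc Kb f′ + w′ u s ≤⟨ ℕₚ.+-monoˡ-≤ (w′ u s) (W-add K₂ (wt f′) r u) ⟩
        bc K₂ f′ + w′ r u + w′ u s ≡⟨ cong₂ (λ a b → bc K₂ f′ + a + b) ru0 us ⟩
        bc K₂ f′ + 0 + w′ r s ≡⟨ cong (_+ w′ r s) (ℕₚ.+-identityʳ (bc K₂ f′)) ⟩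
        bc K₂ f′ + w′ r s ≤⟨ W-del K₁ (wt f′) r s r≢s rs (symS S₁ {r} {s} rs) ⟩
        bc K₁ f′ ≤⟨ same ⟩
        bc K₁ f ≤⟨ W-add K₀ (wt f) p q ⟩
        bc K₀ f + w p q ≤⟨ ℕₚ.+-monoʳ-≤ (bc K₀ f) tri ⟩
        bc K₀ f + (w u q + w u p) ≡⟨ sym (ℕₚ.+-assoc (bc K₀ f) (w u q) (w u p)) ⟩
        bc K₀ f + w u q + w u p ≤⟨ ℕₚ.+-monoˡ-≤ (w u p) (W-del Ka (wt f) u q u≢q uqa (symS Sa {u} {q} uqa)) ⟩
        bc Ka f + w u p ≤⟨ W-del K (wt f) u p u≢p up (symS S up) ⟩
        bc K f ∎
        where
        open ℕₚ.≤-Reasoning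
        l₃ : ∀ a b c d → (a + b) + (c + d) ≡ (b + c) + (d + a)
        l₃ = solve-∀
        tri : w p q ≤ w u q + w u p
        tri = ℕₚ.≤-trans (ℕₚ.+-mono-≤ (wt-tri f p u q) (wt-tri f q u p)) (ℕₚ.≤-reflexive (l₃ (wt f p u) (wt f u q) (wt f q u) (wt f u p)))

  module _ (n : ℕ) where

    private m = V n

    cap : Fin m → ℕ
    cap i = if toℕ i ≤ᵇ n then 1 else 3

    record Sparse (G : Graph m) : Set where
      field
        simp : Simp G
        capped : ∀ i → deg G i ≤ cap i

    LeafAgree : (f f′ : Fin m → Fin m) → Set
    LeafAgree f f′ = ∀ i → toℕ i ≤ n → f′ i ≡ f i

    private
      Half : Fin m → Fin m → Graph m → Set
      Half u v K = Simp K × (∀ i → deg K i + (𝟙 ⌊ i ≟ u ⌋ + 𝟙 ⌊ i ≟ v ⌋) ≤ cap i)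

      cap≤3 : ∀ i → cap i ≤ 3
      cap≤3 i with toℕ i ≤ᵇ n
      ... | true  = s≤s z≤n
      ... | false = s≤s (s≤s (s≤s z≤n))

      -- TBRSide minus isolation and reachability.
      Side : Graph m → Fin m → Graph m → Set
      Side K u K′ = (K′ ≐ K) ⊎ (∃[ p ] ∃[ q ] ∃[ r ] ∃[ s ] (p ≢ q × K u p ≡ true × K u q ≡ true
        × addE (delE (delE K u p) u q) p q r s ≡ true
        × K′ ≐ addE (addE (delE (addE (delE (delE K u p) u q) p q) r s) r u) u s))

      side-step : ∀ {u v K K′} f → Half u v K → Side K u K′ → ∃[ f′ ] (Half u v K′ × LeafAgree f f′ × bc K′ f′ ≤ bc K f)
      side-step {u} {v} {K} {K′} f (S , D) (inj₁ h) = f , (Simp-cong (λ i j → sym (h i j)) S ,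
        λ i → subst (λ z → z + _ ≤ cap i) (sym (deg-cong h i)) (D i)) , (λ _ _ → refl) , ℕₚ.≤-reflexive (W-cong (wt f) h)
      side-step {u} {v} {K} {K′} f (S , D) (inj₂ (p , q , r , s , p≢q , up , uq , rs , h)) = finish (side-bc f S d2 p≢q up uq rs)
        where
        K₃ = addE (addE (delE (addE (delE (delE K u p) u q) p q) r s) r u) u s
        f′ = recolour f u (f r)
        one : 1 ≤ 𝟙 ⌊ u ≟ u ⌋ + 𝟙 ⌊ u ≟ v ⌋
        one = subst (λ b → 1 ≤ 𝟙 b + 𝟙 ⌊ u ≟ v ⌋) (sym (⇒does (u ≟ u) refl)) (s≤s z≤n)
        d2 : deg K u ≤ 2
        d2 = ℕₚ.+-cancelʳ-≤ 1 (deg K u) 2 (ℕₚ.≤-trans (ℕₚ.+-monoʳ-≤ (deg K u) one) (ℕₚ.≤-trans (D u) (cap≤3 u)))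
        two : 2 ≤ deg K u
        two = subst₂ (λ a b → 𝟙 a + 𝟙 b ≤ deg K u) up uq (∑-two (λ j → 𝟙 (K u j)) (∈-allFin p) (∈-allFin q) p≢q)
        agree : LeafAgree f f′
        agree i le = recolour-≢ f u (f r) (λ { refl → ℕₚ.<⇒≱ (s≤s (s≤s z≤n)) (ℕₚ.≤-trans two (ℕₚ.≤-trans (ℕₚ.m≤m+n (deg K u) _) (subst (λ b → deg K u + (𝟙 ⌊ u ≟ u ⌋ + 𝟙 ⌊ u ≟ v ⌋) ≤ (if b then 1 else 3)) (≤ᵇ-true le) (D u)))) })
        finish : Simp K₃ × (∀ i → deg K₃ i ≤ deg K i) × bc K₃ f′ ≤ bc K f → ∃[ f′ ] (Half u v K′ × LeafAgree f f′ × bc K′ f′ ≤ bc K f)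
        finish (S₃ , degs , b) = f′ , (Simp-cong (λ i j → sym (h i j)) S₃ ,
          λ i → ℕₚ.≤-trans (ℕₚ.+-monoˡ-≤ _ (ℕₚ.≤-trans (ℕₚ.≤-reflexive (deg-cong h i)) (degs i))) (D i)) ,
          agree , ℕₚ.≤-trans (ℕₚ.≤-reflexive (W-cong (wt f′) h)) b

    bisect-bc : ∀ {G u v G₁ G₂} f → Sparse G → G u v ≡ true → Side (delE G u v) u G₁ → Side G₁ v G₂ →
      ∃[ f′ ] (Sparse (addE G₂ u v) × LeafAgree f f′ × bc (addE G₂ u v) f′ ≤ bc G f + 2)
    bisect-bc {G} {u} {v} {G₁} {G₂} f SG uv s₁ s₂ with side-step {u} {v} f half₀ s₁
      where
      open Sparse SG
      half₀ : Half u v (delE G u v)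
      half₀ = Simp-del simp , λ i → ℕₚ.≤-trans (deg-del G u v i (Simp.irrS simp uv) uv (Simp.symS simp uv)) (capped i)
    ... | f₁ , (S₁ , D₁) , a₁ , b₁ with side-step {v} {u} f₁ (S₁ , λ i → subst (λ z → deg G₁ i + z ≤ cap i) (ℕₚ.+-comm (𝟙 ⌊ i ≟ u ⌋) _) (D₁ i)) s₂
    ...   | f₂ , (S₂ , D₂) , a₂ , b₂ = f₂ ,
        record { simp = Simp-add (Simp.irrS simp uv) S₂
               ; capped = λ i → ℕₚ.≤-trans (deg-add G₂ u v i) (subst (λ z → deg G₂ i + z ≤ cap i) (ℕₚ.+-comm (𝟙 ⌊ i ≟ v ⌋) _) (D₂ i)) } ,
        (λ i le → trans (a₂ i le) (a₁ i le)) ,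
        ℕₚ.≤-trans (W-add G₂ (wt f₂) u v) (ℕₚ.+-mono-≤ (ℕₚ.≤-trans b₂ (ℕₚ.≤-trans b₁ (ℕₚ.≤-trans (ℕₚ.m≤m+n _ _) (W-del G (wt f) u v (Simp.irrS simp uv) uv (Simp.symS simp uv)))))
          (ℕₚ.+-mono-≤ (𝟙≤1 (not ⌊ f₂ u ≟ f₂ v ⌋)) (𝟙≤1 (not ⌊ f₂ v ≟ f₂ u ⌋))))
      where open Sparse SG

    iso-bc : ∀ {G H} f → Sparse G → Iso n G H → ∃[ f′ ] (Sparse H × LeafAgree f f′ × bc H f′ ≡ bc G f)
    iso-bc {G} {H} f SG (π , fix , hom) = f ∘ ρ ,
      record { simp = record { symS = λ {i} {j} e → trans (H≡ j i) (Simp.symS simp (trans (sym (H≡ i j)) e))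
                             ; irrS = λ {i} {j} e q → Simp.irrS simp (trans (sym (H≡ i j)) e) (cong ρ q) }
             ; capped = λ i → subst₂ _≤_ (degH i) (capρ i) (capped (ρ i)) } ,
      (λ i le → cong f (trans (cong ρ (sym (fix i le))) (ρσ i))) ,
      trans (sym (∑-bij σ ρ σρ ρσ (λ i → ∑[ j ∈ allFin m ] (𝟙 (H i j) * wt (f ∘ ρ) i j))))
        (∑-cong (allFin m) (λ i _ → trans (sym (∑-bij σ ρ σρ ρσ (λ j → 𝟙 (H (σ i) j) * wt (f ∘ ρ) (σ i) j)))
          (∑-cong (allFin m) (λ j _ → cong₂ (λ a b → 𝟙 a * b) (hom i j) (cong₂ (λ a b → 𝟙 (not ⌊ f a ≟ f b ⌋)) (ρσ i) (ρσ j))))))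
      where
      open Sparse SG
      σ ρ : Fin m → Fin m
      σ = π ⟨$⟩ʳ_
      ρ = π ⟨$⟩ˡ_
      σρ : ∀ i → σ (ρ i) ≡ i
      σρ i = inverseʳ π
      ρσ : ∀ i → ρ (σ i) ≡ i
      ρσ i = inverseˡ π
      H≡ : ∀ i j → H i j ≡ G (ρ i) (ρ j)
      H≡ i j = trans (cong₂ H (sym (σρ i)) (sym (σρ j))) (hom (ρ i) (ρ j))
      degH : ∀ i → deg G (ρ i) ≡ deg H i
      degH i = trans (∑-cong (allFin m) (λ j _ → trans (cong 𝟙 (sym (hom (ρ i) j))) (cong (λ z → 𝟙 (H z (σ j))) (σρ i)))) (∑-bij σ ρ σρ ρσ (λ j → 𝟙 (H i j)))
      capρ : ∀ i → cap (ρ i) ≡ cap i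
      capρ i with ℕₚ.≤-<-connex (toℕ i) n | ℕₚ.≤-<-connex (toℕ (ρ i)) n
      ... | inj₁ a | _ = cong cap (trans (cong ρ (sym (fix i a))) (ρσ i))
      ... | inj₂ a | inj₁ b = cong cap (trans (sym (fix (ρ i) b)) (σρ i))
      ... | inj₂ a | inj₂ b = cong (λ a → if a then 1 else 3) (trans (≤ᵇ-false b) (sym (≤ᵇ-false a)))

    spr≐ : ∀ {G x y a b c d} → Simp G → SPRData n G x y a b c d →
      sprResult n G x a b c d ≐ addE (addE (addE (delE (addE (delE (delE (delE G x y) x a) x b) a b) c d) c x) x d) x y
    spr≐ S (xy , _ , _ , _ , xy-ax , xy-xb , xy-cd , _) = spr-tbr S xy xy-ax xy-xb xy-cd
      (deleted _ _ _) (deleted _ _ _) (added _ _ _) (deleted _ _ _) (added _ _ _) (added _ _ _)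
      (deleted _ _ _) (deleted _ _ _) (deleted _ _ _) (added _ _ _) (deleted _ _ _) (added _ _ _) (added _ _ _) (added _ _ _)

    Stepped : Graph m → Graph m → (Fin m → Fin m) → ℕ → Set
    Stepped G H f k = ∃[ f′ ] (Sparse H × LeafAgree f f′ × bc H f′ ≤ bc G f + k)

    iso-after : ∀ {G X X′ H} f → Stepped G X f 2 → X′ ≐ X → Iso n X′ H → Stepped G H f 2
    iso-after {G} {X} {X′} f (f₁ , S₁ , a₁ , b₁) h iso with iso-bc {X′} f₁ S′ iso
      where
      S′ : Sparse X′
      S′ = record { simp = Simp-cong (λ i j → sym (h i j)) (Sparse.simp S₁) ; capped = λ i → subst (_≤ cap i) (sym (deg-cong h i)) (Sparse.capped S₁ i) }
    ... | f₂ , S₂ , a₂ , b₂ = f₂ , S₂ , (λ i le → trans (a₂ i le) (a₁ i le)) ,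
      ℕₚ.≤-trans (ℕₚ.≤-reflexive (trans b₂ (W-cong (wt f₁) h))) b₁

    spr-bc : ∀ {G H} f → Sparse G → SPRStep n G H → Stepped G H f 2
    spr-bc {G} f SG (x , y , a , b , c , d , dat@(xy , ax , xb , cd , xy-ax , xy-xb , xy-cd , ax-xb , ax-cd , xb-cd , _) , iso) =
      iso-after {G} f (bisect-bc {G} {x} {y} {G₁} {G₁} f SG xy side (inj₁ (λ i j → refl))) (spr≐ S dat) iso
      where
      S = Sparse.simp SG
      G₀ = delE G x y
      G₁ = addE (addE (delE (addE (delE (delE G₀ x a) x b) a b) c d) c x) x d
      xa₀ : G₀ x a ≡ true
      xa₀ = delE-keep G {x} {y} {x} {a} (λ z → xy-ax (SE-sym (SE-flip z))) (Simp.symS S ax)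
      xb₀ : G₀ x b ≡ true
      xb₀ = delE-keep G {x} {y} {x} {b} (λ z → xy-xb (SE-sym z)) xb
      cd₁ : addE (delE (delE G₀ x a) x b) a b c d ≡ true
      cd₁ = addE-old (delE (delE G₀ x a) x b) {a} {b} {c} {d} (delE-keep (delE G₀ x a) {x} {b} {c} {d} (λ z → xb-cd (SE-sym z))
        (delE-keep G₀ {x} {a} {c} {d} (λ z → ax-cd (SE-sym (SE-trans z SE-swap))) (delE-keep G {x} {y} {c} {d} (λ z → xy-cd (SE-sym z)) cd)))
      side : Side G₀ x G₁
      side = inj₂ (a , b , c , d , (λ { refl → ax-xb SE-swap }) , xa₀ , xb₀ , cd₁ , λ i j → refl)

    step-bc : ∀ χ {G H} f → Sparse G → Step n χ G H → Stepped G H f 2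
    step-bc SPR f SG st = spr-bc f SG st
    step-bc rSPR f SG (x , y , a , b , c , d , dat , _ , iso) = spr-bc f SG (x , y , a , b , c , d , dat , iso)
    step-bc TBR {G} f SG (u , v , G₁ , G₂ , uv , s₁ , s₂ , iso) = iso-after {G} f (bisect-bc {G} {u} {v} {G₁} {G₂} f SG uv (relax s₁) (relax s₂)) (λ i j → refl) iso
      where
      relax : ∀ {K u K′} → TBRSide n K u K′ → Side K u K′
      relax (inj₁ (_ , h)) = inj₁ h
      relax (inj₂ (p , q , r , s , ne , up , uq , rs , _ , h)) = inj₂ (p , q , r , s , ne , up , uq , rs , h)

    steps-bc : ∀ χ {k G H} f → Sparse G → Steps n χ k G H → Stepped G H f (k * 2)
    steps-bc χ f SG (done iso) with iso-bc f SG iso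
    ... | f₁ , S₁ , a₁ , b₁ = f₁ , S₁ , a₁ , ℕₚ.≤-reflexive (trans b₁ (sym (ℕₚ.+-identityʳ _)))
    steps-bc χ {suc k} {G} f SG (move st sts) with step-bc χ f SG st
    ... | f₁ , S₁ , a₁ , b₁ with steps-bc χ f₁ S₁ sts
    ...   | f₂ , S₂ , a₂ , b₂ = f₂ , S₂ , (λ i le → trans (a₂ i le) (a₁ i le)) ,
      ℕₚ.≤-trans b₂ (ℕₚ.≤-trans (ℕₚ.+-monoˡ-≤ (k * 2) b₁) (ℕₚ.≤-reflexive (ℕₚ.+-assoc (bc G f) 2 (k * 2))))

  module _ {m : ℕ} (g h : Fin m → Fin m) where

    bothᵇ : Fin m → Fin m → Bool
    bothᵇ x y = ⌊ g x ≟ g y ⌋ ∧ ⌊ h x ≟ h y ⌋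

    cost : List (Fin m × Fin m) → ℕ
    cost E = ∑[ e ∈ E ] 𝟙 (not (bothᵇ (proj₁ e) (proj₂ e)))

    private
      col : Fin m → Fin m × Fin m
      col v = g v , h v

      _≟ᶜ_ : (a b : Fin m × Fin m) → Dec (a ≡ b)
      (a , b) ≟ᶜ (c , d) = map′ (λ (p , q) → cong₂ _,_ p q) (λ e → cong proj₁ e , cong proj₂ e) ((a ≟ c) ×-dec (b ≟ d))

      bothᵇ-≡ : ∀ {x y} → bothᵇ x y ≡ true → col x ≡ col y
      bothᵇ-≡ e = let (a , b) = ⌊≟⌋∧⇒ e in cong₂ _,_ a b

      scan : ∀ p t (S : List (Fin m × Fin m)) → col p ∈ S →
        ∃[ S′ ] ((∀ {c} → c ∈ S → c ∈ S′) × (∀ {v} → v ∈ verts t → col v ∈ S′) × length S′ ≤ length S + cost (edges p t))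
      add-colour : ∀ p v (S : List (Fin m × Fin m)) → col p ∈ S →
        ∃[ S′ ] ((∀ {c} → c ∈ S → c ∈ S′) × col v ∈ S′ × length S′ ≤ length S + 𝟙 (not (bothᵇ p v)))
      add-colour p v S i with anyL? (col v ≟ᶜ_) S
      ... | yes j = S , id , j , ℕₚ.m≤m+n _ _
      ... | no ¬j = col v ∷ S , there , here refl , ℕₚ.≤-reflexive (trans (ℕₚ.+-comm 1 (length S))
        (cong (λ b → length S + 𝟙 (not b)) (sym (≢true⇒≡false (λ e → ¬j (subst (_∈ S) (bothᵇ-≡ e) i))))))
      scan p (leaf v) S i with add-colour p v S i
      ... | S′ , sub , j , le = S′ , sub , (λ { (here refl) → j }) , ℕₚ.≤-trans le (ℕₚ.+-monoʳ-≤ (length S) (ℕₚ.m≤m+n _ 0))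
      scan p (node v l r) S i with add-colour p v S i
      ... | S₁ , sub₁ , j , le₁ with scan v l S₁ j
      ...   | S₂ , sub₂ , al , le₂ with scan v r S₂ (sub₂ j)
      ...     | S₃ , sub₃ , ar , le₃ = S₃ , (λ z → sub₃ (sub₂ (sub₁ z))) , vs ,
          ℕₚ.≤-trans le₃ (ℕₚ.≤-trans (ℕₚ.+-monoˡ-≤ cr (ℕₚ.≤-trans le₂ (ℕₚ.+-monoˡ-≤ cl le₁)))
            (ℕₚ.≤-reflexive (trans (l₁ (length S) w cl cr) (cong (λ z → length S + (w + z)) (sym (∑-++ _ (edges v l) (edges v r)))))))
        where
        w = 𝟙 (not (bothᵇ p v))
        cl = cost (edges v l)
        cr = cost (edges v r)
        l₁ : ∀ a w x y → a + w + x + y ≡ a + (w + (x + y))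
        l₁ = solve-∀
        vs : ∀ {u} → u ∈ v ∷ verts l ++ verts r → col u ∈ S₃
        vs (here refl) = sub₃ (sub₂ j)
        vs (there k) with ∈ₚ.∈-++⁻ (verts l) k
        ... | inj₁ k′ = sub₃ (al k′)
        ... | inj₂ k′ = ar k′

      collisions : ∀ (S : List (Fin m × Fin m)) xs → Unique xs → (∀ {x} → x ∈ xs → col x ∈ S) →
        length xs ≤ length S + ∑[ x ∈ xs ] ∑[ y ∈ xs ] (𝟙 (not ⌊ x ≟ y ⌋) * 𝟙 (bothᵇ x y))
      collisions S [] u f = z≤n
      collisions S (x ∷ xs) u f = go (anyL? (λ y → bothᵇ x y 𝔹ₚ.≟ true) xs)
        where
        P : Fin m → Fin m → ℕ
        P x y = 𝟙 (not ⌊ x ≟ y ⌋) * 𝟙 (bothᵇ x y)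
        rest = ∑[ z ∈ xs ] ∑[ y ∈ xs ] P z y
        total = ∑[ z ∈ x ∷ xs ] ∑[ y ∈ x ∷ xs ] P z y
        grow : ∑[ y ∈ xs ] P x y + rest ≤ total
        grow = ℕₚ.+-mono-≤ (ℕₚ.m≤n+m _ (P x x)) (∑-mono xs (λ z _ → ℕₚ.m≤n+m _ (P z x)))
        go : Dec (Any (λ y → bothᵇ x y ≡ true) xs) → suc (length xs) ≤ length S + total
        go (yes a) with Data.List.Membership.Propositional.find a
        ... | y , y∈ , e = begin
          suc (length xs) ≤⟨ s≤s (collisions S xs (Unique-tail u) (λ i → f (there i))) ⟩
          suc (length S + rest) ≡⟨ sym (ℕₚ.+-suc (length S) rest) ⟩
          length S + (1 + rest) ≤⟨ ℕₚ.+-monoʳ-≤ (length S) (ℕₚ.≤-trans (ℕₚ.+-monoˡ-≤ rest hit) grow) ⟩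
          length S + total ∎
          where
          open ℕₚ.≤-Reasoning
          hit : 1 ≤ ∑[ y ∈ xs ] P x y
          hit = ℕₚ.≤-trans (ℕₚ.≤-reflexive (sym (cong₂ (λ a b → 𝟙 (not a) * 𝟙 b) (¬does⇒ (x ≟ y) (λ { refl → Unique-head u y∈ })) e))) (∑-term (P x) y∈)
        go (no ¬a) with ∈⇒↭ (f (here refl))
        ... | S⁻ , p = subst (λ z → suc (length xs) ≤ z + total) (sym (↭ₚ.↭-length p))
          (s≤s (ℕₚ.≤-trans (collisions S⁻ xs (Unique-tail u) f⁻) (ℕₚ.+-monoʳ-≤ (length S⁻) (ℕₚ.≤-trans (ℕₚ.m≤n+m rest _) grow))))
          where
          f⁻ : ∀ {z} → z ∈ xs → col z ∈ S⁻
          f⁻ i with ↭ₚ.∈-resp-↭ p (f (there i))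
          ... | here e  = ⊥-elim (¬a (Any-map (λ { refl → ⇒⌊≟⌋∧ (sym (cong proj₁ e)) (sym (cong proj₂ e)) }) i))
          ... | there j = j

    colour-count : ∀ r t xs → Unique xs → (∀ {x} → x ∈ xs → x ∈ verts t) →
      length xs ≤ 1 + cost (edges r t) + ∑[ x ∈ xs ] ∑[ y ∈ xs ] (𝟙 (not ⌊ x ≟ y ⌋) * 𝟙 (bothᵇ x y))
    colour-count r t xs u f with scan r t (col r ∷ []) (here refl)
    ... | S , _ , vs , le = ℕₚ.≤-trans (collisions S xs u (λ i → vs (f i))) (ℕₚ.+-monoˡ-≤ _ le)

    cost-bc : ∀ {G} r t → Unique (r ∷ verts t) → Rep G (edges r t) → cost (edges r t) * 2 ≤ bc G g + bc G h
    cost-bc {G} r t u rp = begin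
      cost E * 2 ≡⟨ sym (∑-*ʳ 2 (λ e → 𝟙 (not (bothᵇ (proj₁ e) (proj₂ e)))) E) ⟩
      ∑[ e ∈ E ] (𝟙 (not (bothᵇ (proj₁ e) (proj₂ e))) * 2) ≤⟨ ∑-mono E (λ (a , b) _ → pt a b) ⟩
      ∑[ e ∈ E ] ((wt g (proj₁ e) (proj₂ e) + wt g (proj₂ e) (proj₁ e)) + (wt h (proj₁ e) (proj₂ e) + wt h (proj₂ e) (proj₁ e))) ≡⟨ ∑-+ _ _ E ⟩
      ∑[ e ∈ E ] (wt g (proj₁ e) (proj₂ e) + wt g (proj₂ e) (proj₁ e)) + ∑[ e ∈ E ] (wt h (proj₁ e) (proj₂ e) + wt h (proj₂ e) (proj₁ e))
        ≡⟨ sym (cong₂ _+_ (W-list (wt g) sm ll rp) (W-list (wt h) sm ll rp)) ⟩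
      bc G g + bc G h ∎
      where
      open ℕₚ.≤-Reasoning
      E = edges r t
      sm = edges-simple r t u
      ll = edges-loopless r t u
      l₁ : ∀ x y → 𝟙 (not (x ∧ y)) * 2 ≤ (𝟙 (not x) + 𝟙 (not x)) + (𝟙 (not y) + 𝟙 (not y))
      l₁ true true = z≤n
      l₁ true false = ℕₚ.≤-refl
      l₁ false y = s≤s (s≤s z≤n)
      pt : ∀ a b → 𝟙 (not (bothᵇ a b)) * 2 ≤ (wt g a b + wt g b a) + (wt h a b + wt h b a)
      pt a b = subst₂ (λ x y → 𝟙 (not (bothᵇ a b)) * 2 ≤ (wt g a b + x) + (wt h a b + y)) (wt-sym g a b) (wt-sym h a b) (l₁ ⌊ g a ≟ g b ⌋ ⌊ h a ≟ h b ⌋)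

  -- Blocks

  module _ {m : ℕ} where

    assoc : List (Fin m × Fin m) → Fin m → Fin m → Fin m
    assoc []             d i = d
    assoc ((v , c) ∷ xs) d i = if ⌊ i ≟ v ⌋ then c else assoc xs d i

    assoc-∈ : ∀ xs d {v c} → Unique (map proj₁ xs) → (v , c) ∈ xs → assoc xs d v ≡ c
    assoc-∈ ((v , c) ∷ xs) d u (here refl) = cong (λ b → if b then c else assoc xs d v) (⇒does (v ≟ v) refl)
    assoc-∈ ((w , c′) ∷ xs) d {v} u (there i) = trans (cong (λ b → if b then c′ else assoc xs d v)
      (¬does⇒ (v ≟ w) (λ { refl → Unique-head u (∈ₚ.∈-map⁺ proj₁ i) }))) (assoc-∈ xs d (Unique-tail u) i)

    assoc-∉ : ∀ xs d {v} → v ∉ map proj₁ xs → assoc xs d v ≡ d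
    assoc-∉ [] d ni = refl
    assoc-∉ ((w , c) ∷ xs) d {v} ni = trans (cong (λ b → if b then c else assoc xs d v) (¬does⇒ (v ≟ w) (λ e → ni (here e))))
      (assoc-∉ xs d (λ i → ni (there i)))

    leaves⊆verts : ∀ (t : Tree {m}) {x} → x ∈ leaves t → x ∈ verts t
    leaves⊆verts (leaf v) i = i
    leaves⊆verts (node v l r) i with ∈ₚ.∈-++⁻ (leaves l) i
    ... | inj₁ j = there (∈ₚ.∈-++⁺ˡ (leaves⊆verts l j))
    ... | inj₂ j = there (∈ₚ.∈-++⁺ʳ (verts l) (leaves⊆verts r j))

    leaves-unique : ∀ (t : Tree {m}) → Unique (verts t) → Unique (leaves t)
    leaves-unique (leaf v) u = u
    leaves-unique (node v l r) u with Unique-++⁻ (verts l) (Unique-tail u)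
    ... | ul , ur , d = Unique-++ (leaves l) (leaves-unique l ul) (leaves-unique r ur) (λ i j → d (leaves⊆verts l i) (leaves⊆verts r j))

    Below : ℕ → Tree {m} → Set
    Below n t = All (λ v → toℕ v ≤ n) (leaves t)

    verts-leaf : ∀ {n} (t : Tree {m}) → Above n t → ∀ {x} → x ∈ verts t → toℕ x ≤ n → x ∈ leaves t
    verts-leaf (leaf v) a i le = i
    verts-leaf (node v l r) (lt , _ , _) (here refl) le = ⊥-elim (ℕₚ.<⇒≱ lt le)
    verts-leaf (node v l r) (_ , al , ar) (there i) le with ∈ₚ.∈-++⁻ (verts l) i
    ... | inj₁ j = ∈ₚ.∈-++⁺ˡ (verts-leaf l al j le)
    ... | inj₂ j = ∈ₚ.∈-++⁺ʳ (leaves l) (verts-leaf r ar j le)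

    module _ (s : ℕ) where

      -- Leaves are passed upwards until at least s of them are pending; then they form a block, named after the current vertex.

      pend : Tree {m} → List (Fin m)
      pend (leaf v)     = v ∷ []
      pend (node v l r) = if s ≤ᵇ length (pend l ++ pend r) then [] else pend l ++ pend r

      closed : Tree {m} → List (Fin m × List (Fin m))
      closed (leaf v)     = []
      closed (node v l r) = if s ≤ᵇ length (pend l ++ pend r) then (v , pend l ++ pend r) ∷ closed l ++ closed r else closed l ++ closed r

      cols : Fin m → Tree {m} → List (Fin m × Fin m)
      cols γ (leaf v)     = (v , γ) ∷ []
      cols γ (node v l r) = (v , γ′) ∷ cols γ′ l ++ cols γ′ r
        where γ′ = if s ≤ᵇ length (pend l ++ pend r) then v else γ

      pend-length : 1 < s → ∀ t → length (pend t) < s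
      pend-length 1<s (leaf v) = 1<s
      pend-length 1<s (node v l r) with s ≤ᵇ length (pend l ++ pend r) in eq
      ... | true  = ℕₚ.<-trans (s≤s z≤n) 1<s
      ... | false = ℕₚ.≰⇒> (λ le → true≢false (≤ᵇ-true le) eq)

      closed-size : 1 < s → ∀ t {v b} → (v , b) ∈ closed t → s ≤ length b × length b ≤ 2 * s
      closed-size 1<s (node v l r) i with s ≤ᵇ length (pend l ++ pend r) in eq
      closed-size 1<s (node v l r) (here refl) | true = ≤ᵇ-elim eq ,
        subst₂ _≤_ (sym (Lₚ.length-++ (pend l))) (cong (s +_) (sym (ℕₚ.+-identityʳ s))) (ℕₚ.+-mono-≤ (ℕₚ.<⇒≤ (pend-length 1<s l)) (ℕₚ.<⇒≤ (pend-length 1<s r)))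
      closed-size 1<s (node v l r) (there i) | true = [ closed-size 1<s l , closed-size 1<s r ]′ (∈ₚ.∈-++⁻ (closed l) i)
      closed-size 1<s (node v l r) i | false = [ closed-size 1<s l , closed-size 1<s r ]′ (∈ₚ.∈-++⁻ (closed l) i)

      blocks-leaves : ∀ t → leaves t ↭ pend t ++ concatMap proj₂ (closed t)
      blocks-leaves (leaf v) = ↭-refl
      blocks-leaves (node v l r) = ↭-trans both step₂
        where
        P = pend l ++ pend r
        C = concatMap proj₂ (closed l ++ closed r)
        both : leaves l ++ leaves r ↭ P ++ C
        both = begin
          leaves l ++ leaves r ↭⟨ ↭ₚ.++⁺ (blocks-leaves l) (blocks-leaves r) ⟩
          (pend l ++ cl) ++ (pend r ++ cr) ≡⟨ Lₚ.++-assoc (pend l) cl (pend r ++ cr) ⟩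
          pend l ++ (cl ++ (pend r ++ cr)) ↭⟨ ↭ₚ.++⁺ˡ (pend l) (↭ₚ.shifts cl (pend r)) ⟩
          pend l ++ (pend r ++ (cl ++ cr)) ≡⟨ sym (Lₚ.++-assoc (pend l) (pend r) (cl ++ cr)) ⟩
          P ++ (cl ++ cr) ≡⟨ cong (P ++_) (sym (Lₚ.concatMap-++ proj₂ (closed l) (closed r))) ⟩
          P ++ C ∎
          where
          open Data.List.Relation.Binary.Permutation.Propositional.PermutationReasoning
          cl = concatMap proj₂ (closed l)
          cr = concatMap proj₂ (closed r)
        step₂ : P ++ C ↭ pend (node v l r) ++ concatMap proj₂ (closed (node v l r))
        step₂ with s ≤ᵇ length (pend l ++ pend r)
        ... | true  = ↭-refl
        ... | false = ↭-refl

      cols-verts : ∀ γ t → map proj₁ (cols γ t) ≡ verts t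
      cols-verts γ (leaf v) = refl
      cols-verts γ (node v l r) = cong (v ∷_) (trans (Lₚ.map-++ proj₁ (cols γ′ l) (cols γ′ r)) (cong₂ _++_ (cols-verts γ′ l) (cols-verts γ′ r)))
        where γ′ = if s ≤ᵇ length (pend l ++ pend r) then v else γ

      cols-pend : ∀ γ t {x} → x ∈ pend t → (x , γ) ∈ cols γ t
      cols-pend γ (leaf v) (here refl) = here refl
      cols-pend γ (node v l r) i with s ≤ᵇ length (pend l ++ pend r)
      ... | false with ∈ₚ.∈-++⁻ (pend l) i
      ...   | inj₁ j = there (∈ₚ.∈-++⁺ˡ (cols-pend γ l j))
      ...   | inj₂ j = there (∈ₚ.∈-++⁺ʳ (cols γ l) (cols-pend γ r j))

      cols-closed : ∀ γ t {v b x} → (v , b) ∈ closed t → x ∈ b → (x , v) ∈ cols γ t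
      cols-closed γ (node v l r) i k with s ≤ᵇ length (pend l ++ pend r)
      cols-closed γ (node v l r) (here refl) k | true with ∈ₚ.∈-++⁻ (pend l) k
      ... | inj₁ j = there (∈ₚ.∈-++⁺ˡ (cols-pend v l j))
      ... | inj₂ j = there (∈ₚ.∈-++⁺ʳ (cols v l) (cols-pend v r j))
      cols-closed γ (node v l r) (there i) k | true with ∈ₚ.∈-++⁻ (closed l) i
      ... | inj₁ j = there (∈ₚ.∈-++⁺ˡ (cols-closed v l j k))
      ... | inj₂ j = there (∈ₚ.∈-++⁺ʳ (cols v l) (cols-closed v r j k))
      cols-closed γ (node v l r) i k | false with ∈ₚ.∈-++⁻ (closed l) i
      ... | inj₁ j = there (∈ₚ.∈-++⁺ˡ (cols-closed γ l j k))
      ... | inj₂ j = there (∈ₚ.∈-++⁺ʳ (cols γ l) (cols-closed γ r j k))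

      -- Only the edges above closing vertices are bichromatic.
      edges-closed : ∀ f p γ t → f p ≡ γ → (∀ {v c} → (v , c) ∈ cols γ t → f v ≡ c) →
        ∑[ e ∈ edges p t ] wt f (proj₁ e) (proj₂ e) ≤ length (closed t)
      edges-closed f p γ (leaf v) fp ag = ℕₚ.≤-reflexive (trans (ℕₚ.+-identityʳ _) (wt-0 f (trans fp (sym (ag (here refl))))))
      edges-closed f p γ (node v l r) fp ag with s ≤ᵇ length (pend l ++ pend r)
      ... | true = s≤s′ (𝟙≤1 _) (children v (ag (here refl)) (λ i → ag (there (∈ₚ.∈-++⁺ˡ i))) (λ i → ag (there (∈ₚ.∈-++⁺ʳ (cols v l) i))))
        where
        s≤s′ : ∀ {a b c} → a ≤ 1 → b ≤ c → a + b ≤ suc c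
        s≤s′ = ℕₚ.+-mono-≤
        children : ∀ γ′ → f v ≡ γ′ → (∀ {w c} → (w , c) ∈ cols γ′ l → f w ≡ c) → (∀ {w c} → (w , c) ∈ cols γ′ r → f w ≡ c) →
          ∑[ e ∈ edges v l ++ edges v r ] wt f (proj₁ e) (proj₂ e) ≤ length (closed l ++ closed r)
        children γ′ fv al ar = subst₂ _≤_ (sym (∑-++ _ (edges v l) (edges v r))) (sym (Lₚ.length-++ (closed l)))
          (ℕₚ.+-mono-≤ (edges-closed f v γ′ l fv al) (edges-closed f v γ′ r fv ar))
      ... | false = subst₂ _≤_ (sym (trans (cong (_+ _) (wt-0 f (trans fp (sym fv)))) (∑-++ _ (edges v l) (edges v r)))) (sym (Lₚ.length-++ (closed l)))
          (ℕₚ.+-mono-≤ (edges-closed f v γ l fv (λ i → ag (there (∈ₚ.∈-++⁺ˡ i)))) (edges-closed f v γ r fv (λ i → ag (there (∈ₚ.∈-++⁺ʳ (cols γ l) i)))))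
        where
        fv : f v ≡ γ
        fv = ag (here refl)

      closed-id : ∀ {n} t → Above n t → ∀ {v} → v ∈ map proj₁ (closed t) → v ∈ verts t × n < toℕ v
      closed-id {n} (node v l r) (lt , al , ar) {w} i with s ≤ᵇ length (pend l ++ pend r)
      ... | true = go i
        where
        go : w ∈ v ∷ map proj₁ (closed l ++ closed r) → w ∈ verts (node v l r) × n < toℕ w
        go (here refl) = here refl , lt
        go (there j) with ∈ₚ.∈-++⁻ (map proj₁ (closed l)) (subst (w ∈_) (Lₚ.map-++ proj₁ (closed l) (closed r)) j)
        ... | inj₁ k = let (a , b) = closed-id l al k in there (∈ₚ.∈-++⁺ˡ a) , b
        ... | inj₂ k = let (a , b) = closed-id r ar k in there (∈ₚ.∈-++⁺ʳ (verts l) a) , b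
      ... | false with ∈ₚ.∈-++⁻ (map proj₁ (closed l)) (subst (w ∈_) (Lₚ.map-++ proj₁ (closed l) (closed r)) i)
      ...   | inj₁ k = let (a , b) = closed-id l al k in there (∈ₚ.∈-++⁺ˡ a) , b
      ...   | inj₂ k = let (a , b) = closed-id r ar k in there (∈ₚ.∈-++⁺ʳ (verts l) a) , b

      closed-unique : ∀ {n} t → Above n t → Unique (verts t) → Unique (map proj₁ (closed t))
      closed-unique (leaf v) _ _ = []
      closed-unique {n} (node v l r) (lt , al , ar) u with Unique-++⁻ (verts l) (Unique-tail u)
      ... | ul , ur , d with s ≤ᵇ length (pend l ++ pend r)
      ...   | true = Unique-∷ fresh rest
        where
        eq = Lₚ.map-++ proj₁ (closed l) (closed r)
        rest : Unique (map proj₁ (closed l ++ closed r))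
        rest = subst Unique (sym eq) (Unique-++ (map proj₁ (closed l)) (closed-unique l al ul) (closed-unique r ar ur) (λ i j → d (proj₁ (closed-id l al i)) (proj₁ (closed-id r ar j))))
        fresh : v ∉ map proj₁ (closed l ++ closed r)
        fresh i with ∈ₚ.∈-++⁻ (map proj₁ (closed l)) (subst (v ∈_) eq i)
        ... | inj₁ k = Unique-head u (∈ₚ.∈-++⁺ˡ (proj₁ (closed-id l al k)))
        ... | inj₂ k = Unique-head u (∈ₚ.∈-++⁺ʳ (verts l) (proj₁ (closed-id r ar k)))
      ...   | false = subst Unique (sym (Lₚ.map-++ proj₁ (closed l) (closed r))) (Unique-++ (map proj₁ (closed l)) (closed-unique l al ul) (closed-unique r ar ur) (λ i j → d (proj₁ (closed-id l al i)) (proj₁ (closed-id r ar j))))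

      -- Keeping the leaves selected by kept, at most two per block, and cutting everything else.
      module _ (kept : Fin m → Bool) where

        cherry : Fin m → Fin m → Shape {m}
        cherry x y = if toℕ x <ᵇ toℕ y then nd (lf x) (lf y) else nd (lf y) (lf x)

        shape : List (Fin m) → Maybe (Shape {m})
        shape []          = nothing
        shape (x ∷ [])    = just (lf x)
        shape (x ∷ y ∷ _) = just (cherry x y)

        shapes : List (Fin m) → List (Shape {m})
        shapes []          = []
        shapes (x ∷ [])    = lf x ∷ []
        shapes (x ∷ y ∷ _) = cherry x y ∷ []

        shape-join : ∀ K₁ K₂ → length (K₁ ++ K₂) ≤ 2 → Join (shape K₁) (shape K₂) (shape (K₁ ++ K₂))
        shape-join [] [] le = j-none
        shape-join [] (x ∷ []) le = j-right
        shape-join [] (x ∷ y ∷ K) le = j-right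
        shape-join (x ∷ []) [] le = j-left
        shape-join (x ∷ []) (y ∷ []) le with toℕ x <ᵇ toℕ y
        ... | true  = j-both
        ... | false = j-swap
        shape-join (x ∷ []) (y ∷ z ∷ K) (s≤s (s≤s ()))
        shape-join (x ∷ y ∷ []) [] le = j-left
        shape-join (x ∷ y ∷ []) (z ∷ K) (s≤s (s≤s ()))
        shape-join (x ∷ y ∷ z ∷ K) K₂ (s≤s (s≤s ()))

        keep : List (Fin m) → List (Fin m)
        keep = filterᵇ kept

        keep-++ : ∀ xs ys → keep (xs ++ ys) ≡ keep xs ++ keep ys
        keep-++ = Lₚ.filter-++ _

        drops : List (Fin m) → List (Shape {m})
        drops xs = map lf (filterᵇ (not ∘ kept) xs)

        drops-++ : ∀ xs ys → drops (xs ++ ys) ≡ drops xs ++ drops ys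
        drops-++ xs ys = trans (cong (map lf) (Lₚ.filter-++ _ xs ys)) (Lₚ.map-++ lf (filterᵇ (not ∘ kept) xs) _)

        pairs : List (Fin m × List (Fin m)) → List (Shape {m})
        pairs = concatMap (λ vb → shapes (keep (proj₂ vb)))

        Paired : List (Fin m) → Set
        Paired b = length (keep b) ≤ 2 × length (keep b) ≢ 1

        mutual

          forest-node : ∀ v l r → (∀ {v b} → (v , b) ∈ closed l → Paired b) → (∀ {v b} → (v , b) ∈ closed r → Paired b) →
            length (keep (pend l ++ pend r)) ≤ 2 →
            ∃[ F ] (Cut (node v l r) (shape (keep (pend l ++ pend r))) F × F ↭ pairs (closed l ++ closed r) ++ drops (leaves l ++ leaves r))
          forest-node v l r prl prr le = Fl ++ Fr , subst (λ z → Cut (node v l r) (shape z) (Fl ++ Fr)) (sym eq) (nodeC hl hr (shape-join Kl Kr le′)) , perm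
            where
            Kl = keep (pend l)
            Kr = keep (pend r)
            eq : keep (pend l ++ pend r) ≡ Kl ++ Kr
            eq = keep-++ (pend l) (pend r)
            le′ : length (Kl ++ Kr) ≤ 2
            le′ = subst (λ z → length z ≤ 2) eq le
            len = Lₚ.length-++ Kl {Kr}
            rl = forest-cut l prl (ℕₚ.≤-trans (ℕₚ.m≤m+n _ _) (subst (_≤ 2) len le′))
            rr = forest-cut r prr (ℕₚ.≤-trans (ℕₚ.m≤n+m (length Kr) (length Kl)) (subst (_≤ 2) len le′))
            Fl = proj₁ rl
            Fr = proj₁ rr
            hl = proj₁ (proj₂ rl)
            hr = proj₁ (proj₂ rr)
            Pl = pairs (closed l)
            Pr = pairs (closed r)
            Dl = drops (leaves l)
            Dr = drops (leaves r)
            perm : Fl ++ Fr ↭ pairs (closed l ++ closed r) ++ drops (leaves l ++ leaves r)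
            perm = begin
              Fl ++ Fr ↭⟨ ↭ₚ.++⁺ (proj₂ (proj₂ rl)) (proj₂ (proj₂ rr)) ⟩
              (Pl ++ Dl) ++ (Pr ++ Dr) ≡⟨ Lₚ.++-assoc Pl Dl (Pr ++ Dr) ⟩
              Pl ++ (Dl ++ (Pr ++ Dr)) ↭⟨ ↭ₚ.++⁺ˡ Pl (↭ₚ.shifts Dl Pr) ⟩
              Pl ++ (Pr ++ (Dl ++ Dr)) ≡⟨ sym (Lₚ.++-assoc Pl Pr (Dl ++ Dr)) ⟩
              (Pl ++ Pr) ++ (Dl ++ Dr) ≡⟨ cong₂ _++_ (sym (Lₚ.concatMap-++ _ (closed l) (closed r))) (sym (drops-++ (leaves l) (leaves r))) ⟩
              pairs (closed l ++ closed r) ++ drops (leaves l ++ leaves r) ∎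
              where open Data.List.Relation.Binary.Permutation.Propositional.PermutationReasoning

          forest-cut : ∀ t → (∀ {v b} → (v , b) ∈ closed t → Paired b) → length (keep (pend t)) ≤ 2 →
            ∃[ F ] (Cut t (shape (keep (pend t))) F × F ↭ pairs (closed t) ++ drops (leaves t))
          forest-cut (leaf v) _ _ with kept v
          ... | true  = [] , leafC , ↭-refl
          ... | false = lf v ∷ [] , cutC leafC , ↭-refl
          forest-cut (node v l r) pr le with s ≤ᵇ length (pend l ++ pend r)
          ... | false = forest-node v l r (λ i → pr (∈ₚ.∈-++⁺ˡ i)) (λ i → pr (∈ₚ.∈-++⁺ʳ (closed l) i)) le
          ... | true = close (keep (pend l ++ pend r)) (proj₂ (pr (here refl)))
              (forest-node v l r (λ i → pr (there (∈ₚ.∈-++⁺ˡ i))) (λ i → pr (there (∈ₚ.∈-++⁺ʳ (closed l) i))) (proj₁ (pr (here refl))))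
            where
            close : ∀ K {P D : List (Shape {m})} → length K ≢ 1 → ∃[ F ] (Cut (node v l r) (shape K) F × F ↭ P ++ D) →
              ∃[ F ] (Cut (node v l r) nothing F × F ↭ (shapes K ++ P) ++ D)
            close [] ne h = h
            close (x ∷ []) ne h = ⊥-elim (ne refl)
            close (x ∷ y ∷ K) ne (F , h , p) = _ , cutC h , prep _ p

  module _ {m : ℕ} where

    pick-≤ : ∀ {B : Set} (w : B → ℕ) (c : Fin m) M (Bs : List (Fin m × B)) → Unique (map proj₁ Bs) → (∀ {vb} → vb ∈ Bs → w (proj₂ vb) ≤ M) →
      ∑[ vb ∈ Bs ] (w (proj₂ vb) * 𝟙 ⌊ proj₁ vb ≟ c ⌋) ≤ M
    pick-≤ w c M [] u h = z≤n
    pick-≤ w c M ((v , b) ∷ Bs) u h with v ≟ c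
    ... | no _ = subst (λ z → z + ∑[ vb ∈ Bs ] (w (proj₂ vb) * 𝟙 ⌊ proj₁ vb ≟ c ⌋) ≤ M) (sym (ℕₚ.*-zeroʳ (w b))) (pick-≤ w c M Bs (Unique-tail u) (λ i → h (there i)))
    ... | yes refl = subst (_≤ M) (sym (trans (cong₂ _+_ (ℕₚ.*-identityʳ (w b)) (∑-zero _ Bs none)) (ℕₚ.+-identityʳ (w b)))) (h (here refl))
      where
      none : ∀ vb → vb ∈ Bs → w (proj₂ vb) * 𝟙 ⌊ proj₁ vb ≟ v ⌋ ≡ 0
      none (v′ , b′) i = trans (cong (λ z → w b′ * 𝟙 z) (¬does⇒ (v′ ≟ v) (λ { refl → Unique-head u (∈ₚ.∈-map⁺ proj₁ i) }))) (ℕₚ.*-zeroʳ (w b′))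

  record LabTree (n : ℕ) (r : Fin (V n)) (t : Tree {V n}) : Set where
    field
      lab   : Labelled n r t
      below : Below n t
    open Labelled lab public

  module Blocks {n : ℕ} (s : ℕ) (1<s : 1 < s) {r : Fin (V n)} (r₀ : toℕ r ≡ 0) (t : Tree {V n}) (LT : LabTree n r t) where

    open LabTree LT

    private m = V n

    colour : Fin m → Fin m
    colour = assoc (cols s r t) r

    allBlocks : List (Fin m × List (Fin m))
    allBlocks = (r , pend s t) ∷ closed s t

    private
      f = colour
      u-cols : Unique (map proj₁ (cols s r t))
      u-cols = subst Unique (sym (cols-verts s r t)) (Unique-tail uniq)

    colour-root : colour r ≡ r
    colour-root = assoc-∉ (cols s r t) r (λ i → Unique-head uniq (subst (r ∈_) (cols-verts s r t) i))

    colour-block : ∀ {v b x} → (v , b) ∈ allBlocks → x ∈ b → colour x ≡ v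
    colour-block (here refl) j = assoc-∈ (cols s r t) r u-cols (cols-pend s r t j)
    colour-block (there i) j = assoc-∈ (cols s r t) r u-cols (cols-closed s r t i j)

    blocks↭ : leaves t ↭ concatMap proj₂ allBlocks
    blocks↭ = blocks-leaves s t

    ids-unique : Unique (map proj₁ allBlocks)
    ids-unique = Unique-∷ (λ i → ℕₚ.<⇒≱ (proj₂ (closed-id s t above i)) (subst (_≤ n) (sym r₀) z≤n)) (closed-unique s t above (Unique-tail uniq))

    block-of : ∀ {x} → x ∈ leaves t → ∃[ b ] ((colour x , b) ∈ allBlocks × x ∈ b)
    block-of {x} i with ∈ₚ.∈-concat⁻′ (map proj₂ allBlocks) (↭ₚ.∈-resp-↭ blocks↭ i)
    ... | b , x∈b , b∈ with ∈ₚ.∈-map⁻ proj₂ b∈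
    ...   | (v , _) , vb∈ , refl = b , subst (λ z → (z , b) ∈ allBlocks) (sym (colour-block vb∈ x∈b)) vb∈ , x∈b

    block-∋ : ∀ {v b x} → (v , b) ∈ allBlocks → x ∈ leaves t → colour x ≡ v → x ∈ b
    block-∋ vb i refl with block-of i
    ... | b′ , vb′ , x∈ = subst (_ ∈_) (functional ids-unique vb′ vb) x∈

    ∑-blocks : ∀ (φ : Fin m → ℕ) → ∑ (leaves t) φ ≡ ∑[ vb ∈ allBlocks ] ∑ (proj₂ vb) φ
    ∑-blocks φ = trans (∑-↭ φ blocks↭) (∑-concatMap proj₂ φ allBlocks)

    row : ∀ c → ∑[ y ∈ leaves t ] 𝟙 ⌊ colour y ≟ c ⌋ ≤ 2 * s
    row c = subst (_≤ 2 * s) (sym eq) (pick-≤ length c (2 * s) allBlocks ids-unique size)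
      where
      eq : ∑[ y ∈ leaves t ] 𝟙 ⌊ colour y ≟ c ⌋ ≡ ∑[ vb ∈ allBlocks ] (length (proj₂ vb) * 𝟙 ⌊ proj₁ vb ≟ c ⌋)
      eq = trans (∑-blocks (λ y → 𝟙 ⌊ colour y ≟ c ⌋)) (∑-cong allBlocks (λ vb i → trans
        (∑-cong (proj₂ vb) (λ y j → cong (λ z → 𝟙 ⌊ z ≟ c ⌋) (colour-block i j))) (∑-const (𝟙 ⌊ proj₁ vb ≟ c ⌋) (proj₂ vb))))
      size : ∀ {vb} → vb ∈ allBlocks → length (proj₂ vb) ≤ 2 * s
      size (here refl) = ℕₚ.≤-trans (ℕₚ.<⇒≤ (pend-length s 1<s t)) (ℕₚ.m≤m+n s _)
      size (there i) = proj₂ (closed-size s 1<s t i)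

    good : Fin m → Fin m → Bool
    good x y = ⌊ colour x ≟ colour y ⌋ ∧ not ⌊ colour x ≟ r ⌋

    closed-total : ∑[ vb ∈ closed s t ] length (proj₂ vb) + length (pend s t) ≡ length (leaves t)
    closed-total = trans (ℕₚ.+-comm _ (length (pend s t))) (sym (trans (lem (leaves t)) (trans (∑-blocks (λ _ → 1)) (∑-cong allBlocks (λ vb _ → sym (lem (proj₂ vb)))))))
      where
      lem : ∀ {A : Set} (xs : List A) → length xs ≡ ∑[ x ∈ xs ] 1
      lem xs = sym (trans (∑-const 1 xs) (ℕₚ.*-identityʳ _))

    good-total : s * length (leaves t) ≤ ∑[ x ∈ leaves t ] ∑[ y ∈ leaves t ] 𝟙 (good x y) + s * s
    good-total = begin
      s * length (leaves t) ≡⟨ cong (s *_) (sym closed-total) ⟩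
      s * (∑[ vb ∈ closed s t ] length (proj₂ vb) + length (pend s t)) ≡⟨ ℕₚ.*-distribˡ-+ s _ _ ⟩
      s * ∑[ vb ∈ closed s t ] length (proj₂ vb) + s * length (pend s t) ≤⟨ ℕₚ.+-mono-≤ main (ℕₚ.*-monoʳ-≤ s (ℕₚ.<⇒≤ (pend-length s 1<s t))) ⟩
      ∑[ x ∈ leaves t ] ∑[ y ∈ leaves t ] 𝟙 (good x y) + s * s ∎
      where
      open ℕₚ.≤-Reasoning
      cnt : Fin m → ℕ
      cnt x = ∑[ y ∈ leaves t ] 𝟙 (good x y)
      big : ∀ {v b x} → (v , b) ∈ closed s t → x ∈ b → s ≤ cnt x
      big {v} {b} {x} i j = begin
        s ≤⟨ proj₁ (closed-size s 1<s t i) ⟩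
        length b ≡⟨ sym (trans (∑-const 1 b) (ℕₚ.*-identityʳ _)) ⟩
        ∑[ y ∈ b ] 1 ≡⟨ ∑-cong b (λ y k → sym (cong₂ (λ a c → 𝟙 (a ∧ not c)) (⇒does (colour x ≟ colour y) (trans fx (sym (colour-block (there i) k)))) (¬does⇒ (colour x ≟ r) (λ e → v≢r (trans (sym fx) e))))) ⟩
        ∑[ y ∈ b ] 𝟙 (good x y) ≤⟨ ∑-term (λ vb → ∑ (proj₂ vb) (λ y → 𝟙 (good x y))) {allBlocks} (there i) ⟩
        ∑[ vb ∈ allBlocks ] ∑[ y ∈ proj₂ vb ] 𝟙 (good x y) ≡⟨ sym (∑-blocks (λ y → 𝟙 (good x y))) ⟩
        cnt x ∎
        where
        fx = colour-block (there i) j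
        v≢r : v ≢ r
        v≢r refl = Unique-head ids-unique (∈ₚ.∈-map⁺ proj₁ i)
      main : s * ∑[ vb ∈ closed s t ] length (proj₂ vb) ≤ ∑ (leaves t) cnt
      main = begin
        s * ∑[ vb ∈ closed s t ] length (proj₂ vb) ≡⟨ sym (∑-*ˡ s (λ vb → length (proj₂ vb)) (closed s t)) ⟩
        ∑[ vb ∈ closed s t ] (s * length (proj₂ vb)) ≡⟨ ∑-cong (closed s t) (λ vb _ → trans (ℕₚ.*-comm s _) (sym (∑-const s (proj₂ vb)))) ⟩
        ∑[ vb ∈ closed s t ] ∑[ x ∈ proj₂ vb ] s ≤⟨ ∑-mono (closed s t) (λ vb i → ∑-mono (proj₂ vb) (λ x j → big i j)) ⟩
        ∑[ vb ∈ closed s t ] ∑ (proj₂ vb) cnt ≤⟨ ℕₚ.m≤n+m _ (∑ (pend s t) cnt) ⟩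
        ∑[ vb ∈ allBlocks ] ∑ (proj₂ vb) cnt ≡⟨ sym (∑-blocks cnt) ⟩
        ∑ (leaves t) cnt ∎

    colour-bc : ∀ {G} → Rep G (edges r t) → s * bc G colour ≤ 2 * length (leaves t)
    colour-bc {G} rp = begin
      s * bc G colour ≡⟨ cong (s *_) (W-list (wt colour) (edges-simple r t uniq) (edges-loopless r t uniq) rp) ⟩
      s * ∑[ e ∈ E ] (w (proj₁ e) (proj₂ e) + w (proj₂ e) (proj₁ e)) ≡⟨ cong (s *_) (∑-cong E (λ e _ → trans (cong (w (proj₁ e) (proj₂ e) +_) (wt-sym colour (proj₂ e) (proj₁ e))) (sym (cong (w (proj₁ e) (proj₂ e) +_) (ℕₚ.+-identityʳ _))))) ⟩
      s * ∑[ e ∈ E ] (2 * w (proj₁ e) (proj₂ e)) ≡⟨ cong (s *_) (∑-*ˡ 2 (λ e → w (proj₁ e) (proj₂ e)) E) ⟩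
      s * (2 * ∑[ e ∈ E ] w (proj₁ e) (proj₂ e)) ≤⟨ ℕₚ.*-monoʳ-≤ s (ℕₚ.*-monoʳ-≤ 2 (edges-closed s colour r r t colour-root (assoc-∈ (cols s r t) r u-cols))) ⟩
      s * (2 * length (closed s t)) ≡⟨ lem s (length (closed s t)) ⟩
      2 * (length (closed s t) * s) ≡⟨ cong (2 *_) (sym (∑-const s (closed s t))) ⟩
      2 * ∑[ vb ∈ closed s t ] s ≤⟨ ℕₚ.*-monoʳ-≤ 2 (∑-mono (closed s t) (λ vb i → proj₁ (closed-size s 1<s t i))) ⟩
      2 * ∑[ vb ∈ closed s t ] length (proj₂ vb) ≤⟨ ℕₚ.*-monoʳ-≤ 2 (subst (∑[ vb ∈ closed s t ] length (proj₂ vb) ≤_) closed-total (ℕₚ.m≤m+n (∑[ vb ∈ closed s t ] length (proj₂ vb)) (length (pend s t)))) ⟩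
      2 * length (leaves t) ∎
      where
      open ℕₚ.≤-Reasoning
      E = edges r t
      w = wt colour
      lem : ∀ a b → a * (2 * b) ≡ 2 * (b * a)
      lem = solve-∀

    module _ (Q : List (Fin m × Fin m))
      (q-lt  : ∀ {x y} → (x , y) ∈ Q → toℕ x < toℕ y)
      (q-∈   : ∀ {x y} → (x , y) ∈ Q → x ∈ leaves t × y ∈ leaves t)
      (q-col : ∀ {x y} → (x , y) ∈ Q → colour x ≡ colour y × colour x ≢ r)
      (q-dis : AllPairs (λ q q′ → colour (proj₁ q) ≢ colour (proj₁ q′)) Q) where

      kept : Fin m → Bool
      kept z = any (λ q → ⌊ z ≟ proj₁ q ⌋ ∨ ⌊ z ≟ proj₂ q ⌋) Q

      toCherry : Fin m × Fin m → Shape {m}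
      toCherry (x , y) = nd (lf x) (lf y)

      private
        ofColour : Fin m → List (Fin m × Fin m)
        ofColour v = filterᵇ (λ q → ⌊ colour (proj₁ q) ≟ v ⌋) Q

        kept⇒ : ∀ {z} → kept z ≡ true → ∃[ q ] (q ∈ Q × (z ≡ proj₁ q ⊎ z ≡ proj₂ q))
        kept⇒ {z} e with any-elim Q e
        ... | (x , y) , i , h = (x , y) , i , ⊎-map (does⇒ (z ≟ x)) (does⇒ (z ≟ y)) (∨-split h)

        kept-col : ∀ {z q} → q ∈ Q → z ≡ proj₁ q ⊎ z ≡ proj₂ q → colour z ≡ colour (proj₁ q)
        kept-col i (inj₁ refl) = refl
        kept-col i (inj₂ refl) = sym (proj₁ (q-col i))

        kept-1 : ∀ {x y} → (x , y) ∈ Q → kept x ≡ true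
        kept-1 {x} {y} i = any-intro i (cong (_∨ ⌊ x ≟ y ⌋) (⇒does (x ≟ x) refl))

        kept-2 : ∀ {x y} → (x , y) ∈ Q → kept y ≡ true
        kept-2 {x} {y} i = any-intro i (∨-introʳ {⌊ y ≟ x ⌋} (⇒does (y ≟ y) refl))

        leaves-u : Unique (leaves t)
        leaves-u = leaves-unique t (Unique-tail uniq)

        two-list : ∀ {A : Set} {xs : List A} {x y} → xs ↭ x ∷ y ∷ [] → xs ≡ x ∷ y ∷ [] ⊎ xs ≡ y ∷ x ∷ []
        two-list {xs = xs} p = go xs p (↭ₚ.↭-length p)
          where
          go : ∀ {A : Set} (xs : List A) {x y} → xs ↭ x ∷ y ∷ [] → length xs ≡ 2 → xs ≡ x ∷ y ∷ [] ⊎ xs ≡ y ∷ x ∷ []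
          go (a ∷ b ∷ []) p _ with ↭ₚ.∈-resp-↭ p (here refl)
          ... | here refl = inj₁ (cong (a ∷_) (↭ₚ.↭-singleton-inv (↭ₚ.drop-∷ p)))
          ... | there (here refl) = inj₂ (cong (a ∷_) (↭ₚ.↭-singleton-inv (↭ₚ.drop-∷ (↭-trans p (swap _ _ ↭-refl)))))

        cherry-lt : ∀ {x y} → toℕ x < toℕ y → cherry s kept x y ≡ toCherry (x , y)
        cherry-lt {x} {y} lt with toℕ x <ᵇ toℕ y in eq
        ... | true  = refl
        ... | false = ⊥-elim (true≢false (≤ᵇ-true lt) eq)

        cherry-gt : ∀ {x y} → toℕ x < toℕ y → cherry s kept y x ≡ toCherry (x , y)
        cherry-gt {x} {y} lt with toℕ y <ᵇ toℕ x in eq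
        ... | false = refl
        ... | true  = ⊥-elim (ℕₚ.<-asym lt (≤ᵇ-elim eq))

        ofColour-cases : ∀ v → ofColour v ≡ [] ⊎ ∃[ q ] (q ∈ Q × colour (proj₁ q) ≡ v × ofColour v ≡ q ∷ [])
        ofColour-cases v with ofColour v in eq
        ... | [] = inj₁ refl
        ... | q ∷ [] = let (i , e) = ∈-filter⁻ _ Q (subst (q ∈_) (sym eq) (here refl)) in inj₂ (q , i , does⇒ (colour (proj₁ q) ≟ v) e , refl)
        ... | q ∷ q′ ∷ rest with subst (AllPairs _) eq (APₚ.filter⁺ (λ x → Data.Bool.T? ⌊ colour (proj₁ x) ≟ v ⌋) q-dis)
        ...   | (ne ∷ _) ∷ _ = ⊥-elim (ne (trans (c (here refl)) (sym (c (there (here refl))))))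
          where
          c : ∀ {p} → p ∈ q ∷ q′ ∷ rest → colour (proj₁ p) ≡ v
          c {p} i = does⇒ (colour (proj₁ p) ≟ v) (proj₂ (∈-filter⁻ (λ q → ⌊ colour (proj₁ q) ≟ v ⌋) Q (subst (p ∈_) (sym eq) i)))

        block-shape : ∀ {v b} → (v , b) ∈ closed s t → shapes s kept (keep s kept b) ≡ map toCherry (ofColour v) × Paired s kept b
        block-shape {v} {b} vb with ofColour-cases v
        ... | inj₁ none = subst (λ K → shapes s kept K ≡ map toCherry (ofColour v) × (length K ≤ 2 × length K ≢ 1)) (sym empty) (cong (map toCherry) (sym none) , z≤n , λ ())
          where
          empty : keep s kept b ≡ []
          empty with keep s kept b in eq
          ... | [] = refl
          ... | z ∷ zs with ∈-filter⁻ kept b (subst (z ∈_) (sym eq) (here refl))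
          ...   | z∈ , kz with kept⇒ kz
          ...     | q , q∈ , zq = ⊥-elim (nomem (subst (q ∈_) none (∈-filter⁺ (λ q → ⌊ colour (proj₁ q) ≟ v ⌋) q∈ (⇒does (colour (proj₁ q) ≟ v) (trans (sym (kept-col q∈ zq)) (colour-block (there vb) z∈))))))
            where
            nomem : ∀ {p : Fin m × Fin m} → p ∈ [] → ⊥
            nomem ()
        ... | inj₂ ((x , y) , q∈ , qv , one) = done′ (two-list perm)
          where
          x∈b : x ∈ b
          x∈b = block-∋ (there vb) (proj₁ (q-∈ q∈)) qv
          y∈b : y ∈ b
          y∈b = block-∋ (there vb) (proj₂ (q-∈ q∈)) (trans (sym (proj₁ (q-col q∈))) qv)
          b-u : Unique b
          b-u = sub (there vb)
            where
            sub : ∀ {v b} → (v , b) ∈ allBlocks → Unique b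
            sub i = go allBlocks (Unique-↭ blocks↭ leaves-u) i
              where
              go : ∀ Bs → Unique (concatMap proj₂ Bs) → ∀ {v b} → (v , b) ∈ Bs → Unique b
              go ((_ , b) ∷ Bs) u (here refl) = proj₁ (Unique-++⁻ b u)
              go ((_ , b) ∷ Bs) u (there i) = go Bs (proj₁ (proj₂ (Unique-++⁻ b u))) i
          perm : keep s kept b ↭ x ∷ y ∷ []
          perm = unique-set-↭ (Unique-filter kept b-u) (Unique-∷ (λ { (here e) → ℕₚ.<⇒≢ (q-lt q∈) (cong toℕ e) }) ([] ∷ [])) f₁ f₂
            where
            f₁ : ∀ {z} → z ∈ keep s kept b → z ∈ x ∷ y ∷ []
            f₁ {z} i with ∈-filter⁻ kept b i
            ... | z∈ , kz with kept⇒ kz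
            ...   | q′ , q′∈ , zq with subst (q′ ∈_) one (∈-filter⁺ (λ q → ⌊ colour (proj₁ q) ≟ v ⌋) q′∈ (⇒does (colour (proj₁ q′) ≟ v) (trans (sym (kept-col q′∈ zq)) (colour-block (there vb) z∈))))
            ...     | here refl = [ here , (λ e → there (here e)) ]′ zq
            f₂ : ∀ {z} → z ∈ x ∷ y ∷ [] → z ∈ keep s kept b
            f₂ (here refl) = ∈-filter⁺ kept x∈b (kept-1 q∈)
            f₂ (there (here refl)) = ∈-filter⁺ kept y∈b (kept-2 q∈)
          goal : List (Fin m) → Set
          goal K = shapes s kept K ≡ map toCherry (ofColour v) × (length K ≤ 2 × length K ≢ 1)
          done′ : keep s kept b ≡ x ∷ y ∷ [] ⊎ keep s kept b ≡ y ∷ x ∷ [] → goal (keep s kept b)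
          done′ (inj₁ e) = subst goal (sym e) (trans (cong (_∷ []) (cherry-lt (q-lt q∈))) (cong (map toCherry) (sym one)) , ℕₚ.≤-refl , λ ())
          done′ (inj₂ e) = subst goal (sym e) (trans (cong (_∷ []) (cherry-gt (q-lt q∈))) (cong (map toCherry) (sym one)) , ℕₚ.≤-refl , λ ())

        pend-none : keep s kept (pend s t) ≡ []
        pend-none with keep s kept (pend s t) in eq
        ... | [] = refl
        ... | z ∷ zs with ∈-filter⁻ kept (pend s t) (subst (z ∈_) (sym eq) (here refl))
        ...   | z∈ , kz with kept⇒ kz
        ...     | q , q∈ , zq = ⊥-elim (proj₂ (q-col q∈) (trans (sym (kept-col q∈ zq)) (colour-block (here refl) z∈)))

        grouped : ∀ (Cs : List (Fin m × List (Fin m))) → Unique (map proj₁ Cs) →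
          Unique (concatMap (λ vb → ofColour (proj₁ vb)) Cs) × (∀ {q} → q ∈ concatMap (λ vb → ofColour (proj₁ vb)) Cs → q ∈ Q × colour (proj₁ q) ∈ map proj₁ Cs)
        grouped [] u = [] , λ ()
        grouped ((v , b) ∷ Cs) u with grouped Cs (Unique-tail u)
        ... | u′ , h = Unique-++ (ofColour v) (Unique-filter _ Q-u) u′ (λ i j → Unique-head u (subst (_∈ map proj₁ Cs) (isv i) (proj₂ (h j)))) , mem
          where
          isv : ∀ {q} → q ∈ ofColour v → colour (proj₁ q) ≡ v
          isv {q} i = does⇒ (colour (proj₁ q) ≟ v) (proj₂ (∈-filter⁻ _ Q i))
          Q-u : Unique Q
          Q-u = Data.List.Relation.Unary.AllPairs.map (λ ne e → ne (cong (λ q → colour (proj₁ q)) e)) q-dis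
          mem : ∀ {q} → q ∈ ofColour v ++ concatMap (λ vb → ofColour (proj₁ vb)) Cs → q ∈ Q × colour (proj₁ q) ∈ v ∷ map proj₁ Cs
          mem i with ∈ₚ.∈-++⁻ (ofColour v) i
          ... | inj₁ j = proj₁ (∈-filter⁻ _ Q j) , here (isv j)
          ... | inj₂ j = let (a , c) = h j in a , there c

        group↭ : concatMap (λ vb → ofColour (proj₁ vb)) (closed s t) ↭ Q
        group↭ with grouped (closed s t) (Unique-tail ids-unique)
        ... | u , h = unique-set-↭ u (Data.List.Relation.Unary.AllPairs.map (λ ne e → ne (cong (λ q → colour (proj₁ q)) e)) q-dis) (λ i → proj₁ (h i)) back
          where
          back : ∀ {q} → q ∈ Q → q ∈ concatMap (λ vb → ofColour (proj₁ vb)) (closed s t)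
          back {q} i with block-of (proj₁ (q-∈ i))
          ... | b , here e , _ = ⊥-elim (proj₂ (q-col i) (cong proj₁ e))
          ... | b , there vb , _ = ∈ₚ.∈-concatMap⁺ (λ vb → ofColour (proj₁ vb)) (Any-map (λ { refl → ∈-filter⁺ _ i (⇒does (colour (proj₁ q) ≟ colour (proj₁ q)) refl) }) vb)

        concatMap-cong : ∀ {A B : Set} {g h : A → List B} xs → (∀ x → x ∈ xs → g x ≡ h x) → concatMap g xs ≡ concatMap h xs
        concatMap-cong [] e = refl
        concatMap-cong (x ∷ xs) e = cong₂ _++_ (e x (here refl)) (concatMap-cong xs (λ y i → e y (there i)))

      pairs-forest : ∃[ F ] (Cut t nothing F × F ↭ map toCherry Q ++ drops s kept (leaves t))
      pairs-forest with forest-cut s kept t (λ i → proj₂ (block-shape i)) (subst (λ K → length K ≤ 2) (sym pend-none) z≤n)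
      ... | F , h , p = F , subst (λ K → Cut t (shape s kept K) F) pend-none h , ↭-trans p (↭ₚ.++⁺ʳ (drops s kept (leaves t))
        (↭-trans (↭-reflexive (trans (concatMap-cong (closed s t) (λ vb i → proj₁ (block-shape i))) (sym (Lₚ.map-concatMap toCherry (λ vb → ofColour (proj₁ vb)) (closed s t))))) (↭ₚ.map⁺ toCherry group↭)))

  module _ {m : ℕ} where

    data Eqv : Tree {m} → Tree {m} → Set where
      eleaf : ∀ {v} → Eqv (leaf v) (leaf v)
      enode : ∀ {v l r l′ r′} → Eqv l l′ → Eqv r r′ → Eqv (node v l r) (node v l′ r′)
      eswap : ∀ {v l r l′ r′} → Eqv l r′ → Eqv r l′ → Eqv (node v l r) (node v l′ r′)

    mapT : (Fin m → Fin m) → Tree {m} → Tree {m}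
    mapT τ (leaf v)     = leaf (τ v)
    mapT τ (node v l r) = node (τ v) (mapT τ l) (mapT τ r)

    module _ (s : ℕ) where

      Eqv-pend : ∀ {t t′} → Eqv t t′ → pend s t ↭ pend s t′
      pend-both : ∀ {v l r l′ r′} → pend s l ++ pend s r ↭ pend s l′ ++ pend s r′ → pend s (node v l r) ↭ pend s (node v l′ r′)
      pend-both {v} {l} {r} {l′} {r′} p with s ≤ᵇ length (pend s l ++ pend s r) | s ≤ᵇ length (pend s l′ ++ pend s r′) | cong (s ≤ᵇ_) (↭ₚ.↭-length p)
      ... | true  | true  | _ = ↭-refl
      ... | false | false | _ = p
      Eqv-pend eleaf = ↭-refl
      Eqv-pend (enode {v} {l} {r} {l′} {r′} a b) = pend-both {v} {l} {r} {l′} {r′} (↭ₚ.++⁺ (Eqv-pend a) (Eqv-pend b))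
      Eqv-pend (eswap {v} {l} {r} {l′} {r′} a b) = pend-both {v} {l} {r} {l′} {r′} (↭-trans (↭ₚ.++⁺ (Eqv-pend a) (Eqv-pend b)) (↭ₚ.++-comm (pend s r′) (pend s l′)))

      private
        closeᵇ : Tree {m} → Tree {m} → Bool
        closeᵇ l r = s ≤ᵇ length (pend s l ++ pend s r)

      Eqv-cols : ∀ γ {t t′} → Eqv t t′ → cols s γ t ↭ cols s γ t′
      Eqv-cols γ eleaf = ↭-refl
      Eqv-cols γ (enode {v} {l} {r} {l′} {r′} a b) = subst (λ c → (v , γ₁) ∷ cols s γ₁ l ++ cols s γ₁ r ↭ (v , c) ∷ cols s c l′ ++ cols s c r′) eq
        (prep _ (↭ₚ.++⁺ (Eqv-cols γ₁ a) (Eqv-cols γ₁ b)))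
        where
        γ₁ = if closeᵇ l r then v else γ
        eq : γ₁ ≡ (if closeᵇ l′ r′ then v else γ)
        eq = cong (λ z → if s ≤ᵇ z then v else γ) (↭ₚ.↭-length (↭ₚ.++⁺ (Eqv-pend a) (Eqv-pend b)))
      Eqv-cols γ (eswap {v} {l} {r} {l′} {r′} a b) = subst (λ c → (v , γ₁) ∷ cols s γ₁ l ++ cols s γ₁ r ↭ (v , c) ∷ cols s c l′ ++ cols s c r′) eq
        (prep _ (↭-trans (↭ₚ.++⁺ (Eqv-cols γ₁ a) (Eqv-cols γ₁ b)) (↭ₚ.++-comm (cols s γ₁ r′) (cols s γ₁ l′))))
        where
        γ₁ = if closeᵇ l r then v else γ
        eq : γ₁ ≡ (if closeᵇ l′ r′ then v else γ)
        eq = cong (λ z → if s ≤ᵇ z then v else γ) (↭ₚ.↭-length (↭-trans (↭ₚ.++⁺ (Eqv-pend a) (Eqv-pend b)) (↭ₚ.++-comm (pend s r′) (pend s l′))))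

      module _ (τ : Fin m → Fin m) where

        mapT-pend : ∀ t → pend s (mapT τ t) ≡ map τ (pend s t)
        mapT-both : ∀ l r → pend s (mapT τ l) ++ pend s (mapT τ r) ≡ map τ (pend s l ++ pend s r)
        mapT-both l r = trans (cong₂ _++_ (mapT-pend l) (mapT-pend r)) (sym (Lₚ.map-++ τ (pend s l) (pend s r)))
        mapT-len : ∀ l r → length (pend s (mapT τ l) ++ pend s (mapT τ r)) ≡ length (pend s l ++ pend s r)
        mapT-len l r = trans (cong length (mapT-both l r)) (Lₚ.length-map τ (pend s l ++ pend s r))
        mapT-pend (leaf v) = refl
        mapT-pend (node v l r) = trans (cong₂ (λ a b → if s ≤ᵇ a then [] else b) (mapT-len l r) (mapT-both l r)) (lem (s ≤ᵇ length (pend s l ++ pend s r)))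
          where
          lem : ∀ b {xs} → (if b then [] else map τ xs) ≡ map τ (if b then [] else xs)
          lem true  = refl
          lem false = refl

        mapT-cols : ∀ γ t {x c} → (x , c) ∈ cols s γ t → (τ x , τ c) ∈ cols s (τ γ) (mapT τ t)
        mapT-cols γ (leaf v) (here refl) = here refl
        mapT-cols γ (node v l r) {x} {c} i = subst (λ z → (τ x , τ c) ∈ (τ v , z) ∷ cols s z (mapT τ l) ++ cols s z (mapT τ r)) eq (go i)
          where
          γ₁ = if closeᵇ l r then v else γ
          lem : ∀ b → τ (if b then v else γ) ≡ (if b then τ v else τ γ)
          lem true  = refl
          lem false = refl
          eq : τ γ₁ ≡ (if closeᵇ (mapT τ l) (mapT τ r) then τ v else τ γ)
          eq = trans (lem (closeᵇ l r)) (cong (λ z → if s ≤ᵇ z then τ v else τ γ) (sym (mapT-len l r)))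
          go : (x , c) ∈ (v , γ₁) ∷ cols s γ₁ l ++ cols s γ₁ r → (τ x , τ c) ∈ (τ v , τ γ₁) ∷ cols s (τ γ₁) (mapT τ l) ++ cols s (τ γ₁) (mapT τ r)
          go (here refl) = here refl
          go (there j) with ∈ₚ.∈-++⁻ (cols s γ₁ l) j
          ... | inj₁ a = there (∈ₚ.∈-++⁺ˡ (mapT-cols γ₁ l a))
          ... | inj₂ a = there (∈ₚ.∈-++⁺ʳ (cols s (τ γ₁) (mapT τ l)) (mapT-cols γ₁ r a))

  module _ {k : ℕ} where

    private
      n = suc k
      m = V n

    labelᵇ : Fin m → Bool
    labelᵇ i = (toℕ i ≤ᵇ n) ∧ not ⌊ i ≟ root ⌋

    abstract

      labels : List (Fin m)
      labels = filterᵇ labelᵇ (allFin m)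

      label⇒ : ∀ {i} → i ∈ labels → toℕ i ≤ n × i ≢ root
      label⇒ {i} h with ∧-split {toℕ i ≤ᵇ n} (proj₂ (∈-filter⁻ labelᵇ (allFin m) h))
      ... | a , b = ≤ᵇ-elim a , λ { refl → true≢false refl (trans (sym b) (cong not (⇒does (root {k} ≟ root) refl))) }

      ⇒label : ∀ {i} → toℕ i ≤ n → i ≢ root → i ∈ labels
      ⇒label {i} le ne = ∈-filter⁺ labelᵇ (∈-allFin i) (cong₂ (λ a b → a ∧ not b) (≤ᵇ-true le) (¬does⇒ (i ≟ root) ne))

      labels-unique : Unique labels
      labels-unique = Unique-filter labelᵇ (Uₚ.allFin⁺ m)

      labels-length : length labels ≡ n
      labels-length = ℕₚ.+-cancelʳ-≡ 1 _ _ (begin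
        length labels + 1 ≡⟨ cong₂ _+_ (length-filter labelᵇ (allFin m)) (sym (∑-δ {m} (λ _ → 1) root)) ⟩
        ∑[ i ∈ allFin m ] 𝟙 (labelᵇ i) + ∑[ i ∈ allFin m ] (𝟙 ⌊ root ≟ i ⌋ * 1) ≡⟨ sym (∑-+ (λ i → 𝟙 (labelᵇ i)) (λ i → 𝟙 ⌊ root ≟ i ⌋ * 1) (allFin m)) ⟩
        ∑[ i ∈ allFin m ] (𝟙 (labelᵇ i) + 𝟙 ⌊ root ≟ i ⌋ * 1) ≡⟨ ∑-cong {f = λ i → 𝟙 (labelᵇ i) + 𝟙 ⌊ root ≟ i ⌋ * 1} {g = λ i → 𝟙 (toℕ i ≤ᵇ n)} (allFin m) (λ i _ → pt i) ⟩
        ∑[ i ∈ allFin m ] 𝟙 (toℕ i ≤ᵇ n) ≡⟨ count-≤ᵇ n (s≤s (ℕₚ.m≤n+m (suc k) k)) ⟩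
        suc n ≡⟨ ℕₚ.+-comm 1 n ⟩
        n + 1 ∎)
        where
        open ≡-Reasoning
        pt : ∀ i → 𝟙 (labelᵇ i) + 𝟙 ⌊ root ≟ i ⌋ * 1 ≡ 𝟙 (toℕ i ≤ᵇ n)
        pt fzero = refl
        pt (fsuc i) with suc (toℕ i) ≤ᵇ n
        ... | true  = refl
        ... | false = refl

    Sub-above : ∀ {G p v t} → Sub {k} G p v t → Above n t × Below n t
    Sub-above (sleaf le _ _) = tt , le ∷ []
    Sub-above (snode lt _ _ _ _ _ _ _ sl sr) = let (a , b) = Sub-above sl ; (c , d) = Sub-above sr in (lt , a , c) , Allₚ.++⁺ b d

    labTree : ∀ {G} (T : TreeOf {k} G) → LabTree n root (TreeOf.tree T)
    labTree T = record { lab = record { uniq = uniq ; compl = compl ; above = proj₁ (Sub-above subt) } ; below = proj₂ (Sub-above subt) }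
      where open TreeOf T

    leaves↭labels : ∀ {t} → LabTree n root t → leaves t ↭ labels
    leaves↭labels {t} LT = unique-set-↭ (leaves-unique t (Unique-tail uniq)) labels-unique
      (λ i → ⇒label (All-lookup below i) (λ { refl → Unique-head uniq (leaves⊆verts t i) }))
      (λ {x} i → back (label⇒ i) (compl x))
      where
      open LabTree LT
      back : ∀ {x} → toℕ x ≤ n × x ≢ root → x ∈ root ∷ verts t → x ∈ leaves t
      back (le , ne) (here e) = ⊥-elim (ne e)
      back (le , ne) (there i) = verts-leaf t above i le

    IsTree⇒Sparse : ∀ {G} → IsTree {k} G → Sparse n G
    IsTree⇒Sparse {G} T = record
      { simp = record { symS = symm ; irrS = λ { {i} e refl → true≢false e (irr i) } }
      ; capped = λ i → capd i (ℕₚ.≤-<-connex (toℕ i) n) }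
      where
      open IsTree T
      capd : ∀ i → (toℕ i ≤ n) ⊎ (n < toℕ i) → deg G i ≤ cap n i
      capd i (inj₁ le) = ℕₚ.≤-reflexive (trans (degL i le) (cong (λ b → if b then 1 else 3) (sym (≤ᵇ-true le))))
      capd i (inj₂ lt) = ℕₚ.≤-reflexive (trans (degN i lt) (cong (λ b → if b then 1 else 3) (sym (≤ᵇ-false lt))))

    treeOf : ∀ G → isBinTree n G ≡ true → TreeOf {k} G
    treeOf G h = Extract.extract G (isBinTree⇒ G h)

    Sub-Eqv : ∀ {G p v t t′} → Sub {k} G p v t → Sub {k} G p v t′ → Eqv t t′
    Sub-Eqv (sleaf _ _ _) (sleaf _ _ _) = eleaf
    Sub-Eqv (sleaf le _ _) (snode lt _ _ _ _ _ _ _ _ _) = ⊥-elim (ℕₚ.<⇒≱ lt le)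
    Sub-Eqv (snode lt _ _ _ _ _ _ _ _ _) (sleaf le _ _) = ⊥-elim (ℕₚ.<⇒≱ lt le)
    Sub-Eqv (snode {a = a} {b} _ _ _ _ ab _ _ h sl sr) (snode {a = a′} {b′} _ _ ga gb ab′ pa pb _ sl′ sr′) with h a′ ga | h b′ gb
    ... | inj₁ e | _ = ⊥-elim (pa (sym e))
    ... | inj₂ _ | inj₁ e = ⊥-elim (pb (sym e))
    ... | inj₂ (inj₁ refl) | inj₂ (inj₁ refl) = ⊥-elim (ab′ refl)
    ... | inj₂ (inj₁ refl) | inj₂ (inj₂ refl) = enode (Sub-Eqv sl sl′) (Sub-Eqv sr sr′)
    ... | inj₂ (inj₂ refl) | inj₂ (inj₁ refl) = eswap (Sub-Eqv sl sr′) (Sub-Eqv sr sl′)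
    ... | inj₂ (inj₂ refl) | inj₂ (inj₂ refl) = ⊥-elim (ab′ refl)

    record LeafSwap (τ : Fin m → Fin m) : Set where
      field
        invol : ∀ i → τ (τ i) ≡ i
        leafy : ∀ {i} → toℕ i ≤ n → toℕ (τ i) ≤ n
        inner-fix : ∀ {i} → n < toℕ i → τ i ≡ i
        root-fix : τ root ≡ root

    module _ {τ : Fin m → Fin m} (LS : LeafSwap τ) where
      open LeafSwap LS

      label-τ : ∀ {x} → x ∈ labels → τ x ∈ labels
      label-τ {x} i = let (le , ne) = label⇒ i in ⇒label (leafy le) (λ e → ne (trans (sym (invol x)) (trans (cong τ e) root-fix)))

      Sub-map : ∀ {G H : Graph m} → (∀ i j → H i j ≡ G (τ i) (τ j)) → ∀ {p v t} → Sub {k} G p v t → Sub {k} H (τ p) (τ v) (mapT τ t)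
      Sub-map {G} {H} h = go
        where
        tr : ∀ {i j} → G i j ≡ true → H (τ i) (τ j) ≡ true
        tr {i} {j} e = trans (h (τ i) (τ j)) (trans (cong₂ G (invol i) (invol j)) e)
        rt : ∀ {i j} → H (τ i) j ≡ true → G i (τ j) ≡ true
        rt {i} {j} e = trans (cong (λ z → G z (τ j)) (sym (invol i))) (trans (sym (h (τ i) j)) e)
        inj : ∀ {i j} → i ≢ j → τ i ≢ τ j
        inj {i} {j} ne e = ne (trans (sym (invol i)) (trans (cong τ e) (invol j)))
        mv : ∀ {j i} → τ j ≡ i → j ≡ τ i
        mv {j} e = trans (sym (invol j)) (cong τ e)
        go : ∀ {p v t} → Sub {k} G p v t → Sub {k} H (τ p) (τ v) (mapT τ t)
        go (sleaf le g u) = sleaf (leafy le) (tr g) (λ j e → mv (u (τ j) (rt e)))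
        go (snode {v = v} lt gp ga gb ab pa pb u sl sr) = snode (subst (λ z → n < toℕ z) (sym (inner-fix lt)) lt) (tr gp) (tr ga) (tr gb) (inj ab) (inj pa) (inj pb)
          (λ j e → ⊎-map mv (⊎-map mv mv) (u (τ j) (rt e))) (go sl) (go sr)

    module Coloured (s : ℕ) (1<s : 1 < s) where

      treeColour : ∀ {G} → TreeOf {k} G → Fin m → Fin m
      treeColour T = Blocks.colour s 1<s refl (TreeOf.tree T) (labTree T)

      -- Junk value (constant colouring) on graphs that are not binary trees.
      colourDec : ∀ G → Dec (isBinTree n G ≡ true) → Fin m → Fin m
      colourDec G (yes h) = treeColour (treeOf G h)
      colourDec G (no _)  = λ _ → root

      abstract
       colourOf : Graph m → Fin m → Fin m
       colourOf G = colourDec G (isBinTree n G 𝔹ₚ.≟ true)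

       colourOf-tree : ∀ G → isBinTree n G ≡ true → ∃[ T ] (colourOf G ≡ treeColour {G} T)
       colourOf-tree G h = go (isBinTree n G 𝔹ₚ.≟ true)
         where
         go : (d : Dec (isBinTree n G ≡ true)) → ∃[ T ] (colourDec G d ≡ treeColour {G} T)
         go (yes p) = treeOf G p , refl
         go (no ¬p) = ⊥-elim (¬p h)

      module _ {τ} (LS : LeafSwap τ) where
        open LeafSwap LS

        treeColour-τ : ∀ {G H} → (∀ i j → H i j ≡ G (τ i) (τ j)) → (TG : TreeOf {k} G) (TH : TreeOf {k} H) →
          ∀ {x} → x ∈ labels → treeColour TH x ≡ treeColour TG (τ x)
        treeColour-τ {G} {H} h TG TH {x} x∈ = trans (cong (treeColour TH) (sym (invol x)))
          (trans (assoc-∈ (cols s root tH) root u-H (↭ₚ.∈-resp-↭ (Eqv-cols s root eqv) in-map)) fixed)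
          where
          module TG = TreeOf TG
          module TH = TreeOf TH
          module BG = Blocks s 1<s refl TG.tree (labTree TG)
          tG = TG.tree
          tH = TH.tree
          z = τ x
          u-H : Unique (map proj₁ (cols s root tH))
          u-H = subst Unique (sym (cols-verts s root tH)) (Unique-tail TH.uniq)
          u-G : Unique (map proj₁ (cols s root tG))
          u-G = subst Unique (sym (cols-verts s root tG)) (Unique-tail TG.uniq)
          tops : τ (top tG) ≡ top tH
          tops = TH.nbr₀ (τ (top tG)) (trans (h root (τ (top tG))) (trans (cong₂ G root-fix (invol (top tG))) (TG.symG (Sub-edge TG.subt (top-edge root tG)))))
          eqv : Eqv (mapT τ tG) tH
          eqv = Sub-Eqv (subst₂ (λ p v → Sub {k} H p v (mapT τ tG)) root-fix tops (Sub-map LS {G} {H} h TG.subt)) TH.subt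
          z∈ : z ∈ leaves tG
          z∈ = ↭ₚ.∈-resp-↭ (↭-sym (leaves↭labels (labTree TG))) (label-τ LS x∈)
          key : ∃[ c ] ((z , c) ∈ cols s root tG)
          key with ∈ₚ.∈-map⁻ proj₁ (subst (z ∈_) (sym (cols-verts s root tG)) (leaves⊆verts tG z∈))
          ... | (_ , c) , i , refl = c , i
          zc : (z , treeColour TG z) ∈ cols s root tG
          zc = subst (λ c → (z , c) ∈ cols s root tG) (sym (assoc-∈ (cols s root tG) root u-G (proj₂ key))) (proj₂ key)
          in-map : (τ z , τ (treeColour TG z)) ∈ cols s root (mapT τ tG)
          in-map = subst (λ q → (τ z , τ (treeColour TG z)) ∈ cols s q (mapT τ tG)) root-fix (mapT-cols s τ root tG zc)
          fixed : τ (treeColour TG z) ≡ treeColour TG z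
          fixed with BG.block-of z∈
          ... | b , here e , _ = trans (cong τ (cong proj₁ e)) (trans root-fix (sym (cong proj₁ e)))
          ... | b , there i , _ = inner-fix (proj₂ (closed-id s tG (LabTree.above (labTree TG)) (∈ₚ.∈-map⁺ proj₁ i)))

        colourOf-τ : ∀ {G H} → (∀ i j → H i j ≡ G (τ i) (τ j)) → isBinTree n G ≡ true → isBinTree n H ≡ true →
          ∀ {x} → x ∈ labels → colourOf H x ≡ colourOf G (τ x)
        colourOf-τ {G} {H} h tG tH x∈ with colourOf-tree G tG | colourOf-tree H tH
        ... | TG , eG | TH , eH = trans (cong (λ f → f _) eH) (trans (treeColour-τ h TG TH x∈) (cong (λ f → f _) (sym eG)))

      module _ {G : Graph m} (h : isBinTree n G ≡ true) where

        private
          T = proj₁ (colourOf-tree G h)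
          eq = proj₂ (colourOf-tree G h)
          LT = labTree T
          perm = leaves↭labels LT
          module B = Blocks s 1<s refl (TreeOf.tree T) LT

        goodOf : (f : Fin m → Fin m) → Fin m → Fin m → Bool
        goodOf f x y = ⌊ f x ≟ f y ⌋ ∧ not ⌊ f x ≟ root ⌋

        row-bound : ∀ c → ∑[ y ∈ labels ] 𝟙 ⌊ colourOf G y ≟ c ⌋ ≤ 2 * s
        row-bound c = subst (λ f → ∑[ y ∈ labels ] 𝟙 ⌊ f y ≟ c ⌋ ≤ 2 * s) (sym eq) (subst (_≤ 2 * s) (∑-↭ _ perm) (B.row c))

        good-bound : s * n ≤ ∑[ x ∈ labels ] ∑[ y ∈ labels ] 𝟙 (goodOf (colourOf G) x y) + s * s
        good-bound = subst (λ f → s * n ≤ ∑[ x ∈ labels ] ∑[ y ∈ labels ] 𝟙 (goodOf f x y) + s * s) (sym eq)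
          (subst₂ (λ a b → s * a ≤ b + s * s) (trans (↭ₚ.↭-length perm) labels-length)
            (trans (∑-cong (leaves (TreeOf.tree T)) (λ x _ → ∑-↭ (λ y → 𝟙 (B.good x y)) perm)) (∑-↭ (λ x → ∑[ y ∈ labels ] 𝟙 (B.good x y)) perm)) B.good-total)

        bc-bound : s * bc G (colourOf G) ≤ 2 * n
        bc-bound = subst (λ f → s * bc G f ≤ 2 * n) (sym eq)
          (subst (λ a → s * bc G B.colour ≤ 2 * a) (trans (↭ₚ.↭-length perm) labels-length) (B.colour-bc (TreeOf.rep T)))

      steps-lower : ∀ χ {j A B} → isBinTree n A ≡ true → isBinTree n B ≡ true → Steps n χ j A B →
        2 * n ≤ 2 + (bc A (colourOf A) + j * 2 + bc B (colourOf B)) + 2 * ∑[ x ∈ labels ] ∑[ y ∈ labels ] (𝟙 (not ⌊ x ≟ y ⌋) * 𝟙 (bothᵇ (colourOf A) (colourOf B) x y))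
      steps-lower χ {j} {A} {B} hA hB st with steps-bc n χ (colourOf A) (IsTree⇒Sparse (isBinTree⇒ A hA)) st
      ... | f , _ , agr , le = begin
        2 * n ≡⟨ cong (2 *_) (sym labels-length) ⟩
        2 * length labels ≤⟨ ℕₚ.*-monoʳ-≤ 2 (colour-count f g root t labels labels-unique inT) ⟩
        2 * (1 + c + P′) ≡⟨ l₁ c P′ ⟩
        2 + c * 2 + 2 * P′ ≤⟨ ℕₚ.+-monoˡ-≤ (2 * P′) (ℕₚ.+-monoʳ-≤ 2 (ℕₚ.≤-trans (cost-bc f g root t (TreeOf.uniq T) (TreeOf.rep T)) (ℕₚ.+-monoˡ-≤ (bc B g) le))) ⟩
        2 + (bc A (colourOf A) + j * 2 + bc B g) + 2 * P′ ≡⟨ cong (λ z → 2 + (bc A (colourOf A) + j * 2 + bc B g) + 2 * z) P≡ ⟩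
        2 + (bc A (colourOf A) + j * 2 + bc B g) + 2 * P ∎
        where
        open ℕₚ.≤-Reasoning
        g = colourOf B
        T = treeOf B hB
        t = TreeOf.tree T
        c = cost f g (edges root t)
        P′ = ∑[ x ∈ labels ] ∑[ y ∈ labels ] (𝟙 (not ⌊ x ≟ y ⌋) * 𝟙 (bothᵇ f g x y))
        P = ∑[ x ∈ labels ] ∑[ y ∈ labels ] (𝟙 (not ⌊ x ≟ y ⌋) * 𝟙 (bothᵇ (colourOf A) g x y))
        inT : ∀ {x} → x ∈ labels → x ∈ verts t
        inT i = leaves⊆verts t (↭ₚ.∈-resp-↭ (↭-sym (leaves↭labels (labTree T))) i)
        fA : ∀ {x} → x ∈ labels → f x ≡ colourOf A x
        fA i = agr _ (proj₁ (label⇒ i))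
        P≡ : P′ ≡ P
        P≡ = ∑-cong labels (λ x i → ∑-cong labels (λ y k → cong₂ (λ a b → 𝟙 (not ⌊ x ≟ y ⌋) * 𝟙 (⌊ a ≟ b ⌋ ∧ ⌊ g x ≟ g y ⌋)) (fA i) (fA k)))
        l₁ : ∀ c p → 2 * (1 + c + p) ≡ 2 + c * 2 + 2 * p
        l₁ = solve-∀

      PairList : Graph m → List (Fin m × Fin m) → Set
      PairList G Q = (∀ {x y} → (x , y) ∈ Q → colourOf G x ≡ colourOf G y × colourOf G x ≢ root)
        × AllPairs (λ q q′ → colourOf G (proj₁ q) ≢ colourOf G (proj₁ q′)) Q

      pairs-upper : ∀ χ {A B} → isBinTree n A ≡ true → isBinTree n B ≡ true → (Q : List (Fin m × Fin m)) →
        (∀ {x y} → (x , y) ∈ Q → toℕ x < toℕ y × x ∈ labels × y ∈ labels) → PairList A Q → PairList B Q →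
        ∃[ j ] (j + length Q ≤ n × Steps n χ j A B)
      pairs-upper χ {A} {B} hA hB Q lt pA pB = proj₁ res , bound , proj₂ (proj₂ res)
        where
        TA = proj₁ (colourOf-tree A hA)
        TB = proj₁ (colourOf-tree B hB)
        forest : ∀ {G} (T : TreeOf {k} G) → colourOf G ≡ treeColour T → PairList G Q →
          let module B = Blocks s 1<s refl (TreeOf.tree T) (labTree T) in
          ∃[ F ] (Cut (TreeOf.tree T) nothing F × F ↭ map (λ q → nd (lf (proj₁ q)) (lf (proj₂ q))) Q ++ map lf (filterᵇ (λ z → not (any (λ q → ⌊ z ≟ proj₁ q ⌋ ∨ ⌊ z ≟ proj₂ q ⌋) Q)) labels))
        forest {G} T e (c , d) with B.pairs-forest Q (λ i → proj₁ (lt i)) mem (subst (λ f → ∀ {x y} → (x , y) ∈ Q → f x ≡ f y × f x ≢ root) e c) (subst (λ f → AllPairs (λ q q′ → f (proj₁ q) ≢ f (proj₁ q′)) Q) e d)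
          where
          module B = Blocks s 1<s refl (TreeOf.tree T) (labTree T)
          mem : ∀ {x y} → (x , y) ∈ Q → x ∈ leaves (TreeOf.tree T) × y ∈ leaves (TreeOf.tree T)
          mem i = let (_ , a , b) = lt i ; p = ↭-sym (leaves↭labels (labTree T)) in ↭ₚ.∈-resp-↭ p a , ↭ₚ.∈-resp-↭ p b
        ... | F , h , p = F , h , ↭-trans p (↭ₚ.++⁺ˡ _ (↭ₚ.map⁺ lf (↭ₚ.filter-↭ _ (leaves↭labels (labTree T)))))
        rA = forest TA (proj₂ (colourOf-tree A hA)) pA
        rB = forest TB (proj₂ (colourOf-tree B hB)) pB
        FA = proj₁ rA
        FB = proj₁ rB
        res = agreement-bound n {root} refl χ (length FA) ℕₚ.≤-refl (proj₁ (proj₂ rA)) (proj₁ (proj₂ rB)) (↭-trans (proj₂ (proj₂ rA)) (↭-sym (proj₂ (proj₂ rB))))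
          (LabTree.lab (labTree TA)) (LabTree.lab (labTree TB)) (TreeOf.rep TA) (TreeOf.rep TB)
        keptᵇ : Fin m → Bool
        keptᵇ z = any (λ q → ⌊ z ≟ proj₁ q ⌋ ∨ ⌊ z ≟ proj₂ q ⌋) Q
        rest = filterᵇ (λ z → not (keptᵇ z)) labels
        ends : List (Fin m × Fin m) → List (Fin m)
        ends = concatMap (λ q → proj₁ q ∷ proj₂ q ∷ [])
        ends-length : ∀ Q → length (ends Q) ≡ length Q + length Q
        ends-length [] = refl
        ends-length (q ∷ Q) = cong suc (trans (cong suc (ends-length Q)) (sym (ℕₚ.+-suc (length Q) (length Q))))
        ends-∈ : ∀ Q {z} → z ∈ ends Q → ∃[ q ] (q ∈ Q × (z ≡ proj₁ q ⊎ z ≡ proj₂ q))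
        ends-∈ (q ∷ Q) (here e) = q , here refl , inj₁ e
        ends-∈ (q ∷ Q) (there (here e)) = q , here refl , inj₂ e
        ends-∈ (q ∷ Q) (there (there i)) = let (q′ , j , e) = ends-∈ Q i in q′ , there j , e
        ends-unique : ∀ R → (∀ {q} → q ∈ R → q ∈ Q) → AllPairs (λ q q′ → colourOf A (proj₁ q) ≢ colourOf A (proj₁ q′)) R → Unique (ends R)
        ends-unique [] sub ap = []
        ends-unique ((x , y) ∷ R) sub (h ∷ ap) = Unique-∷ x∉ (Unique-∷ y∉ (ends-unique R (λ i → sub (there i)) ap))
          where
          far : ∀ {z} → z ∈ ends R → colourOf A z ≢ colourOf A x
          far i e with ends-∈ R i
          ... | q , j , inj₁ refl = All-lookup h j (sym e)
          ... | q , j , inj₂ refl = All-lookup h j (trans (sym e) (sym (proj₁ (proj₁ pA (sub (there j))))))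
          y∉ : y ∉ ends R
          y∉ i = far i (sym (proj₁ (proj₁ pA (sub (here refl)))))
          x∉ : x ∉ y ∷ ends R
          x∉ (here e) = ℕₚ.<⇒≢ (proj₁ (lt (sub (here refl)))) (cong toℕ e)
          x∉ (there i) = far i refl
        kept-ends : ∀ {z} → z ∈ ends Q → keptᵇ z ≡ true
        kept-ends {z} i with ends-∈ Q i
        ... | (x , y) , j , inj₁ refl = any-intro j (cong (_∨ ⌊ x ≟ y ⌋) (⇒does (x ≟ x) refl))
        ... | (x , y) , j , inj₂ refl = any-intro j (∨-introʳ {⌊ y ≟ x ⌋} (⇒does (y ≟ y) refl))
        lens : length (ends Q ++ rest) ≤ n
        lens = subst (length (ends Q ++ rest) ≤_) labels-length (unique-⊆-length
          (Unique-++ (ends Q) (ends-unique Q id (proj₂ pA)) (Unique-filter (λ z → not (keptᵇ z)) labels-unique)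
            (λ i j → true≢false (kept-ends i) (trans (sym (𝔹ₚ.not-involutive _)) (cong not (proj₂ (∈-filter⁻ (λ z → not (keptᵇ z)) labels j))))))
          sub)
          where
          sub : ∀ {z} → z ∈ ends Q ++ rest → z ∈ labels
          sub i with ∈ₚ.∈-++⁻ (ends Q) i
          ... | inj₂ j = proj₁ (∈-filter⁻ (λ z → not (keptᵇ z)) labels j)
          ... | inj₁ j with ends-∈ Q j
          ...   | q , q∈ , inj₁ refl = proj₁ (proj₂ (lt q∈))
          ...   | q , q∈ , inj₂ refl = proj₂ (proj₂ (lt q∈))
        FA-len : length FA ≡ length Q + length rest
        FA-len = trans (↭ₚ.↭-length (proj₂ (proj₂ rA))) (trans (Lₚ.length-++ (map (λ q → nd (lf (proj₁ q)) (lf (proj₂ q))) Q)) (cong₂ _+_ (Lₚ.length-map _ Q) (Lₚ.length-map lf rest)))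
        bound : proj₁ res + length Q ≤ n
        bound = begin
          proj₁ res + length Q ≤⟨ ℕₚ.+-monoˡ-≤ (length Q) (proj₁ (proj₂ res)) ⟩
          length FA + length Q ≡⟨ cong (_+ length Q) FA-len ⟩
          length Q + length rest + length Q ≡⟨ l₁ (length Q) (length rest) ⟩
          length Q + length Q + length rest ≡⟨ sym (trans (Lₚ.length-++ (ends Q)) (cong (_+ length rest) (ends-length Q))) ⟩
          length (ends Q ++ rest) ≤⟨ lens ⟩
          n ∎
          where
          open ℕₚ.≤-Reasoning
          l₁ : ∀ a b → a + b + a ≡ a + a + b
          l₁ = solve-∀

  -- Invariance under relabelling

  module _ {m : ℕ} where

    all-invol : ∀ (τ : Fin m → Fin m) → (∀ i → τ (τ i) ≡ i) → ∀ p → all (p ∘ τ) (allFin m) ≡ all p (allFin m)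
    all-invol τ inv p = Bool-≡
      (λ e → all-intro (allFin m) (λ x _ → trans (cong p (sym (inv x))) (all-elim {p = p ∘ τ} {xs = allFin m} e (∈-allFin (τ x)))))
      (λ e → all-intro (allFin m) (λ x _ → all-elim {p = p} {xs = allFin m} e (∈-allFin (τ x))))

    any-invol : ∀ (τ : Fin m → Fin m) → (∀ i → τ (τ i) ≡ i) → ∀ p → any (p ∘ τ) (allFin m) ≡ any p (allFin m)
    any-invol τ inv p = Bool-≡
      (λ e → let (x , _ , h) = any-elim {p = p ∘ τ} (allFin m) e in any-intro {p = p} (∈-allFin (τ x)) h)
      (λ e → let (x , _ , h) = any-elim {p = p} (allFin m) e in any-intro {p = p ∘ τ} (∈-allFin (τ x)) (trans (cong p (inv x)) h))

    all-cong : ∀ {p q : Fin m → Bool} xs → (∀ x → p x ≡ q x) → all p xs ≡ all q xs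
    all-cong []       h = refl
    all-cong (x ∷ xs) h = cong₂ _∧_ (h x) (all-cong xs h)

    any-cong : ∀ {p q : Fin m → Bool} xs → (∀ x → p x ≡ q x) → any p xs ≡ any q xs
    any-cong []       h = refl
    any-cong (x ∷ xs) h = cong₂ _∨_ (h x) (any-cong xs h)

    swapF : Fin m → Fin m → Fin m → Fin m
    swapF x y i = if ⌊ i ≟ x ⌋ then y else if ⌊ i ≟ y ⌋ then x else i

    swapF-x : ∀ x y → swapF x y x ≡ y
    swapF-x x y = cong (λ b → if b then y else if ⌊ x ≟ y ⌋ then x else x) (⇒does (x ≟ x) refl)

    swapF-y : ∀ x y → swapF x y y ≡ x
    swapF-y x y with y ≟ x
    ... | yes e = e
    ... | no _ = cong (λ b → if b then x else y) (⇒does (y ≟ y) refl)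

    swapF-other : ∀ x y {i} → i ≢ x → i ≢ y → swapF x y i ≡ i
    swapF-other x y {i} nx ny = trans (cong (λ b → if b then y else if ⌊ i ≟ y ⌋ then x else i) (¬does⇒ (i ≟ x) nx)) (cong (λ b → if b then x else i) (¬does⇒ (i ≟ y) ny))

    swapF-cases : ∀ (x y i : Fin m) → (i ≡ x) ⊎ (i ≡ y) ⊎ (i ≢ x × i ≢ y)
    swapF-cases x y i with i ≟ x | i ≟ y
    ... | yes e | _ = inj₁ e
    ... | no _ | yes e = inj₂ (inj₁ e)
    ... | no a | no b = inj₂ (inj₂ (a , b))

    swapF-invol : ∀ x y i → swapF x y (swapF x y i) ≡ i
    swapF-invol x y i with swapF-cases x y i
    ... | inj₁ refl = trans (cong (swapF x y) (swapF-x x y)) (swapF-y x y)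
    ... | inj₂ (inj₁ refl) = trans (cong (swapF x y) (swapF-y x y)) (swapF-x x y)
    ... | inj₂ (inj₂ (a , b)) = trans (cong (swapF x y) (swapF-other x y a b)) (swapF-other x y a b)

  module _ (n : ℕ) where

    vecsOf-complete : ∀ {A : Set} (xs : List A) → (∀ x → x ∈ xs) → ∀ k (v : Vec A k) → v ∈ vecsOf n xs k
    vecsOf-complete xs c zero    []ᵥ       = here refl
    vecsOf-complete xs c (suc k) (x ∷ᵥ v) = ∈ₚ.∈-concatMap⁺ (λ x → map (x ∷ᵥ_) (vecsOf n xs k))
      (Any-map (λ { refl → ∈ₚ.∈-map⁺ (x ∷ᵥ_) (vecsOf-complete xs c k v) }) (c x))

    vecsOf-unique : ∀ {A : Set} {xs : List A} → Unique xs → ∀ k → Unique (vecsOf n xs k)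
    vecsOf-unique u zero = [] ∷ []
    vecsOf-unique {A} {xs} u (suc k) = go xs u
      where
      W′ = vecsOf n xs k
      go : ∀ ys → Unique ys → Unique (concatMap (λ x → map (x ∷ᵥ_) W′) ys)
      go [] _ = []
      go (y ∷ ys) uy = Unique-++ (map (y ∷ᵥ_) W′) (Uₚ.map⁺ (λ { refl → refl }) (vecsOf-unique u k)) (go ys (Unique-tail uy)) disj
        where
        disj : ∀ {v} → v ∈ map (y ∷ᵥ_) W′ → v ∉ concatMap (λ x → map (x ∷ᵥ_) W′) ys
        disj i j with ∈ₚ.∈-map⁻ (y ∷ᵥ_) i | ∈ₚ.∈-concatMap⁻ (λ x → map (x ∷ᵥ_) W′) {xs = ys} j
        ... | v , _ , refl | a = Unique-head uy (Any-map (λ {z} h → headEq h) a)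
          where
          headEq : ∀ {z} → (y ∷ᵥ v) ∈ map (z ∷ᵥ_) W′ → y ≡ z
          headEq h with ∈ₚ.∈-map⁻ _ h
          ... | _ , _ , refl = refl

  module _ {k : ℕ} where

    private
      n = suc k
      m = V n

    open LeafSwap

    swap-leafSwap : ∀ {x y} → x ∈ labels {k} → y ∈ labels {k} → LeafSwap {k} (swapF x y)
    invol (swap-leafSwap {x} {y} hx hy) = swapF-invol x y
    leafy (swap-leafSwap {x} {y} hx hy) {i} le with swapF-cases x y i
    ... | inj₁ refl = subst (λ z → toℕ z ≤ n) (sym (swapF-x x y)) (proj₁ (label⇒ {k} hy))
    ... | inj₂ (inj₁ refl) = subst (λ z → toℕ z ≤ n) (sym (swapF-y x y)) (proj₁ (label⇒ {k} hx))
    ... | inj₂ (inj₂ (a , b)) = subst (λ z → toℕ z ≤ n) (sym (swapF-other x y a b)) le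
    inner-fix (swap-leafSwap {x} {y} hx hy) lt = swapF-other x y
      (λ { refl → ℕₚ.<⇒≱ lt (proj₁ (label⇒ {k} hx)) }) (λ { refl → ℕₚ.<⇒≱ lt (proj₁ (label⇒ {k} hy)) })
    root-fix (swap-leafSwap {x} {y} hx hy) = swapF-other x y (λ e → proj₂ (label⇒ {k} hx) (sym e)) (λ e → proj₂ (label⇒ {k} hy) (sym e))

    module _ {τ : Fin m → Fin m} (LS : LeafSwap {k} τ) {G H : Graph m} (h : ∀ i j → H i j ≡ G (τ i) (τ j)) where

      private
        ≟-τ : ∀ i j → ⌊ i ≟ j ⌋ ≡ ⌊ τ i ≟ τ j ⌋
        ≟-τ i j = Bool-≡ (λ e → ⇒does (τ i ≟ τ j) (cong τ (does⇒ (i ≟ j) e)))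
          (λ e → ⇒does (i ≟ j) (trans (sym (invol LS i)) (trans (cong τ (does⇒ (τ i ≟ τ j) e)) (invol LS j))))

        leaf-τ : ∀ i → (toℕ i ≤ᵇ n) ≡ (toℕ (τ i) ≤ᵇ n)
        leaf-τ i with ℕₚ.≤-<-connex (toℕ i) n
        ... | inj₁ le = trans (≤ᵇ-true le) (sym (≤ᵇ-true (leafy LS le)))
        ... | inj₂ lt = cong (λ z → toℕ z ≤ᵇ n) (sym (inner-fix LS lt))

        sym-τ : ∀ i j → symᵇ {k} H i j ≡ symᵇ {k} G (τ i) (τ j)
        sym-τ i j = cong₂ _∧_ (cong₂ (λ a b → not a ∨ b) (h i j) (h j i)) (cong₂ (λ a b → not (a ∧ b)) (≟-τ i j) (h i j))

        deg-τ : ∀ i → degᵇ {k} H i ≡ degᵇ {k} G (τ i)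
        deg-τ i = cong₂ (λ b d → if b then d ≡ᵇ 1 else d ≡ᵇ 3) (leaf-τ i)
          (trans (sum-map (λ j → 𝟙 (H i j)) (allFin m)) (trans (∑-cong (allFin m) (λ j _ → cong 𝟙 (h i j)))
            (trans (∑-invol τ (invol LS) (λ j → 𝟙 (G (τ i) j))) (sym (sum-map (λ j → 𝟙 (G (τ i) j)) (allFin m))))))

        iter-τ : ∀ c i j → iter n c (reachStep n H) (λ a b → ⌊ a ≟ b ⌋ ∨ H a b) i j ≡ iter n c (reachStep n G) (λ a b → ⌊ a ≟ b ⌋ ∨ G a b) (τ i) (τ j)
        iter-τ zero i j = cong₂ _∨_ (≟-τ i j) (h i j)
        iter-τ (suc c) i j = cong₂ _∨_ (iter-τ c i j) (trans (any-cong (allFin m) (λ l → cong₂ _∧_ (iter-τ c i l) (h l j)))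
          (any-invol τ (invol LS) (λ l → iter n c (reachStep n G) (λ a b → ⌊ a ≟ b ⌋ ∨ G a b) (τ i) l ∧ G l (τ j))))

        all² : ∀ (p q : Fin m → Fin m → Bool) → (∀ i j → p i j ≡ q (τ i) (τ j)) →
          all (λ i → all (p i) (allFin m)) (allFin m) ≡ all (λ i → all (q i) (allFin m)) (allFin m)
        all² p q e = trans (all-cong (allFin m) (λ i → trans (all-cong (allFin m) (e i)) (all-invol τ (invol LS) (q (τ i)))))
          (all-invol τ (invol LS) (λ i → all (q i) (allFin m)))

      isBinTree-τ : isBinTree n H ≡ isBinTree n G
      isBinTree-τ = cong₂ _∧_ (all² (symᵇ {k} H) (symᵇ {k} G) sym-τ)
        (cong₂ _∧_ (trans (all-cong (allFin m) deg-τ) (all-invol τ (invol LS) (degᵇ {k} G))) (all² (reachMat n H) (reachMat n G) (iter-τ m)))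

    private
      rows : List (Vec Bool m)
      rows = vecsOf n (true ∷ false ∷ []) m

      mats : List (Vec (Vec Bool m) m)
      mats = vecsOf n rows m

      mats-complete : ∀ M → M ∈ mats
      mats-complete = vecsOf-complete n rows (vecsOf-complete n (true ∷ false ∷ []) (λ { true → here refl ; false → there (here refl) }) m) m

      mats-unique : Unique mats
      mats-unique = vecsOf-unique n (vecsOf-unique n (((λ ()) ∷ []) ∷ ([] ∷ [])) m) m

    trees⇒isBinTree : ∀ {G} → G ∈ trees n → isBinTree n G ≡ true
    trees⇒isBinTree i = proj₂ (∈-filter⁻ (isBinTree n) (map (toGraph n) mats) i)

    id-leafSwap : LeafSwap {k} id
    id-leafSwap = record { invol = λ _ → refl ; leafy = id ; inner-fix = λ _ → refl ; root-fix = refl }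

    trees-nonempty : ∀ G → isBinTree n G ≡ true → 0 < length (trees n)
    trees-nonempty G h = nonempty (∈-filter⁺ (isBinTree n) {xs = map (toGraph n) mats} (∈ₚ.∈-map⁺ (toGraph n) (mats-complete M)) (trans (isBinTree-τ id-leafSwap {G} {toGraph n M} same) h))
      where
      M : Vec (Vec Bool m) m
      M = tabulate (λ i → tabulate (λ j → G i j))
      same : ∀ i j → toGraph n M i j ≡ G i j
      same i j = trans (cong (λ v → lookup v j) (Vₚ.lookup∘tabulate (λ i → tabulate (λ j → G i j)) i)) (Vₚ.lookup∘tabulate (λ j → G i j) j)
      nonempty : ∀ {A : Set} {x : A} {xs} → x ∈ xs → 0 < length xs
      nonempty (here _)  = s≤s z≤n
      nonempty (there _) = s≤s z≤n

    trees-τ : ∀ {τ : Fin m → Fin m} → LeafSwap {k} τ → ∀ (φ φ′ : Graph m → ℕ) →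
      (∀ G H → isBinTree n G ≡ true → isBinTree n H ≡ true → (∀ i j → H i j ≡ G (τ i) (τ j)) → φ H ≡ φ′ G) → ∑ (trees n) φ ≡ ∑ (trees n) φ′
    trees-τ {τ} LS φ φ′ e = begin
      ∑ (trees n) φ ≡⟨ expand φ ⟩
      ∑ mats (ψ φ) ≡⟨ sym (∑-↭ (ψ φ) perm) ⟩
      ∑ (map g mats) (ψ φ) ≡⟨ ∑-map g (ψ φ) mats ⟩
      ∑ mats (ψ φ ∘ g) ≡⟨ ∑-cong mats (λ M _ → pt M) ⟩
      ∑ mats (ψ φ′) ≡⟨ sym (expand φ′) ⟩
      ∑ (trees n) φ′ ∎
      where
      open ≡-Reasoning
      ψ : (Graph m → ℕ) → Vec (Vec Bool m) m → ℕ
      ψ φ M = 𝟙 (isBinTree n (toGraph n M)) * φ (toGraph n M)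
      expand : ∀ φ → ∑ (trees n) φ ≡ ∑ mats (ψ φ)
      expand φ = trans (∑-filter (isBinTree n) φ (map (toGraph n) mats)) (∑-map (toGraph n) (λ G → 𝟙 (isBinTree n G) * φ G) mats)
      g : Vec (Vec Bool m) m → Vec (Vec Bool m) m
      g M = tabulate (λ i → tabulate (λ j → toGraph n M (τ i) (τ j)))
      toGraph-g : ∀ M i j → toGraph n (g M) i j ≡ toGraph n M (τ i) (τ j)
      toGraph-g M i j = trans (cong (λ v → lookup v j) (Vₚ.lookup∘tabulate (λ i → tabulate (λ j → toGraph n M (τ i) (τ j))) i)) (Vₚ.lookup∘tabulate (λ j → toGraph n M (τ i) (τ j)) j)
      gg : ∀ M → g (g M) ≡ M
      gg M = trans (Vₚ.tabulate-cong (λ i → trans (Vₚ.tabulate-cong (λ j → trans (toGraph-g M (τ i) (τ j)) (cong₂ (toGraph n M) (invol LS i) (invol LS j)))) (Vₚ.tabulate∘lookup (lookup M i)))) (Vₚ.tabulate∘lookup M)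
      perm : map g mats ↭ mats
      perm = unique-set-↭ (Uₚ.map⁺ (λ {M} {N} e → trans (sym (gg M)) (trans (cong g e) (gg N))) mats-unique) mats-unique
        (λ {M} _ → mats-complete M) (λ {M} _ → subst (_∈ map g mats) (gg M) (∈ₚ.∈-map⁺ g (mats-complete (g M))))
      pt : ∀ M → ψ φ (g M) ≡ ψ φ′ M
      pt M = go (isBinTree n (toGraph n M)) refl
        where
        eqT : isBinTree n (toGraph n (g M)) ≡ isBinTree n (toGraph n M)
        eqT = isBinTree-τ LS {toGraph n M} {toGraph n (g M)} (toGraph-g M)
        go : ∀ b → isBinTree n (toGraph n M) ≡ b → ψ φ (g M) ≡ ψ φ′ M
        go false q = trans (cong (λ b → 𝟙 b * φ (toGraph n (g M))) (trans eqT q)) (sym (cong (λ b → 𝟙 b * φ′ (toGraph n M)) q))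
        go true q = cong₂ (λ b z → 𝟙 b * z) eqT (e (toGraph n M) (toGraph n (g M)) q (trans eqT q) (toGraph-g M))

    Equivariant : (Graph m → List (Fin m) → ℕ) → Set
    Equivariant R = ∀ {τ} → LeafSwap {k} τ → ∀ G H → isBinTree n G ≡ true → isBinTree n H ≡ true → (∀ i j → H i j ≡ G (τ i) (τ j)) →
      ∀ v → All (_∈ labels {k}) v → R H v ≡ R G (map τ v)

    total : (Graph m → List (Fin m) → ℕ) → List (Fin m) → ℕ
    total R v = ∑[ B ∈ trees n ] R B v

    total-τ : ∀ R → Equivariant R → ∀ {τ} → LeafSwap {k} τ → ∀ v → All (_∈ labels {k}) v → total R v ≡ total R (map τ v)
    total-τ R eq LS v hv = trees-τ LS (λ B → R B v) (λ B → R B (map _ v)) (λ G H tG tH h → eq LS G H tG tH h v hv)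

    -- Any two repetition-free tuples of labels of the same length are related by a product of transpositions.
    total-const : ∀ R → Equivariant R → ∀ v w → length v ≡ length w → Unique v → Unique w → All (_∈ labels {k}) v → All (_∈ labels {k}) w → total R v ≡ total R w
    total-const R eq v w len uv uw hv hw with connect v w len uv uw hv hw
      where
      act : List (Fin m × Fin m) → Fin m → Fin m
      act []             i = i
      act ((x , y) ∷ ps) i = swapF x y (act ps i)
      Valid : List (Fin m × Fin m) → Set
      Valid = All (λ p → proj₁ p ∈ labels {k} × proj₂ p ∈ labels {k})
      act-label : ∀ ps → Valid ps → ∀ {x} → x ∈ labels {k} → act ps x ∈ labels {k}
      act-label [] _ i = i
      act-label ((x , y) ∷ ps) ((hx , hy) ∷ h) i = label-τ (swap-leafSwap hx hy) (act-label ps h i)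
      act-inj : ∀ ps {x y} → act ps x ≡ act ps y → x ≡ y
      act-inj [] e = e
      act-inj ((a , b) ∷ ps) {x} {y} e = act-inj ps (trans (sym (swapF-invol a b (act ps x))) (trans (cong (swapF a b) e) (swapF-invol a b (act ps y))))
      map-id : ∀ {f : Fin m → Fin m} xs → (∀ {x} → x ∈ xs → f x ≡ x) → map f xs ≡ xs
      map-id [] h = refl
      map-id (x ∷ xs) h = cong₂ _∷_ (h (here refl)) (map-id xs (λ i → h (there i)))
      connect : ∀ v w → length v ≡ length w → Unique v → Unique w → All (_∈ labels {k}) v → All (_∈ labels {k}) w →
        ∃[ ps ] (Valid ps × map (act ps) v ≡ w × total R v ≡ total R w)
      invariant : ∀ ps → Valid ps → ∀ v → All (_∈ labels {k}) v → total R v ≡ total R (map (act ps) v)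
      invariant [] _ v hv = cong (total R) (sym (Lₚ.map-id v))
      invariant ((x , y) ∷ ps) ((hx , hy) ∷ h) v hv = trans (invariant ps h v hv)
        (trans (total-τ R eq (swap-leafSwap hx hy) (map (act ps) v) (Allₚ.map⁺ (All-map (act-label ps h) hv))) (cong (total R) (sym (Lₚ.map-∘ v))))
      reach : ∀ v w → length v ≡ length w → Unique v → Unique w → All (_∈ labels {k}) v → All (_∈ labels {k}) w →
        ∃[ ps ] (Valid ps × map (act ps) v ≡ w)
      reach [] [] _ _ _ _ _ = [] , [] , refl
      reach (x ∷ v) (y ∷ w) len uv uw (hx ∷ hv) (hy ∷ hw) with reach v w (ℕₚ.suc-injective len) (Unique-tail uv) (Unique-tail uw) hv hw
      ... | ps , val , e = (x′ , y) ∷ ps , (act-label ps val hx , hy) ∷ val , cong₂ _∷_ (swapF-x x′ y) (trans (Lₚ.map-∘ v) (trans (cong (map (swapF x′ y)) e) (map-id w fix)))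
        where
        x′ = act ps x
        fix : ∀ {z} → z ∈ w → swapF x′ y z ≡ z
        fix {z} i = swapF-other x′ y (λ { refl → x′∉ i }) (λ { refl → Unique-head uw i })
          where
          x′∉ : x′ ∉ w
          x′∉ j with ∈ₚ.∈-map⁻ (act ps) (subst (x′ ∈_) (sym e) j)
          ... | u , u∈ , q = Unique-head uv (subst (_∈ v) (sym (act-inj ps q)) u∈)
      connect v w len uv uw hv hw with reach v w len uv uw hv hw
      ... | ps , val , e = ps , val , e , trans (invariant ps val v hv) (cong (total R) e)
    ... | _ , _ , _ , r = r

    tuples : ℕ → List (List (Fin m))
    tuples zero    = [] ∷ []
    tuples (suc j) = concatMap (λ x → map (x ∷_) (tuples j)) (labels {k})

    uniqᵇ : List (Fin m) → Bool
    uniqᵇ []       = true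
    uniqᵇ (x ∷ xs) = not (any (λ y → ⌊ x ≟ y ⌋) xs) ∧ uniqᵇ xs

    uniqᵇ⇒ : ∀ v → uniqᵇ v ≡ true → Unique v
    uniqᵇ⇒ [] _ = []
    uniqᵇ⇒ (x ∷ v) e with ∧-split {not (any (λ y → ⌊ x ≟ y ⌋) v)} e
    ... | a , b = Unique-∷ (λ i → true≢false (any-intro i (⇒does (x ≟ x) refl)) (trans (sym (𝔹ₚ.not-involutive _)) (cong not a))) (uniqᵇ⇒ v b)

    ⇒uniqᵇ : ∀ v → Unique v → uniqᵇ v ≡ true
    ⇒uniqᵇ [] _ = refl
    ⇒uniqᵇ (x ∷ v) u = cong₂ _∧_ (cong not (≢true⇒≡false (λ e → let (y , y∈ , q) = any-elim v e in Unique-head u (subst (_∈ v) (sym (does⇒ (x ≟ y) q)) y∈)))) (⇒uniqᵇ v (Unique-tail u))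

    ∑-tuples : ∀ j (φ : List (Fin m) → ℕ) → ∑ (tuples (suc j)) φ ≡ ∑[ x ∈ labels {k} ] ∑[ v ∈ tuples j ] φ (x ∷ v)
    ∑-tuples j φ = trans (∑-concatMap (λ x → map (x ∷_) (tuples j)) φ (labels {k})) (∑-cong (labels {k}) (λ x _ → ∑-map (x ∷_) φ (tuples j)))

    tuples-∈ : ∀ j {v} → v ∈ tuples j → length v ≡ j × All (_∈ labels {k}) v
    tuples-∈ zero (here refl) = refl , []
    tuples-∈ (suc j) i with Data.List.Membership.Propositional.find (∈ₚ.∈-concatMap⁻ (λ x → map (x ∷_) (tuples j)) {xs = labels {k}} i)
    ... | x , x∈ , h with ∈ₚ.∈-map⁻ (x ∷_) h
    ...   | v , v∈ , refl = let (a , b) = tuples-∈ j v∈ in cong suc a , x∈ ∷ b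

    distinct : ℕ → List (List (Fin m))
    distinct j = filterᵇ uniqᵇ (tuples j)

    average : ∀ j (RA : List (Fin m) → ℕ) R → Equivariant R →
      length (distinct j) * ∑[ B ∈ trees n ] ∑[ v ∈ distinct j ] (RA v * R B v) ≡ ∑ (distinct j) RA * ∑[ B ∈ trees n ] ∑[ v ∈ distinct j ] R B v
    average j RA R eq = begin
      N * ∑[ B ∈ trees n ] ∑[ v ∈ D ] (RA v * R B v) ≡⟨ cong (N *_) (∑-swap (λ B v → RA v * R B v) (trees n) D) ⟩
      N * ∑[ v ∈ D ] ∑[ B ∈ trees n ] (RA v * R B v) ≡⟨ cong (N *_) (∑-cong D (λ v _ → ∑-*ˡ (RA v) (λ B → R B v) (trees n))) ⟩
      N * ∑[ v ∈ D ] (RA v * total R v) ≡⟨ sym (∑-*ˡ N (λ v → RA v * total R v) D) ⟩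
      ∑[ v ∈ D ] (N * (RA v * total R v)) ≡⟨ ∑-cong D (λ v i → trans (lem N (RA v) (total R v)) (cong (RA v *_) (sym (const v i)))) ⟩
      ∑[ v ∈ D ] (RA v * ∑ D (total R)) ≡⟨ ∑-*ʳ (∑ D (total R)) RA D ⟩
      ∑ D RA * ∑ D (total R) ≡⟨ cong (∑ D RA *_) (∑-swap (λ v B → R B v) D (trees n)) ⟩
      ∑ D RA * ∑[ B ∈ trees n ] ∑[ v ∈ D ] R B v ∎
      where
      open ≡-Reasoning
      D = distinct j
      N = length D
      lem : ∀ a b c → a * (b * c) ≡ b * (a * c)
      lem = solve-∀
      mem : ∀ {v} → v ∈ D → Unique v × length v ≡ j × All (_∈ labels {k}) v
      mem {v} i = let (a , b) = ∈-filter⁻ uniqᵇ (tuples j) i ; (c , d) = tuples-∈ j a in uniqᵇ⇒ v b , c , d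
      const : ∀ v → v ∈ D → ∑ D (total R) ≡ N * total R v
      const v i = trans (∑-cong D (λ w i′ → let (u , l , h) = mem i ; (u′ , l′ , h′) = mem i′ in total-const R eq w v (trans l′ (sym l)) u′ u h′ h)) (∑-const (total R v) D)

    distinct-suc : ∀ j → length (distinct j) * (n ∸ j) ≤ length (distinct (suc j))
    distinct-suc j = begin
      length (distinct j) * (n ∸ j) ≡⟨ sym (∑-const (n ∸ j) (distinct j)) ⟩
      ∑[ v ∈ distinct j ] (n ∸ j) ≤⟨ ∑-mono (distinct j) (λ v i → fresh v (proj₁ (tuples-∈ j (proj₁ (∈-filter⁻ uniqᵇ (tuples j) i))))) ⟩
      ∑[ v ∈ distinct j ] ∑[ x ∈ labels {k} ] 𝟙 (new x v) ≡⟨ ∑-filter uniqᵇ (λ v → ∑[ x ∈ labels {k} ] 𝟙 (new x v)) (tuples j) ⟩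
      ∑[ v ∈ tuples j ] (𝟙 (uniqᵇ v) * ∑[ x ∈ labels {k} ] 𝟙 (new x v)) ≡⟨ ∑-cong (tuples j) (λ v _ → sym (∑-*ˡ (𝟙 (uniqᵇ v)) (λ x → 𝟙 (new x v)) (labels {k}))) ⟩
      ∑[ v ∈ tuples j ] ∑[ x ∈ labels {k} ] (𝟙 (uniqᵇ v) * 𝟙 (new x v)) ≡⟨ ∑-swap (λ v x → 𝟙 (uniqᵇ v) * 𝟙 (new x v)) (tuples j) (labels {k}) ⟩
      ∑[ x ∈ labels {k} ] ∑[ v ∈ tuples j ] (𝟙 (uniqᵇ v) * 𝟙 (new x v)) ≡⟨ ∑-cong (labels {k}) (λ x _ → ∑-cong (tuples j) (λ v _ → trans (ℕₚ.*-comm (𝟙 (uniqᵇ v)) _) (sym (𝟙-∧ {m} (new x v) (uniqᵇ v))))) ⟩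
      ∑[ x ∈ labels {k} ] ∑[ v ∈ tuples j ] 𝟙 (uniqᵇ (x ∷ v)) ≡⟨ sym (∑-tuples j (λ v → 𝟙 (uniqᵇ v))) ⟩
      ∑[ v ∈ tuples (suc j) ] 𝟙 (uniqᵇ v) ≡⟨ sym (length-filter uniqᵇ (tuples (suc j))) ⟩
      length (distinct (suc j)) ∎
      where
      open ℕₚ.≤-Reasoning
      new : Fin m → List (Fin m) → Bool
      new x v = not (any (λ y → ⌊ x ≟ y ⌋) v)
      old≤ : ∀ v → ∑[ x ∈ labels {k} ] 𝟙 (any (λ y → ⌊ x ≟ y ⌋) v) ≤ length v
      old≤ [] = ℕₚ.≤-reflexive (∑-0 (labels {k}))
      old≤ (y ∷ v) = ℕₚ.≤-trans (∑-mono (labels {k}) (λ x _ → 𝟙-∨ ⌊ x ≟ y ⌋ _)) (ℕₚ.≤-trans (ℕₚ.≤-reflexive (∑-+ (λ x → 𝟙 ⌊ x ≟ y ⌋) (λ x → 𝟙 (any (λ y → ⌊ x ≟ y ⌋) v)) (labels {k})))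
        (ℕₚ.+-mono-≤ (ℕₚ.≤-trans (ℕₚ.≤-reflexive (∑-cong (labels {k}) (λ x _ → trans (cong 𝟙 (≟-comm x y)) (sym (ℕₚ.*-identityʳ _))))) (∑-δ-≤ (λ _ → 1) y (labels-unique {k}))) (old≤ v)))
        where
        𝟙-∨ : ∀ a b → 𝟙 (a ∨ b) ≤ 𝟙 a + 𝟙 b
        𝟙-∨ true  b = s≤s z≤n
        𝟙-∨ false b = ℕₚ.≤-refl
      fresh : ∀ v → length v ≡ j → n ∸ j ≤ ∑[ x ∈ labels {k} ] 𝟙 (new x v)
      fresh v refl = ℕₚ.m≤n+o⇒m∸n≤o n (length v) (ℕₚ.≤-trans (ℕₚ.≤-reflexive split) (ℕₚ.+-monoˡ-≤ _ (old≤ v)))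
        where
        split : n ≡ ∑[ x ∈ labels {k} ] 𝟙 (any (λ y → ⌊ x ≟ y ⌋) v) + ∑[ x ∈ labels {k} ] 𝟙 (new x v)
        split = sym (trans (sym (∑-+ (λ x → 𝟙 (any (λ y → ⌊ x ≟ y ⌋) v)) (λ x → 𝟙 (new x v)) (labels {k}))) (trans (∑-cong (labels {k}) (λ x _ → lem (any (λ y → ⌊ x ≟ y ⌋) v))) (trans (∑-const 1 (labels {k})) (trans (ℕₚ.*-identityʳ _) (labels-length {k})))))
          where
          lem : ∀ b → 𝟙 b + 𝟙 (not b) ≡ 1
          lem true  = refl
          lem false = refl

  -- Counting pairs and conflicts

  module _ {A : Set} (neᵇ conf : A → A → Bool) where

    -- Discarding one element of every conflicting pair.
    independent : ∀ xs → (∀ {e e′} → e ∈ xs → e′ ∈ xs → e ≢ e′ → neᵇ e e′ ≡ true) → Unique xs →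
      ∃[ Q ] ((∀ {q} → q ∈ Q → q ∈ xs) × AllPairs (λ q q′ → conf q q′ ≡ false) Q
        × length xs ≤ length Q + ∑[ e ∈ xs ] ∑[ e′ ∈ xs ] (𝟙 (neᵇ e e′) * 𝟙 (conf e e′)))
    independent [] _ _ = [] , (λ ()) , [] , z≤n
    independent (x ∷ xs) ne u with independent xs (λ i j → ne (there i) (there j)) (Unique-tail u)
    ... | Q , sub , ap , le = go (anyL? (λ y → conf x y 𝔹ₚ.≟ true) xs)
      where
      P : A → A → ℕ
      P e e′ = 𝟙 (neᵇ e e′) * 𝟙 (conf e e′)
      rest = ∑[ e ∈ xs ] ∑[ e′ ∈ xs ] P e e′
      tot = ∑[ e ∈ x ∷ xs ] ∑[ e′ ∈ x ∷ xs ] P e e′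
      grow : ∑ xs (P x) + rest ≤ tot
      grow = ℕₚ.+-mono-≤ (ℕₚ.m≤n+m (∑ xs (P x)) (P x x)) (∑-mono xs (λ z _ → ℕₚ.m≤n+m (∑ xs (P z)) (P z x)))
      go : Dec (Any (λ y → conf x y ≡ true) xs) →
        ∃[ Q ] ((∀ {q} → q ∈ Q → q ∈ x ∷ xs) × AllPairs (λ q q′ → conf q q′ ≡ false) Q × suc (length xs) ≤ length Q + tot)
      go (yes a) with Data.List.Membership.Propositional.find a
      ... | y , y∈ , e = Q , (λ i → there (sub i)) , ap , (begin
          suc (length xs) ≤⟨ s≤s le ⟩
          suc (length Q + rest) ≡⟨ sym (ℕₚ.+-suc (length Q) rest) ⟩
          length Q + (1 + rest) ≤⟨ ℕₚ.+-monoʳ-≤ (length Q) (ℕₚ.≤-trans (ℕₚ.+-monoˡ-≤ rest hit) grow) ⟩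
          length Q + tot ∎)
        where
        open ℕₚ.≤-Reasoning
        hit : 1 ≤ ∑ xs (P x)
        hit = ℕₚ.≤-trans (ℕₚ.≤-reflexive (sym (cong₂ (λ a b → 𝟙 a * 𝟙 b) (ne (here refl) (there y∈) (λ { refl → Unique-head u y∈ })) e))) (∑-term (P x) y∈)
      go (no ¬a) = x ∷ Q , (λ { (here e) → here e ; (there i) → there (sub i) }) ,
        All-tabulate (λ i → ≢true⇒≡false (λ e → ¬a (Any-map (λ { refl → e }) (sub i)))) ∷ ap ,
        s≤s (ℕₚ.≤-trans le (ℕₚ.+-monoʳ-≤ (length Q) (ℕₚ.≤-trans (ℕₚ.m≤n+m rest (∑ xs (P x))) grow)))

  ∑-cartesian : ∀ {A B : Set} (φ : A × B → ℕ) xs ys → ∑ (cartesianProduct xs ys) φ ≡ ∑[ x ∈ xs ] ∑[ y ∈ ys ] φ (x , y)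
  ∑-cartesian φ [] ys = refl
  ∑-cartesian φ (x ∷ xs) ys = trans (∑-++ φ (map (x ,_) ys) (cartesianProduct xs ys)) (cong₂ _+_ (∑-map (x ,_) φ ys) (∑-cartesian φ xs ys))

  𝟙⁴-≤ : ∀ {a b c d R} → (a ≡ true → b ≡ true → c ≡ true → d ≡ true → 1 ≤ R) → 𝟙 a * (𝟙 b * (𝟙 c * 𝟙 d)) ≤ R
  𝟙⁴-≤ {true} {true} {true} {true} h = h refl refl refl refl
  𝟙⁴-≤ {true} {true} {true} {false} h = z≤n
  𝟙⁴-≤ {true} {true} {false} h = z≤n
  𝟙⁴-≤ {true} {false} h = z≤n
  𝟙⁴-≤ {false} h = z≤n

  module _ {k : ℕ} where

    private
      n = suc k
      m = V n

      L : List (Fin m)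
      L = labels {k}

      Ts : List (Graph m)
      Ts = trees n

    -- Relations between colours; on lists of other lengths they are 0.

    ρ₂ ρg ρ₃ ρs ρp : List (Fin m) → ℕ
    ρ₂ (a ∷ b ∷ []) = 𝟙 ⌊ a ≟ b ⌋
    ρ₂ _ = 0
    ρg (a ∷ b ∷ []) = 𝟙 (⌊ a ≟ b ⌋ ∧ not ⌊ a ≟ root {k} ⌋)
    ρg _ = 0
    ρ₃ (a ∷ b ∷ c ∷ []) = 𝟙 ⌊ a ≟ b ⌋ * 𝟙 ⌊ a ≟ c ⌋
    ρ₃ _ = 0
    ρs (a ∷ b ∷ c ∷ d ∷ []) = 𝟙 ⌊ a ≟ b ⌋ * (𝟙 ⌊ a ≟ c ⌋ * 𝟙 ⌊ a ≟ d ⌋)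
    ρs _ = 0
    ρp (a ∷ b ∷ c ∷ d ∷ []) = 𝟙 ⌊ a ≟ b ⌋ * 𝟙 ⌊ c ≟ d ⌋
    ρp _ = 0

    ∑-tuples₂ : ∀ (φ : List (Fin m) → ℕ) → ∑ (tuples {k} 2) φ ≡ ∑[ x ∈ L ] ∑[ y ∈ L ] φ (x ∷ y ∷ [])
    ∑-tuples₂ φ = trans (∑-tuples {k} 1 φ) (∑-cong L (λ x _ → trans (∑-tuples {k} 0 (λ v → φ (x ∷ v))) (∑-cong L (λ y _ → ℕₚ.+-identityʳ _))))

    ∑-tuples₃ : ∀ (φ : List (Fin m) → ℕ) → ∑ (tuples {k} 3) φ ≡ ∑[ x ∈ L ] ∑[ y ∈ L ] ∑[ z ∈ L ] φ (x ∷ y ∷ z ∷ [])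
    ∑-tuples₃ φ = trans (∑-tuples {k} 2 φ) (∑-cong L (λ x _ → ∑-tuples₂ (λ v → φ (x ∷ v))))

    ∑-tuples₄ : ∀ (φ : List (Fin m) → ℕ) → ∑ (tuples {k} 4) φ ≡ ∑[ x ∈ L ] ∑[ y ∈ L ] ∑[ z ∈ L ] ∑[ w ∈ L ] φ (x ∷ y ∷ z ∷ w ∷ [])
    ∑-tuples₄ φ = trans (∑-tuples {k} 3 φ) (∑-cong L (λ x _ → ∑-tuples₃ (λ v → φ (x ∷ v))))

    ∑-distinct-≤ : ∀ j (φ : List (Fin m) → ℕ) → ∑ (distinct {k} j) φ ≤ ∑ (tuples {k} j) φ
    ∑-distinct-≤ j φ = subst (_≤ ∑ (tuples {k} j) φ) (sym (∑-filter (uniqᵇ {k}) φ (tuples {k} j)))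
      (∑-mono (tuples {k} j) (λ v _ → ℕₚ.≤-trans (ℕₚ.*-monoˡ-≤ (φ v) (𝟙≤1 (uniqᵇ {k} v))) (ℕₚ.≤-reflexive (ℕₚ.*-identityˡ (φ v)))))

    uniq₂ : ∀ x y → uniqᵇ {k} (x ∷ y ∷ []) ≡ not ⌊ x ≟ y ⌋
    uniq₂ x y with ⌊ x ≟ y ⌋
    ... | true  = refl
    ... | false = refl

    ∑-distinct₂ : ∀ (φ : List (Fin m) → ℕ) → ∑ (distinct {k} 2) φ ≡ ∑[ x ∈ L ] ∑[ y ∈ L ] (𝟙 (not ⌊ x ≟ y ⌋) * φ (x ∷ y ∷ []))
    ∑-distinct₂ φ = trans (∑-filter (uniqᵇ {k}) φ (tuples {k} 2)) (trans (∑-tuples₂ (λ v → 𝟙 (uniqᵇ {k} v) * φ v))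
      (∑-cong L (λ x _ → ∑-cong L (λ y _ → cong (λ b → 𝟙 b * φ (x ∷ y ∷ [])) (uniq₂ x y)))))

    module Rows (f : Fin m → Fin m) (M : ℕ) (row : ∀ c → ∑[ y ∈ L ] 𝟙 ⌊ f y ≟ c ⌋ ≤ M) where

      row′ : ∀ x → ∑[ y ∈ L ] 𝟙 ⌊ f x ≟ f y ⌋ ≤ M
      row′ x = subst (_≤ M) (∑-cong L (λ y _ → cong 𝟙 (≟-comm (f y) (f x)))) (row (f x))

      const-≤ : ∀ {φ : Fin m → ℕ} {C} → (∀ x → φ x ≤ C) → ∑ L φ ≤ n * C
      const-≤ {φ} {C} h = ℕₚ.≤-trans (∑-mono L (λ x _ → h x)) (ℕₚ.≤-reflexive (trans (∑-const C L) (cong (_* C) (labels-length {k}))))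

      row-* : ∀ x {φ : Fin m → ℕ} {C} → (∀ y → φ y ≤ C) → ∑[ y ∈ L ] (𝟙 ⌊ f x ≟ f y ⌋ * φ y) ≤ M * C
      row-* x {φ} {C} h = ℕₚ.≤-trans (∑-mono L (λ y _ → ℕₚ.*-monoʳ-≤ (𝟙 ⌊ f x ≟ f y ⌋) (h y)))
        (ℕₚ.≤-trans (ℕₚ.≤-reflexive (∑-*ʳ C (λ y → 𝟙 ⌊ f x ≟ f y ⌋) L)) (ℕₚ.*-monoˡ-≤ C (row′ x)))

      sum₂ : ∑[ v ∈ tuples {k} 2 ] ρ₂ (map f v) ≤ n * M
      sum₂ = subst (_≤ n * M) (sym (∑-tuples₂ (λ v → ρ₂ (map f v)))) (const-≤ row′)

      sum₃ : ∑[ v ∈ tuples {k} 3 ] ρ₃ (map f v) ≤ n * (M * M)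
      sum₃ = subst (_≤ n * (M * M)) (sym (∑-tuples₃ (λ v → ρ₃ (map f v)))) (const-≤ (λ x →
        ℕₚ.≤-trans (ℕₚ.≤-reflexive (∑-cong L (λ y _ → ∑-*ˡ (𝟙 ⌊ f x ≟ f y ⌋) (λ z → 𝟙 ⌊ f x ≟ f z ⌋) L))) (row-* x (λ _ → row′ x))))

      sumS : ∑[ v ∈ tuples {k} 4 ] ρs (map f v) ≤ n * (M * (M * M))
      sumS = subst (_≤ n * (M * (M * M))) (sym (∑-tuples₄ (λ v → ρs (map f v)))) (const-≤ (λ x →
        ℕₚ.≤-trans (ℕₚ.≤-reflexive (∑-cong L (λ y _ → trans (∑-cong L (λ z _ → trans (∑-*ˡ (𝟙 ⌊ f x ≟ f y ⌋) (λ w → 𝟙 ⌊ f x ≟ f z ⌋ * 𝟙 ⌊ f x ≟ f w ⌋) L)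
            (cong (𝟙 ⌊ f x ≟ f y ⌋ *_) (∑-*ˡ (𝟙 ⌊ f x ≟ f z ⌋) (λ w → 𝟙 ⌊ f x ≟ f w ⌋) L)))) (∑-*ˡ (𝟙 ⌊ f x ≟ f y ⌋) (λ z → 𝟙 ⌊ f x ≟ f z ⌋ * ∑[ w ∈ L ] 𝟙 ⌊ f x ≟ f w ⌋) L))))
          (row-* x (λ _ → row-* x (λ _ → row′ x)))))

      sumP : ∑[ v ∈ tuples {k} 4 ] ρp (map f v) ≤ n * (M * (n * M))
      sumP = subst (_≤ n * (M * (n * M))) (sym (∑-tuples₄ (λ v → ρp (map f v)))) (const-≤ (λ x →
        ℕₚ.≤-trans (ℕₚ.≤-reflexive (∑-cong L (λ y _ → trans (∑-cong L (λ z _ → ∑-*ˡ (𝟙 ⌊ f x ≟ f y ⌋) (λ w → 𝟙 ⌊ f z ≟ f w ⌋) L))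
            (∑-*ˡ (𝟙 ⌊ f x ≟ f y ⌋) (λ z → ∑[ w ∈ L ] 𝟙 ⌊ f z ≟ f w ⌋) L))))
          (row-* x (λ _ → const-≤ row′))))

    private
      half : ∀ j → j ≤ 3 → 6 ≤ n → n ≤ 2 * (n ∸ j)
      half j le 6≤n = ℕₚ.+-cancelʳ-≤ j n (2 * (n ∸ j)) (begin
        n + j ≡⟨ cong (_+ j) (sym (ℕₚ.m∸n+n≡m j≤n)) ⟩
        n ∸ j + j + j ≡⟨ ℕₚ.+-assoc (n ∸ j) j j ⟩
        n ∸ j + (j + j) ≤⟨ ℕₚ.+-monoʳ-≤ (n ∸ j) (ℕₚ.+-monoˡ-≤ j (ℕₚ.≤-trans le (ℕₚ.m+n≤o⇒m≤o∸n 3 (ℕₚ.≤-trans (ℕₚ.+-monoʳ-≤ 3 le) 6≤n)))) ⟩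
        n ∸ j + (n ∸ j + j) ≡⟨ lem (n ∸ j) j ⟩
        2 * (n ∸ j) + j ∎)
        where
        open ℕₚ.≤-Reasoning
        j≤n : j ≤ n
        j≤n = ℕₚ.≤-trans le (ℕₚ.≤-trans (s≤s (s≤s (s≤s z≤n))) 6≤n)
        lem : ∀ a j → a + (a + j) ≡ 2 * a + j
        lem = solve-∀

    private
      N : ℕ → ℕ
      N j = length (distinct {k} j)

    N₁ : n ≤ N 1
    N₁ = ℕₚ.≤-trans (ℕₚ.≤-reflexive (sym (ℕₚ.+-identityʳ n))) (distinct-suc {k} 0)

    Nstep : 6 ≤ n → ∀ j → j ≤ 3 → ∀ {c C} → c ≤ C * N j → c * n ≤ 2 * C * N (suc j)
    Nstep 6≤n j le {c} {C} h = begin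
      c * n ≤⟨ ℕₚ.*-mono-≤ h (half j le 6≤n) ⟩
      C * N j * (2 * (n ∸ j)) ≡⟨ lem C (N j) (n ∸ j) ⟩
      2 * C * (N j * (n ∸ j)) ≤⟨ ℕₚ.*-monoʳ-≤ (2 * C) (distinct-suc {k} j) ⟩
      2 * C * N (suc j) ∎
      where
      open ℕₚ.≤-Reasoning
      lem : ∀ a b c → a * b * (2 * c) ≡ 2 * a * (b * c)
      lem = solve-∀

    N₂ : 6 ≤ n → n * n ≤ 2 * N 2
    N₂ h = Nstep h 1 (s≤s z≤n) {n} {1} (ℕₚ.≤-trans N₁ (ℕₚ.≤-reflexive (sym (ℕₚ.*-identityˡ (N 1)))))

    N₃ : 6 ≤ n → n * n * n ≤ 4 * N 3
    N₃ h = Nstep h 2 (s≤s (s≤s z≤n)) {n * n} {2} (N₂ h)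

    N₄ : 6 ≤ n → n * n * n * n ≤ 8 * N 4
    N₄ h = Nstep h 3 ℕₚ.≤-refl {n * n * n} {4} (N₃ h)

    N₂-upper : N 2 ≤ n * n
    N₂-upper = ℕₚ.≤-trans (ℕₚ.≤-reflexive (trans (sym (ℕₚ.*-identityʳ (N 2))) (sym (∑-const 1 (distinct {k} 2))))) (ℕₚ.≤-trans (∑-distinct-≤ 2 (λ _ → 1))
      (ℕₚ.≤-reflexive (trans (∑-tuples₂ (λ _ → 1)) (trans (∑-cong L (λ _ _ → trans (∑-const 1 L) (trans (ℕₚ.*-identityʳ _) (labels-length {k})))) (trans (∑-const n L) (cong (_* n) (labels-length {k})))))))

    module Avg (s : ℕ) (1<s : 1 < s) where

      open Coloured {k} s 1<s

      private
        col : Graph m → Fin m → Fin m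
        col = colourOf

      equivariant : ∀ (ρ : List (Fin m) → ℕ) → Equivariant {k} (λ B v → ρ (map (col B) v))
      equivariant ρ {τ} LS G H tG tH h v hv = cong ρ (trans (go v hv) (Lₚ.map-∘ v))
        where
        go : ∀ v → All (_∈ L) v → map (col H) v ≡ map (λ x → col G (τ x)) v
        go [] [] = refl
        go (x ∷ v) (x∈ ∷ hv) = cong₂ _∷_ (colourOf-τ LS h tG tH x∈) (go v hv)

      average-≤ : ∀ j (RA ρ : List (Fin m) → ℕ) {c C X Y} → c ≤ C * N j → ∑ (tuples {k} j) RA ≤ X →
        (∀ {B} → B ∈ Ts → ∑[ v ∈ tuples {k} j ] ρ (map (col B) v) ≤ Y) →
        c * ∑[ B ∈ Ts ] ∑[ v ∈ distinct {k} j ] (RA v * ρ (map (col B) v)) ≤ C * (X * (length Ts * Y))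
      average-≤ j RA ρ {c} {C} {X} {Y} hN hX hY = begin
        c * S ≤⟨ ℕₚ.*-monoˡ-≤ S hN ⟩
        C * N j * S ≡⟨ ℕₚ.*-assoc C (N j) S ⟩
        C * (N j * S) ≡⟨ cong (C *_) (average {k} j RA (λ B v → ρ (map (col B) v)) (equivariant ρ)) ⟩
        C * (∑ (distinct {k} j) RA * ∑[ B ∈ Ts ] ∑[ v ∈ distinct {k} j ] ρ (map (col B) v)) ≤⟨ ℕₚ.*-monoʳ-≤ C (ℕₚ.*-mono-≤ (ℕₚ.≤-trans (∑-distinct-≤ j RA) hX)
          (ℕₚ.≤-trans (∑-mono Ts (λ B B∈ → ℕₚ.≤-trans (∑-distinct-≤ j (λ v → ρ (map (col B) v))) (hY B∈))) (ℕₚ.≤-reflexive (∑-const Y Ts)))) ⟩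
        C * (X * (length Ts * Y)) ∎
        where
        open ℕₚ.≤-Reasoning
        S = ∑[ B ∈ Ts ] ∑[ v ∈ distinct {k} j ] (RA v * ρ (map (col B) v))

      average-≥ : ∀ (RA ρ : List (Fin m) → ℕ) {X Y} → X ≤ ∑ (distinct {k} 2) RA →
        (∀ {B} → B ∈ Ts → Y ≤ ∑[ v ∈ distinct {k} 2 ] ρ (map (col B) v)) →
        X * (length Ts * Y) ≤ n * n * ∑[ B ∈ Ts ] ∑[ v ∈ distinct {k} 2 ] (RA v * ρ (map (col B) v))
      average-≥ RA ρ {X} {Y} hX hY = begin
        X * (length Ts * Y) ≤⟨ ℕₚ.*-mono-≤ hX (ℕₚ.≤-trans (ℕₚ.≤-reflexive (sym (∑-const Y Ts))) (∑-mono Ts (λ B B∈ → hY B∈))) ⟩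
        ∑ (distinct {k} 2) RA * ∑[ B ∈ Ts ] ∑[ v ∈ distinct {k} 2 ] ρ (map (col B) v) ≡⟨ sym (average {k} 2 RA (λ B v → ρ (map (col B) v)) (equivariant ρ)) ⟩
        N 2 * S ≤⟨ ℕₚ.*-monoˡ-≤ S N₂-upper ⟩
        n * n * S ∎
        where
        open ℕₚ.≤-Reasoning
        S = ∑[ B ∈ Ts ] ∑[ v ∈ distinct {k} 2 ] (RA v * ρ (map (col B) v))

      private
        row : ∀ {B} → B ∈ Ts → ∀ c → ∑[ y ∈ L ] 𝟙 ⌊ col B y ≟ c ⌋ ≤ 2 * s
        row {B} B∈ = row-bound {B} (trees⇒isBinTree {k} B∈)

      collide : Graph m → Graph m → ℕ
      collide A B = ∑[ x ∈ L ] ∑[ y ∈ L ] (𝟙 (not ⌊ x ≟ y ⌋) * 𝟙 (bothᵇ (col A) (col B) x y))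

      collide-bound : 6 ≤ n → ∀ {A} → A ∈ Ts → ∑[ B ∈ Ts ] collide A B ≤ 8 * (s * s) * length Ts
      collide-bound 6≤n {A} A∈ = ℕₚ.*-cancelˡ-≤ (n * n) (begin
        n * n * ∑[ B ∈ Ts ] collide A B ≡⟨ cong (n * n *_) (∑-cong Ts (λ B _ → eq B)) ⟩
        n * n * ∑[ B ∈ Ts ] ∑[ v ∈ distinct {k} 2 ] (ρ₂ (map (col A) v) * ρ₂ (map (col B) v)) ≤⟨ average-≤ 2 (λ v → ρ₂ (map (col A) v)) ρ₂ {n * n} {2} (N₂ 6≤n) (Rows.sum₂ (col A) (2 * s) (row A∈)) (λ {B} B∈ → Rows.sum₂ (col B) (2 * s) (row B∈)) ⟩
        2 * (n * (2 * s) * (length Ts * (n * (2 * s)))) ≡⟨ lem n s (length Ts) ⟩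
        n * n * (8 * (s * s) * length Ts) ∎)
        where
        open ℕₚ.≤-Reasoning
        eq : ∀ B → collide A B ≡ ∑[ v ∈ distinct {k} 2 ] (ρ₂ (map (col A) v) * ρ₂ (map (col B) v))
        eq B = sym (trans (∑-distinct₂ (λ v → ρ₂ (map (col A) v) * ρ₂ (map (col B) v)))
          (∑-cong L (λ x _ → ∑-cong L (λ y _ → cong (𝟙 (not ⌊ x ≟ y ⌋) *_) (sym (𝟙-∧ {m} ⌊ col A x ≟ col A y ⌋ ⌊ col B x ≟ col B y ⌋))))))
        lem : ∀ n s t → 2 * (n * (2 * s) * (t * (n * (2 * s)))) ≡ n * n * (8 * (s * s) * t)
        lem = solve-∀

  -- Two different good pairs in conflict consist of four or of three different leaves; in the latter case they share a leaf in one of four ways.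
  module _ {m : ℕ} (q₃ : Fin m → Fin m → Fin m → ℕ) (q₄a q₄b : Fin m → Fin m → Fin m → Fin m → ℕ) where

    sixTerms : Fin m → Fin m → Fin m → Fin m → ℕ
    sixTerms x y z w = q₄a x y z w + (q₄b x y z w + (𝟙 ⌊ x ≟ z ⌋ * q₃ x y w + (𝟙 ⌊ x ≟ w ⌋ * q₃ x y z + (𝟙 ⌊ y ≟ z ⌋ * q₃ y x w + 𝟙 ⌊ y ≟ w ⌋ * q₃ y x z))))

    module _ (cA cB : Fin m → Fin m)
      (q₃-one : ∀ {a b c} → a ≢ b → a ≢ c → b ≢ c → cA a ≡ cA b → cA a ≡ cA c → cB a ≡ cB b → cB a ≡ cB c → q₃ a b c ≡ 1)
      (q₄a-one : ∀ {x y z w} → x ≢ y → x ≢ z → x ≢ w → y ≢ z → y ≢ w → z ≢ w → cA x ≡ cA y → cA z ≡ cA w → cB x ≡ cB y → cB z ≡ cB w → cA x ≡ cA z → q₄a x y z w ≡ 1)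
      (q₄b-one : ∀ {x y z w} → x ≢ y → x ≢ z → x ≢ w → y ≢ z → y ≢ w → z ≢ w → cA x ≡ cA y → cA z ≡ cA w → cB x ≡ cB y → cB z ≡ cB w → cB x ≡ cB z → q₄b x y z w ≡ 1) where

      sixTerms-≥1 : ∀ {x y z w} → toℕ x < toℕ y → toℕ z < toℕ w → cA x ≡ cA y → cA z ≡ cA w → cB x ≡ cB y → cB z ≡ cB w →
        ¬ (x ≡ z × y ≡ w) → cA x ≡ cA z ⊎ cB x ≡ cB z → 1 ≤ sixTerms x y z w
      sixTerms-≥1 {x} {y} {z} {w} xy zw A₁ A₂ B₁ B₂ diff conf = cases (x ≟ z) (x ≟ w) (y ≟ z) (y ≟ w)
        where
        x≢y : x ≢ y
        x≢y e = ℕₚ.<⇒≢ xy (cong toℕ e)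
        z≢w : z ≢ w
        z≢w e = ℕₚ.<⇒≢ zw (cong toℕ e)
        δ* : ∀ {x z : Fin m} {c} → x ≡ z → c ≡ 1 → 1 ≤ 𝟙 ⌊ x ≟ z ⌋ * c
        δ* {x} {z} e h = ℕₚ.≤-reflexive (sym (cong₂ _*_ (cong 𝟙 (⇒does (x ≟ z) e)) h))
        up₁ : ∀ {a} b → 1 ≤ a → 1 ≤ a + b
        up₁ {a} b h = ℕₚ.≤-trans h (ℕₚ.m≤m+n a b)
        up₂ : ∀ a {b} → 1 ≤ b → 1 ≤ a + b
        up₂ a {b} h = ℕₚ.≤-trans h (ℕₚ.m≤n+m b a)
        t₁ = q₄a x y z w
        t₂ = q₄b x y z w
        t₃ = 𝟙 ⌊ x ≟ z ⌋ * q₃ x y w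
        t₄ = 𝟙 ⌊ x ≟ w ⌋ * q₃ x y z
        t₅ = 𝟙 ⌊ y ≟ z ⌋ * q₃ y x w
        cases : Dec (x ≡ z) → Dec (x ≡ w) → Dec (y ≡ z) → Dec (y ≡ w) → 1 ≤ sixTerms x y z w
        cases (yes e) _ _ _ = up₂ t₁ (up₂ t₂ (up₁ _ (δ* e (q₃-one x≢y (λ q → z≢w (trans (sym e) q)) (λ q → diff (e , q))
          A₁ (trans (cong cA e) A₂) B₁ (trans (cong cB e) B₂)))))
        cases (no _) (yes e) _ _ = up₂ t₁ (up₂ t₂ (up₂ t₃ (up₁ _ (δ* e (q₃-one x≢y (λ q → z≢w (trans (sym q) e)) (λ q → ℕₚ.<-asym xy (subst₂ (λ a b → toℕ a < toℕ b) (sym q) (sym e) zw))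
          A₁ (trans (cong cA e) (sym A₂)) B₁ (trans (cong cB e) (sym B₂)))))))
        cases (no _) (no _) (yes e) _ = up₂ t₁ (up₂ t₂ (up₂ t₃ (up₂ t₄ (up₁ _ (δ* e (q₃-one (λ q → x≢y (sym q)) (λ q → z≢w (trans (sym e) q)) (λ q → ℕₚ.<-asym xy (subst₂ (λ a b → toℕ a < toℕ b) (sym e) (sym q) zw))
          (sym A₁) (trans (cong cA e) A₂) (sym B₁) (trans (cong cB e) B₂)))))))
        cases (no x≢z) (no _) (no _) (yes e) = up₂ t₁ (up₂ t₂ (up₂ t₃ (up₂ t₄ (up₂ t₅ (δ* e (q₃-one (λ q → x≢y (sym q)) (λ q → z≢w (trans (sym q) e)) x≢z
          (sym A₁) (trans (cong cA e) (sym A₂)) (sym B₁) (trans (cong cB e) (sym B₂))))))))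
        cases (no xz) (no xw) (no yz) (no yw) = [ (λ c → up₁ _ (ℕₚ.≤-reflexive (sym (q₄a-one x≢y xz xw yz yw z≢w A₁ A₂ B₁ B₂ c)))) ,
          (λ c → up₂ t₁ (up₁ _ (ℕₚ.≤-reflexive (sym (q₄b-one x≢y xz xw yz yw z≢w A₁ A₂ B₁ B₂ c))))) ]′ conf

  module Bounds {k : ℕ} (s : ℕ) (1<s : 1 < s) where

    open Coloured {k} s 1<s
    open Avg {k} s 1<s

    private
      n = suc k
      m = V n

      L : List (Fin m)
      L = labels {k}

      Ts : List (Graph m)
      Ts = trees n

      col : Graph m → Fin m → Fin m
      col = colourOf

      isT : ∀ {B} → B ∈ Ts → isBinTree n B ≡ true
      isT = trees⇒isBinTree {k}

      row : ∀ {B} → B ∈ Ts → ∀ c → ∑[ y ∈ L ] 𝟙 ⌊ col B y ≟ c ⌋ ≤ 2 * s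
      row {B} B∈ = row-bound {B} (isT B∈)

    gd : (Fin m → Fin m) → Fin m → Fin m → Bool
    gd f x y = ⌊ f x ≟ f y ⌋ ∧ not ⌊ f x ≟ root {k} ⌋

    ltᵇ : Fin m → Fin m → Bool
    ltᵇ x y = toℕ x <ᵇ toℕ y

    gd-sym : ∀ f x y → gd f x y ≡ gd f y x
    gd-sym f x y = Bool-≡ (flip′ x y) (flip′ y x)
      where
      flip′ : ∀ x y → gd f x y ≡ true → gd f y x ≡ true
      flip′ x y e with ∧-split {⌊ f x ≟ f y ⌋} e
      ... | a , b = cong₂ _∧_ (⇒does (f y ≟ f x) (sym (does⇒ (f x ≟ f y) a))) (subst (λ z → not ⌊ z ≟ root {k} ⌋ ≡ true) (does⇒ (f x ≟ f y) a) b)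

    ltρ : List (Fin m) → ℕ
    ltρ (x ∷ y ∷ []) = 𝟙 (ltᵇ x y)
    ltρ _ = 0

    lt⇒≢ : ∀ {x y} → ltᵇ x y ≡ true → x ≢ y
    lt⇒≢ {x} e refl = ℕₚ.<-irrefl refl (≤ᵇ-elim {suc (toℕ x)} {toℕ x} e)

    lt⇒< : ∀ {x y} → ltᵇ x y ≡ true → toℕ x < toℕ y
    lt⇒< {x} {y} e = ≤ᵇ-elim {suc (toℕ x)} {toℕ y} e

    lt-half : ∀ f → 2 * ∑[ v ∈ distinct {k} 2 ] (ltρ v * ρg {k} (map f v)) ≡ ∑[ v ∈ distinct {k} 2 ] ρg {k} (map f v)
    lt-half f = begin
      2 * ∑[ v ∈ distinct {k} 2 ] (ltρ v * ρg {k} (map f v)) ≡⟨ cong (2 *_) (∑-distinct₂ {k} (λ v → ltρ v * ρg {k} (map f v))) ⟩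
      2 * S ≡⟨ cong (S +_) (ℕₚ.+-identityʳ S) ⟩
      S + S ≡⟨ cong (S +_) (trans (∑-swap term L L) (∑-cong L (λ y _ → ∑-cong L (λ x _ → flipped x y)))) ⟩
      S + ∑[ y ∈ L ] ∑[ x ∈ L ] (𝟙 (not ⌊ y ≟ x ⌋) * (𝟙 (ltᵇ x y) * 𝟙 (gd f y x))) ≡⟨ sym (trans (∑-cong L (λ x _ → ∑-+ (term x) (term′ x) L)) (∑-+ (λ x → ∑ L (term x)) (λ x → ∑ L (term′ x)) L)) ⟩
      ∑[ x ∈ L ] ∑[ y ∈ L ] (term x y + term′ x y) ≡⟨ ∑-cong L (λ x _ → ∑-cong L (λ y _ → pt x y)) ⟩
      ∑[ x ∈ L ] ∑[ y ∈ L ] (𝟙 (not ⌊ x ≟ y ⌋) * 𝟙 (gd f x y)) ≡⟨ sym (∑-distinct₂ {k} (λ v → ρg {k} (map f v))) ⟩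
      ∑[ v ∈ distinct {k} 2 ] ρg {k} (map f v) ∎
      where
      open ≡-Reasoning
      term term′ : Fin m → Fin m → ℕ
      term x y = 𝟙 (not ⌊ x ≟ y ⌋) * (𝟙 (ltᵇ x y) * 𝟙 (gd f x y))
      term′ x y = 𝟙 (not ⌊ x ≟ y ⌋) * (𝟙 (ltᵇ y x) * 𝟙 (gd f x y))
      S = ∑[ x ∈ L ] ∑[ y ∈ L ] term x y
      flipped : ∀ x y → term x y ≡ term′ y x
      flipped x y = cong₂ (λ a b → 𝟙 (not a) * (𝟙 (ltᵇ x y) * 𝟙 b)) (≟-comm x y) (gd-sym f x y)
      pt : ∀ x y → term x y + term′ x y ≡ 𝟙 (not ⌊ x ≟ y ⌋) * 𝟙 (gd f x y)
      pt x y with x ≟ y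
      ... | yes _ = refl
      ... | no ne with ltᵇ x y in e₁ | ltᵇ y x in e₂
      ...   | true  | false = lem (𝟙 (gd f x y))
        where
        lem : ∀ a → (a + 0) + 0 + 0 ≡ a + 0
        lem = solve-∀
      ...   | false | true  = lem (𝟙 (gd f x y))
        where
        lem : ∀ a → (a + 0) + 0 ≡ a + 0
        lem = solve-∀
      ...   | true  | true  = ⊥-elim (ℕₚ.<-asym (lt⇒< {x} {y} e₁) (lt⇒< {y} {x} e₂))
      ...   | false | false = ⊥-elim (neither (ℕₚ.<-cmp (toℕ x) (toℕ y)))
        where
        neither : Tri (toℕ x < toℕ y) (toℕ x ≡ toℕ y) (toℕ y < toℕ x) → ⊥
        neither (tri< a _ _) = true≢false (≤ᵇ-true {suc (toℕ x)} {toℕ y} a) e₁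
        neither (tri≈ _ b _) = ne (𝔽ₚ.toℕ-injective b)
        neither (tri> _ _ c) = true≢false (≤ᵇ-true {suc (toℕ y)} {toℕ x} c) e₂

    good-lower : 4 ≤ s → 4 * s ≤ n → ∀ {B} → B ∈ Ts → s * n ≤ ∑[ v ∈ distinct {k} 2 ] (2 * ρg {k} (map (col B) v))
    good-lower 4≤s 4s≤n {B} B∈ = subst (s * n ≤_) (sym (∑-*ˡ 2 (λ v → ρg {k} (map f v)) (distinct {k} 2))) (ℕₚ.*-cancelˡ-≤ 2 (ℕₚ.+-cancelʳ-≤ (s * n + s * n) _ _ (begin
      2 * (s * n) + (s * n + s * n) ≡⟨ l₁ (s * n) ⟩
      4 * (s * n) ≤⟨ ℕₚ.*-monoʳ-≤ 4 main ⟩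
      4 * (D + n + s * s) ≡⟨ l₂ D n s ⟩
      2 * (2 * D) + (4 * n + s * (4 * s)) ≤⟨ ℕₚ.+-monoʳ-≤ (2 * (2 * D)) (ℕₚ.+-mono-≤ (ℕₚ.*-monoˡ-≤ n 4≤s) (ℕₚ.*-monoʳ-≤ s 4s≤n)) ⟩
      2 * (2 * D) + (s * n + s * n) ∎)))
      where
      open ℕₚ.≤-Reasoning
      f = col B
      D = ∑[ v ∈ distinct {k} 2 ] ρg {k} (map f v)
      l₁ : ∀ a → 2 * a + (a + a) ≡ 4 * a
      l₁ = solve-∀
      l₂ : ∀ d n s → 4 * (d + n + s * s) ≡ 2 * (2 * d) + (4 * n + s * (4 * s))
      l₂ = solve-∀
      diag : ∀ x → ∑[ y ∈ L ] 𝟙 (gd f x y) ≤ ∑[ y ∈ L ] (𝟙 (not ⌊ x ≟ y ⌋) * 𝟙 (gd f x y)) + 1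
      diag x = ℕₚ.≤-trans (∑-mono L (λ y _ → pt ⌊ x ≟ y ⌋ (gd f x y))) (ℕₚ.≤-trans (ℕₚ.≤-reflexive (∑-+ (λ y → 𝟙 (not ⌊ x ≟ y ⌋) * 𝟙 (gd f x y)) (λ y → 𝟙 ⌊ x ≟ y ⌋ * 1) L))
        (ℕₚ.+-monoʳ-≤ (∑[ y ∈ L ] (𝟙 (not ⌊ x ≟ y ⌋) * 𝟙 (gd f x y))) (∑-δ-≤ (λ _ → 1) x (labels-unique {k}))))
        where
        pt : ∀ a b → 𝟙 b ≤ 𝟙 (not a) * 𝟙 b + 𝟙 a * 1
        pt true  b = 𝟙≤1 b
        pt false b = ℕₚ.≤-trans (ℕₚ.m≤m+n (𝟙 b) 0) (ℕₚ.m≤m+n (𝟙 b + 0) 0)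
      main : s * n ≤ D + n + s * s
      main = ℕₚ.≤-trans (good-bound {B} (isT B∈)) (ℕₚ.+-monoˡ-≤ (s * s) (ℕₚ.≤-trans (∑-mono L (λ x _ → diag x))
        (ℕₚ.≤-reflexive (trans (∑-+ (λ x → ∑[ y ∈ L ] (𝟙 (not ⌊ x ≟ y ⌋) * 𝟙 (gd f x y))) (λ _ → 1) L)
          (cong₂ _+_ (sym (∑-distinct₂ {k} (λ v → ρg {k} (map f v)))) (trans (∑-const 1 L) (trans (ℕₚ.*-identityʳ _) (labels-length {k}))))))))

    module _ (A B : Graph m) where

      private
        cA = col A
        cB = col B

      goodCount : ℕ
      goodCount = ∑[ v ∈ distinct {k} 2 ] (ltρ v * ρg {k} (map cA v) * ρg {k} (map cB v))

      sel : Fin m × Fin m → Bool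
      sel (x , y) = ltᵇ x y ∧ (gd cA x y ∧ gd cB x y)

      pairsE : List (Fin m × Fin m)
      pairsE = filterᵇ sel (cartesianProduct L L)

      conf ne : Fin m × Fin m → Fin m × Fin m → Bool
      conf (x , y) (z , w) = ⌊ cA x ≟ cA z ⌋ ∨ ⌊ cB x ≟ cB z ⌋
      ne (x , y) (z , w) = not (⌊ x ≟ z ⌋ ∧ ⌊ y ≟ w ⌋)

      confSum : ℕ
      confSum = ∑[ e ∈ pairsE ] ∑[ e′ ∈ pairsE ] (𝟙 (ne e e′) * 𝟙 (conf e e′))

      pairsE-length : length pairsE ≡ goodCount
      pairsE-length = trans (length-filter sel (cartesianProduct L L)) (trans (∑-cartesian (λ e → 𝟙 (sel e)) L L)
        (trans (∑-cong L (λ x _ → ∑-cong L (λ y _ → pt x y))) (sym (∑-distinct₂ {k} (λ v → ltρ v * ρg {k} (map cA v) * ρg {k} (map cB v))))))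
        where
        pt : ∀ x y → 𝟙 (sel (x , y)) ≡ 𝟙 (not ⌊ x ≟ y ⌋) * (𝟙 (ltᵇ x y) * 𝟙 (gd cA x y) * 𝟙 (gd cB x y))
        pt x y with ltᵇ x y in e
        ... | false = sym (ℕₚ.*-zeroʳ (𝟙 (not ⌊ x ≟ y ⌋)))
        ... | true = trans (𝟙-∧ {m} (gd cA x y) (gd cB x y)) (trans (lem (𝟙 (gd cA x y)) (𝟙 (gd cB x y)))
          (cong (λ b → 𝟙 (not b) * ((𝟙 (gd cA x y) + 0) * 𝟙 (gd cB x y))) (sym (¬does⇒ (x ≟ y) (lt⇒≢ {x} {y} e)))))
          where
          lem : ∀ a b → a * b ≡ (a + 0) * b + 0
          lem = solve-∀

      selected : ∀ {x y} → (x , y) ∈ pairsE → ltᵇ x y ≡ true × x ∈ L × y ∈ L × gd cA x y ≡ true × gd cB x y ≡ true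
      selected {x} {y} i with ∈-filter⁻ sel (cartesianProduct L L) i
      ... | c , h with ∈ₚ.∈-cartesianProduct⁻ L L c | ∧-split {ltᵇ x y} h
      ...   | x∈ , y∈ | a , b = let (u , v) = ∧-split {gd cA x y} b in a , x∈ , y∈ , u , v

      gd⇒ : ∀ {f x y} → gd f x y ≡ true → f x ≡ f y × f x ≢ root {k}
      gd⇒ {f} {x} {y} e with ∧-split {⌊ f x ≟ f y ⌋} e
      ... | a , b = does⇒ (f x ≟ f y) a , λ q → true≢false (⇒does (f x ≟ root {k}) q) (trans (sym (𝔹ₚ.not-involutive _)) (cong not b))

      distance-upper : ∀ χ {d} → isBinTree n A ≡ true → isBinTree n B ≡ true → (∀ j → Steps n χ j A B → d ≤ j) → d + goodCount ≤ n + confSum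
      distance-upper χ {d} hA hB dmin = finish (independent ne conf pairsE distinct-ne (Unique-filter sel (Uₚ.cartesianProduct⁺ (labels-unique {k}) (labels-unique {k}))))
        where
        distinct-ne : ∀ {e e′} → e ∈ pairsE → e′ ∈ pairsE → e ≢ e′ → ne e e′ ≡ true
        distinct-ne {x , y} {z , w} _ _ h = cong not (≢true⇒≡false (λ q → let (a , b) = ⌊≟⌋∧⇒ {i = x} {y} {z} {w} q in h (cong₂ _,_ a b)))
        ∨-falseˡ : ∀ {a b} → a ∨ b ≡ false → a ≡ false
        ∨-falseˡ {false} _ = refl
        ∨-falseʳ : ∀ a {b} → a ∨ b ≡ false → b ≡ false
        ∨-falseʳ false e = e
        finish : ∃[ Q ] ((∀ {q} → q ∈ Q → q ∈ pairsE) × AllPairs (λ q q′ → conf q q′ ≡ false) Q × length pairsE ≤ length Q + confSum) → d + goodCount ≤ n + confSum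
        finish (Q , sub , ap , le) = begin
          d + goodCount ≤⟨ ℕₚ.+-mono-≤ (dmin (proj₁ res) (proj₂ (proj₂ res))) (ℕₚ.≤-trans (ℕₚ.≤-reflexive (sym pairsE-length)) le) ⟩
          proj₁ res + (length Q + confSum) ≡⟨ sym (ℕₚ.+-assoc (proj₁ res) (length Q) confSum) ⟩
          proj₁ res + length Q + confSum ≤⟨ ℕₚ.+-monoˡ-≤ confSum (proj₁ (proj₂ res)) ⟩
          n + confSum ∎
          where
          open ℕₚ.≤-Reasoning
          res : ∃[ j ] (j + length Q ≤ n × Steps n χ j A B)
          res = pairs-upper χ hA hB Q (λ i → let (a , b , c , _) = selected (sub i) in lt⇒< a , b , c)
            ((λ i → let (_ , _ , _ , g , _) = selected (sub i) in gd⇒ {cA} g) , Data.List.Relation.Unary.AllPairs.map (λ {q} {q′} h e → true≢false (⇒does (cA (proj₁ q) ≟ cA (proj₁ q′)) e) (∨-falseˡ h)) ap)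
            ((λ i → let (_ , _ , _ , _ , g) = selected (sub i) in gd⇒ {cB} g) , Data.List.Relation.Unary.AllPairs.map (λ {q} {q′} h e → true≢false (⇒does (cB (proj₁ q) ≟ cB (proj₁ q′)) e) (∨-falseʳ ⌊ cA (proj₁ q) ≟ cA (proj₁ q′) ⌋ h)) ap)

      q₃ q₄a q₄b : List (Fin m) → ℕ
      q₃ v = 𝟙 (uniqᵇ {k} v) * (ρ₃ {k} (map cA v) * ρ₃ {k} (map cB v))
      q₄a v = 𝟙 (uniqᵇ {k} v) * (ρs {k} (map cA v) * ρp {k} (map cB v))
      q₄b v = 𝟙 (uniqᵇ {k} v) * (ρp {k} (map cA v) * ρs {k} (map cB v))

      H₃ H₄a H₄b : ℕ
      H₃ = ∑[ v ∈ distinct {k} 3 ] (ρ₃ {k} (map cA v) * ρ₃ {k} (map cB v))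
      H₄a = ∑[ v ∈ distinct {k} 4 ] (ρs {k} (map cA v) * ρp {k} (map cB v))
      H₄b = ∑[ v ∈ distinct {k} 4 ] (ρp {k} (map cA v) * ρs {k} (map cB v))

      private
        one : ∀ {a b : Fin m} → a ≡ b → 𝟙 ⌊ a ≟ b ⌋ ≡ 1
        one {a} {b} e = cong 𝟙 (⇒does (a ≟ b) e)

        prod-one : ∀ {u x y} → u ≡ true → x ≡ 1 → y ≡ 1 → 𝟙 u * (x * y) ≡ 1
        prod-one refl refl refl = refl

        q₃-one : ∀ {a b c} → a ≢ b → a ≢ c → b ≢ c → cA a ≡ cA b → cA a ≡ cA c → cB a ≡ cB b → cB a ≡ cB c → q₃ (a ∷ b ∷ c ∷ []) ≡ 1
        q₃-one {a} {b} {c} ab ac bc p q p′ q′ = prod-one (⇒uniqᵇ {k} (a ∷ b ∷ c ∷ []) ((ab ∷ ac ∷ []) ∷ (bc ∷ []) ∷ [] ∷ []))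
          (cong₂ _*_ (one p) (one q)) (cong₂ _*_ (one p′) (one q′))

        uniq₄ : ∀ {x y z w : Fin m} → x ≢ y → x ≢ z → x ≢ w → y ≢ z → y ≢ w → z ≢ w → uniqᵇ {k} (x ∷ y ∷ z ∷ w ∷ []) ≡ true
        uniq₄ {x} {y} {z} {w} xy xz xw yz yw zw = ⇒uniqᵇ {k} (x ∷ y ∷ z ∷ w ∷ []) ((xy ∷ xz ∷ xw ∷ []) ∷ (yz ∷ yw ∷ []) ∷ (zw ∷ []) ∷ [] ∷ [])

        q₄a-one : ∀ {x y z w} → x ≢ y → x ≢ z → x ≢ w → y ≢ z → y ≢ w → z ≢ w →
          cA x ≡ cA y → cA z ≡ cA w → cB x ≡ cB y → cB z ≡ cB w → cA x ≡ cA z → q₄a (x ∷ y ∷ z ∷ w ∷ []) ≡ 1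
        q₄a-one xy xz xw yz yw zw A₁ A₂ B₁ B₂ c = prod-one (uniq₄ xy xz xw yz yw zw)
          (cong₂ _*_ (one A₁) (cong₂ _*_ (one c) (one (trans c A₂)))) (cong₂ _*_ (one B₁) (one B₂))

        q₄b-one : ∀ {x y z w} → x ≢ y → x ≢ z → x ≢ w → y ≢ z → y ≢ w → z ≢ w →
          cA x ≡ cA y → cA z ≡ cA w → cB x ≡ cB y → cB z ≡ cB w → cB x ≡ cB z → q₄b (x ∷ y ∷ z ∷ w ∷ []) ≡ 1
        q₄b-one xy xz xw yz yw zw A₁ A₂ B₁ B₂ c = prod-one (uniq₄ xy xz xw yz yw zw)
          (cong₂ _*_ (one A₁) (one A₂)) (cong₂ _*_ (one B₁) (cong₂ _*_ (one c) (one (trans c B₂))))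

        six : Fin m → Fin m → Fin m → Fin m → ℕ
        six = sixTerms (λ x y z → q₃ (x ∷ y ∷ z ∷ [])) (λ x y z w → q₄a (x ∷ y ∷ z ∷ w ∷ [])) (λ x y z w → q₄b (x ∷ y ∷ z ∷ w ∷ []))

        six-bound : ∀ x y z w → 𝟙 (sel (x , y)) * (𝟙 (sel (z , w)) * (𝟙 (ne (x , y) (z , w)) * 𝟙 (conf (x , y) (z , w)))) ≤ six x y z w
        six-bound x y z w = 𝟙⁴-≤ go
          where
          go : sel (x , y) ≡ true → sel (z , w) ≡ true → ne (x , y) (z , w) ≡ true → conf (x , y) (z , w) ≡ true → 1 ≤ six x y z w
          go s₁ s₂ h c = sixTerms-≥1 (λ x y z → q₃ (x ∷ y ∷ z ∷ [])) (λ x y z w → q₄a (x ∷ y ∷ z ∷ w ∷ [])) (λ x y z w → q₄b (x ∷ y ∷ z ∷ w ∷ []))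
            cA cB q₃-one q₄a-one q₄b-one (lt⇒< {x} {y} (proj₁ t₁)) (lt⇒< {z} {w} (proj₁ t₂))
            (proj₁ (gd⇒ {cA} {x} {y} (proj₁ g₁))) (proj₁ (gd⇒ {cA} {z} {w} (proj₁ g₂))) (proj₁ (gd⇒ {cB} {x} {y} (proj₂ g₁))) (proj₁ (gd⇒ {cB} {z} {w} (proj₂ g₂)))
            (λ (e , e′) → true≢false (⇒⌊≟⌋∧ {i = x} {y} {z} {w} e e′) (trans (sym (𝔹ₚ.not-involutive _)) (cong not h)))
            (⊎-map (does⇒ (cA x ≟ cA z)) (does⇒ (cB x ≟ cB z)) (∨-split {⌊ cA x ≟ cA z ⌋} c))
            where
            t₁ = ∧-split {ltᵇ x y} {gd cA x y ∧ gd cB x y} s₁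
            t₂ = ∧-split {ltᵇ z w} {gd cA z w ∧ gd cB z w} s₂
            g₁ = ∧-split {gd cA x y} {gd cB x y} (proj₂ t₁)
            g₂ = ∧-split {gd cA z w} {gd cB z w} (proj₂ t₂)

        ∑₄ : (Fin m → Fin m → Fin m → Fin m → ℕ) → ℕ
        ∑₄ φ = ∑[ x ∈ L ] ∑[ y ∈ L ] ∑[ z ∈ L ] ∑[ w ∈ L ] φ x y z w

        ∑₄-+ : ∀ φ ψ → ∑₄ (λ x y z w → φ x y z w + ψ x y z w) ≡ ∑₄ φ + ∑₄ ψ
        ∑₄-+ φ ψ = trans (∑-cong L (λ x _ → trans (∑-cong L (λ y _ → trans (∑-cong L (λ z _ → ∑-+ (φ x y z) (ψ x y z) L))
          (∑-+ (λ z → ∑ L (φ x y z)) (λ z → ∑ L (ψ x y z)) L))) (∑-+ (λ y → ∑[ z ∈ L ] ∑ L (φ x y z)) (λ y → ∑[ z ∈ L ] ∑ L (ψ x y z)) L)))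
          (∑-+ (λ x → ∑[ y ∈ L ] ∑[ z ∈ L ] ∑ L (φ x y z)) (λ x → ∑[ y ∈ L ] ∑[ z ∈ L ] ∑ L (ψ x y z)) L)

        ∑₄-mono : ∀ {φ ψ} → (∀ x y z w → φ x y z w ≤ ψ x y z w) → ∑₄ φ ≤ ∑₄ ψ
        ∑₄-mono h = ∑-mono L (λ x _ → ∑-mono L (λ y _ → ∑-mono L (λ z _ → ∑-mono L (λ w _ → h x y z w))))

        S₃ : ℕ
        S₃ = ∑[ x ∈ L ] ∑[ y ∈ L ] ∑[ z ∈ L ] q₃ (x ∷ y ∷ z ∷ [])

        δ-out : ∀ (a : Fin m) (φ : Fin m → ℕ) → ∑[ z ∈ L ] ∑[ w ∈ L ] (𝟙 ⌊ a ≟ z ⌋ * φ w) ≤ ∑ L φ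
        δ-out a φ = ℕₚ.≤-trans (ℕₚ.≤-reflexive (∑-cong L (λ z _ → ∑-*ˡ (𝟙 ⌊ a ≟ z ⌋) φ L))) (∑-δ-≤ (λ _ → ∑ L φ) a (labels-unique {k}))

        δ-in : ∀ (a : Fin m) (φ : Fin m → ℕ) → ∑[ z ∈ L ] ∑[ w ∈ L ] (𝟙 ⌊ a ≟ w ⌋ * φ z) ≤ ∑ L φ
        δ-in a φ = ∑-mono L (λ z _ → ∑-δ-≤ (λ _ → φ z) a (labels-unique {k}))

        d₃ : ∑₄ (λ x y z w → 𝟙 ⌊ x ≟ z ⌋ * q₃ (x ∷ y ∷ w ∷ [])) ≤ S₃
        d₃ = ∑-mono L (λ x _ → ∑-mono L (λ y _ → δ-out x (λ w → q₃ (x ∷ y ∷ w ∷ []))))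
        d₄ : ∑₄ (λ x y z w → 𝟙 ⌊ x ≟ w ⌋ * q₃ (x ∷ y ∷ z ∷ [])) ≤ S₃
        d₄ = ∑-mono L (λ x _ → ∑-mono L (λ y _ → δ-in x (λ z → q₃ (x ∷ y ∷ z ∷ []))))
        d₅ : ∑₄ (λ x y z w → 𝟙 ⌊ y ≟ z ⌋ * q₃ (y ∷ x ∷ w ∷ [])) ≤ S₃
        d₅ = ℕₚ.≤-trans (∑-mono L (λ x _ → ∑-mono L (λ y _ → δ-out y (λ w → q₃ (y ∷ x ∷ w ∷ []))))) (ℕₚ.≤-reflexive (∑-swap (λ x y → ∑[ w ∈ L ] q₃ (y ∷ x ∷ w ∷ [])) L L))
        d₆ : ∑₄ (λ x y z w → 𝟙 ⌊ y ≟ w ⌋ * q₃ (y ∷ x ∷ z ∷ [])) ≤ S₃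
        d₆ = ℕₚ.≤-trans (∑-mono L (λ x _ → ∑-mono L (λ y _ → δ-in y (λ z → q₃ (y ∷ x ∷ z ∷ []))))) (ℕₚ.≤-reflexive (∑-swap (λ x y → ∑[ w ∈ L ] q₃ (y ∷ x ∷ w ∷ [])) L L))

        S₃≡ : S₃ ≡ H₃
        S₃≡ = trans (sym (∑-tuples₃ {k} q₃)) (sym (∑-filter (uniqᵇ {k}) (λ v → ρ₃ {k} (map cA v) * ρ₃ {k} (map cB v)) (tuples {k} 3)))
        S₄a≡ : ∑₄ (λ x y z w → q₄a (x ∷ y ∷ z ∷ w ∷ [])) ≡ H₄a
        S₄a≡ = trans (sym (∑-tuples₄ {k} q₄a)) (sym (∑-filter (uniqᵇ {k}) (λ v → ρs {k} (map cA v) * ρp {k} (map cB v)) (tuples {k} 4)))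
        S₄b≡ : ∑₄ (λ x y z w → q₄b (x ∷ y ∷ z ∷ w ∷ [])) ≡ H₄b
        S₄b≡ = trans (sym (∑-tuples₄ {k} q₄b)) (sym (∑-filter (uniqᵇ {k}) (λ v → ρp {k} (map cA v) * ρs {k} (map cB v)) (tuples {k} 4)))

        confSum-expand : confSum ≡ ∑₄ (λ x y z w → 𝟙 (sel (x , y)) * (𝟙 (sel (z , w)) * (𝟙 (ne (x , y) (z , w)) * 𝟙 (conf (x , y) (z , w)))))
        confSum-expand = trans (∑-filter sel (λ e → ∑[ e′ ∈ pairsE ] (𝟙 (ne e e′) * 𝟙 (conf e e′))) (cartesianProduct L L))
          (trans (∑-cartesian (λ e → 𝟙 (sel e) * ∑[ e′ ∈ pairsE ] (𝟙 (ne e e′) * 𝟙 (conf e e′))) L L) (∑-cong L (λ x _ → ∑-cong L (λ y _ → inner′ (x , y)))))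
          where
          inner′ : ∀ e → 𝟙 (sel e) * ∑[ e′ ∈ pairsE ] (𝟙 (ne e e′) * 𝟙 (conf e e′)) ≡ ∑[ z ∈ L ] ∑[ w ∈ L ] (𝟙 (sel e) * (𝟙 (sel (z , w)) * (𝟙 (ne e (z , w)) * 𝟙 (conf e (z , w)))))
          inner′ e = trans (cong (𝟙 (sel e) *_) (trans (∑-filter sel (λ e′ → 𝟙 (ne e e′) * 𝟙 (conf e e′)) (cartesianProduct L L)) (∑-cartesian (λ e′ → 𝟙 (sel e′) * (𝟙 (ne e e′) * 𝟙 (conf e e′))) L L)))
            (trans (sym (∑-*ˡ (𝟙 (sel e)) (λ z → ∑[ w ∈ L ] (𝟙 (sel (z , w)) * (𝟙 (ne e (z , w)) * 𝟙 (conf e (z , w))))) L))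
              (∑-cong L (λ z _ → sym (∑-*ˡ (𝟙 (sel e)) (λ w → 𝟙 (sel (z , w)) * (𝟙 (ne e (z , w)) * 𝟙 (conf e (z , w)))) L))))

      confSum-bound : confSum ≤ H₄a + (H₄b + 4 * H₃)
      confSum-bound = begin
        confSum ≡⟨ confSum-expand ⟩
        ∑₄ _ ≤⟨ ∑₄-mono six-bound ⟩
        ∑₄ six ≡⟨ trans (∑₄-+ f₁ _) (cong (∑₄ f₁ +_) (trans (∑₄-+ f₂ _) (cong (∑₄ f₂ +_) (trans (∑₄-+ f₃ _) (cong (∑₄ f₃ +_) (trans (∑₄-+ f₄ _) (cong (∑₄ f₄ +_) (∑₄-+ f₅ f₆)))))))) ⟩
        ∑₄ f₁ + (∑₄ f₂ + (∑₄ f₃ + (∑₄ f₄ + (∑₄ f₅ + ∑₄ f₆)))) ≤⟨ ℕₚ.+-mono-≤ (ℕₚ.≤-reflexive S₄a≡) (ℕₚ.+-mono-≤ (ℕₚ.≤-reflexive S₄b≡) (ℕₚ.+-mono-≤ d₃ (ℕₚ.+-mono-≤ d₄ (ℕₚ.+-mono-≤ d₅ d₆)))) ⟩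
        H₄a + (H₄b + (S₃ + (S₃ + (S₃ + S₃)))) ≡⟨ cong (λ z → H₄a + (H₄b + z)) (trans (lem S₃) (cong (4 *_) S₃≡)) ⟩
        H₄a + (H₄b + 4 * H₃) ∎
        where
        open ℕₚ.≤-Reasoning
        f₁ f₂ f₃ f₄ f₅ f₆ : Fin m → Fin m → Fin m → Fin m → ℕ
        f₁ x y z w = q₄a (x ∷ y ∷ z ∷ w ∷ [])
        f₂ x y z w = q₄b (x ∷ y ∷ z ∷ w ∷ [])
        f₃ x y z w = 𝟙 ⌊ x ≟ z ⌋ * q₃ (x ∷ y ∷ w ∷ [])
        f₄ x y z w = 𝟙 ⌊ x ≟ w ⌋ * q₃ (x ∷ y ∷ z ∷ [])
        f₅ x y z w = 𝟙 ⌊ y ≟ z ⌋ * q₃ (y ∷ x ∷ w ∷ [])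
        f₆ x y z w = 𝟙 ⌊ y ≟ w ⌋ * q₃ (y ∷ x ∷ z ∷ [])
        lem : ∀ a → a + (a + (a + a)) ≡ 4 * a
        lem = solve-∀

  abstract

    K₀ : ℕ
    K₀ = 16 * 768

    K₀-value : K₀ ≡ 16 * 768
    K₀-value = refl

  module Totals {k : ℕ} (s : ℕ) (1<s : 1 < s) where

    open Coloured {k} s 1<s
    open Avg {k} s 1<s
    open Bounds {k} s 1<s

    private
      n = suc k
      m = V n

      Ts : List (Graph m)
      Ts = trees n

      T = length Ts

      col : Graph m → Fin m → Fin m
      col = colourOf

      isT : ∀ {B} → B ∈ Ts → isBinTree n B ≡ true
      isT = trees⇒isBinTree {k}

      row : ∀ {B} → B ∈ Ts → ∀ c → ∑[ y ∈ labels {k} ] 𝟙 ⌊ col B y ≟ c ⌋ ≤ 2 * s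
      row {B} B∈ = row-bound {B} (isT B∈)

      M = 2 * s

    module _ (6≤n : 6 ≤ n) {A : Graph m} (A∈ : A ∈ Ts) where

      private
        module RA = Rows {k} (col A) M (row A∈)
        module RB {B} (B∈ : B ∈ Ts) = Rows {k} (col B) M (row B∈)

      H₃-total : n * ∑[ B ∈ Ts ] H₃ A B ≤ 64 * (s * s * s * s) * T
      H₃-total = ℕₚ.*-cancelˡ-≤ (n * n) (begin
        n * n * (n * X) ≡⟨ sym (ℕₚ.*-assoc (n * n) n X) ⟩
        n * n * n * X ≤⟨ average-≤ 3 (λ v → ρ₃ {k} (map (col A) v)) (ρ₃ {k}) {n * n * n} {4} (N₃ {k} 6≤n) RA.sum₃ (λ B∈ → RB.sum₃ B∈) ⟩
        4 * (n * (M * M) * (T * (n * (M * M)))) ≡⟨ lem n s T ⟩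
        n * n * (64 * (s * s * s * s) * T) ∎)
        where
        open ℕₚ.≤-Reasoning
        X = ∑[ B ∈ Ts ] H₃ A B
        lem : ∀ n s t → 4 * (n * (2 * s * (2 * s)) * (t * (n * (2 * s * (2 * s))))) ≡ n * n * (64 * (s * s * s * s) * t)
        lem = solve-∀

      H₄a-total : n * ∑[ B ∈ Ts ] H₄a A B ≤ 256 * (s * s * s * s * s) * T
      H₄a-total = ℕₚ.*-cancelˡ-≤ (n * n * n) (begin
        n * n * n * (n * X) ≡⟨ sym (ℕₚ.*-assoc (n * n * n) n X) ⟩
        n * n * n * n * X ≤⟨ average-≤ 4 (λ v → ρs {k} (map (col A) v)) (ρp {k}) {n * n * n * n} {8} (N₄ {k} 6≤n) RA.sumS (λ B∈ → RB.sumP B∈) ⟩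
        8 * (n * (M * (M * M)) * (T * (n * (M * (n * M))))) ≡⟨ lem n s T ⟩
        n * n * n * (256 * (s * s * s * s * s) * T) ∎)
        where
        open ℕₚ.≤-Reasoning
        X = ∑[ B ∈ Ts ] H₄a A B
        lem : ∀ n s t → 8 * (n * (2 * s * (2 * s * (2 * s))) * (t * (n * (2 * s * (n * (2 * s)))))) ≡ n * n * n * (256 * (s * s * s * s * s) * t)
        lem = solve-∀

      H₄b-total : n * ∑[ B ∈ Ts ] H₄b A B ≤ 256 * (s * s * s * s * s) * T
      H₄b-total = ℕₚ.*-cancelˡ-≤ (n * n * n) (begin
        n * n * n * (n * X) ≡⟨ sym (ℕₚ.*-assoc (n * n * n) n X) ⟩
        n * n * n * n * X ≤⟨ average-≤ 4 (λ v → ρp {k} (map (col A) v)) (ρs {k}) {n * n * n * n} {8} (N₄ {k} 6≤n) RA.sumP (λ B∈ → RB.sumS B∈) ⟩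
        8 * (n * (M * (n * M)) * (T * (n * (M * (M * M))))) ≡⟨ lem n s T ⟩
        n * n * n * (256 * (s * s * s * s * s) * T) ∎)
        where
        open ℕₚ.≤-Reasoning
        X = ∑[ B ∈ Ts ] H₄b A B
        lem : ∀ n s t → 8 * (n * (2 * s * (n * (2 * s))) * (t * (n * (2 * s * (2 * s * (2 * s)))))) ≡ n * n * n * (256 * (s * s * s * s * s) * t)
        lem = solve-∀

      conf-total : n * ∑[ B ∈ Ts ] confSum A B ≤ 768 * (s * s * s) * (s * s * T)
      conf-total = begin
        n * ∑[ B ∈ Ts ] confSum A B ≤⟨ ℕₚ.*-monoʳ-≤ n (∑-mono Ts (λ B _ → confSum-bound A B)) ⟩
        n * ∑[ B ∈ Ts ] (H₄a A B + (H₄b A B + 4 * H₃ A B)) ≡⟨ cong (n *_) (trans (∑-+ (H₄a A) (λ B → H₄b A B + 4 * H₃ A B) Ts)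
          (cong (∑ Ts (H₄a A) +_) (trans (∑-+ (H₄b A) (λ B → 4 * H₃ A B) Ts) (cong (∑ Ts (H₄b A) +_) (∑-*ˡ 4 (H₃ A) Ts))))) ⟩
        n * (∑ Ts (H₄a A) + (∑ Ts (H₄b A) + 4 * ∑ Ts (H₃ A))) ≡⟨ l₁ n (∑ Ts (H₄a A)) (∑ Ts (H₄b A)) (∑ Ts (H₃ A)) ⟩
        n * ∑ Ts (H₄a A) + (n * ∑ Ts (H₄b A) + 4 * (n * ∑ Ts (H₃ A))) ≤⟨ ℕₚ.+-mono-≤ H₄a-total (ℕₚ.+-mono-≤ H₄b-total (ℕₚ.*-monoʳ-≤ 4 H₃-total)) ⟩
        256 * (s * s * s * s * s) * T + (256 * (s * s * s * s * s) * T + 4 * (64 * (s * s * s * s) * T)) ≡⟨ l₂ s T ⟩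
        512 * (s * s * s) * (s * s * T) + 256 * (s * s * s) * (s * T) ≤⟨ ℕₚ.+-monoʳ-≤ (512 * (s * s * s) * (s * s * T)) (ℕₚ.*-monoʳ-≤ (256 * (s * s * s)) (ℕₚ.*-monoˡ-≤ T (ℕₚ.≤-trans (ℕₚ.≤-reflexive (sym (ℕₚ.*-identityˡ s))) (ℕₚ.*-monoˡ-≤ s (ℕₚ.<⇒≤ 1<s))))) ⟩
        512 * (s * s * s) * (s * s * T) + 256 * (s * s * s) * (s * s * T) ≡⟨ l₃ (s * s * s) (s * s * T) ⟩
        768 * (s * s * s) * (s * s * T) ∎
        where
        open ℕₚ.≤-Reasoning
        l₁ : ∀ n a b c → n * (a + (b + 4 * c)) ≡ n * a + (n * b + 4 * (n * c))
        l₁ = solve-∀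
        l₂ : ∀ s t → 256 * (s * s * s * s * s) * t + (256 * (s * s * s * s * s) * t + 4 * (64 * (s * s * s * s) * t)) ≡ 512 * (s * s * s) * (s * s * t) + 256 * (s * s * s) * (s * t)
        l₂ = solve-∀
        l₃ : ∀ a b → 512 * a * b + 256 * a * b ≡ 768 * a * b
        l₃ = solve-∀

      conf-small : K₀ * (s * s * s) ≤ n → 16 * ∑[ B ∈ Ts ] confSum A B ≤ s * s * T
      conf-small big = ℕₚ.*-cancelˡ-≤ (768 * (s * s * s)) {{nz}} (begin
        768 * (s * s * s) * (16 * X) ≡⟨ trans (lem (s * s * s) X) (cong (λ z → z * (s * s * s) * X) (sym K₀-value)) ⟩
        K₀ * (s * s * s) * X ≤⟨ ℕₚ.*-monoˡ-≤ X big ⟩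
        n * X ≤⟨ conf-total ⟩
        768 * (s * s * s) * (s * s * T) ∎)
        where
        open ℕₚ.≤-Reasoning
        X = ∑[ B ∈ Ts ] confSum A B
        s>0 : 0 < s
        s>0 = ℕₚ.<-trans (s≤s z≤n) 1<s
        nz : NonZero (768 * (s * s * s))
        nz = Data.Nat.>-nonZero (ℕₚ.*-mono-≤ {1} {768} (s≤s z≤n) (ℕₚ.*-mono-≤ (ℕₚ.*-mono-≤ s>0 s>0) s>0))
        lem : ∀ a x → 768 * a * (16 * x) ≡ 16 * 768 * a * x
        lem = solve-∀

      good-total : 4 ≤ s → 4 * s ≤ n → s * s * T ≤ 8 * ∑[ B ∈ Ts ] goodCount A B
      good-total 4≤s 4s≤n = ℕₚ.*-cancelˡ-≤ (n * n) (begin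
        n * n * (s * s * T) ≡⟨ l₁ n s T ⟩
        s * n * (T * (s * n)) ≤⟨ average-≥ (λ v → 4 * (ltρ v * ρg {k} (map (col A) v))) (λ v → 2 * ρg {k} v) lower (good-lower 4≤s 4s≤n) ⟩
        n * n * ∑[ B ∈ Ts ] ∑[ v ∈ distinct {k} 2 ] (4 * (ltρ v * ρg {k} (map (col A) v)) * (2 * ρg {k} (map (col B) v))) ≡⟨ cong (n * n *_) (trans (∑-cong Ts (λ B _ → trans
            (∑-cong (distinct {k} 2) (λ v _ → l₂ (ltρ v * ρg {k} (map (col A) v)) (ρg {k} (map (col B) v)))) (∑-*ˡ 8 (λ v → ltρ v * ρg {k} (map (col A) v) * ρg {k} (map (col B) v)) (distinct {k} 2)))) (∑-*ˡ 8 (goodCount A) Ts)) ⟩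
        n * n * (8 * ∑[ B ∈ Ts ] goodCount A B) ∎)
        where
        open ℕₚ.≤-Reasoning
        l₁ : ∀ n s t → n * n * (s * s * t) ≡ s * n * (t * (s * n))
        l₁ = solve-∀
        l₂ : ∀ a b → 4 * a * (2 * b) ≡ 8 * (a * b)
        l₂ = solve-∀
        D = distinct {k} 2
        lower : s * n ≤ ∑[ v ∈ D ] (4 * (ltρ v * ρg {k} (map (col A) v)))
        lower = ℕₚ.≤-trans (good-lower 4≤s 4s≤n A∈) (ℕₚ.≤-reflexive (trans (∑-*ˡ 2 (λ v → ρg {k} (map (col A) v)) D)
          (trans (cong (2 *_) (sym (lt-half (col A)))) (trans (l₃ (∑[ v ∈ D ] (ltρ v * ρg {k} (map (col A) v)))) (sym (∑-*ˡ 4 (λ v → ltρ v * ρg {k} (map (col A) v)) D))))))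
          where
          l₃ : ∀ a → 2 * (2 * a) ≡ 4 * a
          l₃ = solve-∀

    module _ (χ : MoveType) (d : Graph m → Graph m → ℕ) (isd : IsDist n χ d) where

      private
        dmin : ∀ {A B} → A ∈ Ts → B ∈ Ts → ∀ j → Steps n χ j A B → d A B ≤ j
        dmin {A} {B} A∈ B∈ = proj₂ (isd A B (isT A∈) (isT B∈))

        dsteps : ∀ {A B} → A ∈ Ts → B ∈ Ts → Steps n χ (d A B) A B
        dsteps {A} {B} A∈ B∈ = proj₁ (isd A B (isT A∈) (isT B∈))

      row-upper : 6 ≤ n → 4 ≤ s → 4 * s ≤ n → K₀ * (s * s * s) ≤ n → ∀ {A} → A ∈ Ts →
        16 * ∑[ B ∈ Ts ] d A B + s * s * T ≤ 16 * (n * T)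
      row-upper 6≤n 4≤s 4s≤n big {A} A∈ = ℕₚ.+-cancelʳ-≤ (s * s * T) _ _ (begin
        16 * Σd + s * s * T + s * s * T ≡⟨ l₁ Σd (s * s * T) ⟩
        16 * Σd + 2 * (s * s * T) ≤⟨ ℕₚ.+-monoʳ-≤ (16 * Σd) (ℕₚ.*-monoʳ-≤ 2 (good-total 6≤n A∈ 4≤s 4s≤n)) ⟩
        16 * Σd + 2 * (8 * Σg) ≡⟨ l₂ Σd Σg ⟩
        16 * (Σd + Σg) ≤⟨ ℕₚ.*-monoʳ-≤ 16 (subst₂ _≤_ (∑-+ (d A) (goodCount A) Ts) (trans (∑-+ (λ _ → n) (confSum A) Ts) (cong (_+ Σc) (trans (∑-const n Ts) (ℕₚ.*-comm T n))))
          (∑-mono Ts (λ B B∈ → distance-upper A B χ (isT A∈) (isT B∈) (dmin A∈ B∈)))) ⟩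
        16 * (n * T + Σc) ≡⟨ ℕₚ.*-distribˡ-+ 16 (n * T) Σc ⟩
        16 * (n * T) + 16 * Σc ≤⟨ ℕₚ.+-monoʳ-≤ (16 * (n * T)) (conf-small 6≤n A∈ big) ⟩
        16 * (n * T) + s * s * T ∎)
        where
        open ℕₚ.≤-Reasoning
        Σd = ∑[ B ∈ Ts ] d A B
        Σg = ∑[ B ∈ Ts ] goodCount A B
        Σc = ∑[ B ∈ Ts ] confSum A B
        l₁ : ∀ a b → 16 * a + b + b ≡ 16 * a + 2 * b
        l₁ = solve-∀
        l₂ : ∀ a b → 16 * a + 2 * (8 * b) ≡ 16 * (a + b)
        l₂ = solve-∀

      row-lower : 6 ≤ n → ∀ C → n ≤ C * (s * s * s) → ∀ {A} → A ∈ Ts →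
        n * T ≤ ∑[ B ∈ Ts ] d A B + (2 * C + 9) * (s * s * T)
      row-lower 6≤n C small {A} A∈ = ℕₚ.*-cancelˡ-≤ (2 * s) {{nz}} (begin
        2 * s * (n * T) ≡⟨ l₁ s n T ⟩
        T * (s * (2 * n)) ≡⟨ sym (∑-const (s * (2 * n)) Ts) ⟩
        ∑[ B ∈ Ts ] (s * (2 * n)) ≤⟨ ∑-mono Ts (λ B B∈ → pointwise B∈) ⟩
        ∑[ B ∈ Ts ] ((2 * s + 4 * n) + 2 * s * (d A B + collide A B)) ≡⟨ trans (∑-+ (λ _ → 2 * s + 4 * n) (λ B → 2 * s * (d A B + collide A B)) Ts)
          (cong₂ _+_ (∑-const (2 * s + 4 * n) Ts) (trans (∑-*ˡ (2 * s) (λ B → d A B + collide A B) Ts) (cong (2 * s *_) (∑-+ (d A) (collide A) Ts)))) ⟩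
        T * (2 * s + 4 * n) + 2 * s * (Σd + Σp) ≤⟨ ℕₚ.+-mono-≤ (ℕₚ.*-monoʳ-≤ T (ℕₚ.+-mono-≤ s1 (ℕₚ.*-monoʳ-≤ 4 small))) (ℕₚ.*-monoʳ-≤ (2 * s) (ℕₚ.+-monoʳ-≤ Σd (collide-bound 6≤n A∈))) ⟩
        T * (2 * s * (s * s) + 4 * (C * (s * s * s))) + 2 * s * (Σd + 8 * (s * s) * T) ≡⟨ l₂ s T C Σd ⟩
        2 * s * (Σd + (2 * C + 9) * (s * s * T)) ∎)
        where
        open ℕₚ.≤-Reasoning
        Σd = ∑[ B ∈ Ts ] d A B
        Σp = ∑[ B ∈ Ts ] collide A B
        s>0 : 0 < s
        s>0 = ℕₚ.<-trans (s≤s z≤n) 1<s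
        nz : NonZero (2 * s)
        nz = Data.Nat.>-nonZero (ℕₚ.*-mono-≤ {1} {2} (s≤s z≤n) s>0)
        s1 : 2 * s ≤ 2 * s * (s * s)
        s1 = ℕₚ.≤-trans (ℕₚ.≤-reflexive (sym (ℕₚ.*-identityʳ (2 * s)))) (ℕₚ.*-monoʳ-≤ (2 * s) (ℕₚ.*-mono-≤ s>0 s>0))
        l₁ : ∀ s n t → 2 * s * (n * t) ≡ t * (s * (2 * n))
        l₁ = solve-∀
        l₂ : ∀ s t c x → t * (2 * s * (s * s) + 4 * (c * (s * s * s))) + 2 * s * (x + 8 * (s * s) * t) ≡ 2 * s * (x + (2 * c + 9) * (s * s * t))
        l₂ = solve-∀
        pointwise : ∀ {B} → B ∈ Ts → s * (2 * n) ≤ (2 * s + 4 * n) + 2 * s * (d A B + collide A B)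
        pointwise {B} B∈ = begin
          s * (2 * n) ≤⟨ ℕₚ.*-monoʳ-≤ s (steps-lower χ (isT A∈) (isT B∈) (dsteps A∈ B∈)) ⟩
          s * (2 + (bA + d A B * 2 + bB) + 2 * collide A B) ≡⟨ l₃ s bA bB (d A B) (collide A B) ⟩
          2 * s + (s * bA + s * bB) + 2 * s * (d A B + collide A B) ≤⟨ ℕₚ.+-monoˡ-≤ (2 * s * (d A B + collide A B)) (ℕₚ.+-monoʳ-≤ (2 * s) (ℕₚ.≤-trans (ℕₚ.+-mono-≤ (bc-bound {A} (isT A∈)) (bc-bound {B} (isT B∈))) (ℕₚ.≤-reflexive (l₄ n)))) ⟩
          2 * s + 4 * n + 2 * s * (d A B + collide A B) ∎
          where
          bA = bc A (col A)
          bB = bc B (col B)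
          l₃ : ∀ s a b d c → s * (2 + (a + d * 2 + b) + 2 * c) ≡ 2 * s + (s * a + s * b) + 2 * s * (d + c)
          l₃ = solve-∀
          l₄ : ∀ n → 2 * n + 2 * n ≡ 4 * n
          l₄ = solve-∀

      ΣΣ : ℕ
      ΣΣ = ∑[ A ∈ Ts ] ∑[ B ∈ Ts ] d A B

      total-upper : 6 ≤ n → 4 ≤ s → 4 * s ≤ n → K₀ * (s * s * s) ≤ n → 16 * ΣΣ + s * s * (T * T) ≤ 16 * n * (T * T)
      total-upper 6≤n 4≤s 4s≤n big = subst₂ _≤_
        (trans (∑-+ (λ A → 16 * ∑[ B ∈ Ts ] d A B) (λ _ → s * s * T) Ts) (cong₂ _+_ (∑-*ˡ 16 (λ A → ∑[ B ∈ Ts ] d A B) Ts) (trans (∑-const (s * s * T) Ts) (l₁ (s * s) T))))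
        (trans (∑-const (16 * (n * T)) Ts) (l₂ n T))
        (∑-mono Ts (λ A A∈ → row-upper 6≤n 4≤s 4s≤n big A∈))
        where
        l₁ : ∀ a t → t * (a * t) ≡ a * (t * t)
        l₁ = solve-∀
        l₂ : ∀ n t → t * (16 * (n * t)) ≡ 16 * n * (t * t)
        l₂ = solve-∀

      total-lower : 6 ≤ n → ∀ C → n ≤ C * (s * s * s) → n * (T * T) ≤ ΣΣ + (2 * C + 9) * (s * s) * (T * T)
      total-lower 6≤n C small = subst₂ _≤_ (trans (∑-const (n * T) Ts) (l₁ n T))
        (trans (∑-+ (λ A → ∑[ B ∈ Ts ] d A B) (λ _ → (2 * C + 9) * (s * s * T)) Ts) (cong (ΣΣ +_) (trans (∑-const ((2 * C + 9) * (s * s * T)) Ts) (l₂ (2 * C + 9) (s * s) T))))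
        (∑-mono Ts (λ A A∈ → row-lower 6≤n C small A∈))
        where
        l₁ : ∀ n t → t * (n * t) ≡ n * (t * t)
        l₁ = solve-∀
        l₂ : ∀ c a t → t * (c * (a * t)) ≡ c * a * (t * t)
        l₂ = solve-∀

  -- Existence of the distance

  Searchable : Set → Set₁
  Searchable A = ∀ {P : A → Set} → (∀ a → Dec (P a)) → Dec (∃ P)

  search-Bool : Searchable Bool
  search-Bool P? with P? true | P? false
  ... | yes p | _     = yes (true , p)
  ... | no _  | yes p = yes (false , p)
  ... | no ¬p | no ¬q = no λ { (true , p) → ¬p p ; (false , q) → ¬q q }

  search-Fin : ∀ {m} → Searchable (Fin m)
  search-Fin = 𝔽ₚ.any?

  search-Vec : ∀ {A : Set} → Searchable A → ∀ j → Searchable (Vec A j)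
  search-Vec sA zero    P? = map′ ([]ᵥ ,_) (λ { ([]ᵥ , p) → p }) (P? []ᵥ)
  search-Vec sA (suc j) P? = map′ (λ (x , v , p) → x ∷ᵥ v , p) (λ { (x ∷ᵥ v , p) → x , v , p })
    (sA (λ x → search-Vec sA j (λ v → P? (x ∷ᵥ v))))

  search-List : ∀ {A : Set} → Searchable A → ∀ j {P : List A → Set} → (∀ vs → Dec (P vs)) → Dec (∃[ vs ] (length vs ≤ j × P vs))
  search-List sA zero P? = map′ (λ p → [] , z≤n , p) (λ { ([] , _ , p) → p }) (P? [])
  search-List sA (suc j) P? = map′
    (λ { (inj₁ p) → [] , z≤n , p ; (inj₂ (x , vs , le , p)) → x ∷ vs , s≤s le , p })
    (λ { ([] , _ , p) → inj₁ p ; (x ∷ vs , s≤s le , p) → inj₂ (x , vs , le , p) })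
    (P? [] ⊎-dec sA (λ x → search-List sA j (λ vs → P? (x ∷ vs))))

  module _ {m : ℕ} where

    search-Graph : ∀ {P : Graph m → Set} → (∀ {G H} → G ≐ H → P G → P H) → (∀ G → Dec (P G)) → Dec (∃ P)
    search-Graph {P} resp P? = map′ (λ (M , p) → mat M , p) (λ (G , p) → toMat G , resp (λ i j → sym (mat-toMat G i j)) p)
      (search-Vec (search-Vec search-Bool m) m (λ M → P? (mat M)))
      where
      mat : Vec (Vec Bool m) m → Graph m
      mat M i j = lookup (lookup M i) j
      toMat : Graph m → Vec (Vec Bool m) m
      toMat G = tabulate (λ i → tabulate (λ j → G i j))
      mat-toMat : ∀ G i j → mat (toMat G) i j ≡ G i j
      mat-toMat G i j = trans (cong (λ v → lookup v j) (Vₚ.lookup∘tabulate (λ i → tabulate (λ j → G i j)) i)) (Vₚ.lookup∘tabulate (λ j → G i j) j)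

    edge? : ∀ (G : Graph m) a b → Dec (Edge G a b)
    edge? G a b = G a b 𝔹ₚ.≟ true

    walk? : ∀ (G : Graph m) a b vs → Dec (Walk G a b vs)
    walk? G a b [] = no λ ()
    walk? G a b (v ∷ []) = map′ (λ { (refl , refl) → here }) (λ { here → refl , refl ; (step _ ()) }) ((a ≟ v) ×-dec (b ≟ v))
    walk? G a b (v ∷ w ∷ vs) = map′ (λ { (refl , e , r) → step e r }) un ((a ≟ v) ×-dec (edge? G a w ×-dec walk? G w b (w ∷ vs)))
      where
      un : Walk G a b (v ∷ w ∷ vs) → a ≡ v × Edge G a w × Walk G w b (w ∷ vs)
      un (step e here) = refl , e , here
      un (step e r@(step _ _)) = refl , e , r

    unique-length : ∀ {vs : List (Fin m)} → Unique vs → length vs ≤ m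
    unique-length {vs} u = subst (length vs ≤_) (length-allFin m) (unique-⊆-length u (λ _ → ∈-allFin _))

    pathThrough? : ∀ (G : Graph m) a b x → Dec (PathThrough G a b x)
    pathThrough? G a b x = map′ (λ (vs , _ , p) → vs , p) (λ (vs , w , u , i) → vs , unique-length u , w , u , i)
      (search-List search-Fin m (λ vs → walk? G a b vs ×-dec (Data.List.Relation.Unary.AllPairs.allPairs? (λ x y → ¬? (x ≟ y)) vs ×-dec anyL? (x ≟_) vs)))

    reach? : ∀ (G : Graph m) a b → Dec (Reach G a b)
    reach? G a b = map′ (λ (vs , _ , p) → vs , p) (λ (vs , w) → let (us , w′ , u) = loop-erase w in us , unique-length u , w′)
      (search-List search-Fin m (λ vs → walk? G a b vs))

    ≐? : ∀ (G H : Graph m) → Dec (G ≐ H)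
    ≐? G H = 𝔽ₚ.all? (λ i → 𝔽ₚ.all? (λ j → G i j 𝔹ₚ.≟ H i j))

    add-cong : ∀ {G H : Graph m} {u v} → G ≐ H → addE G u v ≐ addE H u v
    add-cong {u = u} {v} h i j = cong (λ b → (⌊ i ≟ u ⌋ ∧ ⌊ j ≟ v ⌋) ∨ (⌊ i ≟ v ⌋ ∧ ⌊ j ≟ u ⌋) ∨ b) (h i j)

    del-cong : ∀ {G H : Graph m} {u v} → G ≐ H → delE G u v ≐ delE H u v
    del-cong {u = u} {v} h i j = cong (λ b → not ((⌊ i ≟ u ⌋ ∧ ⌊ j ≟ v ⌋) ∨ (⌊ i ≟ v ⌋ ∧ ⌊ j ≟ u ⌋)) ∧ b) (h i j)

    edge-resp : ∀ {G H : Graph m} → G ≐ H → ∀ {a b} → Edge G a b → Edge H a b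
    edge-resp h {a} {b} e = trans (sym (h a b)) e

    path-resp : ∀ {G H : Graph m} → G ≐ H → ∀ {a b x} → PathThrough G a b x → PathThrough H a b x
    path-resp h (vs , w , r) = vs , Walk-mono (edge-resp h) w , r

  module _ (n : ℕ) where

    private m = V n

    iso? : ∀ (G H : Graph m) → Dec (Iso n G H)
    iso? G H = map′ to from
      (search-Vec search-Fin m (λ f → search-Vec search-Fin m (λ g →
        𝔽ₚ.all? (λ i → lookup f (lookup g i) ≟ i) ×-dec (𝔽ₚ.all? (λ i → lookup g (lookup f i) ≟ i)
        ×-dec (𝔽ₚ.all? (λ i → Relation.Nullary.Decidable._→-dec_ (toℕ i ≤? n) (lookup f i ≟ i))
        ×-dec 𝔽ₚ.all? (λ i → 𝔽ₚ.all? (λ j → H (lookup f i) (lookup f j) 𝔹ₚ.≟ G i j)))))))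
      where
      to : ∃[ f ] ∃[ g ] ((∀ i → lookup f (lookup g i) ≡ i) × (∀ i → lookup g (lookup f i) ≡ i) × (∀ i → toℕ i ≤ n → lookup f i ≡ i) × (∀ i j → H (lookup f i) (lookup f j) ≡ G i j)) → Iso n G H
      to (f , g , a , b , c , d) = permutation (lookup f) (lookup g) a b , c , d
      from : Iso n G H → ∃[ f ] ∃[ g ] ((∀ i → lookup f (lookup g i) ≡ i) × (∀ i → lookup g (lookup f i) ≡ i) × (∀ i → toℕ i ≤ n → lookup f i ≡ i) × (∀ i j → H (lookup f i) (lookup f j) ≡ G i j))
      from (π , c , d) = tabulate σ , tabulate ρ ,
        (λ i → trans (cong (lookup (tabulate σ)) (Vₚ.lookup∘tabulate ρ i)) (trans (Vₚ.lookup∘tabulate σ (ρ i)) (inverseʳ π))) ,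
        (λ i → trans (cong (lookup (tabulate ρ)) (Vₚ.lookup∘tabulate σ i)) (trans (Vₚ.lookup∘tabulate ρ (σ i)) (inverseˡ π))) ,
        (λ i le → trans (Vₚ.lookup∘tabulate σ i) (c i le)) ,
        (λ i j → trans (cong₂ H (Vₚ.lookup∘tabulate σ i) (Vₚ.lookup∘tabulate σ j)) (d i j))
        where
        σ ρ : Fin m → Fin m
        σ = π ⟨$⟩ʳ_
        ρ = π ⟨$⟩ˡ_

    iso-resp : ∀ {G G′ H H′ : Graph m} → G ≐ G′ → H ≐ H′ → Iso n G H → Iso n G′ H′
    iso-resp g h (π , c , d) = π , c , λ i j → trans (sym (h _ _)) (trans (d i j) (g i j))

    spr-cong : ∀ {G H : Graph m} → G ≐ H → ∀ x a b c d → sprResult n G x a b c d ≐ sprResult n H x a b c d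
    spr-cong {G} {H} h x a b c d = add-cong {G = addE (delE (A₂ G) c d) c x} {addE (delE (A₂ H) c d) c x} (add-cong {G = delE (A₂ G) c d} {delE (A₂ H) c d} (del-cong {G = A₂ G} {A₂ H}
      (add-cong {G = delE (delE G a x) x b} {delE (delE H a x) x b} (del-cong {G = delE G a x} {delE H a x} (del-cong {G = G} {H} h)))))
      where
      A₂ : Graph m → Graph m
      A₂ K = addE (delE (delE K a x) x b) a b

    sprData? : ∀ (G : Graph m) x y a b c d → Dec (SPRData n G x y a b c d)
    sprData? G x y a b c d = edge? G x y ×-dec (edge? G a x ×-dec (edge? G x b ×-dec (edge? G c d
      ×-dec (¬? (sameEdge? x y a x) ×-dec (¬? (sameEdge? x y x b) ×-dec (¬? (sameEdge? x y c d)
      ×-dec (¬? (sameEdge? a x x b) ×-dec (¬? (sameEdge? a x c d) ×-dec (¬? (sameEdge? x b c d) ×-dec pathThrough? G c y x)))))))))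

    sprData-resp : ∀ {G H : Graph m} → G ≐ H → ∀ {x y a b c d} → SPRData n G x y a b c d → SPRData n H x y a b c d
    sprData-resp {G} {H} h (e₁ , e₂ , e₃ , e₄ , n₁ , n₂ , n₃ , n₄ , n₅ , n₆ , p) =
      edge-resp {G = G} {H} h e₁ , edge-resp {G = G} {H} h e₂ , edge-resp {G = G} {H} h e₃ , edge-resp {G = G} {H} h e₄ , n₁ , n₂ , n₃ , n₄ , n₅ , n₆ , path-resp {G = G} {H} h p

    suppress : Graph m → (u p q : Fin m) → Graph m
    suppress G u p q = addE (delE (delE G u p) u q) p q

    suppress-cong : ∀ {G H : Graph m} → G ≐ H → ∀ u p q → suppress G u p q ≐ suppress H u p q
    suppress-cong {G} {H} h u p q = add-cong {G = delE (delE G u p) u q} {delE (delE H u p) u q} (del-cong {G = delE G u p} {delE H u p} (del-cong {G = G} {H} h))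

    subdivide : Graph m → (u r s : Fin m) → Graph m
    subdivide G u r s = addE (addE (delE G r s) r u) u s

    subdivide-cong : ∀ {G H : Graph m} → G ≐ H → ∀ u r s → subdivide G u r s ≐ subdivide H u r s
    subdivide-cong {G} {H} h u r s = add-cong {G = addE (delE G r s) r u} {addE (delE H r s) r u} (add-cong {G = delE G r s} {delE H r s} (del-cong {G = G} {H} h))

    tbrSide? : ∀ (G : Graph m) u G′ → Dec (TBRSide n G u G′)
    tbrSide? G u G′ = (𝔽ₚ.all? (λ w → G u w 𝔹ₚ.≟ false) ×-dec ≐? G′ G) ⊎-dec
      𝔽ₚ.any? (λ p → 𝔽ₚ.any? (λ q → 𝔽ₚ.any? (λ r → 𝔽ₚ.any? (λ s → ¬? (p ≟ q) ×-dec (edge? G u p ×-dec (edge? G u q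
        ×-dec (edge? (suppress G u p q) r s ×-dec (reach? (suppress G u p q) p r ×-dec ≐? G′ (subdivide (suppress G u p q) u r s)))))))))

    tbrSide-resp : ∀ {G H G′ H′ : Graph m} → G ≐ H → G′ ≐ H′ → ∀ {u} → TBRSide n G u G′ → TBRSide n H u H′
    tbrSide-resp {G} {H} {G′} {H′} h h′ {u} (inj₁ (a , b)) = inj₁ ((λ w → trans (sym (h u w)) (a w)) , λ i j → trans (sym (h′ i j)) (trans (b i j) (h i j)))
    tbrSide-resp {G} {H} {G′} {H′} h h′ {u} (inj₂ (p , q , r , s , ne , e₁ , e₂ , e₃ , (vs , w) , b)) =
      inj₂ (p , q , r , s , ne , edge-resp {G = G} {H} h e₁ , edge-resp {G = G} {H} h e₂ , edge-resp {G = suppress G u p q} {suppress H u p q} hs {r} {s} e₃ , (vs , Walk-mono (λ {i} {j} → edge-resp {G = suppress G u p q} {suppress H u p q} hs {i} {j}) w) ,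
        λ i j → trans (sym (h′ i j)) (trans (b i j) (subdivide-cong {suppress G u p q} {suppress H u p q} hs u r s i j)))
      where
      hs = suppress-cong {G} {H} h u p q

    step? : ∀ χ (G H : Graph m) → Dec (Step n χ G H)
    step? SPR G H = 𝔽ₚ.any? (λ x → 𝔽ₚ.any? (λ y → 𝔽ₚ.any? (λ a → 𝔽ₚ.any? (λ b → 𝔽ₚ.any? (λ c → 𝔽ₚ.any? (λ d →
      sprData? G x y a b c d ×-dec iso? (sprResult n G x a b c d) H))))))
    step? rSPR G H = 𝔽ₚ.any? (λ x → 𝔽ₚ.any? (λ y → 𝔽ₚ.any? (λ a → 𝔽ₚ.any? (λ b → 𝔽ₚ.any? (λ c → 𝔽ₚ.any? (λ d →
      sprData? G x y a b c d ×-dec (𝔽ₚ.any? (λ r → (toℕ r Data.Nat.≟ 0) ×-dec pathThrough? G r y x) ×-dec iso? (sprResult n G x a b c d) H)))))))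
    step? TBR G H = 𝔽ₚ.any? (λ u → 𝔽ₚ.any? (λ v →
      search-Graph {m} (λ { {G₁} {G₁′} h (G₂ , e , s₁ , s₂ , i) → G₂ , e , tbrSide-resp {delE G u v} {delE G u v} {G₁} {G₁′} (λ _ _ → refl) h s₁ , tbrSide-resp {G₁} {G₁′} {G₂} {G₂} h (λ _ _ → refl) s₂ , i })
        (λ G₁ → search-Graph {m} (λ { {G₂} {G₂′} h (e , s₁ , s₂ , i) → e , s₁ , tbrSide-resp {G₁} {G₁} {G₂} {G₂′} (λ _ _ → refl) h s₂ , iso-resp {addE G₂ u v} {addE G₂′ u v} {H} {H} (add-cong {G = G₂} {G₂′} h) (λ _ _ → refl) i })
          (λ G₂ → edge? G u v ×-dec (tbrSide? (delE G u v) u G₁ ×-dec (tbrSide? G₁ v G₂ ×-dec iso? (addE G₂ u v) H))))))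

    step-resp : ∀ χ {G G′ H H′ : Graph m} → G ≐ G′ → H ≐ H′ → Step n χ G H → Step n χ G′ H′
    step-resp SPR {G} {G′} g h (x , y , a , b , c , d , dat , i) = x , y , a , b , c , d , sprData-resp {G} {G′} g dat , iso-resp (spr-cong {G} {G′} g x a b c d) h i
    step-resp rSPR {G} {G′} g h (x , y , a , b , c , d , dat , (r , r₀ , p) , i) = x , y , a , b , c , d , sprData-resp {G} {G′} g dat , (r , r₀ , path-resp {G = G} {G′} g p) , iso-resp (spr-cong {G} {G′} g x a b c d) h i
    step-resp TBR {G} {G′} g h (u , v , G₁ , G₂ , e , s₁ , s₂ , i) = u , v , G₁ , G₂ , edge-resp {G = G} {G′} g e ,
      tbrSide-resp {delE G u v} {delE G′ u v} {G₁} {G₁} (del-cong {G = G} {G′} g) (λ _ _ → refl) s₁ , s₂ , iso-resp {addE G₂ u v} {addE G₂ u v} (λ _ _ → refl) h i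

    steps-resp : ∀ χ {j} {G G′ H : Graph m} → G ≐ G′ → Steps n χ j G H → Steps n χ j G′ H
    steps-resp χ {G = G} {G′} {H} g (done i) = done (iso-resp {G} {G′} {H} {H} g (λ _ _ → refl) i)
    steps-resp χ {G = G} {G′} g (move {B = B} st sts) = move (step-resp χ {G} {G′} {B} {B} g (λ _ _ → refl) st) sts

    steps? : ∀ χ j (A B : Graph m) → Dec (Steps n χ j A B)
    steps? χ zero A B = map′ done (λ { (done i) → i }) (iso? A B)
    steps? χ (suc j) A B = map′ (λ (C , a , b) → move a b) (λ { (move a b) → _ , a , b })
      (search-Graph {m} (λ { {C} {C′} h (a , b) → step-resp χ {A} {A} {C} {C′} (λ _ _ → refl) h a , steps-resp χ {G = C} {C′} h b }) (λ C → step? χ A C ×-dec steps? χ j C B))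

  minimise : ∀ {P : ℕ → Set} → (∀ j → Dec (P j)) → ∀ K → P K → ∃[ j ] (P j × (∀ i → P i → j ≤ i))
  minimise {P} P? K pK with least (λ j → ⌊ P? j ⌋) K (⇒does (P? K) pK)
  ... | j , _ , e , mn = j , does⇒ (P? j) e , λ i pi → ℕₚ.≮⇒≥ (λ lt → true≢false (⇒does (P? i) pi) (mn i lt))

  connected : ∀ n χ (A B : Graph (V n)) → isBinTree n A ≡ true → isBinTree n B ≡ true → ∃[ j ] Steps n χ j A B
  connected zero χ A B _ _ = 0 , done (Data.Fin.Permutation.id , (λ ()) , (λ ()))
  connected (suc k) χ A B hA hB = let (j , _ , st) = Coloured.pairs-upper {k} 2 (s≤s (s≤s z≤n)) χ hA hB [] (λ ()) ((λ ()) , []) ((λ ()) , []) in j , st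

  distance : ∀ χ n → Σ (Graph (V n) → Graph (V n) → ℕ) (IsDist n χ)
  distance χ n = (λ A B → d A B (isBinTree n A 𝔹ₚ.≟ true) (isBinTree n B 𝔹ₚ.≟ true)) , λ A B hA hB → spec A B hA hB (isBinTree n A 𝔹ₚ.≟ true) (isBinTree n B 𝔹ₚ.≟ true)
    where
    best : ∀ A B → isBinTree n A ≡ true → isBinTree n B ≡ true → ∃[ j ] (Steps n χ j A B × (∀ i → Steps n χ i A B → j ≤ i))
    best A B hA hB = let (j , st) = connected n χ A B hA hB in minimise (λ j → steps? n χ j A B) j st
    d : ∀ A B → Dec (isBinTree n A ≡ true) → Dec (isBinTree n B ≡ true) → ℕ
    d A B (yes hA) (yes hB) = proj₁ (best A B hA hB)
    d A B _ _ = 0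
    spec : ∀ A B → isBinTree n A ≡ true → isBinTree n B ≡ true → ∀ a b → Steps n χ (d A B a b) A B × (∀ i → Steps n χ i A B → d A B a b ≤ i)
    spec A B hA hB (yes a) (yes b) = proj₂ (best A B a b)
    spec A B hA hB (yes a) (no b) = ⊥-elim (b hB)
    spec A B hA hB (no a) _ = ⊥-elim (a hA)

  -- Existence of a tree

  module _ {m : ℕ} where

    nodesOf : Tree {m} → List (Fin m)
    nodesOf (leaf v)     = []
    nodesOf (node v l r) = v ∷ nodesOf l ++ nodesOf r

    nodesOf⊆verts : ∀ t {x} → x ∈ nodesOf t → x ∈ verts t
    nodesOf⊆verts (node v l r) (here e) = here e
    nodesOf⊆verts (node v l r) (there i) with ∈ₚ.∈-++⁻ (nodesOf l) i
    ... | inj₁ j = there (∈ₚ.∈-++⁺ˡ (nodesOf⊆verts l j))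
    ... | inj₂ j = there (∈ₚ.∈-++⁺ʳ (verts l) (nodesOf⊆verts r j))

    nodesOf-unique : ∀ t → Unique (verts t) → Unique (nodesOf t)
    nodesOf-unique (leaf v) u = []
    nodesOf-unique (node v l r) u with Unique-++⁻ (verts l) (Unique-tail u)
    ... | ul , ur , d = Unique-∷ fresh (Unique-++ (nodesOf l) (nodesOf-unique l ul) (nodesOf-unique r ur) (λ i j → d (nodesOf⊆verts l i) (nodesOf⊆verts r j)))
      where
      fresh : v ∉ nodesOf l ++ nodesOf r
      fresh i with ∈ₚ.∈-++⁻ (nodesOf l) i
      ... | inj₁ j = Unique-head u (∈ₚ.∈-++⁺ˡ (nodesOf⊆verts l j))
      ... | inj₂ j = Unique-head u (∈ₚ.∈-++⁺ʳ (verts l) (nodesOf⊆verts r j))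

    nodesOf-above : ∀ {n} t → Above n t → ∀ {x} → x ∈ nodesOf t → n < toℕ x
    nodesOf-above (node v l r) (lt , al , ar) (here refl) = lt
    nodesOf-above (node v l r) (lt , al , ar) (there i) = [ nodesOf-above l al , nodesOf-above r ar ]′ (∈ₚ.∈-++⁻ (nodesOf l) i)

    verts-node : ∀ {n} t → Below n t → ∀ {x} → x ∈ verts t → n < toℕ x → x ∈ nodesOf t
    verts-node (leaf v) (le ∷ []) (here refl) lt = ⊥-elim (ℕₚ.<⇒≱ lt le)
    verts-node (node v l r) b (here e) lt = here e
    verts-node (node v l r) b (there i) lt with ∈ₚ.∈-++⁻ (verts l) i
    ... | inj₁ j = there (∈ₚ.∈-++⁺ˡ (verts-node l (Allₚ.++⁻ˡ (leaves l) b) j lt))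
    ... | inj₂ j = there (∈ₚ.∈-++⁺ʳ (nodesOf l) (verts-node r (Allₚ.++⁻ʳ (leaves l) b) j lt))

    occ : Fin m → List (Fin m) → ℕ
    occ i xs = ∑[ v ∈ xs ] 𝟙 ⌊ i ≟ v ⌋

    occ-∈ : ∀ {i xs} → Unique xs → i ∈ xs → occ i xs ≡ 1
    occ-∈ {i} {xs} u h = trans (∑-cong xs (λ v _ → sym (ℕₚ.*-identityʳ _))) (∑-δ-∈ (λ _ → 1) i u h)

    occ-∉ : ∀ {i xs} → i ∉ xs → occ i xs ≡ 0
    occ-∉ {i} {xs} h = ∑-zero (λ v → 𝟙 ⌊ i ≟ v ⌋) xs (λ v v∈ → cong 𝟙 (¬does⇒ (i ≟ v) (λ { refl → h v∈ })))

    ends-count : ∀ i p t → ∑[ e ∈ edges p t ] (𝟙 ⌊ i ≟ proj₁ e ⌋ + 𝟙 ⌊ i ≟ proj₂ e ⌋) ≡ 𝟙 ⌊ i ≟ p ⌋ + (occ i (leaves t) + 3 * occ i (nodesOf t))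
    ends-count i p (leaf v) = lem (𝟙 ⌊ i ≟ p ⌋) (𝟙 ⌊ i ≟ v ⌋)
      where
      lem : ∀ a b → a + b + 0 ≡ a + (b + 0 + 0)
      lem = solve-∀
    ends-count i p (node v l r) = begin
      P + V′ + ∑ (edges v l ++ edges v r) φ ≡⟨ cong (P + V′ +_) (trans (∑-++ φ (edges v l) (edges v r)) (cong₂ _+_ (ends-count i v l) (ends-count i v r))) ⟩
      P + V′ + ((V′ + (Ll + 3 * Nl)) + (V′ + (Lr + 3 * Nr))) ≡⟨ lem P V′ Ll Lr Nl Nr ⟩
      P + ((Ll + Lr) + 3 * (V′ + (Nl + Nr))) ≡⟨ cong (P +_) (sym (cong₂ (λ a b → a + 3 * (V′ + b)) (∑-++ (λ v → 𝟙 ⌊ i ≟ v ⌋) (leaves l) (leaves r)) (∑-++ (λ v → 𝟙 ⌊ i ≟ v ⌋) (nodesOf l) (nodesOf r)))) ⟩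
      P + (occ i (leaves l ++ leaves r) + 3 * occ i (v ∷ nodesOf l ++ nodesOf r)) ∎
      where
      open ≡-Reasoning
      φ : Fin m × Fin m → ℕ
      φ e = 𝟙 ⌊ i ≟ proj₁ e ⌋ + 𝟙 ⌊ i ≟ proj₂ e ⌋
      P = 𝟙 ⌊ i ≟ p ⌋
      V′ = 𝟙 ⌊ i ≟ v ⌋
      Ll = occ i (leaves l)
      Lr = occ i (leaves r)
      Nl = occ i (nodesOf l)
      Nr = occ i (nodesOf r)
      lem : ∀ p v a b c d → p + v + ((v + (a + 3 * c)) + (v + (b + 3 * d))) ≡ p + ((a + b) + 3 * (v + (c + d)))
      lem = solve-∀

  module _ {k : ℕ} where

    private
      n = suc k
      m = V n

    Walk⇒reachMat : ∀ {G : Graph m} {a b} → Reach G a b → reachMat n G a b ≡ true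
    Walk⇒reachMat {G} {a} {b} (vs , w) = mono-to m (unique-length (proj₂ (proj₂ (loop-erase w))))
        (go 0 (cong (_∨ G a a) (⇒does (a ≟ a) refl)) (proj₁ (proj₂ (loop-erase w))))
      where
      R : ℕ → Fin m → Bool
      R c = iter n c (reachStep n G) (λ i j → ⌊ i ≟ j ⌋ ∨ G i j) a
      R-suc : ∀ c j → R c j ≡ true → R (suc c) j ≡ true
      R-suc c j e = cong (_∨ any (λ l → R c l ∧ G l j) (allFin m)) e
      go : ∀ c {x y vs} → R c x ≡ true → Walk G x y vs → R (c + length vs) y ≡ true
      go c {x} e here = subst (λ z → R z x ≡ true) (ℕₚ.+-comm 1 c) (R-suc c x e)
      go c {x} {y} e (step {b = z} {vs = vs} q r) = subst (λ t → R t y ≡ true) (sym (ℕₚ.+-suc c (length vs)))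
        (go (suc c) (∨-introʳ {R c z} (any-intro {p = λ l → R c l ∧ G l z} (∈-allFin x) (cong₂ _∧_ e q))) r)
      mono-to : ∀ c {c′} → c′ ≤ c → R c′ b ≡ true → R c b ≡ true
      mono-to c {c′} le e = subst (λ z → R z b ≡ true) (ℕₚ.m+[n∸m]≡n le) (up (c ∸ c′))
        where
        up : ∀ d → R (c′ + d) b ≡ true
        up zero = subst (λ z → R z b ≡ true) (sym (ℕₚ.+-identityʳ c′)) e
        up (suc d) = subst (λ z → R z b ≡ true) (sym (ℕₚ.+-suc c′ d)) (R-suc (c′ + d) b (up d))

    tree-isBinTree : ∀ {t : Tree {m}} → LabTree n root t → isBinTree n (toG (edges root t)) ≡ true
    tree-isBinTree {t} LT = cong₂ _∧_ (all-intro {p = λ i → all (symᵇ {k} G i) (allFin m)} (allFin m) (λ i _ → all-intro {p = symᵇ {k} G i} (allFin m) (λ j _ → symm i j)))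
      (cong₂ _∧_ (all-intro {p = degᵇ {k} G} (allFin m) (λ i _ → degs i (ℕₚ.≤-<-connex (toℕ i) n)))
        (all-intro {p = λ i → all (reachMat n G i) (allFin m)} (allFin m) (λ i _ → all-intro {p = reachMat n G i} (allFin m) (λ j _ → Walk⇒reachMat (edges-reach root t rp (compl i) (compl j))))))
      where
      open LabTree LT
      E = edges root t
      G = toG E
      rp : Rep G E
      rp = Rep-toG E
      ll = edges-loopless root t uniq
      noloop : ∀ {F} → Loopless {m} F → ∀ {i} → ¬ InE F i i
      noloop (ne ∷ _) (here (inj₁ (refl , refl))) = ne refl
      noloop (ne ∷ _) (here (inj₂ (refl , refl))) = ne refl
      noloop (_ ∷ l) (there i) = noloop l i
      symm : ∀ i j → symᵇ {k} G i j ≡ true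
      symm i j = cell (G i j) (G j i) ⌊ i ≟ j ⌋ (Rep-sym rp {i} {j}) (λ e q → noloop ll (subst (InE E i) (sym (does⇒ (i ≟ j) q)) (proj₁ (rp i j) e)))
        where
        cell : ∀ a b c → (a ≡ true → b ≡ true) → (a ≡ true → c ≡ true → ⊥) → (not a ∨ b) ∧ not (c ∧ a) ≡ true
        cell true  true  true  f g = ⊥-elim (g refl refl)
        cell true  true  false f g = refl
        cell true  false c f g = ⊥-elim (true≢false (f refl) refl)
        cell false b true  f g = refl
        cell false b false f g = refl
      deg≡ : ∀ i → degree n G i ≡ 𝟙 ⌊ i ≟ root ⌋ + (occ i (leaves t) + 3 * occ i (nodesOf t))
      deg≡ i = trans (sum-map (λ j → 𝟙 (G i j)) (allFin m)) (trans (sym (W-degree G i)) (trans (W-list (λ a _ → 𝟙 ⌊ i ≟ a ⌋) (edges-simple root t uniq) ll rp) (ends-count i root t)))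
      lu = leaves-unique t (Unique-tail uniq)
      nu = nodesOf-unique t (Unique-tail uniq)
      degs : ∀ i → (toℕ i ≤ n) ⊎ (n < toℕ i) → degᵇ {k} G i ≡ true
      degs i (inj₁ le) = trans (cong (λ b → if b then degree n G i ≡ᵇ 1 else degree n G i ≡ᵇ 3) (≤ᵇ-true le)) (cong (_≡ᵇ 1) (trans (deg≡ i) (one (compl i))))
        where
        no-node : occ i (nodesOf t) ≡ 0
        no-node = occ-∉ (λ h → ℕₚ.<⇒≱ (nodesOf-above t above h) le)
        one : i ∈ root ∷ verts t → 𝟙 ⌊ i ≟ root ⌋ + (occ i (leaves t) + 3 * occ i (nodesOf t)) ≡ 1
        one (here refl) = cong₂ (λ a b → 1 + (a + 3 * b)) (occ-∉ (λ h → Unique-head uniq (leaves⊆verts t h))) no-node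
        one (there h) = cong₂ _+_ (cong 𝟙 (¬does⇒ (i ≟ root) (λ { refl → Unique-head uniq h }))) (cong₂ (λ a b → a + 3 * b) (occ-∈ lu (verts-leaf t above h le)) no-node)
      degs i (inj₂ lt) = trans (cong (λ b → if b then degree n G i ≡ᵇ 1 else degree n G i ≡ᵇ 3) (≤ᵇ-false lt)) (cong (_≡ᵇ 3) (trans (deg≡ i) (three (compl i))))
        where
        three : i ∈ root ∷ verts t → 𝟙 ⌊ i ≟ root ⌋ + (occ i (leaves t) + 3 * occ i (nodesOf t)) ≡ 3
        three (here refl) = ⊥-elim (ℕₚ.<⇒≱ lt z≤n)
        three (there h) = cong₂ _+_ (cong 𝟙 (¬does⇒ (i ≟ root) (λ { refl → Unique-head uniq h }))) (cong₂ (λ a b → a + 3 * b)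
          (occ-∉ (λ l → ℕₚ.<⇒≱ lt (All-lookup below l))) (occ-∈ nu (verts-node t below h lt)))

    private
      vx : ℕ → Fin m
      vx i with i <? m
      ... | yes p = fromℕ< p
      ... | no _  = root

      vx-toℕ : ∀ {i} → i < m → toℕ (vx i) ≡ i
      vx-toℕ {i} lt with i <? m
      ... | yes p = 𝔽ₚ.toℕ-fromℕ< p
      ... | no ¬p = ⊥-elim (¬p lt)

      vx-of : ∀ v → vx (toℕ v) ≡ v
      vx-of v = 𝔽ₚ.toℕ-injective (vx-toℕ (𝔽ₚ.toℕ<n v))

      n<m : n < m
      n<m = s≤s (ℕₚ.m≤n+m (suc k) k)

      low : ∀ {i} → i ≤ n → toℕ (vx i) ≡ i
      low le = vx-toℕ (ℕₚ.≤-<-trans le n<m)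

      high : ∀ {j} → suc j ≤ k → toℕ (vx (suc n + j)) ≡ suc n + j
      high {j} le = vx-toℕ (subst (_< m) (ℕₚ.+-suc n j) (ℕₚ.+-monoʳ-< n (s≤s le)))

      cat : ℕ → Tree {m}
      cat zero    = leaf (vx 1)
      cat (suc j) = node (vx (suc n + j)) (leaf (vx (suc (suc j)))) (cat j)

      Range : ℕ → ℕ → Set
      Range j i = (1 ≤ i × i ≤ suc j) ⊎ (n < i × i ≤ n + j)

      Range-suc : ∀ {j i} → Range j i → Range (suc j) i
      Range-suc {j} (inj₁ (a , b)) = inj₁ (a , ℕₚ.≤-trans b (ℕₚ.n≤1+n _))
      Range-suc {j} (inj₂ (a , b)) = inj₂ (a , ℕₚ.≤-trans b (ℕₚ.+-monoʳ-≤ n (ℕₚ.n≤1+n j)))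

      range : ∀ j → j ≤ k → ∀ {v} → v ∈ verts (cat j) → Range j (toℕ v)
      range zero le (here refl) = inj₁ (ℕₚ.≤-reflexive (sym (low (s≤s z≤n))) , ℕₚ.≤-reflexive (low (s≤s z≤n)))
      range (suc j) le (here refl) = inj₂ (subst (n <_) (sym (high le)) (s≤s (ℕₚ.m≤m+n n j)) , ℕₚ.≤-reflexive (trans (high le) (sym (ℕₚ.+-suc n j))))
      range (suc j) le (there (here refl)) = inj₁ (subst (1 ≤_) (sym (low (s≤s le))) (s≤s z≤n) , ℕₚ.≤-reflexive (low (s≤s le)))
      range (suc j) le (there (there i)) = Range-suc (range j (ℕₚ.<⇒≤ le) i)

      cat-unique : ∀ j → j ≤ k → Unique (verts (cat j))
      cat-unique zero le = [] ∷ []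
      cat-unique (suc j) le = Unique-∷ fresh₁ (Unique-∷ fresh₂ (cat-unique j (ℕₚ.<⇒≤ le)))
        where
        fresh₂ : vx (suc (suc j)) ∉ verts (cat j)
        fresh₂ i with range j (ℕₚ.<⇒≤ le) i
        ... | inj₁ (_ , b) = ℕₚ.<-irrefl refl (subst (_≤ suc j) (low (s≤s le)) b)
        ... | inj₂ (a , _) = ℕₚ.<⇒≱ (subst (n <_) (low (s≤s le)) a) (s≤s le)
        fresh₁ : vx (suc n + j) ∉ vx (suc (suc j)) ∷ verts (cat j)
        fresh₁ (here e) = ℕₚ.<⇒≢ (s≤s (ℕₚ.≤-trans (s≤s le) (ℕₚ.m≤m+n n j))) (trans (sym (low (s≤s le))) (trans (cong toℕ (sym e)) (high le)))
        fresh₁ (there i) with range j (ℕₚ.<⇒≤ le) i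
        ... | inj₁ (_ , b) = ℕₚ.<⇒≱ (s≤s (ℕₚ.≤-trans le (ℕₚ.≤-trans (ℕₚ.n≤1+n k) (ℕₚ.m≤m+n n j)))) (subst (_≤ suc j) (high le) b)
        ... | inj₂ (_ , b) = ℕₚ.<-irrefl refl (subst (_≤ n + j) (high le) b)

      cat-complete : ∀ j → j ≤ k → ∀ {i} → Range j i → vx i ∈ verts (cat j)
      cat-complete zero le (inj₁ (a , b)) = here (cong vx (ℕₚ.≤-antisym b a))
      cat-complete zero le {i} (inj₂ (a , b)) = ⊥-elim (ℕₚ.<⇒≱ a (subst (i ≤_) (ℕₚ.+-identityʳ n) b))
      cat-complete (suc j) le {i} (inj₁ (a , b)) with ℕₚ.m≤n⇒m<n∨m≡n b
      ... | inj₁ (s≤s lt) = there (there (cat-complete j (ℕₚ.<⇒≤ le) (inj₁ (a , lt))))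
      ... | inj₂ refl = there (here refl)
      cat-complete (suc j) le {i} (inj₂ (a , b)) with ℕₚ.m≤n⇒m<n∨m≡n b
      ... | inj₁ lt = there (there (cat-complete j (ℕₚ.<⇒≤ le) (inj₂ (a , ℕₚ.≤-pred (subst (i <_) (ℕₚ.+-suc n j) lt)))))
      ... | inj₂ refl = here (cong vx (ℕₚ.+-suc n j))

      cat-above : ∀ j → j ≤ k → Above n (cat j)
      cat-above zero le = tt
      cat-above (suc j) le = subst (n <_) (sym (high le)) (s≤s (ℕₚ.m≤m+n n j)) , tt , cat-above j (ℕₚ.<⇒≤ le)

      cat-below : ∀ j → j ≤ k → Below n (cat j)
      cat-below zero le = subst (_≤ n) (sym (low (s≤s z≤n))) (s≤s z≤n) ∷ []
      cat-below (suc j) le = subst (_≤ n) (sym (low (s≤s le))) (s≤s le) ∷ cat-below j (ℕₚ.<⇒≤ le)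

      position : ∀ v → v ≢ root {k} → Range k (toℕ v)
      position v ne with ℕₚ.≤-<-connex (toℕ v) n
      ... | inj₁ le = inj₁ (ℕₚ.n≢0⇒n>0 (λ e → ne (𝔽ₚ.toℕ-injective e)) , le)
      ... | inj₂ lt = inj₂ (lt , ℕₚ.≤-pred (subst (toℕ v <_) (cong suc (ℕₚ.+-suc k k)) (𝔽ₚ.toℕ<n v)))

      caterpillar : LabTree n (root {k}) (cat k)
      caterpillar = record
        { lab = record
          { uniq  = Unique-∷ (λ i → noroot (range k ℕₚ.≤-refl i)) (cat-unique k ℕₚ.≤-refl)
          ; compl = λ v → case v ≟ root of λ { (yes e) → here e ; (no ne) → there (subst (_∈ verts (cat k)) (vx-of v) (cat-complete k ℕₚ.≤-refl (position v ne))) }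
          ; above = cat-above k ℕₚ.≤-refl }
        ; below = cat-below k ℕₚ.≤-refl }
        where
        noroot : Range k 0 → ⊥
        noroot (inj₁ (() , _))
        noroot (inj₂ (() , _))

    trees-exist : 0 < length (trees n)
    trees-exist = trees-nonempty {k} (toG (edges (root {k}) (cat k))) (tree-isBinTree caterpillar)

  -- Passage to rationals

  open Data.Rational.Solver.+-*-Solver using (solve; _:+_; _:*_; _:-_; _:=_)

  frac : ℕ → ℕ → ℚᵘ.ℚᵘ
  frac a w = ℚᵘ.mkℚᵘ (ℤ.+ a) w

  ℕtoℚ-+ : ∀ a b → ℕtoℚ (a + b) ≡ ℕtoℚ a ℚ.+ ℕtoℚ b
  ℕtoℚ-+ a b = ℚₚ.toℚᵘ-injective (ℚᵘₚ.≃-trans (ℚₚ.toℚᵘ-fromℚᵘ (frac (a + b) 0)) (ℚᵘₚ.≃-sym (ℚᵘₚ.≃-trans (ℚₚ.toℚᵘ-homo-+ (ℕtoℚ a) (ℕtoℚ b))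
    (ℚᵘₚ.≃-trans (ℚᵘₚ.+-cong (ℚₚ.toℚᵘ-fromℚᵘ (frac a 0)) (ℚₚ.toℚᵘ-fromℚᵘ (frac b 0)))
      (ℚᵘ.*≡* (cong (ℤ._* ℤ.+ 1) (cong₂ ℤ._+_ (ℤₚ.*-identityʳ (ℤ.+ a)) (ℤₚ.*-identityʳ (ℤ.+ b)))))))))

  ℕtoℚ-* : ∀ a b → ℕtoℚ (a * b) ≡ ℕtoℚ a ℚ.* ℕtoℚ b
  ℕtoℚ-* a b = ℚₚ.toℚᵘ-injective (ℚᵘₚ.≃-trans (ℚₚ.toℚᵘ-fromℚᵘ (frac (a * b) 0)) (ℚᵘₚ.≃-sym (ℚᵘₚ.≃-trans (ℚₚ.toℚᵘ-homo-* (ℕtoℚ a) (ℕtoℚ b))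
    (ℚᵘₚ.≃-trans (ℚᵘₚ.*-cong (ℚₚ.toℚᵘ-fromℚᵘ (frac a 0)) (ℚₚ.toℚᵘ-fromℚᵘ (frac b 0))) (ℚᵘ.*≡* (cong (ℤ._* ℤ.+ 1) (sym (ℤₚ.pos-* a b))))))))

  ℕtoℚ-mono : ∀ {a b} → a ≤ b → ℕtoℚ a ℚ.≤ ℕtoℚ b
  ℕtoℚ-mono {a} {b} le = ℚₚ.toℚᵘ-cancel-≤ (ℚᵘₚ.≤-respˡ-≃ (ℚᵘₚ.≃-sym (ℚₚ.toℚᵘ-fromℚᵘ (frac a 0))) (ℚᵘₚ.≤-respʳ-≃ (ℚᵘₚ.≃-sym (ℚₚ.toℚᵘ-fromℚᵘ (frac b 0)))
    (ℚᵘ.*≤* (ℤₚ.*-monoʳ-≤-nonNeg (ℤ.+ 1) (ℤ.+≤+ le)))))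

  divℚ-* : ∀ n S w → divℚ n S (suc w) ℚ.* ℕtoℚ (suc w) ≡ ℕtoℚ S
  divℚ-* n S w = ℚₚ.toℚᵘ-injective (ℚᵘₚ.≃-trans (ℚₚ.toℚᵘ-homo-* (divℚ n S (suc w)) (ℕtoℚ (suc w)))
    (ℚᵘₚ.≃-trans (ℚᵘₚ.*-cong (ℚₚ.toℚᵘ-fromℚᵘ (frac S w)) (ℚₚ.toℚᵘ-fromℚᵘ (frac (suc w) 0)))
      (ℚᵘₚ.≃-trans (ℚᵘ.*≡* (trans (ℤₚ.*-identityʳ _) (cong (λ z → ℤ.+ S ℤ.* ℤ.+ z) (cong suc (sym (ℕₚ.*-identityʳ w)))))) (ℚᵘₚ.≃-sym (ℚₚ.toℚᵘ-fromℚᵘ (frac S 0))))))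

  ℕtoℚ-pos : ∀ w → ℚ.Positive (ℕtoℚ (suc w))
  ℕtoℚ-pos w = ℚₚ.normalize-pos (suc w) 1

  ℕtoℚ-≥0 : ∀ a → ℚ.0ℚ ℚ.≤ ℕtoℚ a
  ℕtoℚ-≥0 a = ℕtoℚ-mono {0} {a} z≤n

  ≤-shiftˡ : ∀ {p q r} → p ℚ.+ q ℚ.≤ r → q ℚ.≤ r ℚ.- p
  ≤-shiftˡ {p} {q} {r} h = subst (ℚ._≤ r ℚ.- p) (solve 2 (λ p q → (p :+ q) :- p := q) refl p q) (ℚₚ.+-monoˡ-≤ (ℚ.- p) h)

  ≤-shiftʳ : ∀ {p q r} → p ℚ.≤ q ℚ.+ r → p ℚ.- q ℚ.≤ r
  ≤-shiftʳ {p} {q} {r} h = subst (p ℚ.- q ℚ.≤_) (solve 2 (λ q r → (q :+ r) :- q := r) refl q r) (ℚₚ.+-monoˡ-≤ (ℚ.- q) h)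

  cube-mono : ∀ {x y} → ℚ.0ℚ ℚ.≤ x → x ℚ.≤ y → cube x ℚ.≤ cube y
  cube-mono {x} {y} x≥0 x≤y = ℚₚ.≤-trans (ℚₚ.*-monoʳ-≤-nonNeg x {{nx}} sq) (ℚₚ.*-monoˡ-≤-nonNeg (y ℚ.* y) {{nyy}} x≤y)
    where
    nx = ℚ.nonNegative x≥0
    ny = ℚ.nonNegative (ℚₚ.≤-trans x≥0 x≤y)
    sq : x ℚ.* x ℚ.≤ y ℚ.* y
    sq = ℚₚ.≤-trans (ℚₚ.*-monoʳ-≤-nonNeg x {{nx}} x≤y) (ℚₚ.*-monoˡ-≤-nonNeg y {{ny}} x≤y)
    nyy : ℚ.NonNegative (y ℚ.* y)
    nyy = ℚ.nonNegative (ℚₚ.≤-trans (ℚₚ.≤-reflexive (sym (ℚₚ.*-zeroˡ x))) (ℚₚ.≤-trans (ℚₚ.*-monoʳ-≤-nonNeg x {{nx}} x≥0) sq))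

  cube-* : ∀ x y → cube (x ℚ.* y) ≡ cube x ℚ.* cube y
  cube-* = solve 2 (λ x y → ((x :* y) :* (x :* y)) :* (x :* y) := ((x :* x) :* x) :* ((y :* y) :* y)) refl

  cube-ℕ : ∀ a → cube (ℕtoℚ a) ≡ ℕtoℚ (a * a * a)
  cube-ℕ a = sym (trans (ℕtoℚ-* (a * a) a) (cong (ℚ._* ℕtoℚ a) (ℕtoℚ-* a a)))

  -- a plays the role of s², and x that of n minus the expectation S / W.
  module Sandwich (n S w a : ℕ) where

    private
      W′ = suc w
      e = divℚ n S W′
      x = ℕtoℚ n ℚ.- e
      instance
        posW : ℚ.Positive (ℕtoℚ W′)
        posW = ℕtoℚ-pos w

    x-lower : 16 * S + a * W′ ≤ 16 * n * W′ → ℕtoℚ a ℚ.≤ ℕtoℚ 16 ℚ.* x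
    x-lower h = subst (ℕtoℚ a ℚ.≤_) (solve 3 (λ c n e → c :* n :- c :* e := c :* (n :- e)) refl (ℕtoℚ 16) (ℕtoℚ n) e)
      (≤-shiftˡ {ℕtoℚ 16 ℚ.* e} {ℕtoℚ a} {ℕtoℚ 16 ℚ.* ℕtoℚ n} (ℚₚ.*-cancelʳ-≤-pos {ℕtoℚ 16 ℚ.* e ℚ.+ ℕtoℚ a} {ℕtoℚ 16 ℚ.* ℕtoℚ n} (ℕtoℚ W′) (subst₂ ℚ._≤_ lhs rhs (ℕtoℚ-mono {_} {_} h))))
      where
      lhs : ℕtoℚ (16 * S + a * W′) ≡ (ℕtoℚ 16 ℚ.* e ℚ.+ ℕtoℚ a) ℚ.* ℕtoℚ W′
      lhs = trans (ℕtoℚ-+ (16 * S) (a * W′)) (trans (cong₂ ℚ._+_ (trans (ℕtoℚ-* 16 S) (cong (ℕtoℚ 16 ℚ.*_) (sym (divℚ-* n S w)))) (ℕtoℚ-* a W′))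
        (solve 4 (λ c e w a → c :* (e :* w) :+ a :* w := (c :* e :+ a) :* w) refl (ℕtoℚ 16) e (ℕtoℚ W′) (ℕtoℚ a)))
      rhs : ℕtoℚ (16 * n * W′) ≡ ℕtoℚ 16 ℚ.* ℕtoℚ n ℚ.* ℕtoℚ W′
      rhs = trans (ℕtoℚ-* (16 * n) W′) (cong (ℚ._* ℕtoℚ W′) (ℕtoℚ-* 16 n))

    x-upper : ∀ b → n * W′ ≤ S + b * W′ → x ℚ.≤ ℕtoℚ b
    x-upper b h = ≤-shiftʳ {ℕtoℚ n} {e} {ℕtoℚ b} (ℚₚ.*-cancelʳ-≤-pos {ℕtoℚ n} {e ℚ.+ ℕtoℚ b} (ℕtoℚ W′) (subst₂ ℚ._≤_ (ℕtoℚ-* n W′) rhs (ℕtoℚ-mono {_} {_} h)))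
      where
      rhs : ℕtoℚ (S + b * W′) ≡ (e ℚ.+ ℕtoℚ b) ℚ.* ℕtoℚ W′
      rhs = trans (ℕtoℚ-+ S (b * W′)) (trans (cong₂ ℚ._+_ (sym (divℚ-* n S w)) (ℕtoℚ-* b W′)) (sym (ℚₚ.*-distribʳ-+ (ℕtoℚ W′) e (ℕtoℚ b))))

    module _ (h : 16 * S + a * W′ ≤ 16 * n * W′) where

      x≥0 : ℚ.0ℚ ℚ.≤ x
      x≥0 = ℚₚ.*-cancelˡ-≤-pos {ℚ.0ℚ} {x} (ℕtoℚ 16) {{ℕtoℚ-pos 15}} (ℚₚ.≤-trans (ℚₚ.≤-reflexive (ℚₚ.*-zeroʳ (ℕtoℚ 16))) (ℚₚ.≤-trans (ℕtoℚ-≥0 a) (x-lower h)))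

      cube-lower : ∀ C q → n * n ≤ C * (a * a * a) → C * (16 * 16 * 16) ≤ suc q * suc q * suc q →
        cube (divℚ 0 1 (suc q)) ℚ.* (ℕtoℚ n ℚ.* ℕtoℚ n) ℚ.≤ cube x
      cube-lower C q hC hq = begin
        cube c ℚ.* (ℕtoℚ n ℚ.* ℕtoℚ n) ≤⟨ ℚₚ.*-monoˡ-≤-nonNeg (cube c) {{nc}} main ⟩
        cube c ℚ.* (cube (ℕtoℚ (suc q)) ℚ.* cube x) ≡⟨ sym (ℚₚ.*-assoc (cube c) (cube (ℕtoℚ (suc q))) (cube x)) ⟩
        cube c ℚ.* cube (ℕtoℚ (suc q)) ℚ.* cube x ≡⟨ cong (ℚ._* cube x) (trans (sym (cube-* c (ℕtoℚ (suc q)))) (cong cube (divℚ-* 0 1 q))) ⟩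
        cube (ℕtoℚ 1) ℚ.* cube x ≡⟨ ℚₚ.*-identityˡ (cube x) ⟩
        cube x ∎
        where
        open ℚₚ.≤-Reasoning
        c = divℚ 0 1 (suc q)
        c≥0 : ℚ.0ℚ ℚ.≤ c
        c≥0 = ℚₚ.<⇒≤ (ℚₚ.positive⁻¹ c {{ℚₚ.normalize-pos 1 (suc q)}})
        nc : ℚ.NonNegative (cube c)
        nc = ℚ.nonNegative (cube-mono {ℚ.0ℚ} {c} ℚₚ.≤-refl c≥0)
        cx≥0 : ℚ.NonNegative (cube x)
        cx≥0 = ℚ.nonNegative (cube-mono {ℚ.0ℚ} {x} ℚₚ.≤-refl x≥0)
        instance
          nC : ℚ.NonNegative (ℕtoℚ C)
          nC = ℚ.nonNegative (ℕtoℚ-≥0 C)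
        main : ℕtoℚ n ℚ.* ℕtoℚ n ℚ.≤ cube (ℕtoℚ (suc q)) ℚ.* cube x
        main = begin
          ℕtoℚ n ℚ.* ℕtoℚ n ≡⟨ sym (ℕtoℚ-* n n) ⟩
          ℕtoℚ (n * n) ≤⟨ ℕtoℚ-mono hC ⟩
          ℕtoℚ (C * (a * a * a)) ≡⟨ trans (ℕtoℚ-* C (a * a * a)) (cong (ℕtoℚ C ℚ.*_) (sym (cube-ℕ a))) ⟩
          ℕtoℚ C ℚ.* cube (ℕtoℚ a) ≤⟨ ℚₚ.*-monoˡ-≤-nonNeg (ℕtoℚ C) (cube-mono {ℕtoℚ a} {ℕtoℚ 16 ℚ.* x} (ℕtoℚ-≥0 a) (x-lower h)) ⟩
          ℕtoℚ C ℚ.* cube (ℕtoℚ 16 ℚ.* x) ≡⟨ trans (cong (ℕtoℚ C ℚ.*_) (cube-* (ℕtoℚ 16) x)) (sym (ℚₚ.*-assoc (ℕtoℚ C) (cube (ℕtoℚ 16)) (cube x))) ⟩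
          ℕtoℚ C ℚ.* cube (ℕtoℚ 16) ℚ.* cube x ≡⟨ cong (ℚ._* cube x) (trans (cong (ℕtoℚ C ℚ.*_) (cube-ℕ 16)) (sym (ℕtoℚ-* C (16 * 16 * 16)))) ⟩
          ℕtoℚ (C * (16 * 16 * 16)) ℚ.* cube x ≤⟨ ℚₚ.*-monoʳ-≤-nonNeg (cube x) {{cx≥0}} (ℕtoℚ-mono hq) ⟩
          ℕtoℚ (suc q * suc q * suc q) ℚ.* cube x ≡⟨ cong (ℚ._* cube x) (sym (cube-ℕ (suc q))) ⟩
          cube (ℕtoℚ (suc q)) ℚ.* cube x ∎

      cube-upper : ∀ b → n * W′ ≤ S + b * a * W′ → a * a * a ≤ n * n → cube x ℚ.≤ cube (ℕtoℚ b) ℚ.* (ℕtoℚ n ℚ.* ℕtoℚ n)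
      cube-upper b hb ha = begin
        cube x ≤⟨ cube-mono {x} {ℕtoℚ (b * a)} x≥0 (x-upper (b * a) hb) ⟩
        cube (ℕtoℚ (b * a)) ≡⟨ trans (cong cube (ℕtoℚ-* b a)) (cube-* (ℕtoℚ b) (ℕtoℚ a)) ⟩
        cube (ℕtoℚ b) ℚ.* cube (ℕtoℚ a) ≡⟨ cong (cube (ℕtoℚ b) ℚ.*_) (cube-ℕ a) ⟩
        cube (ℕtoℚ b) ℚ.* ℕtoℚ (a * a * a) ≤⟨ ℚₚ.*-monoˡ-≤-nonNeg (cube (ℕtoℚ b)) {{ℚ.nonNegative (cube-mono {ℚ.0ℚ} {ℕtoℚ b} ℚₚ.≤-refl (ℕtoℚ-≥0 b))}} (ℕtoℚ-mono ha) ⟩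
        cube (ℕtoℚ b) ℚ.* ℕtoℚ (n * n) ≡⟨ cong (cube (ℕtoℚ b) ℚ.*_) (ℕtoℚ-* n n) ⟩
        cube (ℕtoℚ b) ℚ.* (ℕtoℚ n ℚ.* ℕtoℚ n) ∎
        where open ℚₚ.≤-Reasoning

  cubed : ℕ → ℕ
  cubed s = s * s * s

  4≤K₀ : 4 ≤ K₀
  4≤K₀ = subst (4 ≤_) (sym K₀-value) (ℕₚ.≤ᵇ⇒≤ 4 (16 * 768) tt)

  0<K₀ : 0 < K₀
  0<K₀ = ℕₚ.≤-trans (s≤s z≤n) 4≤K₀

  cubed-mono : ∀ {a b} → a ≤ b → cubed a ≤ cubed b
  cubed-mono le = ℕₚ.*-mono-≤ (ℕₚ.*-mono-≤ le le) le

  cube-root : ∀ K → 0 < K → ∀ n → ∃[ s ] (K * cubed s ≤ n × n < K * cubed (suc s))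
  cube-root K K>0 zero = 0 , ℕₚ.≤-reflexive (ℕₚ.*-zeroʳ K) , subst (0 <_) (sym (ℕₚ.*-identityʳ K)) K>0
  cube-root K K>0 (suc n) with cube-root K K>0 n
  ... | s , lo , hi with ℕₚ.<-≤-connex (suc n) (K * cubed (suc s))
  ...   | inj₁ lt = s , ℕₚ.≤-trans lo (ℕₚ.n≤1+n n) , lt
  ...   | inj₂ ge = suc s , ge , ℕₚ.≤-<-trans hi (ℕₚ.*-monoʳ-< K {{Data.Nat.>-nonZero K>0}} (ℕₚ.*-mono-< (ℕₚ.*-mono-< (ℕₚ.n<1+n (suc s)) (ℕₚ.n<1+n (suc s))) (ℕₚ.n<1+n (suc s))))

  -- The denominator is chosen so that (8 K₀)² · 16³ ≤ 65536³.
  c₁ : ℚ.ℚ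
  c₁ = divℚ 0 1 65536

  c₁-pos : ℚ.0ℚ ℚ.< c₁
  c₁-pos = ℚₚ.positive⁻¹ c₁ {{ℚₚ.normalize-pos 1 65536}}

  c₂ℕ N₀ : ℕ
  c₂ℕ = 2 * (8 * K₀) + 9
  N₀ = K₀ * 64

  c₂-pos : ℚ.0ℚ ℚ.< ℕtoℚ c₂ℕ
  c₂-pos = ℚₚ.positive⁻¹ (ℕtoℚ c₂ℕ) {{ℚₚ.normalize-pos c₂ℕ 1 {{_}} {{Data.Nat.>-nonZero (ℕₚ.≤-trans (s≤s z≤n) (ℕₚ.m≤n+m 9 (2 * (8 * K₀))))}}}}

  Bounded : (n : ℕ) → ℚ.ℚ → Set
  Bounded n e = (cube c₁ ℚ.* (ℕtoℚ n ℚ.* ℕtoℚ n) ℚ.≤ cube (ℕtoℚ n ℚ.- e)) × (cube (ℕtoℚ n ℚ.- e) ℚ.≤ cube (ℕtoℚ c₂ℕ) ℚ.* (ℕtoℚ n ℚ.* ℕtoℚ n))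

  module Scale (K n s : ℕ) (4≤K : 4 ≤ K) (big : K * 64 ≤ n) (lo : K * cubed s ≤ n) (hi : n < K * cubed (suc s)) where

    4≤s : 4 ≤ s
    4≤s = ℕₚ.≮⇒≥ (λ lt → ℕₚ.<⇒≱ hi (ℕₚ.≤-trans (ℕₚ.*-monoʳ-≤ K (cubed-mono lt)) big))

    1<s : 1 < s
    1<s = ℕₚ.≤-trans (s≤s (s≤s z≤n)) 4≤s

    private
      s≥1 : 1 ≤ s
      s≥1 = ℕₚ.<⇒≤ 1<s

    4s≤n : 4 * s ≤ n
    4s≤n = ℕₚ.≤-trans (ℕₚ.*-mono-≤ 4≤K (ℕₚ.≤-trans (ℕₚ.≤-reflexive (sym (ℕₚ.*-identityˡ s))) (ℕₚ.*-monoˡ-≤ s (ℕₚ.*-mono-≤ s≥1 s≥1)))) lo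

    6≤n : 6 ≤ n
    6≤n = ℕₚ.≤-trans (ℕₚ.≤-trans (ℕₚ.≤ᵇ⇒≤ 6 16 tt) (ℕₚ.*-monoʳ-≤ 4 4≤s)) 4s≤n

    small : n ≤ 8 * K * cubed s
    small = ℕₚ.≤-trans (ℕₚ.<⇒≤ hi) (ℕₚ.≤-trans (ℕₚ.*-monoʳ-≤ K (cubed-mono {suc s} {2 * s} (ℕₚ.≤-trans (ℕₚ.+-monoˡ-≤ s s≥1) (ℕₚ.≤-reflexive (cong (s +_) (sym (ℕₚ.+-identityʳ s)))))))
      (ℕₚ.≤-reflexive (lem K s)))
      where
      lem : ∀ K s → K * (2 * s * (2 * s) * (2 * s)) ≡ 8 * K * (s * s * s)
      lem = solve-∀

    square-upper : n * n ≤ 8 * K * (8 * K) * (s * s * (s * s) * (s * s))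
    square-upper = ℕₚ.≤-trans (ℕₚ.*-mono-≤ small small) (ℕₚ.≤-reflexive (lem (8 * K) s))
      where
      lem : ∀ C s → C * (s * s * s) * (C * (s * s * s)) ≡ C * C * (s * s * (s * s) * (s * s))
      lem = solve-∀

    square-lower : s * s * (s * s) * (s * s) ≤ n * n
    square-lower = ℕₚ.≤-trans (ℕₚ.≤-reflexive (lem s)) (ℕₚ.*-mono-≤ s³≤n s³≤n)
      where
      lem : ∀ s → s * s * (s * s) * (s * s) ≡ s * s * s * (s * s * s)
      lem = solve-∀
      s³≤n : cubed s ≤ n
      s³≤n = ℕₚ.≤-trans (ℕₚ.m≤n*m (cubed s) K {{Data.Nat.>-nonZero (ℕₚ.≤-trans (s≤s z≤n) 4≤K)}}) lo

  module _ (n : ℕ) (d : Graph (V n) → Graph (V n) → ℕ) where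

    private
      Ts = trees n

    ΣΣd : ℕ
    ΣΣd = ∑[ A ∈ Ts ] ∑[ B ∈ Ts ] d A B

    expectation-∑ : expectation n d ≡ divℚ n ΣΣd (length Ts * length Ts)
    expectation-∑ = cong (λ z → divℚ n z (length Ts * length Ts)) (lem Ts)
      where
      lem : ∀ Us → sum (concatMap (λ A → map (λ B → d A B) Us) Us) ≡ ∑[ A ∈ Us ] ∑[ B ∈ Us ] d A B
      lem Us = trans (trans (cong sum (sym (Lₚ.map-id (concatMap (λ A → map (λ B → d A B) Us) Us)))) (sum-map id (concatMap (λ A → map (λ B → d A B) Us) Us)))
        (trans (∑-concatMap (λ A → map (λ B → d A B) Us) id Us) (∑-cong Us (λ A _ → ∑-map (d A) id Us)))

  -- With W = T², the two counting estimates say s² / 16 ≤ n - S / W ≤ c₂ s².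
  sandwich : ∀ n S W a → 0 < W → 16 * S + a * W ≤ 16 * n * W → n * W ≤ S + c₂ℕ * a * W →
    n * n ≤ 8 * K₀ * (8 * K₀) * (a * a * a) → a * a * a ≤ n * n → Bounded n (divℚ n S W)
  sandwich n S (suc w) a _ hU hL n² a³ =
    Sandwich.cube-lower n S w a hU (8 * K₀ * (8 * K₀)) 65535 n² bound ,
    Sandwich.cube-upper n S w a hU c₂ℕ hL a³
    where
    bound : 8 * K₀ * (8 * K₀) * (16 * 16 * 16) ≤ suc 65535 * suc 65535 * suc 65535
    bound = subst (λ K → 8 * K * (8 * K) * (16 * 16 * 16) ≤ suc 65535 * suc 65535 * suc 65535) (sym K₀-value)
      (ℕₚ.≤ᵇ⇒≤ (8 * (16 * 768) * (8 * (16 * 768)) * (16 * 16 * 16)) (suc 65535 * suc 65535 * suc 65535) tt)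

  expectation-bounds : ∀ χ n → N₀ ≤ n → (d : Graph (V n) → Graph (V n) → ℕ) → IsDist n χ d → Bounded n (expectation n d)
  expectation-bounds χ zero big d isd = ⊥-elim (ℕₚ.<⇒≱ (ℕₚ.*-mono-< {0} {K₀} {0} {64} 0<K₀ (s≤s z≤n)) big)
  expectation-bounds χ n@(suc k) big d isd = subst (Bounded n) (sym (expectation-∑ n d))
    (sandwich n (ΣΣd n d) (length (trees n) * length (trees n)) (s * s) (ℕₚ.*-mono-< {0} {_} {0} (trees-exist {k}) (trees-exist {k}))
      (Totals.total-upper {k} s R.1<s χ d isd R.6≤n R.4≤s R.4s≤n lo) (Totals.total-lower {k} s R.1<s χ d isd R.6≤n (8 * K₀) R.small)
      R.square-upper R.square-lower)
    where
    root₃ = cube-root K₀ 0<K₀ n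
    s = proj₁ root₃
    lo = proj₁ (proj₂ root₃)
    module R = Scale K₀ n s 4≤K₀ big lo (proj₂ (proj₂ root₃))

open import Data.Rational using (ℚ; 0ℚ; _-_; _*_; _≤_; _<_)
open import Data.Product using (Σ; ∃; ∃-syntax; _×_; _,_)

theorem1p11 : (χ : MoveType) →
    ((n : Data.Nat.ℕ) → Σ (Graph (V n) → Graph (V n) → Data.Nat.ℕ) (IsDist n χ))
    × (∃[ c₁ ] ∃[ c₂ ] ∃[ N ]
    (0ℚ < c₁ × 0ℚ < c₂
    × ((n : Data.Nat.ℕ) → N Data.Nat.≤ n → (d : Graph (V n) → Graph (V n) → Data.Nat.ℕ) → IsDist n χ d →
    (cube c₁ * (ℕtoℚ n * ℕtoℚ n) ≤ cube (ℕtoℚ n - expectation n d))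
    × (cube (ℕtoℚ n - expectation n d) ≤ cube c₂ * (ℕtoℚ n * ℕtoℚ n)))))
theorem1p11 χ = Proof.distance χ ,
  (Proof.c₁ , ℕtoℚ Proof.c₂ℕ , Proof.N₀ , Proof.c₁-pos , Proof.c₂-pos , Proof.expectation-bounds χ)
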